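{- Let $w\in B_n$ avoid the patterns $3412$ and $4231$, and let $Q=Q(w)$ be the associated type-$\mathsf{BC}$ unit interval order. For every bipartition $(\lambda,\mu)\vdash n$ we have \begin{align*} (\epsilon\epsilon)^{\lambda,\mu}(C'_w(1)) &= \#\{(U,V)\in \mathrm{Tab}(Q,\lambda^{\top},\mu^{\top}) : U,V \text{ column-strict}\},\\ (\epsilon\eta)^{\lambda,\mu}(C'_w(1)) &= \#\{(U,V)\in \mathrm{Tab}(Q,\lambda^{\top},\mu) : U \text{ column-strict},\ V \text{ row-semistrict}\},\\ (\eta\epsilon)^{\lambda,\mu}(C'_w(1)) &= \#\{(U,V)\in \mathrm{Tab}(Q,\lambda,\mu^{\top}) : U \text{ row-semistrict},\ V \text{ column-strict}\},\\ (\eta\eta)^{\lambda,\mu}(C'_w(1)) &= \#\{(U,V)\in \mathrm{Tab}(Q,\lambda,\mu) : U,V \text{ row-semistrict}\}. \end{align*}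
   Context: Notation: $[\bar n,n]=\{ -n,\dots,-1,1,\dots,n\}$, $\bar a=-a$, $[n]=\{1,\dots,n\}$; for $h\le l$, $[h,l]=\{h,\dots,l\}\setminus\{0\}$. $B_n$ is the group of permutations $w$ of $[\bar n,n]$ with $w(\bar i)=\overline{w(i)}$ (the Coxeter group of type $B_n=C_n$ with Bruhat order $\le_{B_n}$); write $w_i=w(i)$. $w$ avoids $3412$ and $4231$ means the word $w_{\bar n}\cdots w_{\bar1}w_1\cdots w_n$ has no subsequence order-isomorphic to $3412$ or $4231$. For such $w$, $C'_w(1)$ denotes the Kazhdan–Lusztig basis element $C'_w(q)$ of the Hecke algebra of $B_n$ specialized at $q=1$; it equals $\sum_{v\le_{B_n}w} v\in\mathbb Z[B_n]$. Traces are extended linearly to $\mathbb Z[B_n]$. Characters: for $u\in B_m$ let $\ell_t(u)=\#\{i\in[m]:u_i<0\}$ and $\varphi(u)\in S_m$, $i\mapsto|u_i|$. For $\lambda\vdash m$, $\epsilon^\lambda$ ($\eta^\lambda$) is the sign (trivial) character of the Young subgroup $S_{\lambda_1}\times\cdots\times S_{\lambda_r}$ induced to $S_m$. For $(\lambda,\mu)\vdash n$ with $|\lambda|=k$ and class functions $\zeta$ of $S_k$, $\xi$ of $S_{n-k}$, define $(\zeta\xi)^{\lambda,\mu}$ as the induction from $B_k\times B_{n-k}$ to $B_n$ of $u\mapsto \zeta(\varphi(u))$ tensored with $u\mapsto(-1)^{\ell_t(u)}\xi(\varphi(u))$; here $B_k\times B_{n-k}$ is the subgroup of $w\in B_n$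 with $\{|w_1|,\dots,|w_k|\}=[k]$, the second factor acting on $[k+1,n]$ identified with $[1,n-k]$. Thus $(\epsilon\epsilon)^{\lambda,\mu}$ uses $\zeta=\epsilon^\lambda,\xi=\epsilon^\mu$; $(\epsilon\eta)^{\lambda,\mu}$ uses $\epsilon^\lambda,\eta^\mu$, etc. Networks: a type-A planar network on an interval $[h,l]$ is a directed planar acyclic multigraph embedded in a disc with boundary vertices labelled clockwise source $h,\dots,$ source $l$, sink $l,\dots,$ sink $h$; edges may carry positive integer multiplicities; sources have indegree 0 and outdegree 1, sinks indegree 1 and outdegree 0. For $[a,b]\subseteq[h,l]$ the simple star network $F_{[a,b]}$ has, for $i\notin[a,b]$, an edge from source $i$ to sink $i$, and one interior vertex $z$ with edges source $i\to z$ and $z\to$ sink $i$ for $i\in[a,b]$ (if $a=b$ there is no interior vertex and all edges go source $i\to$ sink $i$). The concatenation $E\circ F$ removes sink $i$ of $E$ and source $i$ of $F$ and merges the edge entering the former with the edge leaving the latter; the condensed concatenation $E\bullet F$ replaces, in $E\circ F$, every set of $m>1$ parallel edges between the same pair of vertices by one edge of multiplicity $m$. A sequence of intervals $[c_1,d_1],\dots,[c_t,d_t]$ satisfies the zig-zag conditions if the intervals are distinct and pairwise non-nesting, and for all $i<j<k$ with $[c_i,d_i]\cap[c_j,d_j]\ne\emptyset\ne[c_j,d_j]\cap[c_k,d_k]$ one has $c_i<c_j<c_k$ or $c_i>c_j>c_k$. A type-A zig-zag network is $F_{[c_1,d_1]}\bullet\cdots\bullet F_{[c_t,d_t]}$ with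 such intervals (or the trivial network). A path family of type $u\in S_{[h,l]}$ in a network is a sequence $(\pi_h,\dots,\pi_l)$ of directed paths with $\pi_i$ from source $i$ to sink $u(i)$; it covers the network if every edge lies on some $\pi_i$. For each zig-zag network $F$ the types of covering path families contain a unique one of maximal length, $w(F)$, and $F\mapsto w(F)$ is a bijection onto permutations of $[h,l]$ avoiding $3412$ and $4231$; $F_w$ denotes the inverse image of $w$. For such $w$ there is a unique path family $\pi$ of type $e$ covering $F_w$, and $P(w)$ is the partial order on $[h,l]$ with $i<_{P(w)}j$ iff $i<j$ and $\pi_i,\pi_j$ share no vertex. $Q(w)$: for $w\in B_n\subset S_{[\bar n,n]}$ avoiding $3412,4231$, with $\pi$ the type-$e$ family covering $F_w$, call $i\in[n]$ grounded if $\pi_i$ and $\pi_{\bar i}$ share a vertex; $Q(w)$ is the subposet of $P(w)$ induced on $[n]$, with grounded elements distinguished. Bitableaux: for a poset $Q$ on $[n]$ with a distinguished set of grounded elements and partitions $\alpha,\beta$ with $|\alpha|+|\beta|=n$, $\mathrm{Tab}(Q,\alpha,\beta)$ is the set of pairs $(U,V)$ where $U,V$ are fillings of the Young diagrams of shapes $\alpha,\beta$ (French convention, row 1 at the bottom; $U_{i,j}$ is the $j$-th entry of row $i$) using each element of $Q$ exactly once in total, all grounded elements lying in $U$, each grounded element being either marked with a star or not (both markings counted separately). A filling $U$ is column-strict if $U_{i,j}<_Q U_{i+1,j}$ whenever both entries exist, and row-semistrict if $U_{i,j}\not>_Q U_{i,j+1}$ whenever both exist. $\lambda^\top$ is the transpose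 partition. -}

module Defs where

open import Data.Bool using (Bool; true; false; if_then_else_; _∧_)
open import Data.Nat as ℕ using (ℕ; zero; suc)
open import Data.Integer as ℤ using (ℤ; +_; -[1+_]; ∣_∣; _/ℕ_)
open import Data.List using (List; []; _∷_; _++_; map; length; concat; concatMap; upTo;
  reverse; take; drop; head; last; foldr; filterᵇ; cartesianProduct)
open import Data.Nat.ListAction using (sum; product)
open import Data.List.Relation.Unary.All using (All)
open import Data.List.Relation.Unary.Linked using (Linked)
open import Data.List.Relation.Unary.Unique.Propositional using (Unique)
open import Data.List.Membership.Propositional using (_∈_)
open import Data.List.Relation.Binary.Permutation.Propositional using (_↭_)
open import Data.Maybe using (Maybe; just; nothing)
open import Data.Fin as Fin using (Fin)
open import Data.Product using (Σ; ∃; _×_; _,_; proj₁; proj₂)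
open import Data.Sum using (_⊎_)
open import Data.Empty using (⊥)
open import Relation.Nullary using (¬_)
open import Relation.Nullary.Decidable using (⌊_⌋)
open import Relation.Binary.PropositionalEquality using (_≡_; _≢_)
open import Function.Bundles using (_⇔_)

range1 : ℕ → List ℕ
range1 m = map suc (upTo m)

at : {A : Set} → A → List A → ℕ → A
at d []       _             = d
at d (x ∷ xs) zero          = d
at d (x ∷ xs) (suc zero)    = x
at d (x ∷ xs) (suc (suc k)) = at d xs (suc k)

atM : {A : Set} → List A → ℕ → Maybe A
atM []       _             = nothing
atM (x ∷ xs) zero          = nothing
atM (x ∷ xs) (suc zero)    = just x
atM (x ∷ xs) (suc (suc k)) = atM xs (suc k)

allB : {A : Set} → (A → Bool) → List A → Bool
allB p = foldr (λ x b → p x ∧ b) true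

sumℤ : List ℤ → ℤ
sumℤ = foldr ℤ._+_ (+ 0)

negPow : ℕ → ℤ
negPow zero    = + 1
negPow (suc k) = ℤ.- negPow k

-- exact division of an integer by a (positive) natural number
divN : ℤ → ℕ → ℤ
divN z zero    = + 0
divN z (suc d) = z /ℕ suc d

ConsecIn : {A : Set} → A → A → List A → Set
ConsecIn {A} x y p = Σ (List A) λ xs → Σ (List A) λ ys → p ≡ xs ++ (x ∷ y ∷ ys)

HasSize : {A : Set} → (A → Set) → ℕ → Set
HasSize {A} P m = (L : List A) → Unique L → ((t : A) → (t ∈ L) ⇔ P t) → length L ≡ m

-- Symmetric groups S_m : permutations of [1..m] in one-line notation

insertAll : ℕ → List ℕ → List (List ℕ)
insertAll x []       = (x ∷ []) ∷ []
insertAll x (y ∷ ys) = (x ∷ y ∷ ys) ∷ map (y ∷_) (insertAll x ys)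

perms : ℕ → List (List ℕ)
perms zero    = [] ∷ []
perms (suc m) = concatMap (insertAll (suc m)) (perms m)

appS : List ℕ → ℕ → ℕ
appS σ i = at i σ i

mulS : List ℕ → List ℕ → List ℕ
mulS σ τ = map (appS σ) τ

posOf : ℕ → List ℕ → ℕ
posOf j []       = 0
posOf j (x ∷ xs) = if x ℕ.≡ᵇ j then 1 else suc (posOf j xs)

invS : List ℕ → List ℕ
invS σ = map (λ j → posOf j σ) (range1 (length σ))

conjS : List ℕ → List ℕ → List ℕ
conjS x σ = mulS (mulS x σ) (invS x)

invCount : List ℕ → ℕ
invCount []       = 0
invCount (x ∷ xs) = length (filterᵇ (λ y → y ℕ.<ᵇ x) xs) ℕ.+ invCount xs

sgnS : List ℕ → ℤ
sgnS σ = negPow (invCount σ)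

-- block (0-based) of the Young subgroup S_{λ1} × S_{λ2} × ... containing i
block : List ℕ → ℕ → ℕ
block []       i = 0
block (l ∷ ls) i = if i ℕ.≤ᵇ l then 0 else suc (block ls (i ℕ.∸ l))

inYoung : List ℕ → List ℕ → Bool
inYoung λ′ σ = allB (λ i → block λ′ (appS σ i) ℕ.≡ᵇ block λ′ i) (range1 (length σ))

factorial : ℕ → ℕ
factorial zero    = 1
factorial (suc k) = suc k ℕ.* factorial k

youngOrder : List ℕ → ℕ
youngOrder λ′ = product (map factorial λ′)

-- η^λ : trivial character of the Young subgroup induced to S_m
-- Ind χ (σ) = (1/|H|) Σ_{x ∈ S_m} χ°(x σ x⁻¹)
etaChar : List ℕ → List ℕ → ℤ
etaChar λ′ σ = divN (sumℤ (map (λ x → if inYoung λ′ (conjS x σ) then + 1 else + 0)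
                              (perms (length σ))))
                    (youngOrder λ′)

-- ε^λ : sign character of the Young subgroup induced to S_m
epsChar : List ℕ → List ℕ → ℤ
epsChar λ′ σ = divN (sumℤ (map (λ x → if inYoung λ′ (conjS x σ) then sgnS (conjS x σ) else + 0)
                              (perms (length σ))))
                    (youngOrder λ′)

-- Hyperoctahedral group B_n : signed permutations w, stored as the list
-- w_1 … w_n of integers; w(ī) = - w(i).

IsBn : ℕ → List ℤ → Set
IsBn n w = length w ≡ n × map ∣_∣ w ↭ range1 n

signs : List ℕ → List (List ℤ)
signs []       = [] ∷ []
signs (a ∷ as) = concatMap (λ r → (+ a ∷ r) ∷ (ℤ.- (+ a) ∷ r) ∷ []) (signs as)

BnList : ℕ → List (List ℤ)
BnList n = concatMap signs (perms n)

appB : List ℤ → ℤ → ℤ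
appB w (+ zero)  = + 0
appB w (+ suc k) = at (+ 0) w (suc k)
appB w -[1+ k ]  = ℤ.- at (+ 0) w (suc k)

idB : ℕ → List ℤ
idB n = map +_ (range1 n)

mulB : List ℤ → List ℤ → List ℤ
mulB x y = map (appB x) y

shiftPos : ℤ → ℤ
shiftPos (+ k)    = + suc k
shiftPos -[1+ k ] = -[1+ suc k ]

posB : ℕ → List ℤ → ℤ
posB j []       = + 0
posB j (x ∷ xs) = if ∣ x ∣ ℕ.≡ᵇ j
                  then (if ⌊ x ℤ.<? + 0 ⌋ then -[1+ 0 ] else + 1)
                  else shiftPos (posB j xs)

invB : List ℤ → List ℤ
invB x = map (λ j → posB j x) (range1 (length x))

conjB : List ℤ → List ℤ → List ℤ
conjB x g = mulB (mulB x g) (invB x)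

negCount : List ℤ → ℕ
negCount u = length (filterᵇ (λ a → ⌊ a ℤ.<? + 0 ⌋) u)

-- Class function of B_k × B_{n-k} (k = |λ|):
--   u ↦ ζ(φ(u₁)) · (-1)^{ℓ_t(u₂)} ξ(φ(u₂))
-- where u₁ = (u_1 … u_k) and u₂ = (u_{k+1} … u_n) acting on [k+1,n] ≅ [1,n-k].
inBkBnk : ℕ → List ℤ → Bool
inBkBnk k u = allB (λ a → ∣ a ∣ ℕ.≤ᵇ k) (take k u)

prodChar : ℕ → (List ℕ → ℤ) → (List ℕ → ℤ) → List ℤ → ℤ
prodChar k ζ ξ u =
  ζ (map ∣_∣ (take k u)) ℤ.* (negPow (negCount (drop k u)) ℤ.* ξ (map (λ a → ∣ a ∣ ℕ.∸ k) (drop k u)))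

-- (ζξ)^{λ,μ}(g) = (1/|B_k × B_{n-k}|) Σ_{x ∈ B_n} χ°(x g x⁻¹),  k = |λ|
-- with |B_k × B_{n-k}| = 2^k k! 2^{n-k} (n-k)!.
bichar : ℕ → ℕ → (List ℕ → ℤ) → (List ℕ → ℤ) → List ℤ → ℤ
bichar n k ζ ξ g =
  divN (sumℤ (map (λ x → if inBkBnk k (conjB x g) then prodChar k ζ ξ (conjB x g) else + 0)
                  (BnList n)))
       (2 ℕ.^ n ℕ.* (factorial k ℕ.* factorial (n ℕ.∸ k)))

-- Bruhat order of the Coxeter group B_n with simple generators
-- s₀ = (1 ↦ 1̄) and s_i = (i i+1)(ī ī+1), 1 ≤ i < n.

swapAt : ℕ → List ℤ → List ℤ
swapAt i []           = []
swapAt i (x ∷ [])     = x ∷ []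
swapAt zero (x ∷ y ∷ xs)    = y ∷ x ∷ xs
swapAt (suc i) (x ∷ xs)     = x ∷ swapAt i xs

gensB : ℕ → List (List ℤ)
gensB zero    = []
gensB (suc m) = (-[1+ 0 ] ∷ map +_ (map suc (range1 m)))
              ∷ map (λ i → swapAt i (idB (suc m))) (upTo m)

prodB : ℕ → List (List ℤ) → List ℤ
prodB n []       = idB n
prodB n (g ∷ gs) = mulB g (prodB n gs)

Len : ℕ → List ℤ → ℕ → Set
Len n w k = (Σ (List (List ℤ)) λ ws → All (_∈ gensB n) ws × length ws ≡ k × prodB n ws ≡ w)
          × ((ws : List (List ℤ)) → All (_∈ gensB n) ws → prodB n ws ≡ w → k ℕ.≤ length ws)

IsRefl : ℕ → List ℤ → Set
IsRefl n t = Σ (List ℤ) λ x → IsBn n x × Σ (List ℤ) λ s → s ∈ gensB n × t ≡ mulB (mulB x s) (invB x)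

data BruhatLe (n : ℕ) : List ℤ → List ℤ → Set where
  bru-refl : ∀ {u} → IsBn n u → BruhatLe n u u
  bru-step : ∀ {u v t} → BruhatLe n u v → IsRefl n t →
             (a b : ℕ) → Len n v a → Len n (mulB v t) b → a ℕ.< b →
             BruhatLe n u (mulB v t)

-- Trace of C'_w(1) = Σ_{v ≤ w} v under a class function χ equals z
TraceCw1 : ℕ → List ℤ → (List ℤ → ℤ) → ℤ → Set
TraceCw1 n w χ z = (L : List (List ℤ)) → Unique L →
                   ((v : List ℤ) → (v ∈ L) ⇔ BruhatLe n v w) → sumℤ (map χ L) ≡ z

-- Pattern avoidance in the word w_{n̄} ⋯ w_{1̄} w_1 ⋯ w_n

fullWord : List ℤ → List ℤ
fullWord w = reverse (map ℤ.-_ w) ++ w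

module _ (ws : List ℤ) where
  private
    v : Fin (length ws) → ℤ
    v = Data.List.lookup ws

  Contains3412 : Set
  Contains3412 = Σ (Fin (length ws)) λ p → Σ (Fin (length ws)) λ q →
                 Σ (Fin (length ws)) λ r → Σ (Fin (length ws)) λ s →
                 p Fin.< q × q Fin.< r × r Fin.< s ×
                 v r ℤ.< v s × v s ℤ.< v p × v p ℤ.< v q

  Contains4231 : Set
  Contains4231 = Σ (Fin (length ws)) λ p → Σ (Fin (length ws)) λ q →
                 Σ (Fin (length ws)) λ r → Σ (Fin (length ws)) λ s →
                 p Fin.< q × q Fin.< r × r Fin.< s ×
                 v s ℤ.< v q × v q ℤ.< v r × v r ℤ.< v p

Avoids3412-4231 : List ℤ → Set
Avoids3412-4231 w = ¬ Contains3412 (fullWord w) × ¬ Contains4231 (fullWord w)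

wires : ℕ → List ℤ
wires n = map (λ k → -[1+ k ]) (reverse (upTo n)) ++ map (λ k → + suc k) (upTo n)

InInt : ℤ × ℤ → ℤ → Set
InInt (a , b) i = a ℤ.≤ i × i ℤ.≤ b

Meets : ℕ → ℤ × ℤ → ℤ × ℤ → Set
Meets n I J = Σ ℤ λ i → i ∈ wires n × InInt I i × InInt J i

-- [a,b] ⊆ [c,d] (endpoints are nonzero)
Nested : ℤ × ℤ → ℤ × ℤ → Set
Nested (a , b) (c , d) = c ℤ.≤ a × b ℤ.≤ d

fst : ℤ × ℤ → ℤ
fst = proj₁

ZigZag : ℕ → List (ℤ × ℤ) → Set
ZigZag n cs =
  All (λ I → proj₁ I ∈ wires n × proj₂ I ∈ wires n × proj₁ I ℤ.≤ proj₂ I) cs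
  × Unique cs
  × ((p q : Fin (length cs)) → p ≢ q → ¬ Nested (I p) (I q))
  × ((p q r : Fin (length cs)) → p Fin.< q → q Fin.< r →
       Meets n (I p) (I q) → Meets n (I q) (I r) →
       (fst (I p) ℤ.< fst (I q) × fst (I q) ℤ.< fst (I r))
       ⊎ (fst (I q) ℤ.< fst (I p) × fst (I r) ℤ.< fst (I q)))
  where
  I : Fin (length cs) → ℤ × ℤ
  I = Data.List.lookup cs

-- vertices of F_{[c_1,d_1]} • ⋯ • F_{[c_t,d_t]}: sources, sinks, and the interior
-- vertex z_k of the k-th star (0-based k), present when c_k < d_k
data Vtx : Set where
  src : ℤ → Vtx
  mid : ℕ → Vtx
  snk : ℤ → Vtx

midsOn : ℕ → List (ℤ × ℤ) → ℤ → List Vtx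
midsOn k []             i = []
midsOn k ((c , d) ∷ cs) i =
  (if ⌊ c ℤ.<? d ⌋ ∧ ⌊ c ℤ.≤? i ⌋ ∧ ⌊ i ℤ.≤? d ⌋ then mid k ∷ [] else [])
  ++ midsOn (suc k) cs i

wireSeq : List (ℤ × ℤ) → ℤ → List Vtx
wireSeq cs i = src i ∷ midsOn 0 cs i ++ snk i ∷ []

-- the edges of the condensed concatenation (parallel edges merged)
Edge : ℕ → List (ℤ × ℤ) → Vtx → Vtx → Set
Edge n cs x y = Σ ℤ λ i → i ∈ wires n × ConsecIn x y (wireSeq cs i)

IsPath : ℕ → List (ℤ × ℤ) → List Vtx → ℤ → ℤ → Set
IsPath n cs p i j = head p ≡ just (src i) × last p ≡ just (snk j) × Linked (Edge n cs) p

IsPermOn : List ℤ → (ℤ → ℤ) → Set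
IsPermOn W u = ((i : ℤ) → i ∈ W → u i ∈ W)
             × ((i j : ℤ) → i ∈ W → j ∈ W → u i ≡ u j → i ≡ j)
             × ((j : ℤ) → j ∈ W → Σ ℤ λ i → i ∈ W × u i ≡ j)

IsFamily : ℕ → List (ℤ × ℤ) → (ℤ → List Vtx) → (ℤ → ℤ) → Set
IsFamily n cs π u = (i : ℤ) → i ∈ wires n → IsPath n cs (π i) i (u i)

Covers : ℕ → List (ℤ × ℤ) → (ℤ → List Vtx) → Set
Covers n cs π = (x y : Vtx) → Edge n cs x y → Σ ℤ λ i → i ∈ wires n × ConsecIn x y (π i)

invOn : ℕ → (ℤ → ℤ) → ℕ
invOn n u = length (filterᵇ (λ ij → ⌊ proj₁ ij ℤ.<? proj₂ ij ⌋ ∧ ⌊ u (proj₂ ij) ℤ.<? u (proj₁ ij) ⌋)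
                            (cartesianProduct (wires n) (wires n)))

MaxCoverType : ℕ → List (ℤ × ℤ) → (ℤ → ℤ) → Set
MaxCoverType n cs u =
  IsPermOn (wires n) u
  × (Σ (ℤ → List Vtx) λ π → IsFamily n cs π u × Covers n cs π)
  × ((u′ : ℤ → ℤ) (π′ : ℤ → List Vtx) → IsPermOn (wires n) u′ →
       IsFamily n cs π′ u′ → Covers n cs π′ →
       invOn n u′ ℕ.≤ invOn n u
       × (invOn n u′ ≡ invOn n u → (i : ℤ) → i ∈ wires n → u′ i ≡ u i))

-- The poset Q(w) on [n], from the type-e covering family π of F_w

ShareVtx : List Vtx → List Vtx → Set
ShareVtx p q = Σ Vtx λ x → x ∈ p × x ∈ q

QLt : (ℤ → List Vtx) → ℕ → ℕ → Set
QLt π i j = i ℕ.< j × ¬ ShareVtx (π (+ i)) (π (+ j))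

Grounded : (ℤ → List Vtx) → ℕ → Set
Grounded π i = ShareVtx (π (+ i)) (π (ℤ.- (+ i)))

IsPartition : List ℕ → Set
IsPartition λ′ = All (λ a → 1 ℕ.≤ a) λ′ × Linked ℕ._≥_ λ′

transpose : List ℕ → List ℕ
transpose []       = []
transpose (l ∷ ls) = map (λ j → length (filterᵇ (λ a → j ℕ.≤ᵇ a) (l ∷ ls))) (range1 l)

-- a filling: list of rows, row 1 first (French convention); entry (i,j) 1-based
entry : List (List ℕ) → ℕ → ℕ → Maybe ℕ
entry U i j with atM U i
... | nothing = nothing
... | just row = atM row j

ColStrict : (ℕ → ℕ → Set) → List (List ℕ) → Set
ColStrict _<Q_ U = (i j a b : ℕ) → entry U i j ≡ just a → entry U (suc i) j ≡ just b → a <Q b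

RowSemistrict : (ℕ → ℕ → Set) → List (List ℕ) → Set
RowSemistrict _<Q_ U = (i j a b : ℕ) → entry U i j ≡ just a → entry U i (suc j) ≡ just b → ¬ (b <Q a)

-- a bitableau (U , V): entries of U carry a star flag (true = starred)
BiTab : Set
BiTab = List (List (ℕ × Bool)) × List (List ℕ)

vals : List (List (ℕ × Bool)) → List (List ℕ)
vals = map (map proj₁)

InTab : ℕ → (ℕ → Set) → List ℕ → List ℕ → BiTab → Set
InTab n grounded α β (U , V) =
  map length U ≡ α × map length V ≡ β
  × (concat (vals U) ++ concat V) ↭ range1 n
  × ((x : ℕ) → x ∈ concat V → ¬ grounded x)
  × ((x : ℕ) → (x , true) ∈ concat U → grounded x)

data FillCond : Set where
  colStrict rowSemistrict : FillCond

Cond : (ℕ → ℕ → Set) → FillCond → List (List ℕ) → Set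
Cond R colStrict     U = ColStrict R U
Cond R rowSemistrict U = RowSemistrict R U

TabWith : ℕ → (ℤ → List Vtx) → List ℕ → List ℕ → FillCond → FillCond → BiTab → Set
TabWith n π α β cU cV t =
  InTab n (Grounded π) α β t × Cond (QLt π) cU (vals (proj₁ t)) × Cond (QLt π) cV (proj₂ t)

CharCount : ℕ → List ℤ → (ℤ → List Vtx) → List ℕ → (List ℕ → ℤ) → (List ℕ → ℤ) →
            List ℕ → List ℕ → FillCond → FillCond → Set
CharCount n w π λ′ ζ ξ α β cU cV =
  (m : ℕ) → HasSize (TabWith n π α β cU cV) m →
  TraceCw1 n w (bichar n (sum λ′) ζ ξ) (+ m)

{-# OPTIONS --safe #-}

-- Write i → a if some path of the network joins source i to sink a.  Exchanging the
-- tails of two paths that meet shows that a covering family of maximal length admits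
-- no inversion-creating exchange.  At its largest index x the relation → has a special
-- shape: the rows meeting column x agree, or dually.  Peeling off x shows that w is
-- determined by → and that { v ≤ w } = { v ∈ B_n : i → v_i for all i }.
--
-- An induced character evaluated at v is a signed sum over the colourings of [n] with
-- content (λ,μ) that |v| preserves.  Summing over v ≤ w yields, for each colouring, the
-- product over the colour classes of the determinant (for ε) or the permanent (for η)
-- of the matrix [i → j] ± [i → -j], with + for the classes of λ and - for those of μ.
-- By the shape of → at x, peeling off x leaves the factor g (1 ∓ b): b counts the
-- smaller elements of the class of x whose paths meet that of x, the sign is - for ε
-- and + for η, and g is 1 if x is not grounded, 2 for a grounded x in a class of λ and 0
-- for a grounded x in a class of μ.  This is the number of ways to mark x and to insert
-- it into a tableau whose columns (for ε) or rows (for η) are the colour classes; a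
-- factor 1 - b with b ≥ 2 occurs only beside a vanishing one.

module Submission where

open import Defs
open import Data.Bool using (Bool; true; false; if_then_else_; _∧_; not; T)
import Data.Bool.Properties as 𝔹ₚ
open import Data.Nat using (ℕ; zero; suc; _+_; _*_; _∸_; _^_; _<_; _≤_; z≤n; s≤s)
import Data.Nat as ℕ
import Data.Nat.Properties as ℕₚ
open import Data.Nat.Tactic.RingSolver using () renaming (solve-∀ to ℕ-solve-∀)
open import Data.Integer.Tactic.RingSolver using () renaming (solve-∀ to ℤ-solve-∀)
open import Data.Nat.ListAction.Properties using (sum-↭)
open import Data.Nat.ListAction using (sum; product)
open import Data.Integer using (ℤ; +_; -[1+_]; ∣_∣)
import Data.Integer as ℤ
import Data.Integer.Properties as ℤₚ
import Data.Integer.DivMod as ℤ÷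
import Data.Fin as Fin
open import Data.Maybe as Maybe using (Maybe; just; nothing; maybe′)
import Data.Maybe.Properties as Maybeₚ
open import Data.List using (List; []; _∷_; _++_; map; length; concat; concatMap; upTo; applyUpTo; reverse; take; drop; head; last; filterᵇ; cartesianProduct; replicate; mapMaybe; lookup)
import Data.List.Properties as Listₚ
open import Data.List.Relation.Unary.All as All using (All; []; _∷_)
import Data.List.Relation.Unary.All.Properties as Allₚ
open import Data.List.Relation.Unary.Any as Any using (Any; here; there)
open import Data.List.Relation.Unary.AllPairs as AllPairs using (AllPairs; []; _∷_)
import Data.List.Relation.Unary.AllPairs.Properties as AllPairsₚ
import Data.List.Relation.Unary.Linked.Properties as Linkedₚ
open import Data.List.Relation.Unary.Linked using (Linked; []; [-]; _∷_)
open import Data.List.Relation.Unary.Unique.Propositional using (Unique)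
import Data.List.Relation.Unary.Unique.Propositional.Properties as Uniqueₚ
open import Data.List.Membership.Propositional using (_∈_; _∉_; find; lose)
import Data.List.Membership.Propositional.Properties as ∈ₚ
open import Data.List.Relation.Binary.Sublist.Propositional using (_⊆_; []; _∷ʳ_; _∷_; from∈)
import Data.List.Relation.Binary.Sublist.Propositional.Properties as ⊆ₚ
open import Data.List.Relation.Binary.Permutation.Propositional using (_↭_; ↭-refl; ↭-sym; ↭-trans; ↭-reflexive; prep; swap)
import Data.List.Relation.Binary.Permutation.Propositional as Perm
import Data.List.Relation.Binary.Permutation.Propositional.Properties as ↭ₚ
open import Data.Product using (∃; ∃₂; _×_; _,_; proj₁; proj₂)
open import Data.Sum using (_⊎_; inj₁; inj₂; [_,_]′)
open import Data.Empty using (⊥; ⊥-elim)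
open import Data.Unit using (tt)
open import Function using (_∘_; id; flip; case_of_)
open import Function.Bundles using (_⇔_; Equivalence; mk⇔)
open import Relation.Nullary using (¬_; Dec; yes; no; contradiction)
open import Relation.Nullary.Decidable using (⌊_⌋; _×-dec_; ¬?; map′; decidable-stable)
open import Relation.Unary using (Decidable)
open import Relation.Binary.Definitions using (tri<; tri≈; tri>)
open import Relation.Binary.PropositionalEquality using (_≡_; _≢_; refl; sym; trans; cong; cong₂; subst; subst₂; module ≡-Reasoning)

-- Parallel edges are merged in the network, so a path has no well-defined wire between two stars.
-- What survives is that the zig-zag conditions force all paths with the same source and sink
-- through the same stars; hence meetings of paths can be read off from →. The shape at x comes from
-- the leftmost star J through x: the left ends cannot turn at J, so the stars before J or the stars
-- after J do not straddle the left end of J.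
--
-- The symmetry of → under negation is not part of the data. It is derived: every related pair lies
-- in the hull of the diagram of w, and w is odd.
--
-- Bruhat order is defined by word length, while exchanges are controlled by inversions. Four times
-- the length of v is the sum of its inversion numbers on the 2n wires and on these wires with 0
-- adjoined, so the exchange argument of type A applies to both summands.
--
-- On the character side, conjugation by x acts only through the colouring that x pulls back, and
-- the number of x giving the same colouring cancels the denominators of the induced characters.

-- Reachability along wires and planarity

Iv : Set
Iv = ℤ × ℤ

Step : Iv → ℤ → ℤ → Set
Step I i p = i ≡ p ⊎ (InInt I i × InInt I p)

-- Wire-level model of the network: a path runs along wires and may change
-- wires inside every star that it meets.
Reach : List Iv → ℤ → ℤ → Set
Reach []       i a = i ≡ a
Reach (I ∷ cs) i a = ∃ λ p → Step I i p × Reach cs p a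

Shares : List Iv → ℤ → ℤ → Set
Shares cs i j = Any (λ K → InInt K i × InInt K j) cs

Reach-refl : ∀ cs {i} → Reach cs i i
Reach-refl []       = refl
Reach-refl (I ∷ cs) = _ , inj₁ refl , Reach-refl cs

Reach-++⁺ : ∀ cs₁ {cs₂ i p a} → Reach cs₁ i p → Reach cs₂ p a → Reach (cs₁ ++ cs₂) i a
Reach-++⁺ []        refl          r = r
Reach-++⁺ (I ∷ cs₁) (q , s , r₁)  r = q , s , Reach-++⁺ cs₁ r₁ r

Reach-++⁻ : ∀ cs₁ {cs₂ i a} → Reach (cs₁ ++ cs₂) i a → ∃ λ p → Reach cs₁ i p × Reach cs₂ p a
Reach-++⁻ []        r           = _ , refl , r
Reach-++⁻ (I ∷ cs₁) (q , s , r) with p , r₁ , r₂ ← Reach-++⁻ cs₁ r = p , (q , s , r₁) , r₂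

Shares-convex : ∀ {cs i j k} → Shares cs i k → i ℤ.≤ j → j ℤ.≤ k → Shares cs i j × Shares cs j k
Shares-convex s i≤j j≤k =
  Any.map (λ ((c≤i , i≤d) , (c≤k , k≤d)) → (c≤i , i≤d) , ℤₚ.≤-trans c≤i i≤j , ℤₚ.≤-trans j≤k k≤d) s ,
  Any.map (λ ((c≤i , i≤d) , (c≤k , k≤d)) → (ℤₚ.≤-trans c≤i i≤j , ℤₚ.≤-trans j≤k k≤d) , c≤k , k≤d) s

InInt? : ∀ K i → Dec (InInt K i)
InInt? (c , d) i = (c ℤ.≤? i) ×-dec (i ℤ.≤? d)

Shares? : ∀ cs i j → Dec (Shares cs i j)
Shares? cs i j = Any.any? (λ K → InInt? K i ×-dec InInt? K j) cs

-- Some step leaves `P`, and only a star can perform it. `P` is an arbitrary decidable predicate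
-- because both half-lines and their complements are needed.
exits : ∀ {P : ℤ → Set} → Decidable P → ∀ cs {i a} → Reach cs i a → P i → ¬ P a →
        Any (λ K → ∃₂ λ p q → InInt K p × InInt K q × P p × ¬ P q) cs
exits P? []       refl Pi ¬Pa = contradiction Pi ¬Pa
exits P? (I ∷ cs) (p , inj₁ refl , r) Pi ¬Pa = there (exits P? cs r Pi ¬Pa)
exits P? (I ∷ cs) {i} (p , inj₂ (i∈ , p∈) , r) Pi ¬Pa with P? p
... | yes Pp = there (exits P? cs r Pp ¬Pa)
... | no ¬Pp = here (i , p , i∈ , p∈ , Pi , ¬Pp)

-- The cut lies just below `m`; these are the stars through which a path can cross it.
Straddles : ℤ → Iv → Set
Straddles m K = proj₁ K ℤ.< m × m ℤ.≤ proj₂ K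

Straddles? : ∀ m → Decidable (Straddles m)
Straddles? m K = (proj₁ K ℤ.<? m) ×-dec (m ℤ.≤? proj₂ K)

stays-below : ∀ {m cs i a} → ¬ Any (Straddles m) cs → Reach cs i a → i ℤ.< m → a ℤ.< m
stays-below {m} {cs} {i} {a} ns r i<m with a ℤ.<? m
... | yes a<m = a<m
... | no  a≮m = contradiction
  (Any.map (λ (p , q , (c≤p , _) , (_ , q≤d) , p<m , q≮m) →
     ℤₚ.≤-<-trans c≤p p<m , ℤₚ.≤-trans (ℤₚ.≮⇒≥ q≮m) q≤d)
   (exits (ℤ._<? m) cs r i<m a≮m)) ns

stays-above : ∀ {m cs i a} → ¬ Any (Straddles m) cs → Reach cs i a → m ℤ.≤ i → m ℤ.≤ a
stays-above {m} {cs} {i} {a} ns r m≤i with m ℤ.≤? a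
... | yes m≤a = m≤a
... | no  m≰a = contradiction
  (Any.map (λ (p , q , (_ , p≤d) , (c≤q , _) , m≤p , m≰q) →
     ℤₚ.≤-<-trans c≤q (ℤₚ.≰⇒> m≰q) , ℤₚ.≤-trans m≤p p≤d)
   (exits (m ℤ.≤?_) cs r m≤i m≰a)) ns

-- Planarity: two paths whose ends are inverted meet in a star.
record MeetIn (cs : List Iv) (i j a b : ℤ) : Set where
  constructor meetIn
  field
    pre post    : List Iv
    star        : Iv
    split       : cs ≡ pre ++ star ∷ post
    {p q p′ q′} : ℤ
    ip          : Reach pre i p
    jq          : Reach pre j q
    p<q         : p ℤ.< q
    p∈          : InInt star p
    q∈          : InInt star q
    p′∈         : InInt star p′
    q′∈         : InInt star q′
    p′a         : Reach post p′ a
    q′b         : Reach post q′ b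

-- If one path stays on its wire while the other jumps over it, convexity of the interval puts that
-- wire inside the star as well.
Step-meet : ∀ {I i j p q} → Step I i p → Step I j q → i ℤ.< j → q ℤ.≤ p →
            InInt I i × InInt I j × InInt I p × InInt I q
Step-meet (inj₁ refl) (inj₁ refl) i<j q≤p = contradiction q≤p (ℤₚ.<⇒≱ i<j)
Step-meet {p = i} (inj₁ refl) (inj₂ (j∈ , q∈)) i<j q≤i = i∈ , j∈ , i∈ , q∈
  where i∈ = ℤₚ.≤-trans (proj₁ q∈) q≤i , ℤₚ.≤-trans (ℤₚ.<⇒≤ i<j) (proj₂ j∈)
Step-meet {q = j} (inj₂ (i∈ , p∈)) (inj₁ refl) i<j j≤p = i∈ , j∈ , p∈ , j∈
  where j∈ = ℤₚ.≤-trans (proj₁ i∈) (ℤₚ.<⇒≤ i<j) , ℤₚ.≤-trans j≤p (proj₂ p∈)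
Step-meet (inj₂ (i∈ , p∈)) (inj₂ (j∈ , q∈)) _ _ = i∈ , j∈ , p∈ , q∈

-- The star found is the first one after which `p < q` fails. Equal sinks are allowed: two paths
-- into one sink meet as well. The field `p<q` records that the star has at least two wires, hence
-- an interior vertex.
crossing : ∀ cs {i j a b} → i ℤ.< j → b ℤ.≤ a → Reach cs i a → Reach cs j b → MeetIn cs i j a b
crossing []       i<j b≤a refl refl = contradiction b≤a (ℤₚ.<⇒≱ i<j)
crossing (I ∷ cs) {i} {j} i<j b≤a (p , s , r) (q , s′ , r′) with p ℤ.<? q
... | no p≮q with i∈ , j∈ , p∈ , q∈ ← Step-meet s s′ i<j (ℤₚ.≮⇒≥ p≮q) =
  meetIn [] cs I refl refl refl i<j i∈ j∈ p∈ q∈ r r′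
... | yes p<q with meetIn pre post K eq ip jq p<q′ p∈ q∈ p′∈ q′∈ p′a q′b ← crossing cs p<q b≤a r r′ =
  meetIn (I ∷ pre) post K (cong (I ∷_) eq) (p , s , ip) (q , s′ , jq) p<q′ p∈ q∈ p′∈ q′∈ p′a q′b

through : ∀ pre {K post i p q a} → Reach pre i p → InInt K p → InInt K q → Reach post q a →
          Reach (pre ++ K ∷ post) i a
through pre ip p∈ q∈ qa = Reach-++⁺ pre ip (_ , inj₂ (p∈ , q∈) , qa)

-- Both paths enter one star, and there their tails can be exchanged.
uncross : ∀ cs {i j a b} → i ℤ.< j → b ℤ.≤ a → Reach cs i a → Reach cs j b → Reach cs i b × Reach cs j a
uncross cs i<j b≤a r r′
  with meetIn pre post K refl ip jq _ p∈ q∈ p′∈ q′∈ p′a q′b ← crossing cs i<j b≤a r r′ =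
  through pre ip p∈ q′∈ q′b , through pre jq q∈ p′∈ p′a

-- The reachable set grows as an interval, which makes reachability decidable.
grow : Iv → Iv → Iv
grow (l , h) (c , d) = if ⌊ c ℤ.≤? h ⌋ ∧ ⌊ l ℤ.≤? d ⌋ then (l ℤ.⊓ c , h ℤ.⊔ d) else (l , h)

span : Iv → List Iv → Iv
span S []       = S
span S (I ∷ cs) = span (grow S I) cs

Proper : List Iv → Set
Proper = All (λ I → proj₁ I ℤ.≤ proj₂ I)

grow⁻ : ∀ S I {a} → proj₁ S ℤ.≤ proj₂ S → proj₁ I ℤ.≤ proj₂ I → InInt (grow S I) a →
        ∃ λ j → InInt S j × Step I j a
grow⁻ (l , h) (c , d) {a} l≤h c≤d a∈ with c ℤ.≤? h | l ℤ.≤? d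
... | no _    | _       = a , a∈ , inj₁ refl
... | yes _   | no _    = a , a∈ , inj₁ refl
... | yes c≤h | yes l≤d with l ℤ.≤? a | a ℤ.≤? h
...   | yes l≤a | yes a≤h = a , (l≤a , a≤h) , inj₁ refl
-- The top wire `h` reaches `a`: it lies in the star because `c ≤ h < a ≤ d`.
...   | yes l≤a | no  a≰h = h , (l≤h , ℤₚ.≤-refl) , inj₂ ((c≤h , ℤₚ.≤-trans (ℤₚ.<⇒≤ h<a) a≤d) , ℤₚ.≤-trans c≤h (ℤₚ.<⇒≤ h<a) , a≤d)
  where
  h<a = ℤₚ.≰⇒> a≰h
  a≤d : a ℤ.≤ d
  a≤d with ℤₚ.⊔-sel h d
  ... | inj₁ e = contradiction (subst (a ℤ.≤_) e (proj₂ a∈)) a≰h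
  ... | inj₂ e = subst (a ℤ.≤_) e (proj₂ a∈)
...   | no  l≰a | _       = l , (ℤₚ.≤-refl , l≤h) , inj₂ ((ℤₚ.≤-trans c≤a (ℤₚ.<⇒≤ a<l) , l≤d) , c≤a , ℤₚ.≤-trans (ℤₚ.<⇒≤ a<l) l≤d)
  where
  a<l = ℤₚ.≰⇒> l≰a
  c≤a : c ℤ.≤ a
  c≤a with ℤₚ.⊓-sel l c
  ... | inj₁ e = contradiction (subst (ℤ._≤ a) e (proj₁ a∈)) l≰a
  ... | inj₂ e = subst (ℤ._≤ a) e (proj₁ a∈)

grow⁺ : ∀ S I {j a} → InInt S j → Step I j a → InInt (grow S I) a
grow⁺ (l , h) (c , d) {j} {a} (l≤j , j≤h) s with c ℤ.≤? h | l ℤ.≤? d | s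
... | no _    | _     | inj₁ refl = l≤j , j≤h
... | no c≰h  | _     | inj₂ ((c≤j , _) , _) = contradiction (ℤₚ.≤-trans c≤j j≤h) c≰h
... | yes _   | no _  | inj₁ refl = l≤j , j≤h
... | yes _   | no l≰d | inj₂ ((_ , j≤d) , _) = contradiction (ℤₚ.≤-trans l≤j j≤d) l≰d
... | yes _   | yes _ | inj₁ refl = ℤₚ.≤-trans (ℤₚ.i⊓j≤i l c) l≤j , ℤₚ.≤-trans j≤h (ℤₚ.i≤i⊔j h d)
... | yes _   | yes _ | inj₂ (_ , c≤a , a≤d) = ℤₚ.≤-trans (ℤₚ.i⊓j≤j l c) c≤a , ℤₚ.≤-trans a≤d (ℤₚ.i≤j⊔i h d)

grow-proper : ∀ S I → proj₁ S ℤ.≤ proj₂ S → proj₁ (grow S I) ℤ.≤ proj₂ (grow S I)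
grow-proper (l , h) (c , d) l≤h with c ℤ.≤? h | l ℤ.≤? d
... | no _  | _     = l≤h
... | yes _ | no _  = l≤h
... | yes _ | yes _ = ℤₚ.≤-trans (ℤₚ.i⊓j≤i l c) (ℤₚ.≤-trans l≤h (ℤₚ.i≤i⊔j h d))

span⁻ : ∀ cs S {a} → Proper cs → proj₁ S ℤ.≤ proj₂ S → InInt (span S cs) a → ∃ λ j → InInt S j × Reach cs j a
span⁻ []       S pr l≤h a∈ = _ , a∈ , refl
span⁻ (I ∷ cs) S (c≤d ∷ pr) l≤h a∈
  with p , p∈ , r ← span⁻ cs (grow S I) pr (grow-proper S I l≤h) a∈
  with j , j∈ , s ← grow⁻ S I l≤h c≤d p∈ = j , j∈ , p , s , r

span⁺ : ∀ cs S {j a} → InInt S j → Reach cs j a → InInt (span S cs) a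
span⁺ []       S j∈ refl        = j∈
span⁺ (I ∷ cs) S j∈ (p , s , r) = span⁺ cs (grow S I) (grow⁺ S I j∈ s) r

Reach? : ∀ cs → Proper cs → ∀ i a → Dec (Reach cs i a)
Reach? cs pr i a = map′ from (span⁺ cs (i , i) (ℤₚ.≤-refl , ℤₚ.≤-refl)) (InInt? (span (i , i) cs) a)
  where
  from : InInt (span (i , i) cs) a → Reach cs i a
  from a∈ with j , (i≤j , j≤i) , r ← span⁻ cs (i , i) pr ℤₚ.≤-refl a∈ =
    subst (λ k → Reach cs k a) (ℤₚ.≤-antisym j≤i i≤j) r

-- Zig-zag sequences of intervals

Touch : Iv → Iv → Set
Touch (a , b) (c , d) = a ℤ.≤ d × c ℤ.≤ b

Monotone₃ : ℤ → ℤ → ℤ → Set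
Monotone₃ a b c = (a ℤ.< b × b ℤ.< c) ⊎ (b ℤ.< a × c ℤ.< b)

-- Positions are replaced by sublists, so that the conditions restrict to every splitting of `cs`,
-- and common wires by inequalities between end points.
record Zig (cs : List Iv) : Set where
  field
    proper   : Proper cs
    nonNest  : ∀ {A B} → (A ∷ B ∷ []) ⊆ cs → ¬ Nested A B × ¬ Nested B A
    monotone : ∀ {A B C} → (A ∷ B ∷ C ∷ []) ⊆ cs → Touch A B → Touch B C →
               Monotone₃ (proj₁ A) (proj₁ B) (proj₁ C)

index₁ : ∀ {A : Set} {a : A} {xs} → (a ∷ []) ⊆ xs → ∃ λ p → lookup xs p ≡ a
index₁ (y ∷ʳ s) with p , e ← index₁ s = Fin.suc p , e
index₁ (refl ∷ s) = Fin.zero , refl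

index₂ : ∀ {A : Set} {a b : A} {xs} → (a ∷ b ∷ []) ⊆ xs →
         ∃₂ λ p q → p Fin.< q × lookup xs p ≡ a × lookup xs q ≡ b
index₂ (y ∷ʳ s) with p , q , p<q , e , e′ ← index₂ s = Fin.suc p , Fin.suc q , s≤s p<q , e , e′
index₂ (refl ∷ s) with q , e ← index₁ s = Fin.zero , Fin.suc q , s≤s z≤n , refl , e

index₃ : ∀ {A : Set} {a b c : A} {xs} → (a ∷ b ∷ c ∷ []) ⊆ xs →
         ∃₂ λ p q → ∃ λ r → p Fin.< q × q Fin.< r × lookup xs p ≡ a × lookup xs q ≡ b × lookup xs r ≡ c
index₃ (y ∷ʳ s) with p , q , r , p<q , q<r , e ← index₃ s =
  Fin.suc p , Fin.suc q , Fin.suc r , s≤s p<q , s≤s q<r , e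
index₃ (refl ∷ s) with q , r , q<r , e , e′ ← index₂ s =
  Fin.zero , Fin.suc q , Fin.suc r , s≤s z≤n , s≤s q<r , refl , e , e′

ZigZag⇒Zig : ∀ {n cs} → ZigZag n cs → Zig cs
ZigZag⇒Zig {n} {cs} (ends , _ , nest , zz) = record
  { proper   = All.map (λ (_ , _ , c≤d) → c≤d) ends
  ; nonNest  = nn
  ; monotone = mono }
  where
  nn : ∀ {A B} → (A ∷ B ∷ []) ⊆ cs → ¬ Nested A B × ¬ Nested B A
  nn s with p , q , p<q , refl , refl ← index₂ s =
    nest p q (λ { refl → ℕₚ.<-irrefl refl p<q }) , nest q p (λ { refl → ℕₚ.<-irrefl refl p<q })
  touch⇒meets : ∀ p q → Touch (lookup cs p) (lookup cs q) → Meets n (lookup cs p) (lookup cs q)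
  touch⇒meets p q (a≤d , c≤b)
    with a∈ , _ , a≤b ← All.lookup ends (∈ₚ.∈-lookup {xs = cs} p)
       | c∈ , _ , c≤d ← All.lookup ends (∈ₚ.∈-lookup {xs = cs} q)
    -- The larger of the two left ends is a wire lying in both intervals.
    with ℤₚ.≤-total (proj₁ (lookup cs p)) (proj₁ (lookup cs q))
  ... | inj₁ a≤c = _ , c∈ , (a≤c , c≤b) , (ℤₚ.≤-refl , c≤d)
  ... | inj₂ c≤a = _ , a∈ , (ℤₚ.≤-refl , a≤b) , (c≤a , a≤d)
  mono : ∀ {A B C} → (A ∷ B ∷ C ∷ []) ⊆ cs → Touch A B → Touch B C →
         Monotone₃ (proj₁ A) (proj₁ B) (proj₁ C)
  mono s t t′ with p , q , r , p<q , q<r , refl , refl , refl ← index₃ s =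
    zz p q r p<q q<r (touch⇒meets p q t) (touch⇒meets q r t′)

-- Shape of the reachability relation at its top index

NoStraddle : (ℤ → ℤ → Set) → ℤ → Set
NoStraddle R m = ∀ {p q} → R p q → (p ℤ.< m → q ℤ.< m) × (m ℤ.≤ p → m ℤ.≤ q)

NoStraddle-flip : ∀ {R m} → NoStraddle R m → NoStraddle (flip R) m
NoStraddle-flip {m = m} ns {p} {q} r =
  (λ p<m → case q ℤ.<? m of λ
     { (yes q<m) → q<m ; (no q≮m) → contradiction (proj₂ (ns r) (ℤₚ.≮⇒≥ q≮m)) (ℤₚ.<⇒≱ p<m) }) ,
  (λ m≤p → case m ℤ.≤? q of λ
     { (yes m≤q) → m≤q ; (no m≰q) → contradiction m≤p (ℤₚ.<⇒≱ (proj₁ (ns r) (ℤₚ.≰⇒> m≰q))) })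

Reach-noStraddle : ∀ {m cs} → ¬ Any (Straddles m) cs → NoStraddle (Reach cs) m
Reach-noStraddle ns r = stays-below ns r , stays-above ns r

-- Shape of the reachability matrix at its top index x, for sources and sinks ≤ x:
-- column x is supported on [y₀,x], and the rows y₀,…,x agree.
record Down (R : ℤ → ℤ → Set) (x y₀ : ℤ) : Set where
  field
    col⁻ : ∀ {y} → y ℤ.≤ x → R y x → y₀ ℤ.≤ y
    col⁺ : ∀ {y} → y₀ ℤ.≤ y → y ℤ.≤ x → R y x
    row⁺ : ∀ {y z} → y₀ ℤ.≤ y → y ℤ.≤ x → z ℤ.≤ x → R x z → R y z
    row⁻ : ∀ {y z} → y₀ ℤ.≤ y → y ℤ.≤ x → z ℤ.≤ x → R y z → R x z
    triv : ∀ {z} → y₀ ≡ x → z ℤ.< x → ¬ R x z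

module _ {R R₁ R₂ : ℤ → ℤ → Set} {c d m x : ℤ}
         (decomp : ∀ {y z} → R y z → ∃₂ λ p q → R₁ y p × Step (c , d) p q × R₂ q z)
         (comp : ∀ {y p q z} → R₁ y p → Step (c , d) p q → R₂ q z → R y z)
         (refl₁ : ∀ {i} → R₁ i i) (refl₂ : ∀ {i} → R₂ i i)
         (unc : ∀ {i j a b} → i ℤ.< j → b ℤ.≤ a → R i a → R j b → R i b × R j a)
         (ns₁ : NoStraddle R₁ c) (ns₂ : NoStraddle R₂ m)
         (c≤m : c ℤ.≤ m) (m≤x : m ℤ.≤ x) (x≤d : x ℤ.≤ d) where

  private
    viaJ : ∀ {y z} → c ℤ.≤ y → y ℤ.≤ x → c ℤ.≤ z → z ℤ.≤ x → R y z
    viaJ c≤y y≤x c≤z z≤x =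
      comp refl₁ (inj₂ ((c≤y , ℤₚ.≤-trans y≤x x≤d) , (c≤z , ℤₚ.≤-trans z≤x x≤d))) refl₂
    c≤x = ℤₚ.≤-trans c≤m m≤x
    Step-above : ∀ {p q} → Step (c , d) p q → c ℤ.≤ p → c ℤ.≤ q
    Step-above (inj₁ refl)      c≤p = c≤p
    Step-above (inj₂ (_ , q∈)) _   = proj₁ q∈

  -- The star `[c,d]` contains `x`; what precedes it respects the cut at `c`, and what follows it
  -- respects a cut `m` between `c` and `x`. So a path to `x` cannot start below `c`, while all
  -- wires from `c` to `x` can enter the star, which makes their rows agree. Abstract relations are
  -- used because the dual shape is the same argument read backwards.
  Down-from : Down R x c
  Down-from = record { col⁻ = col⁻ ; col⁺ = col⁺ ; row⁺ = row⁺ ; row⁻ = row⁻ ; triv = triv }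
    where
    col⁻ : ∀ {y} → y ℤ.≤ x → R y x → c ℤ.≤ y
    col⁻ {y} y≤x r with c ℤ.≤? y
    ... | yes c≤y = c≤y
    ... | no  c≰y with p , q , r₁ , s , r₂ ← decomp r with s
    ...   | inj₁ refl = contradiction m≤x (ℤₚ.<⇒≱ (proj₁ (ns₂ r₂) (ℤₚ.<-≤-trans (proj₁ (ns₁ r₁) (ℤₚ.≰⇒> c≰y)) c≤m)))
    ...   | inj₂ ((c≤p , _) , _) = contradiction c≤p (ℤₚ.<⇒≱ (proj₁ (ns₁ r₁) (ℤₚ.≰⇒> c≰y)))
    col⁺ : ∀ {y} → c ℤ.≤ y → y ℤ.≤ x → R y x
    col⁺ c≤y y≤x = viaJ c≤y y≤x c≤x ℤₚ.≤-refl
    row⁺ : ∀ {y z} → c ℤ.≤ y → y ℤ.≤ x → z ℤ.≤ x → R x z → R y z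
    row⁺ {y} {z} c≤y y≤x z≤x r with c ℤ.≤? z | y ℤₚ.≟ x
    ... | yes c≤z | _ = viaJ c≤y y≤x c≤z z≤x
    ... | no _    | yes refl = r
    -- The straight route `y → y` through the star crosses `x → z`; uncrossing yields `y → z`.
    ... | no c≰z  | no y≢x = proj₁ (unc (ℤₚ.≤∧≢⇒< y≤x y≢x) (ℤₚ.<⇒≤ (ℤₚ.<-≤-trans (ℤₚ.≰⇒> c≰z) c≤y)) (viaJ c≤y y≤x c≤y y≤x) r)
    row⁻ : ∀ {y z} → c ℤ.≤ y → y ℤ.≤ x → z ℤ.≤ x → R y z → R x z
    row⁻ {y} {z} c≤y y≤x z≤x r with c ℤ.≤? z
    ... | yes c≤z = viaJ c≤x ℤₚ.≤-refl c≤z z≤x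
    ... | no  c≰z with p , q , r₁ , s , r₂ ← decomp r with p ℤ.≤? d | s
    ...   | yes p≤d | inj₁ refl = comp refl₁ (inj₂ ((c≤x , x≤d) , (proj₂ (ns₁ r₁) c≤y , p≤d))) r₂
    ...   | yes p≤d | inj₂ (_ , q∈) = comp refl₁ (inj₂ ((c≤x , x≤d) , q∈)) r₂
    ...   | no  p≰d | inj₂ ((_ , p≤d) , _) = contradiction p≤d p≰d
    -- Beyond `d` the path is above the cut `m`, so the rest of it cannot descend below `c`.
    ...   | no  p≰d | inj₁ refl = contradiction (ℤₚ.≤-trans c≤m (proj₂ (ns₂ r₂) (ℤₚ.≤-trans (ℤₚ.≤-trans m≤x x≤d) (ℤₚ.<⇒≤ (ℤₚ.≰⇒> p≰d))))) c≰z
    triv : ∀ {z} → c ≡ x → z ℤ.< x → ¬ R x z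
    triv refl z<x r with p , q , r₁ , s , r₂ ← decomp r =
      ℤₚ.<⇒≱ z<x (ℤₚ.≤-trans c≤m (proj₂ (ns₂ r₂) (ℤₚ.≤-trans m≤x (Step-above s (proj₂ (ns₁ r₁) ℤₚ.≤-refl)))))

-- `y₀` is the left end of the leftmost star through `x`, or `x` itself when no star contains `x`.
-- As intervals are convex, it also decides which smaller wires share a star with `x`.
record Dichotomy (cs : List Iv) (x : ℤ) : Set where
  field
    y₀     : ℤ
    y₀≤x   : y₀ ℤ.≤ x
    y₀-end : y₀ ≡ x ⊎ ∃ λ K → K ∈ cs × y₀ ≡ proj₁ K
    share⁺ : ∀ {y} → y₀ ℤ.≤ y → y ℤ.< x → Shares cs y x
    share⁻ : ∀ {y} → y ℤ.≤ x → Shares cs y x → y₀ ℤ.≤ y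
    shape  : Down (Reach cs) x y₀ ⊎ Down (flip (Reach cs)) x y₀

leftmost : ∀ x cs → (∀ {K} → K ∈ cs → ¬ InInt K x) ⊎
           ∃ λ J → J ∈ cs × InInt J x × (∀ {K} → K ∈ cs → InInt K x → proj₁ J ℤ.≤ proj₁ K)
leftmost x [] = inj₁ λ ()
leftmost x (I ∷ cs) with InInt? I x | leftmost x cs
... | no x∉  | inj₁ none = inj₁ λ { (here refl) → x∉ ; (there k) → none k }
... | no x∉  | inj₂ (J , J∈ , x∈ , min) =
  inj₂ (J , there J∈ , x∈ , λ { (here refl) x∈I → contradiction x∈I x∉ ; (there k) → min k })
... | yes x∈I | inj₁ none =
  inj₂ (I , here refl , x∈I , λ { (here refl) _ → ℤₚ.≤-refl ; (there k) x∈K → contradiction x∈K (none k) })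
... | yes x∈I | inj₂ (J , J∈ , x∈ , min) with ℤₚ.≤-total (proj₁ I) (proj₁ J)
...   | inj₁ I≤J = inj₂ (I , here refl , x∈I , λ { (here refl) _ → ℤₚ.≤-refl ; (there k) x∈K → ℤₚ.≤-trans I≤J (min k x∈K) })
...   | inj₂ J≤I = inj₂ (J , there J∈ , x∈ , λ { (here refl) _ → J≤I ; (there k) → min k })

-- `m` is the left end of the leftmost star `L` of `cs` through `x`, or `x` if there is none. A star
-- `M` across `m` must miss `x`. Starting inside `J` it would be nested in `J`; starting to the left
-- of `J` it would make `J` the median of three mutually touching stars, which `notMid` forbids when
-- `J` comes before or after both of the others.
unstraddled : ∀ {J x} cs → InInt J x →
  (∀ {K} → K ∈ cs → InInt K x → proj₁ J ℤ.≤ proj₁ K) →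
  (∀ {K} → K ∈ cs → ¬ Nested K J × ¬ Nested J K) →
  (∀ {M L} → M ∈ cs → L ∈ cs → Touch J M → Touch J L → Touch M L → ¬ (proj₁ M ℤ.< proj₁ J × proj₁ J ℤ.< proj₁ L)) →
  Proper cs →
  ∃ λ m → proj₁ J ℤ.≤ m × m ℤ.≤ x × ¬ Any (Straddles m) cs
unstraddled {J} {x} cs (c≤x , x≤d) min nest notMid proper with leftmost x cs
... | inj₁ none = x , c≤x , ℤₚ.≤-refl ,
  λ s → case find s of λ (K , K∈ , (c<x , x≤d)) → none K∈ (ℤₚ.<⇒≤ c<x , x≤d)
... | inj₂ (L , L∈ , x∈L , minL) = proj₁ L , min L∈ x∈L , proj₁ x∈L , noS
  where
  J<L : proj₁ J ℤ.< proj₁ L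
  J<L = ℤₚ.≤∧≢⇒< (min L∈ x∈L) λ e → case ℤₚ.≤-total (proj₂ J) (proj₂ L) of λ
    { (inj₁ le) → proj₂ (nest L∈) (ℤₚ.≤-reflexive (sym e) , le)
    ; (inj₂ le) → proj₁ (nest L∈) (ℤₚ.≤-reflexive e , le) }
  noS : ¬ Any (Straddles (proj₁ L)) cs
  noS s with M , M∈ , (M<L , L≤dM) ← find s with InInt? M x
  ... | yes x∈M = ℤₚ.<⇒≱ M<L (minL M∈ x∈M)
  ... | no  x∉M with proj₁ J ℤ.≤? proj₁ M
  ...   | yes J≤M = proj₁ (nest M∈) (J≤M , ℤₚ.≤-trans (ℤₚ.<⇒≤ dM<x) x≤d)
    where
    dM<x : proj₂ M ℤ.< x
    dM<x = ℤₚ.≰⇒> λ x≤dM → x∉M (ℤₚ.≤-trans (ℤₚ.<⇒≤ M<L) (proj₁ x∈L) , x≤dM)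
  ...   | no  J≰M = notMid M∈ L∈
    (ℤₚ.≤-trans (ℤₚ.<⇒≤ J<L) L≤dM , ℤₚ.≤-trans (ℤₚ.<⇒≤ (ℤₚ.≰⇒> J≰M)) (ℤₚ.≤-trans c≤x x≤d))
    (ℤₚ.≤-trans c≤x (proj₂ x∈L) , ℤₚ.≤-trans (proj₁ x∈L) x≤d)
    (ℤₚ.≤-trans (ℤₚ.<⇒≤ M<L) (ℤₚ.≤-trans (proj₁ x∈L) (proj₂ x∈L)) , L≤dM)
    (ℤₚ.≰⇒> J≰M , J<L)

pair-order : ∀ {A : Set} {a b : A} {xs} → a ∈ xs → b ∈ xs → a ≢ b → ((a ∷ b ∷ []) ⊆ xs) ⊎ ((b ∷ a ∷ []) ⊆ xs)
pair-order (here refl) (here refl) a≢b = contradiction refl a≢b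
pair-order (here refl) (there q)   _   = inj₁ (refl ∷ from∈ q)
pair-order (there p)   (here refl) _   = inj₂ (refl ∷ from∈ p)
pair-order (there p)   (there q)   a≢b with pair-order p q a≢b
... | inj₁ s = inj₁ (_ ∷ʳ s)
... | inj₂ s = inj₂ (_ ∷ʳ s)

-- If stars before `J` and stars after `J` both straddled its left end, the left ends would turn at
-- `J`. So one side respects the cut at `c`, and `unstraddled` supplies a cut in `[c,x]` for the
-- other. Which side it is decides between the shape and its dual.
dichotomy : ∀ {cs} → Zig cs → ∀ x → Dichotomy cs x
dichotomy {cs} zig x with leftmost x cs
... | inj₁ none = record
  { y₀ = x ; y₀≤x = ℤₚ.≤-refl ; y₀-end = inj₁ refl
  ; share⁺ = λ x≤y y<x → contradiction x≤y (ℤₚ.<⇒≱ y<x)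
  ; share⁻ = λ _ s → case find s of λ (K , K∈ , _ , x∈) → contradiction x∈ (none K∈)
  ; shape  = inj₁ record
    { col⁻ = λ y≤x r → stays-above¹ r
    ; col⁺ = λ x≤y y≤x → subst (λ y → Reach cs y x) (ℤₚ.≤-antisym x≤y y≤x) (Reach-refl cs)
    ; row⁺ = λ {_} {z} x≤y y≤x _ → subst (λ y → Reach cs y z) (ℤₚ.≤-antisym x≤y y≤x)
    ; row⁻ = λ {_} {z} x≤y y≤x _ → subst (λ y → Reach cs y z) (ℤₚ.≤-antisym y≤x x≤y)
    ; triv = λ _ z<x r → ℤₚ.<⇒≱ z<x (stays-above unstr r ℤₚ.≤-refl) } }
  where
  unstr : ¬ Any (Straddles x) cs
  unstr s with K , K∈ , (c<x , x≤d) ← find s = none K∈ (ℤₚ.<⇒≤ c<x , x≤d)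
  stays-above¹ : ∀ {y} → Reach cs y x → x ℤ.≤ y
  stays-above¹ r = proj₂ (NoStraddle-flip (Reach-noStraddle unstr) r) ℤₚ.≤-refl
... | inj₂ (J , J∈ , x∈J , minJ) with cs₁ , cs₂ , refl ← ∈ₚ.∈-∃++ J∈ = result
  where
  open Zig zig
  c = proj₁ J
  d = proj₂ J
  in₁ : ∀ {K} → K ∈ cs₁ → K ∈ cs₁ ++ J ∷ cs₂
  in₁ = ∈ₚ.∈-++⁺ˡ
  in₂ : ∀ {K} → K ∈ cs₂ → K ∈ cs₁ ++ J ∷ cs₂
  in₂ k = ∈ₚ.∈-++⁺ʳ cs₁ (there k)
  sub₂ : ∀ {xs} → xs ⊆ cs₂ → (J ∷ xs) ⊆ cs₁ ++ J ∷ cs₂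
  sub₂ s = ⊆ₚ.++⁺ˡ cs₁ (refl ∷ s)
  sub₁ : ∀ {xs} → xs ⊆ cs₁ → (xs ++ J ∷ []) ⊆ cs₁ ++ J ∷ cs₂
  sub₁ s = ⊆ₚ.++⁺ s (from∈ (here refl))
  c<⇒≢ : ∀ {M L : Iv} → proj₁ M ℤ.< proj₁ L → M ≢ L
  c<⇒≢ M<L refl = ℤₚ.<-irrefl refl M<L
  cut₁ : ∃ λ m → c ℤ.≤ m × m ℤ.≤ x × ¬ Any (Straddles m) cs₁
  cut₁ = unstraddled cs₁ x∈J (λ k → minJ (in₁ k)) (λ k → nonNest (sub₁ (from∈ k))) notMid (Allₚ.++⁻ˡ cs₁ proper)
    where
    notMid : ∀ {M L} → M ∈ cs₁ → L ∈ cs₁ → Touch J M → Touch J L → Touch M L → ¬ (proj₁ M ℤ.< c × c ℤ.< proj₁ L)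
    notMid M∈ L∈ JM (JL , LJ) (ML , LM) (M<J , J<L) with pair-order M∈ L∈ (c<⇒≢ (ℤₚ.<-trans M<J J<L))
    ... | inj₁ s with monotone (sub₁ s) (ML , LM) (LJ , JL)
    ...   | inj₁ (_ , L<J) = ℤₚ.<-asym L<J J<L
    ...   | inj₂ (L<M , _) = ℤₚ.<-asym L<M (ℤₚ.<-trans M<J J<L)
    notMid M∈ L∈ (JM , MJ) JL (ML , LM) (M<J , J<L) | inj₂ s with monotone (sub₁ s) (LM , ML) (MJ , JM)
    ...   | inj₁ (L<M , _) = ℤₚ.<-asym L<M (ℤₚ.<-trans M<J J<L)
    ...   | inj₂ (_ , J<M) = ℤₚ.<-asym J<M M<J
  cut₂ : ∃ λ m → c ℤ.≤ m × m ℤ.≤ x × ¬ Any (Straddles m) cs₂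
  cut₂ = unstraddled cs₂ x∈J (λ k → minJ (in₂ k)) (λ k → let nn = nonNest (sub₂ (from∈ k)) in proj₂ nn , proj₁ nn) notMid (All.tail (Allₚ.++⁻ʳ cs₁ proper))
    where
    notMid : ∀ {M L} → M ∈ cs₂ → L ∈ cs₂ → Touch J M → Touch J L → Touch M L → ¬ (proj₁ M ℤ.< c × c ℤ.< proj₁ L)
    notMid M∈ L∈ JM JL (ML , LM) (M<J , J<L) with pair-order M∈ L∈ (c<⇒≢ (ℤₚ.<-trans M<J J<L))
    ... | inj₁ s with monotone (sub₂ s) JM (ML , LM)
    ...   | inj₁ (J<M , _) = ℤₚ.<-asym J<M M<J
    ...   | inj₂ (_ , L<M) = ℤₚ.<-asym L<M (ℤₚ.<-trans M<J J<L)
    notMid M∈ L∈ JM JL (ML , LM) (M<J , J<L) | inj₂ s with monotone (sub₂ s) JL (LM , ML)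
    ...   | inj₁ (_ , L<M) = ℤₚ.<-asym L<M (ℤₚ.<-trans M<J J<L)
    ...   | inj₂ (L<J , _) = ℤₚ.<-asym L<J J<L
  share⁺ : ∀ {y} → c ℤ.≤ y → y ℤ.< x → Shares (cs₁ ++ J ∷ cs₂) y x
  share⁺ c≤y y<x = lose J∈ ((c≤y , ℤₚ.≤-trans (ℤₚ.<⇒≤ y<x) (proj₂ x∈J)) , x∈J)
  share⁻ : ∀ {y} → y ℤ.≤ x → Shares (cs₁ ++ J ∷ cs₂) y x → c ℤ.≤ y
  share⁻ _ s with K , K∈ , y∈ , x∈ ← find s = ℤₚ.≤-trans (minJ K∈ x∈) (proj₁ y∈)
  unc : ∀ {i j a b} → i ℤ.< j → b ℤ.≤ a → Reach (cs₁ ++ J ∷ cs₂) i a → Reach (cs₁ ++ J ∷ cs₂) j b → _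
  unc = uncross (cs₁ ++ J ∷ cs₂)
  dec : ∀ {y z} → Reach (cs₁ ++ J ∷ cs₂) y z → ∃₂ λ p q → Reach cs₁ y p × Step J p q × Reach cs₂ q z
  dec r with p , r₁ , q , s , r₂ ← Reach-++⁻ cs₁ r = p , q , r₁ , s , r₂
  Step-flip : ∀ {p q} → Step J p q → Step J q p
  Step-flip (inj₁ refl)    = inj₁ refl
  Step-flip (inj₂ (p , q)) = inj₂ (q , p)
  shape : Down (Reach (cs₁ ++ J ∷ cs₂)) x c ⊎ Down (flip (Reach (cs₁ ++ J ∷ cs₂))) x c
  shape with Any.any? (Straddles? c) cs₁
  ... | no none with m , c≤m , m≤x , ns ← cut₂ =
    inj₁ (Down-from dec (λ r₁ s r₂ → Reach-++⁺ cs₁ r₁ (_ , s , r₂)) (Reach-refl cs₁) (Reach-refl cs₂) unc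
           (Reach-noStraddle none) (Reach-noStraddle ns) c≤m m≤x (proj₂ x∈J))
  ... | yes str with m , c≤m , m≤x , ns ← cut₁ =
    inj₂ (Down-from (λ r → let p , q , r₁ , s , r₂ = dec r in q , p , r₂ , Step-flip s , r₁)
           (λ r₂ s r₁ → Reach-++⁺ cs₁ r₁ (_ , Step-flip s , r₂)) (Reach-refl cs₂) (Reach-refl cs₁)
           (λ i<j b≤a r r′ → unc′ i<j b≤a r r′)
           (NoStraddle-flip (Reach-noStraddle none₂)) (NoStraddle-flip (Reach-noStraddle ns)) c≤m m≤x (proj₂ x∈J))
    where
    unc′ : ∀ {i j a b} → i ℤ.< j → b ℤ.≤ a → Reach (cs₁ ++ J ∷ cs₂) a i → Reach (cs₁ ++ J ∷ cs₂) b j →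
           Reach (cs₁ ++ J ∷ cs₂) b i × Reach (cs₁ ++ J ∷ cs₂) a j
    unc′ {i} {j} {a} {b} i<j b≤a r r′ with b ℤₚ.≟ a
    ... | yes refl = r , r′
    ... | no b≢a = unc (ℤₚ.≤∧≢⇒< b≤a b≢a) (ℤₚ.<⇒≤ i<j) r′ r
    none₂ : ¬ Any (Straddles c) cs₂
    none₂ str₂ with K , K∈ , (K<J , J≤dK) ← find str | L , L∈ , (L<J , J≤dL) ← find str₂
      with monotone (⊆ₚ.++⁺ (from∈ K∈) (refl ∷ from∈ L∈))
             (ℤₚ.≤-trans (ℤₚ.<⇒≤ K<J) (ℤₚ.≤-trans (proj₁ x∈J) (proj₂ x∈J)) , J≤dK)
             (J≤dL , ℤₚ.≤-trans (ℤₚ.<⇒≤ L<J) (ℤₚ.≤-trans (proj₁ x∈J) (proj₂ x∈J)))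
    ... | inj₁ (_ , J<L) = ℤₚ.<-asym J<L L<J
    ... | inj₂ (J<K , _) = ℤₚ.<-asym J<K K<J
  result : Dichotomy (cs₁ ++ J ∷ cs₂) x
  result = record { y₀ = c ; y₀≤x = proj₁ x∈J ; y₀-end = inj₂ (J , J∈ , refl) ; share⁺ = share⁺ ; share⁻ = share⁻ ; shape = shape }

-- Whichever shape holds at `j`, one of the two relations forces `y₀ ≤ i`.
Reach-mutual⇒Shares : ∀ {cs} → Zig cs → ∀ {i j} → i ℤ.< j → Reach cs i j → Reach cs j i → Shares cs i j
Reach-mutual⇒Shares zig {i} {j} i<j ij ji with shape
  where open Dichotomy (dichotomy zig j)
... | inj₁ dn = Dichotomy.share⁺ (dichotomy zig j) (Down.col⁻ dn (ℤₚ.<⇒≤ i<j) ij) i<j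
... | inj₂ up = Dichotomy.share⁺ (dichotomy zig j) (Down.col⁻ up (ℤₚ.<⇒≤ i<j) ji) i<j

-- Inversions

Unique-↭ : ∀ {A : Set} {xs ys : List A} → xs ↭ ys → Unique xs → Unique ys
Unique-↭ Perm.refl u = u
Unique-↭ (prep x p) (a ∷ u) = ↭ₚ.All-resp-↭ p a ∷ Unique-↭ p u
Unique-↭ (swap x y p) ((x≢y ∷ ax) ∷ ay ∷ u) =
  ((λ e → x≢y (sym e)) ∷ ↭ₚ.All-resp-↭ p ay) ∷ ↭ₚ.All-resp-↭ p ax ∷ Unique-↭ p u
Unique-↭ (Perm.trans p q) u = Unique-↭ q (Unique-↭ p u)

χ : Bool → ℕ
χ b = if b then 1 else 0

sumOf : {A : Set} → (A → ℕ) → List A → ℕ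
sumOf f xs = sum (map f xs)

sumOf-↭ : ∀ {A : Set} (f : A → ℕ) {xs ys} → xs ↭ ys → sumOf f xs ≡ sumOf f ys
sumOf-↭ f p = sum-↭ (↭ₚ.map⁺ f p)

sumOf-cong : ∀ {A : Set} {f g : A → ℕ} xs → (∀ {x} → x ∈ xs → f x ≡ g x) → sumOf f xs ≡ sumOf g xs
sumOf-cong []       _  = refl
sumOf-cong (x ∷ xs) eq = cong₂ _+_ (eq (here refl)) (sumOf-cong xs (eq ∘ there))

sumOf-mono : ∀ {A : Set} {f g : A → ℕ} xs → (∀ {x} → x ∈ xs → f x ≤ g x) → sumOf f xs ≤ sumOf g xs
sumOf-mono []       _  = z≤n
sumOf-mono (x ∷ xs) le = ℕₚ.+-mono-≤ (le (here refl)) (sumOf-mono xs (le ∘ there))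

sumOf-++ : ∀ {A : Set} (f : A → ℕ) xs ys → sumOf f (xs ++ ys) ≡ sumOf f xs + sumOf f ys
sumOf-++ f []       ys = refl
sumOf-++ f (x ∷ xs) ys = trans (cong (_+_ (f x)) (sumOf-++ f xs ys)) (sym (ℕₚ.+-assoc (f x) _ _))

sumOf-+ : ∀ {A : Set} (f g : A → ℕ) xs → sumOf (λ x → f x + g x) xs ≡ sumOf f xs + sumOf g xs
sumOf-+ f g []       = refl
sumOf-+ f g (x ∷ xs) = trans (cong (_+_ (f x + g x)) (sumOf-+ f g xs)) (interchange (f x) (g x) _ _)
  where
  interchange : ∀ a b c d → (a + b) + (c + d) ≡ (a + c) + (b + d)
  interchange = ℕ-solve-∀

sumOf-map : ∀ {A B : Set} (f : B → ℕ) (g : A → B) xs → sumOf f (map g xs) ≡ sumOf (f ∘ g) xs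
sumOf-map f g xs = cong sum (sym (Listₚ.map-∘ xs))

sumOf-zero : ∀ {A : Set} (xs : List A) → sumOf (λ _ → 0) xs ≡ 0
sumOf-zero []       = refl
sumOf-zero (x ∷ xs) = sumOf-zero xs

sumOf-swap : ∀ {A B : Set} (f : A → B → ℕ) xs ys →
             sumOf (λ x → sumOf (f x) ys) xs ≡ sumOf (λ y → sumOf (λ x → f x y) xs) ys
sumOf-swap f []       ys = sym (sumOf-zero ys)
sumOf-swap f (x ∷ xs) ys =
  trans (cong (_+_ (sumOf (f x) ys)) (sumOf-swap f xs ys)) (sym (sumOf-+ (f x) (λ y → sumOf (λ x → f x y) xs) ys))

length-filterᵇ : ∀ {A : Set} (p : A → Bool) xs → length (filterᵇ p xs) ≡ sumOf (χ ∘ p) xs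
length-filterᵇ p [] = refl
length-filterᵇ p (x ∷ xs) with p x
... | true  = cong suc (length-filterᵇ p xs)
... | false = length-filterᵇ p xs

sumOf-cartesian : ∀ {A B : Set} (f : A × B → ℕ) xs ys →
                  sumOf f (cartesianProduct xs ys) ≡ sumOf (λ x → sumOf (λ y → f (x , y)) ys) xs
sumOf-cartesian f []       ys = refl
sumOf-cartesian f (x ∷ xs) ys =
  trans (sumOf-++ f (map (x ,_) ys) _) (cong₂ _+_ (sumOf-map f (x ,_) ys) (sumOf-cartesian f xs ys))

inverted : (ℤ → ℤ) → ℤ → ℤ → Bool
inverted u a b = ⌊ a ℤ.<? b ⌋ ∧ ⌊ u b ℤ.<? u a ⌋

-- All ordered pairs of entries are tested, so the value does not depend on the order in which `W`
-- is listed.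
inversions : (ℤ → ℤ) → List ℤ → ℕ
inversions u W = sumOf (λ a → sumOf (λ b → χ (inverted u a b)) W) W

invOn-inversions : ∀ n u → invOn n u ≡ inversions u (wires n)
invOn-inversions n u = trans (length-filterᵇ _ (cartesianProduct (wires n) (wires n))) (sumOf-cartesian _ (wires n) (wires n))

inversions-↭ : ∀ u {W W′} → W ↭ W′ → inversions u W ≡ inversions u W′
inversions-↭ u {W} {W′} p = trans (sumOf-cong W (λ {a} _ → sumOf-↭ (λ b → χ (inverted u a b)) p)) (sumOf-↭ _ p)

transp : ℤ → ℤ → ℤ → ℤ
transp i j k = if ⌊ k ℤₚ.≟ i ⌋ then j else if ⌊ k ℤₚ.≟ j ⌋ then i else k

transp-fst : ∀ i j → transp i j i ≡ j
transp-fst i j with i ℤₚ.≟ i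
... | yes _   = refl
... | no  i≢i = contradiction refl i≢i

transp-snd : ∀ i j → transp i j j ≡ i
transp-snd i j with j ℤₚ.≟ i
... | yes j≡i = j≡i
... | no  _ with j ℤₚ.≟ j
...   | yes _   = refl
...   | no  j≢j = contradiction refl j≢j

transp-other : ∀ {i j k} → k ≢ i → k ≢ j → transp i j k ≡ k
transp-other {i} {j} {k} k≢i k≢j with k ℤₚ.≟ i
... | yes e = contradiction e k≢i
... | no  _ with k ℤₚ.≟ j
...   | yes e = contradiction e k≢j
...   | no  _ = refl

⌊⌋-mono : ∀ {P Q : Set} (P? : Dec P) (Q? : Dec Q) → (P → Q) → T ⌊ P? ⌋ → T ⌊ Q? ⌋
⌊⌋-mono (yes p) (yes q) f _ = tt
⌊⌋-mono (yes p) (no ¬q) f _ = ¬q (f p)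

-- k can only gain inversions with {i,j} when u_i < u_j are exchanged
χ-exchange : ∀ A B X X′ → (T B → T A) → (T X → T X′) → χ (A ∧ X) + χ (B ∧ X′) ≤ χ (A ∧ X′) + χ (B ∧ X)
χ-exchange true  true  X     X′    _ _ = ℕₚ.≤-reflexive (ℕₚ.+-comm (χ X) (χ X′))
χ-exchange false true  X     X′    h _ = ⊥-elim (h tt)
χ-exchange false false X     X′    _ _ = z≤n
χ-exchange true  false false X′    _ _ = z≤n
χ-exchange true  false true  true  _ _ = ℕₚ.≤-refl
χ-exchange true  false true  false _ h = ⊥-elim (h tt)

-- After `W` is listed as `i ∷ j ∷ V`, the pair of `i` and `j` gains an inversion, `χ-exchange`
-- shows that no `k` in `V` loses any with `i` and `j` together, and pairs inside `V` are untouched.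
inversions-transp : ∀ u {W i j} → Unique W → i ∈ W → j ∈ W → i ℤ.< j → u i ℤ.< u j →
                    inversions u W < inversions (u ∘ transp i j) W
inversions-transp u {W} {i} {j} uniq i∈ j∈ i<j ui<uj
  with xs , ys , refl ← ∈ₚ.∈-∃++ i∈ = subst₂ _<_ (sym (inversions-↭ u W↭)) (sym (inversions-↭ u′ W↭)) core
  where
  u′ = u ∘ transp i j
  i≢j : i ≢ j
  i≢j refl = ℤₚ.<-irrefl refl i<j
  W₁↭ : xs ++ i ∷ ys ↭ i ∷ (xs ++ ys)
  W₁↭ = ↭ₚ.shift i xs ys
  j∈′ : j ∈ xs ++ ys
  j∈′ with ↭ₚ.∈-resp-↭ W₁↭ j∈
  ... | here e  = contradiction (sym e) i≢j
  ... | there p = p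
  split = ∈ₚ.∈-∃++ j∈′
  V = proj₁ split ++ proj₁ (proj₂ split)
  W↭ : xs ++ i ∷ ys ↭ i ∷ j ∷ V
  W↭ = ↭-trans W₁↭ (prep i (↭-trans (↭-reflexive (proj₂ (proj₂ split))) (↭ₚ.shift j (proj₁ split) _)))
  uniq′ : Unique (i ∷ j ∷ V)
  uniq′ = Unique-↭ W↭ uniq
  notin : ∀ {k} → k ∈ V → k ≢ i × k ≢ j
  notin k∈ with (_ ∷ i∉) ∷ j∉ ∷ _ ← uniq′ =
    (λ e → All.lookup i∉ k∈ (sym e)) , (λ e → All.lookup j∉ k∈ (sym e))
  u′i : u′ i ≡ u j
  u′i = cong u (transp-fst i j)
  u′j : u′ j ≡ u i
  u′j = cong u (transp-snd i j)
  u′k : ∀ {k} → k ∈ V → u′ k ≡ u k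
  u′k k∈ = cong u (transp-other (proj₁ (notin k∈)) (proj₂ (notin k∈)))
  diag : ∀ v a → χ (inverted v a a) ≡ 0
  diag v a with a ℤ.<? a
  ... | yes a<a = contradiction a<a (ℤₚ.<-irrefl refl)
  ... | no _ = refl
  ji : ∀ v → χ (inverted v j i) ≡ 0
  ji v with j ℤ.<? i
  ... | yes j<i = contradiction j<i (ℤₚ.<-asym i<j)
  ... | no _ = refl
  ij : χ (inverted u i j) ≡ 0
  ij with i ℤ.<? j | u j ℤ.<? u i
  ... | _     | yes uj<ui = contradiction uj<ui (ℤₚ.<-asym ui<uj)
  ... | yes _ | no _ = refl
  ... | no _  | no _ = refl
  ij′ : χ (inverted u′ i j) ≡ 1
  ij′ rewrite u′i | u′j with i ℤ.<? j | u i ℤ.<? u j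
  ... | yes _ | yes _ = refl
  ... | no ¬p | _     = contradiction i<j ¬p
  ... | yes _ | no ¬p = contradiction ui<uj ¬p
  side : (ℤ → ℤ) → ℤ → ℕ
  side v k = (χ (inverted v i k) + χ (inverted v j k)) + (χ (inverted v k i) + χ (inverted v k j))
  inner : (ℤ → ℤ) → ℕ
  inner v = sumOf (λ k → sumOf (λ l → χ (inverted v k l)) V) V
  expand : ∀ v → inversions v (i ∷ j ∷ V) ≡ χ (inverted v i j) + (sumOf (side v) V + inner v)
  expand v = begin
    (dii + (χ (inverted v i j) + sumOf fi V)) + ((χ (inverted v j i) + (djj + sumOf fj V)) + sumOf (λ k → χ (inverted v k i) + (χ (inverted v k j) + sumOf (λ l → χ (inverted v k l)) V)) V)
      ≡⟨ cong₂ _+_ (cong (_+ (χ (inverted v i j) + sumOf fi V)) (diag v i)) (cong₂ _+_ (cong₂ _+_ (ji v) (cong (_+ sumOf fj V) (diag v j))) rest) ⟩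
    (χ (inverted v i j) + sumOf fi V) + (sumOf fj V + (sumOf gi V + (sumOf gj V + inner v)))
      ≡⟨ arrange (χ (inverted v i j)) (sumOf fi V) (sumOf fj V) (sumOf gi V) (sumOf gj V) (inner v) ⟩
    χ (inverted v i j) + (((sumOf fi V + sumOf fj V) + (sumOf gi V + sumOf gj V)) + inner v)
      ≡⟨ cong (λ t → χ (inverted v i j) + (t + inner v)) (sym (trans (sumOf-+ _ _ V) (cong₂ _+_ (sumOf-+ fi fj V) (sumOf-+ gi gj V)))) ⟩
    χ (inverted v i j) + (sumOf (side v) V + inner v) ∎
    where
    open ≡-Reasoning
    fi = λ k → χ (inverted v i k)
    fj = λ k → χ (inverted v j k)
    gi = λ k → χ (inverted v k i)
    gj = λ k → χ (inverted v k j)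
    dii = χ (inverted v i i)
    djj = χ (inverted v j j)
    rest = trans (sumOf-+ gi _ V) (cong (_+_ (sumOf gi V)) (sumOf-+ gj _ V))
    arrange : ∀ a b c d e f → (a + b) + (c + (d + (e + f))) ≡ a + (((b + c) + (d + e)) + f)
    arrange = ℕ-solve-∀
  side-≤ : ∀ {k} → k ∈ V → side u k ≤ side u′ k
  side-≤ {k} k∈ rewrite u′i | u′j | u′k k∈ =
    ℕₚ.+-mono-≤
      (χ-exchange ⌊ i ℤ.<? k ⌋ ⌊ j ℤ.<? k ⌋ ⌊ u k ℤ.<? u i ⌋ ⌊ u k ℤ.<? u j ⌋
        (⌊⌋-mono (j ℤ.<? k) (i ℤ.<? k) (ℤₚ.<-trans i<j))
        (⌊⌋-mono (u k ℤ.<? u i) (u k ℤ.<? u j) (λ p → ℤₚ.<-trans p ui<uj)))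
      (subst₂ _≤_ (ℕₚ.+-comm (χ (⌊ k ℤ.<? j ⌋ ∧ ⌊ u j ℤ.<? u k ⌋)) _) (ℕₚ.+-comm (χ (⌊ k ℤ.<? j ⌋ ∧ ⌊ u i ℤ.<? u k ⌋)) _)
        (χ-exchange ⌊ k ℤ.<? j ⌋ ⌊ k ℤ.<? i ⌋ ⌊ u j ℤ.<? u k ⌋ ⌊ u i ℤ.<? u k ⌋
          (⌊⌋-mono (k ℤ.<? i) (k ℤ.<? j) (λ p → ℤₚ.<-trans p i<j))
          (⌊⌋-mono (u j ℤ.<? u k) (u i ℤ.<? u k) (ℤₚ.<-trans ui<uj))))
  inner-≡ : inner u ≡ inner u′
  inner-≡ = sumOf-cong V λ {k} k∈ → sumOf-cong V λ {l} l∈ →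
    cong₂ (λ s t → χ (⌊ k ℤ.<? l ⌋ ∧ ⌊ s ℤ.<? t ⌋)) (sym (u′k l∈)) (sym (u′k k∈))
  core : inversions u (i ∷ j ∷ V) < inversions u′ (i ∷ j ∷ V)
  core rewrite expand u | expand u′ | ij | ij′ = s≤s (ℕₚ.+-mono-≤ (sumOf-mono V side-≤) (ℕₚ.≤-reflexive inner-≡))

-- Covering path families

-- A star on a single wire has no interior vertex.
On : Iv → ℤ → Set
On (c , d) q = c ℤ.< d × InInt (c , d) q

On? : ∀ I q → Dec (On I q)
On? (c , d) q = (c ℤ.<? d) ×-dec InInt? (c , d) q

midsOn-on : ∀ k I cs {q} → On I q → midsOn k (I ∷ cs) q ≡ mid k ∷ midsOn (suc k) cs q
midsOn-on k (c , d) cs {q} (c<d , c≤q , q≤d) with c ℤ.<? d | c ℤ.≤? q | q ℤ.≤? d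
... | yes _   | yes _   | yes _   = refl
... | no c≮d  | _       | _       = contradiction c<d c≮d
... | yes _   | no c≰q  | _       = contradiction c≤q c≰q
... | yes _   | yes _   | no q≰d  = contradiction q≤d q≰d

midsOn-off : ∀ k I cs {q} → ¬ On I q → midsOn k (I ∷ cs) q ≡ midsOn (suc k) cs q
midsOn-off k (c , d) cs {q} off with c ℤ.<? d | c ℤ.≤? q | q ℤ.≤? d
... | yes c<d | yes c≤q | yes q≤d = contradiction (c<d , c≤q , q≤d) off
... | no _    | _       | _       = refl
... | yes _   | no _    | _       = refl
... | yes _   | yes _   | no _    = refl

midsOn-++ : ∀ k pre cs q → midsOn k (pre ++ cs) q ≡ midsOn k pre q ++ midsOn (k + length pre) cs q
midsOn-++ k []        cs q rewrite ℕₚ.+-identityʳ k = refl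
midsOn-++ k (I ∷ pre) cs q rewrite ℕₚ.+-suc k (length pre) | midsOn-++ (suc k) pre cs q =
  sym (Listₚ.++-assoc (if ⌊ proj₁ I ℤ.<? proj₂ I ⌋ ∧ ⌊ proj₁ I ℤ.≤? q ⌋ ∧ ⌊ q ℤ.≤? proj₂ I ⌋ then mid k ∷ [] else []) (midsOn (suc k) pre q) _)

midsOn-mid : ∀ k cs q {v} → v ∈ midsOn k cs q → ∃ λ j → v ≡ mid j × k ≤ j × j < k + length cs
midsOn-mid k (I ∷ cs) q v∈ with On? I q
... | yes on rewrite midsOn-on k I cs on with v∈
...   | here refl = k , refl , ℕₚ.≤-refl , ℕₚ.m<m+n k (s≤s z≤n)
...   | there v∈′ with j , e , k<j , j< ← midsOn-mid (suc k) cs q v∈′ =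
  j , e , ℕₚ.<⇒≤ k<j , subst (j <_) (sym (ℕₚ.+-suc k (length cs))) j<
midsOn-mid k (I ∷ cs) q v∈ | no off rewrite midsOn-off k I cs off
  with j , e , k<j , j< ← midsOn-mid (suc k) cs q v∈ =
  j , e , ℕₚ.<⇒≤ k<j , subst (j <_) (sym (ℕₚ.+-suc k (length cs))) j<

Consec-++ʳ : ∀ {A : Set} {x y : A} us {vs} → x ∉ us → ConsecIn x y (us ++ vs) → ConsecIn x y vs
Consec-++ʳ []       x∉ c = c
Consec-++ʳ (u ∷ us) x∉ ([] , ys , e) = contradiction (here (sym (Listₚ.∷-injectiveˡ e))) x∉
Consec-++ʳ (u ∷ us) x∉ (_ ∷ xs , ys , e) = Consec-++ʳ us (x∉ ∘ there) (xs , ys , Listₚ.∷-injectiveʳ e)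

Consec-head : ∀ {A : Set} {x y : A} {vs} → x ∉ vs → ConsecIn x y (x ∷ vs) → ∃ λ r → vs ≡ y ∷ r
Consec-head x∉ ([] , ys , e) = ys , Listₚ.∷-injectiveʳ e
Consec-head {x = x} x∉ (z ∷ xs , ys , e) =
  contradiction (subst (x ∈_) (sym (Listₚ.∷-injectiveʳ e)) (∈ₚ.∈-++⁺ʳ xs (here refl))) x∉

Consec-left : ∀ {A : Set} {x y : A} {vs} → ConsecIn x y vs → x ∈ vs
Consec-left (xs , ys , refl) = ∈ₚ.∈-++⁺ʳ xs (here refl)

mids-then-snk : ∀ k cs q {v} → v ∈ midsOn k cs q ++ snk q ∷ [] → (∃ λ j → v ≡ mid j × k ≤ j) ⊎ v ≡ snk q
mids-then-snk k cs q v∈ with ∈ₚ.∈-++⁻ (midsOn k cs q) v∈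
... | inj₁ m with j , e , k≤j , _ ← midsOn-mid k cs q m = inj₁ (j , e , k≤j)
... | inj₂ (here e) = inj₂ e

-- The interior vertices of a wire appear in increasing order of their numbers, so this vertex
-- occurs at most once and only later stars follow it.
after-mid : ∀ pre I cs q {z} → ConsecIn (mid (length pre)) z (wireSeq (pre ++ I ∷ cs) q) →
            On I q × ∃ λ r → midsOn (suc (length pre)) cs q ++ snk q ∷ [] ≡ z ∷ r
after-mid pre I cs q {z} c = case On? I q of λ
    { (yes on) → on , Consec-head (notMid ∘ mids-then-snk (suc k) cs q) (subst (ConsecIn (mid k) z) (cong (_++ snk q ∷ []) (midsOn-on k I cs on)) c₁)
    ; (no off) → contradiction (mids-then-snk (suc k) cs q (Consec-left (subst (ConsecIn (mid k) z) (cong (_++ snk q ∷ []) (midsOn-off k I cs off)) c₁))) notMid }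
  where
  k = length pre
  notMid : ¬ ((∃ λ j → mid k ≡ mid j × suc k ≤ j) ⊎ mid k ≡ snk q)
  notMid (inj₁ (j , refl , k<k)) = ℕₚ.<-irrefl refl k<k
  c₀ : ConsecIn (mid k) z ((src q ∷ midsOn 0 pre q) ++ (midsOn k (I ∷ cs) q ++ snk q ∷ []))
  c₀ = subst (λ l → ConsecIn (mid k) z (src q ∷ l))
         (trans (cong (_++ snk q ∷ []) (midsOn-++ 0 pre (I ∷ cs) q)) (Listₚ.++-assoc (midsOn 0 pre q) _ _)) c
  c₁ : ConsecIn (mid k) z (midsOn k (I ∷ cs) q ++ snk q ∷ [])
  c₁ = Consec-++ʳ (src q ∷ midsOn 0 pre q)
    (λ { (here ()) ; (there m) → case midsOn-mid 0 pre q m of λ { (j , refl , _ , k<k) → ℕₚ.<-irrefl refl k<k } }) c₀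

after-src : ∀ cs i q {z} → ConsecIn (src i) z (wireSeq cs q) → i ≡ q × ∃ λ r → midsOn 0 cs q ++ snk q ∷ [] ≡ z ∷ r
after-src cs i q {z} c with Consec-left c
... | here refl = refl , Consec-head (λ m → case mids-then-snk 0 cs q m of λ { (inj₁ ()) ; (inj₂ ()) }) c
... | there m = case mids-then-snk 0 cs q m of λ { (inj₁ ()) ; (inj₂ ()) }

after-snk : ∀ cs i q {z} → ¬ ConsecIn (snk i) z (wireSeq cs q)
after-snk cs i q {z} c with Consec-++ʳ (src q ∷ midsOn 0 cs q) notSnk c
  where
  notSnk : snk i ∉ src q ∷ midsOn 0 cs q
  notSnk (there m) with () ← midsOn-mid 0 cs q m
... | (x ∷ [] , ys , ())
... | (x ∷ y ∷ xs , ys , ())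

-- The vertices (after the source) of a path that enters the stars cs, numbered
-- from k, on wire q and ends in sink a.
data Trace : ℕ → List Iv → ℤ → ℤ → List Vtx → Set where
  end  : ∀ {k a} → Trace k [] a a (snk a ∷ [])
  pass : ∀ {k I cs q a p} → ¬ On I q → Trace (suc k) cs q a p → Trace k (I ∷ cs) q a p
  hit  : ∀ {k I cs q q′ a p} → On I q → On I q′ → Trace (suc k) cs q′ a p → Trace k (I ∷ cs) q a (mid k ∷ p)

-- Since parallel edges are merged, the path does not determine a wire between two stars. The trace
-- keeps a representative `q` on which `y` is the next vertex; after a star it switches to the wire
-- that witnesses the next edge.
toTrace : ∀ n css pre cs {k q a y r p} → css ≡ pre ++ cs → k ≡ length pre →
          midsOn k cs q ++ snk q ∷ [] ≡ y ∷ r → Linked (Edge n css) (y ∷ p) → last (y ∷ p) ≡ just (snk a) →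
          Trace k cs q a (y ∷ p)
toTrace n css pre [] {p = []} eq refl refl [-] refl = end
toTrace n css pre [] {p = z ∷ p} eq refl refl ((i , _ , c) ∷ _) la = contradiction c (after-snk css _ i)
toTrace n css pre (I ∷ cs) {q = q} {a} {p = p} refl refl e l la with On? I q
... | no off rewrite midsOn-off (length pre) I cs off =
  pass off (toTrace n css (pre ++ I ∷ []) cs (sym (Listₚ.++-assoc pre (I ∷ []) cs))
             (trans (ℕₚ.+-comm 1 (length pre)) (sym (Listₚ.length-++ pre))) e l la)
... | yes on rewrite midsOn-on (length pre) I cs on with refl , refl ← Listₚ.∷-injective e with p | l | la
...   | []     | _ | ()
...   | z ∷ p′ | (i , _ , c) ∷ l′ | la′ with on′ , r , e′ ← after-mid pre I cs i c =
  hit on on′ (toTrace n css (pre ++ I ∷ []) cs (sym (Listₚ.++-assoc pre (I ∷ []) cs))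
             (trans (ℕₚ.+-comm 1 (length pre)) (sym (Listₚ.length-++ pre))) e′ l′ la′)

path⇒Trace : ∀ n cs {p i a} → IsPath n cs p i a → ∃ λ p′ → p ≡ src i ∷ p′ × Trace 0 cs i a p′
path⇒Trace n cs {p = []} (() , _)
path⇒Trace n cs {p = x ∷ []} (refl , () , _)
path⇒Trace n cs {p = x ∷ y ∷ p} {i} (refl , la , (q , _ , c) ∷ l) with refl , r , e ← after-src cs i q c =
  y ∷ p , refl , toTrace n cs [] cs refl refl e l la

Trace⇒Reach : ∀ {k cs q a p} → Trace k cs q a p → Reach cs q a
Trace⇒Reach end              = refl
Trace⇒Reach (pass _ t)       = _ , inj₁ refl , Trace⇒Reach t
Trace⇒Reach (hit on on′ t)   = _ , inj₂ (proj₂ on , proj₂ on′) , Trace⇒Reach t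

Trace-src : ∀ {k cs q a p b} → Trace k cs q a p → src b ∉ p
Trace-src end         (here ())
Trace-src end         (there ())
Trace-src (pass _ t)  v∈         = Trace-src t v∈
Trace-src (hit _ _ t) (there v∈) = Trace-src t v∈

Trace-snk : ∀ {k cs q a p b} → Trace k cs q a p → snk b ∈ p → b ≡ a
Trace-snk end         (here refl) = refl
Trace-snk (pass _ t)  v∈          = Trace-snk t v∈
Trace-snk (hit _ _ t) (there v∈)  = Trace-snk t v∈

Via : List Iv → Iv → List Iv → ℤ → ℤ → Set
Via pre K post i a = ∃₂ λ p q → Reach pre i p × InInt K p × InInt K q × Reach post q a

Trace-mid : ∀ {k cs q a p j} → Trace k cs q a p → mid j ∈ p →
            ∃₂ λ pre K → ∃ λ post → cs ≡ pre ++ K ∷ post × j ≡ k + length pre × Via pre K post q a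
Trace-mid end (here ())
Trace-mid end (there ())
Trace-mid {k} (pass {I = I} _ t) v∈ with pre , K , post , refl , refl , p , r , ip , rest ← Trace-mid t v∈ =
  I ∷ pre , K , post , refl , sym (ℕₚ.+-suc k (length pre)) , p , r , (_ , inj₁ refl , ip) , rest
Trace-mid {k} (hit {I = I} {cs} on on′ t) (here refl) =
  [] , I , cs , refl , sym (ℕₚ.+-identityʳ k) , _ , _ , refl , proj₂ on , proj₂ on′ , Trace⇒Reach t
Trace-mid {k} (hit {I = I} on on′ t) (there v∈) with pre , K , post , refl , refl , p , r , ip , rest ← Trace-mid t v∈ =
  I ∷ pre , K , post , refl , sym (ℕₚ.+-suc k (length pre)) , p , r , (_ , inj₂ (proj₂ on , proj₂ on′) , ip) , rest

Trace-avoid : ∀ pre {K post k q a p} → Trace k (pre ++ K ∷ post) q a p →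
              (mid (k + length pre) ∈ p) ⊎ ∃ λ s → Reach pre q s × ¬ On K s × Reach post s a
Trace-avoid [] {k = k} (pass off t) = inj₂ (_ , refl , off , Trace⇒Reach t)
Trace-avoid [] {k = k} (hit on on′ t) rewrite ℕₚ.+-identityʳ k = inj₁ (here refl)
Trace-avoid (I ∷ pre) {k = k} (pass off t) rewrite ℕₚ.+-suc k (length pre) with Trace-avoid pre t
... | inj₁ m = inj₁ m
... | inj₂ (s , r , rest) = inj₂ (s , (_ , inj₁ refl , r) , rest)
Trace-avoid (I ∷ pre) {k = k} (hit on on′ t) rewrite ℕₚ.+-suc k (length pre) with Trace-avoid pre t
... | inj₁ m = inj₁ (there m)
... | inj₂ (s , r , rest) = inj₂ (s , (_ , inj₂ (proj₂ on , proj₂ on′) , r) , rest)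

-- A star before K and a star after K on the same side of K would form a turn at K.
no-avoid : ∀ pre {K post i a s} → Zig (pre ++ K ∷ post) → Via pre K post i a →
           Reach pre i s → ¬ InInt K s → Reach post s a → ⊥
no-avoid pre {K} {post} {i} {a} {s} zig (p , q , ip , p∈ , q∈ , qa) is s∉ sa with proj₁ K ℤ.≤? s
... | no c≰s = clash
    (exits′ pre is ip (ℤₚ.≰⇒> c≰s) (ℤₚ.≤⇒≯ (proj₁ p∈)) )
    (exits″ post sa qa (ℤₚ.≰⇒> c≰s) (ℤₚ.≤⇒≯ (proj₁ q∈)))
  where
  open Zig zig
  c = proj₁ K
  L? = λ k → k ℤ.<? c
  H? = λ k → ¬? (k ℤ.<? c)
  toStraddle : ∀ {M} → ∃₂ (λ p q → InInt M p × InInt M q × p ℤ.< c × ¬ q ℤ.< c) → Straddles c M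
  toStraddle (p , q , p∈ , q∈ , p<c , q≮c) = ℤₚ.≤-<-trans (proj₁ p∈) p<c , ℤₚ.≤-trans (ℤₚ.≮⇒≥ q≮c) (proj₂ q∈)
  toStraddle′ : ∀ {M} → ∃₂ (λ p q → InInt M p × InInt M q × ¬ p ℤ.< c × ¬ ¬ q ℤ.< c) → Straddles c M
  toStraddle′ (p , q , p∈ , q∈ , p≮c , q<c) = toStraddle (q , p , q∈ , p∈ , decidable-stable (q ℤ.<? c) q<c , p≮c)
  -- The two routes leave the same source and end on different sides of `c`, so wherever the source
  -- lies one of them crosses the cut. `exits″` is the same argument at the common sink.
  exits′ : ∀ cs {i s p} → Reach cs i s → Reach cs i p → s ℤ.< c → ¬ p ℤ.< c → Any (Straddles c) cs
  exits′ cs {i} is ip s<c p≮c with i ℤ.<? c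
  ... | yes i<c = Any.map toStraddle (exits L? cs ip i<c p≮c)
  ... | no  i≮c = Any.map toStraddle′ (exits H? cs is i≮c (λ f → f s<c))
  exits″ : ∀ cs {a s q} → Reach cs s a → Reach cs q a → s ℤ.< c → ¬ q ℤ.< c → Any (Straddles c) cs
  exits″ cs {a} sa qa s<c q≮c with a ℤ.<? c
  ... | yes a<c = Any.map toStraddle′ (exits H? cs qa q≮c (λ f → f a<c))
  ... | no  a≮c = Any.map toStraddle (exits L? cs sa s<c a≮c)
  clash : Any (Straddles c) pre → Any (Straddles c) post → ⊥
  clash x y with A , A∈ , (A<c , c≤A) ← find x | B , B∈ , (B<c , c≤B) ← find y
    with monotone (⊆ₚ.++⁺ (from∈ A∈) (refl ∷ from∈ B∈))
      (ℤₚ.≤-trans (ℤₚ.<⇒≤ A<c) (ℤₚ.≤-trans (proj₁ p∈) (proj₂ p∈)) , c≤A)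
      (c≤B , ℤₚ.≤-trans (ℤₚ.<⇒≤ B<c) (ℤₚ.≤-trans (proj₁ p∈) (proj₂ p∈)))
  ... | inj₁ (_ , K<B) = ℤₚ.<-asym K<B B<c
  ... | inj₂ (K<A , _) = ℤₚ.<-asym K<A A<c
... | yes c≤s = clash
    (exits′ pre is ip d≮s (proj₂ p∈))
    (exits″ post sa qa d≮s (proj₂ q∈))
  where
  open Zig zig
  d = proj₂ K
  d≮s : ¬ s ℤ.≤ d
  d≮s s≤d = s∉ (c≤s , s≤d)
  Beyond : Iv → Set
  Beyond M = proj₁ M ℤ.≤ d × d ℤ.< proj₂ M
  L? = λ k → k ℤ.≤? d
  H? = λ k → ¬? (k ℤ.≤? d)
  toBeyond : ∀ {M} → ∃₂ (λ p q → InInt M p × InInt M q × p ℤ.≤ d × ¬ q ℤ.≤ d) → Beyond M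
  toBeyond (p , q , p∈ , q∈ , p≤d , q≰d) = ℤₚ.≤-trans (proj₁ p∈) p≤d , ℤₚ.<-≤-trans (ℤₚ.≰⇒> q≰d) (proj₂ q∈)
  toBeyond′ : ∀ {M} → ∃₂ (λ p q → InInt M p × InInt M q × ¬ p ℤ.≤ d × ¬ ¬ q ℤ.≤ d) → Beyond M
  toBeyond′ (p , q , p∈ , q∈ , p≰d , q≤d) = toBeyond (q , p , q∈ , p∈ , decidable-stable (q ℤ.≤? d) q≤d , p≰d)
  exits′ : ∀ cs {i s p} → Reach cs i s → Reach cs i p → ¬ s ℤ.≤ d → p ℤ.≤ d → Any Beyond cs
  exits′ cs {i} is ip s≰d p≤d with i ℤ.≤? d
  ... | yes i≤d = Any.map toBeyond (exits L? cs is i≤d s≰d)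
  ... | no  i≰d = Any.map toBeyond′ (exits H? cs ip i≰d (λ f → f p≤d))
  exits″ : ∀ cs {a s q} → Reach cs s a → Reach cs q a → ¬ s ℤ.≤ d → q ℤ.≤ d → Any Beyond cs
  exits″ cs {a} sa qa s≰d q≤d with a ℤ.≤? d
  ... | yes a≤d = Any.map toBeyond′ (exits H? cs sa s≰d (λ f → f a≤d))
  ... | no  a≰d = Any.map toBeyond (exits L? cs qa q≤d a≰d)
  clash : Any Beyond pre → Any Beyond post → ⊥
  clash x y with A , A∈ , (A≤d , d<A) ← find x | B , B∈ , (B≤d , d<B) ← find y
    with monotone (⊆ₚ.++⁺ (from∈ A∈) (refl ∷ from∈ B∈))
      (A≤d , ℤₚ.≤-trans (ℤₚ.≤-trans (proj₁ p∈) (proj₂ p∈)) (ℤₚ.<⇒≤ d<A))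
      (ℤₚ.≤-trans (ℤₚ.≤-trans (proj₁ p∈) (proj₂ p∈)) (ℤₚ.<⇒≤ d<B) , B≤d)
  -- `monotone` compares left ends, while the stars found here reach beyond the right end `d`; a
  -- star that starts before `K` and ends after it would contain `K`.
  ... | inj₁ (A<K , _) = proj₂ (nonNest (⊆ₚ.++⁺ (from∈ A∈) (refl ∷ ⊆ₚ.[]⊆-universal post))) (ℤₚ.<⇒≤ A<K , ℤₚ.<⇒≤ d<A)
  ... | inj₂ (_ , B<K) = proj₁ (nonNest (⊆ₚ.++⁺ˡ pre (refl ∷ from∈ B∈))) (ℤₚ.<⇒≤ B<K , ℤₚ.<⇒≤ d<B)

-- The stars visited by a path thus depend only on its source and sink, which lets routes along
-- wires speak about the paths of an arbitrary given family.
visits : ∀ n cs {p i a} pre {K post} → Zig cs → IsPath n cs p i a → cs ≡ pre ++ K ∷ post →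
         proj₁ K ℤ.< proj₂ K → Via pre K post i a → mid (length pre) ∈ p
visits n cs pre zig path refl c<d via with p′ , refl , t ← path⇒Trace n cs path with Trace-avoid pre t
... | inj₁ m = there m
... | inj₂ (s , is , off , sa) = ⊥-elim (no-avoid pre zig via is (λ s∈ → off (c<d , s∈)) sa)

split-unique : ∀ {A : Set} (pre pre′ : List A) {K K′ post post′} → pre ++ K ∷ post ≡ pre′ ++ K′ ∷ post′ →
               length pre ≡ length pre′ → pre ≡ pre′ × K ≡ K′ × post ≡ post′
split-unique []        []         e _ = refl , Listₚ.∷-injective e
split-unique (x ∷ pre) (y ∷ pre′) e l
  with refl , e′ ← Listₚ.∷-injective e with refl , rest ← split-unique pre pre′ e′ (ℕₚ.suc-injective l) = refl , rest

-- At a common interior vertex the tails can be exchanged; a common sink is excluded by `a ≢ b`.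
Trace-shared⇒Reach : ∀ {cs p q i j a b x} → Trace 0 cs i a p → Trace 0 cs j b q → a ≢ b →
                     x ∈ p → x ∈ q → Reach cs i b × Reach cs j a
Trace-shared⇒Reach {x = src _} t t′ a≢b v v′ = contradiction v (Trace-src t)
Trace-shared⇒Reach {x = snk _} t t′ a≢b v v′ = contradiction (trans (sym (Trace-snk t v)) (Trace-snk t′ v′)) a≢b
Trace-shared⇒Reach {x = mid _} t t′ a≢b v v′
  with pre , K , post , refl , refl , p , q , ip , p∈ , q∈ , qa ← Trace-mid t v
     | pre′ , K′ , post′ , e , l , p′ , q′ , jp′ , p′∈ , q′∈ , q′b ← Trace-mid t′ v′
  with refl , refl , refl ← split-unique pre pre′ e l =
  through pre ip p∈ q′∈ q′b , through pre jp′ p′∈ q∈ qa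

shared-vertex⇒Reach : ∀ n cs {p q i j a b} → IsPath n cs p i a → IsPath n cs q j b → i ≢ j → a ≢ b →
                      ShareVtx p q → Reach cs i b × Reach cs j a
shared-vertex⇒Reach n cs pp qq i≢j a≢b (x , x∈p , x∈q)
  with _ , refl , t ← path⇒Trace n cs pp | _ , refl , t′ ← path⇒Trace n cs qq with x∈p | x∈q
... | here refl | here refl = contradiction refl i≢j
... | here refl | there v   = contradiction v (Trace-src t′)
... | there v   | here refl = contradiction v (Trace-src t)
... | there v   | there v′  = Trace-shared⇒Reach t t′ a≢b v v′

module TypeE n cs {π} (zig : Zig cs) (fam : IsFamily n cs π id) where

  -- The paths of `π` need not follow their own wires, but the straight routes through `K` exist,
  -- and `visits` then puts its vertex on both paths.
  Shares⇒ShareVtx : ∀ {i j} → i ∈ wires n → j ∈ wires n → i ℤ.< j → Shares cs i j → ShareVtx (π i) (π j)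
  Shares⇒ShareVtx {i} {j} iw jw i<j s
    with K , K∈ , i∈ , j∈ ← find s with pre , post , refl ← ∈ₚ.∈-∃++ K∈ =
    mid (length pre) , visits n _ pre zig (fam i iw) refl c<d (_ , _ , Reach-refl pre , i∈ , i∈ , Reach-refl post)
                     , visits n _ pre zig (fam j jw) refl c<d (_ , _ , Reach-refl pre , j∈ , j∈ , Reach-refl post)
    where c<d = ℤₚ.≤-<-trans (proj₁ i∈) (ℤₚ.<-≤-trans i<j (proj₂ j∈))

  ShareVtx⇒Shares : ∀ {i j} → i ∈ wires n → j ∈ wires n → i ℤ.< j → ShareVtx (π i) (π j) → Shares cs i j
  ShareVtx⇒Shares {i} {j} iw jw i<j s
    with ij , ji ← shared-vertex⇒Reach n cs (fam i iw) (fam j jw) (ℤₚ.<⇒≢ i<j) (ℤₚ.<⇒≢ i<j) s = Reach-mutual⇒Shares zig i<j ij ji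

-- Exchanging tails in a covering family of maximal length

pos∈wires : ∀ {n k} → k < n → + suc k ∈ wires n
pos∈wires {n} k<n = ∈ₚ.∈-++⁺ʳ (map -[1+_] (reverse (upTo n))) (∈ₚ.∈-map⁺ (λ k → + suc k) (∈ₚ.∈-upTo⁺ k<n))

neg∈wires : ∀ {n k} → k < n → -[1+ k ] ∈ wires n
neg∈wires {n} k<n = ∈ₚ.∈-++⁺ˡ (∈ₚ.∈-map⁺ -[1+_] (↭ₚ.∈-resp-↭ (↭-sym (↭ₚ.↭-reverse (upTo n))) (∈ₚ.∈-upTo⁺ k<n)))

data WireView (n : ℕ) : ℤ → Set where
  pos : ∀ {k} → k < n → WireView n (+ suc k)
  neg : ∀ {k} → k < n → WireView n -[1+ k ]

wireView : ∀ n {i} → i ∈ wires n → WireView n i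
wireView n i∈ with ∈ₚ.∈-++⁻ (map -[1+_] (reverse (upTo n))) i∈
... | inj₁ m with k , k∈ , refl ← ∈ₚ.∈-map⁻ -[1+_] m = neg (∈ₚ.∈-upTo⁻ (↭ₚ.∈-resp-↭ (↭ₚ.↭-reverse (upTo n)) k∈))
... | inj₂ m with k , k∈ , refl ← ∈ₚ.∈-map⁻ (λ k → + suc k) m = pos (∈ₚ.∈-upTo⁻ k∈)

wires-neg : ∀ n {i} → i ∈ wires n → ℤ.- i ∈ wires n
wires-neg n i∈ with wireView n i∈
... | pos k<n = neg∈wires k<n
... | neg k<n = pos∈wires k<n

wires-unique : ∀ n → Unique (wires n)
wires-unique n = Uniqueₚ.++⁺
  (Uniqueₚ.map⁺ (λ { refl → refl }) (Unique-↭ (↭-sym (↭ₚ.↭-reverse (upTo n))) (Uniqueₚ.upTo⁺ n)))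
  (Uniqueₚ.map⁺ (λ { refl → refl }) (Uniqueₚ.upTo⁺ n))
  λ (p , q) → case (∈ₚ.∈-map⁻ -[1+_] p , ∈ₚ.∈-map⁻ (λ k → + suc k) q) of λ { ((_ , _ , refl) , (_ , _ , ())) }

module _ {A : Set} {R : A → A → Set} where

  Linked-split : ∀ xs {z ys} → Linked R (xs ++ z ∷ ys) → Linked R (xs ++ z ∷ []) × Linked R (z ∷ ys)
  Linked-split []            l       = [-] , l
  Linked-split (x ∷ [])      (r ∷ l) = r ∷ [-] , l
  Linked-split (x ∷ x′ ∷ xs) (r ∷ l) with l₁ , l₂ ← Linked-split (x′ ∷ xs) l = r ∷ l₁ , l₂

  Linked-join : ∀ xs {z ys} → Linked R (xs ++ z ∷ []) → Linked R (z ∷ ys) → Linked R (xs ++ z ∷ ys)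
  Linked-join []            _       l = l
  Linked-join (x ∷ [])      (r ∷ _) l = r ∷ l
  Linked-join (x ∷ x′ ∷ xs) (r ∷ k) l = r ∷ Linked-join (x′ ∷ xs) k l

last-++ : ∀ {A : Set} (xs : List A) {z ys} → last (xs ++ z ∷ ys) ≡ last (z ∷ ys)
last-++ []            = refl
last-++ (x ∷ [])      = refl
last-++ (x ∷ x′ ∷ xs) = last-++ (x′ ∷ xs)

head-++ : ∀ {A : Set} (xs : List A) {z ys ys′} → head (xs ++ z ∷ ys) ≡ head (xs ++ z ∷ ys′)
head-++ []       = refl
head-++ (x ∷ xs) = refl

Consec-split : ∀ {A : Set} {x y : A} xs {z ys} → ConsecIn x y (xs ++ z ∷ ys) →
               ConsecIn x y (xs ++ z ∷ []) ⊎ ConsecIn x y (z ∷ ys)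
Consec-split []            c = inj₂ c
Consec-split (x ∷ [])      ([] , bs , refl) = inj₁ ([] , [] , refl)
Consec-split (x ∷ x′ ∷ xs) ([] , bs , refl) = inj₁ ([] , _ , refl)
Consec-split (x ∷ xs)      (a ∷ as , bs , e) with Consec-split xs (as , bs , Listₚ.∷-injectiveʳ e)
... | inj₁ (as′ , bs′ , e′) = inj₁ (x ∷ as′ , bs′ , cong (x ∷_) e′)
... | inj₂ c = inj₂ c

Consec-append : ∀ {A : Set} {x y : A} xs {z} ys → ConsecIn x y (xs ++ z ∷ []) → ConsecIn x y (xs ++ z ∷ ys)
Consec-append {x = x} {y} xs {z} ys (as , bs , e) = as , bs ++ ys ,
  trans (sym (Listₚ.++-assoc xs (z ∷ []) ys)) (trans (cong (_++ ys) e) (Listₚ.++-assoc as (x ∷ y ∷ bs) ys))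

Consec-prepend : ∀ {A : Set} {x y : A} xs {zs} → ConsecIn x y zs → ConsecIn x y (xs ++ zs)
Consec-prepend {x = x} {y} xs (as , bs , e) = xs ++ as , bs , trans (cong (xs ++_) e) (sym (Listₚ.++-assoc xs as _))

transp-involutive : ∀ {i j} → i ≢ j → ∀ k → transp i j (transp i j k) ≡ k
transp-involutive {i} {j} i≢j k with k ℤₚ.≟ i
... | yes refl = transp-snd i j
... | no k≢i with k ℤₚ.≟ j
...   | yes refl = transp-fst i j
...   | no k≢j = transp-other k≢i k≢j

transp-∈ : ∀ {i j k} {W : List ℤ} → i ∈ W → j ∈ W → k ∈ W → transp i j k ∈ W
transp-∈ {i} {j} {k} i∈ j∈ k∈ with k ℤₚ.≟ i
... | yes _ = j∈
... | no _ with k ℤₚ.≟ j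
...   | yes _ = i∈
...   | no _ = k∈

LocMax : ℕ → List Iv → (ℤ → ℤ) → Set
LocMax n cs u = ∀ {i j} → i ∈ wires n → j ∈ wires n → i ℤ.< j → u i ℤ.< u j →
                Reach cs i (u j) → Reach cs j (u i) → ⊥

module _ {n : ℕ} {cs : List Iv} {u : ℤ → ℤ} (zig : Zig cs) (mct : MaxCoverType n cs u) where

  private
    perm = proj₁ mct
    π    = proj₁ (proj₁ (proj₂ mct))
    fam  = proj₁ (proj₂ (proj₁ (proj₂ mct)))
    cov  = proj₂ (proj₂ (proj₁ (proj₂ mct)))

  maxCover-Reach : ∀ {i} → i ∈ wires n → Reach cs i (u i)
  maxCover-Reach i∈ = Trace⇒Reach (proj₂ (proj₂ (path⇒Trace n cs (fam _ i∈))))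

  -- If the paths from i and j meet, exchanging their tails keeps the family covering
  -- and creates an inversion.
  maxCover-LocMax : LocMax n cs u
  maxCover-LocMax {i} {j} iw jw i<j ui<uj iuj jui
    with meetIn pre post K refl {p} {q} {p′} {q′} ip jq p<q p∈ q∈ p′∈ q′∈ p′uj q′ui ← crossing cs i<j (ℤₚ.<⇒≤ ui<uj) iuj jui =
    ℕₚ.<⇒≱ more fewer
    where
    c<d : proj₁ K ℤ.< proj₂ K
    c<d = ℤₚ.≤-<-trans (proj₁ p∈) (ℤₚ.<-≤-trans p<q (proj₂ q∈))
    z = mid (length pre)
    i≢j : i ≢ j
    i≢j = ℤₚ.<⇒≢ i<j
    -- `K` comes from crossing the exchanged routes `i → u j` and `j → u i`. Recombined at `K` they
    -- give routes `i → u i` and `j → u j` through `K`, so `visits` puts `z` on both given paths.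
    si = ∈ₚ.∈-∃++ (visits n cs pre zig (fam i iw) refl c<d (p , q′ , ip , p∈ , q′∈ , q′ui))
    sj = ∈ₚ.∈-∃++ (visits n cs pre zig (fam j jw) refl c<d (q , p′ , jq , q∈ , p′∈ , p′uj))
    xs = proj₁ si
    ys = proj₁ (proj₂ si)
    ei : π i ≡ xs ++ z ∷ ys
    ei = proj₂ (proj₂ si)
    xs′ = proj₁ sj
    ys′ = proj₁ (proj₂ sj)
    ej : π j ≡ xs′ ++ z ∷ ys′
    ej = proj₂ (proj₂ sj)
    u′ = u ∘ transp i j
    π′ : ℤ → List Vtx
    π′ k with k ℤₚ.≟ i
    ... | yes _ = xs ++ z ∷ ys′
    ... | no _ with k ℤₚ.≟ j
    ...   | yes _ = xs′ ++ z ∷ ys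
    ...   | no _ = π k
    splice : ∀ {a b c d} xs ys xs′ ys′ → IsPath n cs (xs ++ z ∷ ys) a b → IsPath n cs (xs′ ++ z ∷ ys′) c d →
             IsPath n cs (xs ++ z ∷ ys′) a d
    splice xs ys xs′ ys′ (h , la , l) (h′ , la′ , l′) =
      trans (head-++ xs) h , trans (last-++ xs) (trans (sym (last-++ xs′)) la′) ,
      Linked-join xs (proj₁ (Linked-split xs l)) (proj₂ (Linked-split xs′ l′))
    pi : IsPath n cs (xs ++ z ∷ ys) i (u i)
    pi = subst (λ p → IsPath n cs p i (u i)) ei (fam i iw)
    pj : IsPath n cs (xs′ ++ z ∷ ys′) j (u j)
    pj = subst (λ p → IsPath n cs p j (u j)) ej (fam j jw)
    fam′ : IsFamily n cs π′ u′
    fam′ k kw with k ℤₚ.≟ i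
    ... | yes refl = splice xs ys xs′ ys′ pi pj
    ... | no _ with k ℤₚ.≟ j
    ...   | yes refl = splice xs′ ys′ xs ys pj pi
    ...   | no _ = fam k kw
    π′i : π′ i ≡ xs ++ z ∷ ys′
    π′i with i ℤₚ.≟ i
    ... | yes _ = refl
    ... | no ¬e = contradiction refl ¬e
    π′j : π′ j ≡ xs′ ++ z ∷ ys
    π′j with j ℤₚ.≟ i
    ... | yes e = contradiction (sym e) i≢j
    ... | no _ with j ℤₚ.≟ j
    ...   | yes _ = refl
    ...   | no ¬e = contradiction refl ¬e
    π′k : ∀ {k} → k ≢ i → k ≢ j → π′ k ≡ π k
    π′k {k} k≢i k≢j with k ℤₚ.≟ i
    ... | yes e = contradiction e k≢i
    ... | no _ with k ℤₚ.≟ j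
    ...   | yes e = contradiction e k≢j
    ...   | no _ = refl
    cov′ : Covers n cs π′
    -- An edge of one of the two paths lies before or after `z`, and is inherited by the new path
    -- that receives this half.
    cov′ x y e with k , kw , c ← cov x y e with k ℤₚ.≟ i | k ℤₚ.≟ j
    ... | no k≢i   | no k≢j   = k , kw , subst (ConsecIn x y) (sym (π′k k≢i k≢j)) c
    ... | yes refl | _        = [ (λ c₁ → i , iw , subst (ConsecIn x y) (sym π′i) (Consec-append xs ys′ c₁))
                                , (λ c₂ → j , jw , subst (ConsecIn x y) (sym π′j) (Consec-prepend xs′ c₂)) ]′
                                (Consec-split xs (subst (ConsecIn x y) ei c))
    ... | no _     | yes refl = [ (λ c₁ → j , jw , subst (ConsecIn x y) (sym π′j) (Consec-append xs′ ys c₁))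
                                , (λ c₂ → i , iw , subst (ConsecIn x y) (sym π′i) (Consec-prepend xs c₂)) ]′
                                (Consec-split xs′ (subst (ConsecIn x y) ej c))
    perm′ : IsPermOn (wires n) u′
    perm′ with into , inj , sur ← perm =
      (λ k kw → into _ (transp-∈ iw jw kw)) ,
      (λ k l kw lw e → trans (sym (transp-involutive i≢j k))
          (trans (cong (transp i j) (inj _ _ (transp-∈ iw jw kw) (transp-∈ iw jw lw) e)) (transp-involutive i≢j l))) ,
      (λ l lw → let k , kw , e = sur l lw in
         transp i j k , transp-∈ iw jw kw , trans (cong u (transp-involutive i≢j k)) e)
    fewer : invOn n u′ ≤ invOn n u
    fewer = proj₁ (proj₂ (proj₂ mct) u′ π′ perm′ fam′ cov′)
    more : invOn n u < invOn n u′
    more = subst₂ _<_ (sym (invOn-inversions n u)) (sym (invOn-inversions n u′))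
             (inversions-transp u (wires-unique n) iw jw i<j ui<uj)

-- Permutations locally maximal for a relation

record Downᴺ (R : ℕ → ℕ → Set) (x y₀ : ℕ) : Set where
  field
    y₀≤x : y₀ ≤ x
    col⁻ : ∀ {y} → y ≤ x → R y x → y₀ ≤ y
    col⁺ : ∀ {y} → y₀ ≤ y → y ≤ x → R y x
    row  : ∀ {y y′ z} → y₀ ≤ y → y ≤ x → y₀ ≤ y′ → y′ ≤ x → z ≤ x → R y z → R y′ z
    triv : ∀ {z} → y₀ ≡ x → z < x → ¬ R x z

-- The inverse `g` is carried along so that transposing `R` merely exchanges `f` and `g`.
record LocMaxᴺ (R : ℕ → ℕ → Set) (m : ℕ) (f g : ℕ → ℕ) : Set where
  field
    f< : ∀ {i} → i < m → f i < m
    g< : ∀ {i} → i < m → g i < m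
    fg : ∀ {i} → i < m → f (g i) ≡ i
    gf : ∀ {i} → i < m → g (f i) ≡ i
    compat : ∀ {i} → i < m → R i (f i)
    loc : ∀ {i j} → i < j → j < m → f i < f j → R i (f j) → R j (f i) → ⊥

LocMaxᴺ-flip : ∀ {R m f g} → LocMaxᴺ R m f g → LocMaxᴺ (flip R) m g f
LocMaxᴺ-flip {R} lm = record
  { f< = g< ; g< = f< ; fg = gf ; gf = fg
  ; compat = λ {i} i<m → subst (R _) (fg i<m) (compat (g< i<m))
  ; loc = λ {i} {j} i<j j<m gi<gj r r′ → let i<m = ℕₚ.<-trans i<j j<m in
      loc gi<gj (g< j<m) (subst₂ _<_ (sym (fg i<m)) (sym (fg j<m)) i<j)
        (subst (R _) (sym (fg j<m)) r′) (subst (R _) (sym (fg i<m)) r) }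
  where open LocMaxᴺ lm

inverse-unique : ∀ {R m f g f₂ g₂} → LocMaxᴺ R m f g → LocMaxᴺ R m f₂ g₂ →
                 (∀ {i} → i < m → g i ≡ g₂ i) → ∀ {i} → i < m → f i ≡ f₂ i
inverse-unique {f = f} {g} {f₂} {g₂} lm lm₂ e i<m =
  trans (sym (LocMaxᴺ.fg lm₂ (LocMaxᴺ.f< lm i<m)))
        (cong f₂ (trans (sym (e (LocMaxᴺ.f< lm i<m))) (LocMaxᴺ.gf lm i<m)))

-- `R` lies inside the hull of the diagram of `f`. Through this bound a symmetry of `f` becomes a
-- symmetry of `R`.
Hullᴺ : (ℕ → ℕ → Set) → ℕ → (ℕ → ℕ) → Set
Hullᴺ R m f = ∀ {i j} → i < m → j < m → R i j →
  (∃ λ k → k ≤ i × j ≤ f k) × (∃ λ l → l < m × i ≤ l × f l ≤ j)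

Hullᴺ-flip : ∀ {R m f g} → LocMaxᴺ R m f g → Hullᴺ R m f → Hullᴺ (flip R) m g
Hullᴺ-flip lm hull i<m j<m r with (k , k≤j , i≤fk) , (l , l<m , j≤l , fl≤i) ← hull j<m i<m r =
  (_ , fl≤i , subst (_ ≤_) (sym (gf l<m)) j≤l) ,
  (_ , f< k<m , i≤fk , subst (_≤ _) (sym (gf k<m)) k≤j)
  where
  open LocMaxᴺ lm
  k<m = ℕₚ.≤-<-trans k≤j j<m

-- The increasing enumeration of the naturals other than `y`.
skip : ℕ → ℕ → ℕ
skip y k = if k ℕ.<ᵇ y then k else suc k

skip-< : ∀ {y k} → k < y → skip y k ≡ k
skip-< {y} {k} k<y with k ℕ.<ᵇ y | ℕₚ.<⇒<ᵇ k<y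
... | true | _ = refl

skip-≥ : ∀ {y k} → y ≤ k → skip y k ≡ suc k
skip-≥ {y} {k} y≤k with k ℕ.<ᵇ y in eq
... | false = refl
... | true  = contradiction y≤k (ℕₚ.<⇒≱ (ℕₚ.<ᵇ⇒< k y (subst T (sym eq) tt)))

skip-cases : ∀ y k → (k < y × skip y k ≡ k) ⊎ (y ≤ k × skip y k ≡ suc k)
skip-cases y k with k ℕ.<? y
... | yes p = inj₁ (p , skip-< p)
... | no ¬p = inj₂ (ℕₚ.≮⇒≥ ¬p , skip-≥ (ℕₚ.≮⇒≥ ¬p))

skip-mono : ∀ y {i j} → i < j → skip y i < skip y j
skip-mono y {i} {j} i<j with skip-cases y i | skip-cases y j
... | inj₁ (_ , e) | inj₁ (_ , e′) rewrite e | e′ = i<j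
... | inj₁ (_ , e) | inj₂ (_ , e′) rewrite e | e′ = ℕₚ.m<n⇒m<1+n i<j
... | inj₂ (p , _) | inj₁ (q , _) = contradiction (ℕₚ.≤-<-trans p (ℕₚ.<-trans i<j q)) (ℕₚ.<-irrefl refl)
... | inj₂ (_ , e) | inj₂ (_ , e′) rewrite e | e′ = s≤s i<j

skip-bound : ∀ y {k m} → k < m → skip y k < suc m
skip-bound y {k} k<m with skip-cases y k
... | inj₁ (_ , e) rewrite e = ℕₚ.m<n⇒m<1+n k<m
... | inj₂ (_ , e) rewrite e = s≤s k<m

skip-≢ : ∀ y k → skip y k ≢ y
skip-≢ y k e with skip-cases y k
... | inj₁ (k<y , e′) = ℕₚ.<-irrefl (trans (sym e′) e) k<y
... | inj₂ (y≤k , e′) = ℕₚ.<-irrefl (trans (sym e) e′) (s≤s y≤k)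

unskip : ℕ → ℕ → ℕ
unskip y k = if k ℕ.<ᵇ y then k else ℕ.pred k

skip-unskip : ∀ y {k} → k ≢ y → skip y (unskip y k) ≡ k
skip-unskip y {k} k≢y with k ℕ.<ᵇ y in eq
... | true  = skip-< (ℕₚ.<ᵇ⇒< k y (subst T (sym eq) tt))
... | false with y≤k ← ℕₚ.≮⇒≥ (λ p → subst T eq (ℕₚ.<⇒<ᵇ {k} {y} p)) with k
...   | zero  = contradiction (sym (ℕₚ.n≤0⇒n≡0 y≤k)) k≢y
...   | suc l = skip-≥ (ℕₚ.≤-pred (ℕₚ.≤∧≢⇒< y≤k (k≢y ∘ sym)))

skip-injective : ∀ y {i j} → skip y i ≡ skip y j → i ≡ j
skip-injective y {i} {j} e with ℕₚ.<-cmp i j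
... | tri≈ _ p _ = p
... | tri< p _ _ = contradiction e (ℕₚ.<⇒≢ (skip-mono y p))
... | tri> _ _ p = contradiction (sym e) (ℕₚ.<⇒≢ (skip-mono y p))

unskip-skip : ∀ y k → unskip y (skip y k) ≡ k
unskip-skip y k = skip-injective y (skip-unskip y (skip-≢ y k))

-- The top value x must sit at position y₀; deleting both leaves a locally maximal
-- permutation for the same relation, because the rows y₀,…,x agree.
module Delete {R m f g y₀} (lm : LocMaxᴺ R (suc m) f g) (dn : Downᴺ R m y₀) where
  open LocMaxᴺ lm
  open Downᴺ dn

  -- If the value `m` stood to the right of `y₀`, it could be exchanged with the value at `y₀`:
  -- `col⁺` admits `m` at `y₀`, and the agreement of rows admits `f y₀` at `g m`. The exchange would
  -- create an inversion.
  g-top : g m ≡ y₀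
  g-top with ℕₚ.m≤n⇒m<n∨m≡n (col⁻ k≤m (subst (R (g m)) fk (compat (g< ℕₚ.≤-refl))))
    where
    k≤m : g m ≤ m
    k≤m = ℕₚ.≤-pred (g< ℕₚ.≤-refl)
    fk : f (g m) ≡ m
    fk = fg ℕₚ.≤-refl
  ... | inj₂ e = sym e
  ... | inj₁ y₀<k = ⊥-elim (loc y₀<k (g< ℕₚ.≤-refl) (subst (f y₀ <_) (sym fk) fy<m)
      (subst (R y₀) (sym fk) (col⁺ ℕₚ.≤-refl y₀≤x))
      (row ℕₚ.≤-refl y₀≤x (ℕₚ.<⇒≤ y₀<k) k≤m (ℕₚ.<⇒≤ fy<m) (compat (s≤s y₀≤x))))
    where
    k≤m : g m ≤ m
    k≤m = ℕₚ.≤-pred (g< ℕₚ.≤-refl)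
    fk : f (g m) ≡ m
    fk = fg ℕₚ.≤-refl
    fy<m : f y₀ < m
    fy<m = ℕₚ.≤∧≢⇒< (ℕₚ.≤-pred (f< (s≤s y₀≤x)))
      λ e → ℕₚ.<-irrefl (trans (sym (gf (s≤s y₀≤x))) (cong g e)) y₀<k

  f-y₀ : f y₀ ≡ m
  f-y₀ = trans (cong f (sym g-top)) (fg ℕₚ.≤-refl)

  f′ g′ : ℕ → ℕ
  f′ k = f (skip y₀ k)
  g′ j = unskip y₀ (g j)

  g≢y₀ : ∀ {j} → j < m → g j ≢ y₀
  g≢y₀ {j} j<m e = ℕₚ.<-irrefl (trans (sym (fg (ℕₚ.m<n⇒m<1+n j<m))) (trans (cong f e) f-y₀)) j<m

  f′< : ∀ {k} → k < m → f′ k < m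
  f′< {k} k<m = ℕₚ.≤∧≢⇒< (ℕₚ.≤-pred (f< (skip-bound y₀ k<m)))
    λ e → skip-≢ y₀ k (trans (sym (gf (skip-bound y₀ k<m))) (trans (cong g e) g-top))

  row-skip : ∀ {k z} → k < m → z ≤ m → R (skip y₀ k) z → R k z
  row-skip {k} k<m z≤m r with skip-cases y₀ k
  ... | inj₁ (_ , e) rewrite e = r
  ... | inj₂ (p , e) rewrite e = row (ℕₚ.≤-trans p (ℕₚ.n≤1+n k)) k<m p (ℕₚ.<⇒≤ k<m) z≤m r

  row-unskip : ∀ {k z} → k < m → z ≤ m → R k z → R (skip y₀ k) z
  row-unskip {k} k<m z≤m r with skip-cases y₀ k
  ... | inj₁ (_ , e) rewrite e = r
  ... | inj₂ (p , e) rewrite e = row p (ℕₚ.<⇒≤ k<m) (ℕₚ.≤-trans p (ℕₚ.n≤1+n k)) k<m z≤m r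

  reduced : LocMaxᴺ R m f′ g′
  reduced = record
    { f< = f′<
    ; g< = λ {j} j<m → unskip< (g< (ℕₚ.m<n⇒m<1+n j<m)) (g≢y₀ j<m)
    ; fg = λ {j} j<m → trans (cong f (skip-unskip y₀ (g≢y₀ j<m))) (fg (ℕₚ.m<n⇒m<1+n j<m))
    ; gf = λ {k} k<m → trans (cong (unskip y₀) (gf (skip-bound y₀ k<m))) (unskip-skip y₀ k)
    ; compat = λ k<m → row-skip k<m (ℕₚ.<⇒≤ (f′< k<m)) (compat (skip-bound y₀ k<m))
    ; loc = λ i<j j<m lt r r′ → let i<m = ℕₚ.<-trans i<j j<m in
        loc (skip-mono y₀ i<j) (skip-bound y₀ j<m) lt
          (row-unskip i<m (ℕₚ.<⇒≤ (f′< j<m)) r) (row-unskip j<m (ℕₚ.<⇒≤ (f′< i<m)) r′) }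
    where
    unskip< : ∀ {k} → k < suc m → k ≢ y₀ → unskip y₀ k < m
    unskip< {k} k≤m k≢y₀ with skip-cases y₀ (unskip y₀ k)
    ... | inj₁ (p , _) = ℕₚ.<-≤-trans p y₀≤x
    ... | inj₂ (_ , e) = ℕₚ.≤-pred (subst (_< suc m) (trans (sym (skip-unskip y₀ k≢y₀)) e) k≤m)

  -- The point at `y₀` with value `m` serves as the upper left bound for every `i ≥ y₀`. The
  -- remaining bounds are immediate or come from the reduced permutation, using that rows `i - 1`
  -- and `i` agree when `i > y₀`.
  hull : Hullᴺ R m f′ → Hullᴺ R (suc m) f
  hull ih {i} {j} i<sm j<sm r = H1 , H2
    where
    i≤m = ℕₚ.≤-pred i<sm
    j≤m = ℕₚ.≤-pred j<sm
    j<m : j ≢ m → j < m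
    j<m = ℕₚ.≤∧≢⇒< j≤m
    H1 : ∃ λ k → k ≤ i × j ≤ f k
    H1 with y₀ ℕ.≤? i
    ... | yes y₀≤i = y₀ , y₀≤i , subst (j ≤_) (sym f-y₀) j≤m
    ... | no  y₀≰i with i<y₀ ← ℕₚ.≰⇒> y₀≰i
        with k , k≤i , j≤f′k ← proj₁ (ih (ℕₚ.<-≤-trans i<y₀ y₀≤x) (j<m λ { refl → y₀≰i (col⁻ i≤m r) }) r) =
      k , k≤i , subst (λ k → j ≤ f k) (skip-< (ℕₚ.≤-<-trans k≤i i<y₀)) j≤f′k
    H2 : ∃ λ l → l < suc m × i ≤ l × f l ≤ j
    H2 with j ℕ.≟ m
    ... | yes refl = i , i<sm , ℕₚ.≤-refl , ℕₚ.≤-pred (f< i<sm)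
    ... | no j≢m with ℕₚ.<-cmp i y₀
    ...   | tri< i<y₀ _ _ with l , l<m , i≤l , le ← proj₂ (ih (ℕₚ.<-≤-trans i<y₀ y₀≤x) (j<m j≢m) r) =
      skip y₀ l , skip-bound y₀ l<m , ℕₚ.≤-trans i≤l (skip-≥k l) , le
      where
      skip-≥k : ∀ l → l ≤ skip y₀ l
      skip-≥k l with skip-cases y₀ l
      ... | inj₁ (_ , e) = ℕₚ.≤-reflexive (sym e)
      ... | inj₂ (_ , e) = ℕₚ.≤-trans (ℕₚ.n≤1+n l) (ℕₚ.≤-reflexive (sym e))
    ...   | tri≈ _ refl _ with i ℕ.≟ m
    -- Here `i`, `y₀` and `m` coincide, and `triv` leaves nothing in row `m` to the left of the
    -- diagonal.
    ...     | yes refl = ⊥-elim (triv refl (j<m j≢m) r)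
    ...     | no i≢m with l , l<m , i≤l , le ← proj₂ (ih (ℕₚ.≤∧≢⇒< i≤m i≢m) (j<m j≢m) r) =
      skip i l , skip-bound i l<m , subst (i ≤_) (sym (skip-≥ i≤l)) (ℕₚ.≤-trans i≤l (ℕₚ.n≤1+n l)) , le
    H2 | no j≢m | tri> _ _ y₀<i = above i≤m y₀<i r
      where
      above : ∀ {i} → i ≤ m → y₀ < i → R i j → ∃ λ l → l < suc m × i ≤ l × f l ≤ j
      above {suc i} i<m y₀<i r with y₀≤i ← ℕₚ.≤-pred y₀<i
        with l , l<m , i≤l , le ← proj₂ (ih i<m (j<m j≢m) (row (ℕₚ.<⇒≤ y₀<i) i<m y₀≤i (ℕₚ.<⇒≤ i<m) j≤m r)) =
        skip y₀ l , skip-bound y₀ l<m , subst (suc i ≤_) (sym (skip-≥ (ℕₚ.≤-trans y₀≤i i≤l))) (s≤s i≤l) , le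

delete-unique : ∀ {R m f g f₂ g₂ y₀} (lm : LocMaxᴺ R (suc m) f g) (lm₂ : LocMaxᴺ R (suc m) f₂ g₂) (dn : Downᴺ R m y₀) →
  (∀ {i} → i < m → Delete.f′ lm dn i ≡ Delete.f′ lm₂ dn i) → ∀ {i} → i < suc m → f i ≡ f₂ i
delete-unique {m = m} {f} {f₂ = f₂} {y₀ = y₀} lm lm₂ dn e {i} i≤m with i ℕ.≟ y₀
... | yes refl = trans (Delete.f-y₀ lm dn) (sym (Delete.f-y₀ lm₂ dn))
... | no i≢y₀ = subst (λ k → f k ≡ f₂ k) (skip-unskip y₀ i≢y₀) (e bound)
  where
  bound : unskip y₀ i < m
  bound with skip-cases y₀ (unskip y₀ i)
  ... | inj₁ (p , _) = ℕₚ.<-≤-trans p (Downᴺ.y₀≤x dn)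
  ... | inj₂ (_ , eq) = ℕₚ.≤-pred (subst (_< suc m) (trans (sym (skip-unskip y₀ i≢y₀)) eq) i≤m)

Shapeᴺ : (ℕ → ℕ → Set) → ℕ → Set
Shapeᴺ R x = ∃ λ y₀ → Downᴺ R x y₀ ⊎ Downᴺ (flip R) x y₀

-- `y₀` depends on `R` alone, so both permutations send it to the top value, and their reductions
-- are locally maximal for the same `R`. For the dual shape the deletion is performed on the
-- inverses.
LocMaxᴺ-unique : ∀ {R} m {f g f₂ g₂} → (∀ {x} → x < m → Shapeᴺ R x) →
  LocMaxᴺ R m f g → LocMaxᴺ R m f₂ g₂ → ∀ {i} → i < m → f i ≡ f₂ i
LocMaxᴺ-unique zero    sh lm lm₂ ()
LocMaxᴺ-unique (suc m) sh lm lm₂ with sh {m} ℕₚ.≤-refl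
... | y₀ , inj₁ dn = delete-unique lm lm₂ dn
  (LocMaxᴺ-unique m (sh ∘ ℕₚ.m<n⇒m<1+n) (Delete.reduced lm dn) (Delete.reduced lm₂ dn))
... | y₀ , inj₂ up = inverse-unique lm lm₂ (delete-unique lmᵀ lm₂ᵀ up
    (inverse-unique (Delete.reduced lmᵀ up) (Delete.reduced lm₂ᵀ up)
      (LocMaxᴺ-unique m (sh ∘ ℕₚ.m<n⇒m<1+n) (LocMaxᴺ-flip (Delete.reduced lmᵀ up)) (LocMaxᴺ-flip (Delete.reduced lm₂ᵀ up)))))
  where
  lmᵀ  = LocMaxᴺ-flip lm
  lm₂ᵀ = LocMaxᴺ-flip lm₂

LocMaxᴺ-hull : ∀ {R} m {f g} → (∀ {x} → x < m → Shapeᴺ R x) → LocMaxᴺ R m f g → Hullᴺ R m f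
LocMaxᴺ-hull zero    sh lm ()
LocMaxᴺ-hull (suc m) sh lm with sh {m} ℕₚ.≤-refl
... | y₀ , inj₁ dn = Delete.hull lm dn (LocMaxᴺ-hull m (sh ∘ ℕₚ.m<n⇒m<1+n) (Delete.reduced lm dn))
... | y₀ , inj₂ up = Hullᴺ-flip lmᵀ (Delete.hull lmᵀ up
    (Hullᴺ-flip (LocMaxᴺ-flip red) (LocMaxᴺ-hull m (sh ∘ ℕₚ.m<n⇒m<1+n) (LocMaxᴺ-flip red))))
  where
  lmᵀ = LocMaxᴺ-flip lm
  red = Delete.reduced lmᵀ up

-- Transport from wires to an initial segment of the naturals

-- Deleting an index closes up a gap, and the wires, which skip 0, are not closed under this; their
-- ranks are. The value at 0 is a dummy.
rank : ℕ → ℤ → ℕ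
rank n (+ zero)  = 0
rank n (+ suc k) = n + k
rank n -[1+ k ]  = n ∸ suc k

wireAt : ℕ → ℕ → ℤ
wireAt n p with p ℕ.<? n
... | yes _ = -[1+ n ∸ suc p ]
... | no _  = + suc (p ∸ n)

wireAt-∈ : ∀ n {p} → p < n + n → wireAt n p ∈ wires n
wireAt-∈ n {p} p<2n with p ℕ.<? n
... | yes p<n = neg∈wires (ℕₚ.∸-monoʳ-< {n} {suc p} {0} (s≤s z≤n) p<n)
... | no  p≮n = pos∈wires (ℕₚ.+-cancelˡ-< n (p ∸ n) n (subst (_< n + n) (sym (ℕₚ.m+[n∸m]≡n (ℕₚ.≮⇒≥ p≮n))) p<2n))

rank-wireAt : ∀ n p → rank n (wireAt n p) ≡ p
rank-wireAt n p with p ℕ.<? n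
... | yes p<n = trans (cong (n ∸_) (sym (ℕₚ.+-∸-assoc 1 p<n))) (ℕₚ.m∸[m∸n]≡n (ℕₚ.<⇒≤ p<n))
... | no  p≮n = ℕₚ.m+[n∸m]≡n (ℕₚ.≮⇒≥ p≮n)

rank-< : ∀ n {i} → i ∈ wires n → rank n i < n + n
rank-< n i∈ with wireView n i∈
... | pos k<n = ℕₚ.+-monoʳ-< n k<n
... | neg {k} k<n = ℕₚ.<-≤-trans (ℕₚ.∸-monoʳ-< {n} {suc k} {0} (s≤s z≤n) k<n) (ℕₚ.m≤m+n n n)

rank-mono : ∀ n {i j} → i ∈ wires n → j ∈ wires n → i ℤ.< j → rank n i < rank n j
rank-mono n i∈ j∈ i<j with wireView n i∈ | wireView n j∈ | i<j
... | pos p | pos q | ℤ.+<+ (s≤s lt) = ℕₚ.+-monoʳ-< n lt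
... | neg {k} p | pos {l} q | _ = ℕₚ.<-≤-trans (ℕₚ.∸-monoʳ-< {n} {suc k} {0} (s≤s z≤n) p) (ℕₚ.m≤m+n n l)
... | neg {k} p | neg {l} q | ℤ.-<- l<k = ℕₚ.∸-monoʳ-< (s≤s l<k) p
... | pos p | neg q | ()

rank-reflects-< : ∀ n {i j} → i ∈ wires n → j ∈ wires n → rank n i < rank n j → i ℤ.< j
rank-reflects-< n {i} {j} i∈ j∈ lt with ℤₚ.<-cmp i j
... | tri< p _ _    = p
... | tri≈ _ refl _ = contradiction lt (ℕₚ.<-irrefl refl)
... | tri> _ _ p    = contradiction lt (ℕₚ.<-asym (rank-mono n j∈ i∈ p))

rank-injective : ∀ n {i j} → i ∈ wires n → j ∈ wires n → rank n i ≡ rank n j → i ≡ j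
rank-injective n {i} {j} i∈ j∈ e with ℤₚ.<-cmp i j
... | tri< p _ _ = contradiction e (ℕₚ.<⇒≢ (rank-mono n i∈ j∈ p))
... | tri≈ _ p _ = p
... | tri> _ _ p = contradiction (sym e) (ℕₚ.<⇒≢ (rank-mono n j∈ i∈ p))

wireAt-rank : ∀ n {i} → i ∈ wires n → wireAt n (rank n i) ≡ i
wireAt-rank n i∈ = rank-injective n (wireAt-∈ n (rank-< n i∈)) i∈ (rank-wireAt n _)

wireAt-mono : ∀ n {p q} → p < q → q < n + n → wireAt n p ℤ.< wireAt n q
wireAt-mono n {p} {q} p<q q<2n = rank-reflects-< n (wireAt-∈ n (ℕₚ.<-trans p<q q<2n)) (wireAt-∈ n q<2n)
  (subst₂ _<_ (sym (rank-wireAt n p)) (sym (rank-wireAt n q)) p<q)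

wireAt-mono-≤ : ∀ n {p q} → p ≤ q → q < n + n → wireAt n p ℤ.≤ wireAt n q
wireAt-mono-≤ n p≤q q<2n with ℕₚ.m≤n⇒m<n∨m≡n p≤q
... | inj₁ lt   = ℤₚ.<⇒≤ (wireAt-mono n lt q<2n)
... | inj₂ refl = ℤₚ.≤-refl

rank-mono-≤ : ∀ n {i j} → i ∈ wires n → j ∈ wires n → i ℤ.≤ j → rank n i ≤ rank n j
rank-mono-≤ n {i} {j} i∈ j∈ i≤j with i ℤₚ.≟ j
... | yes refl = ℕₚ.≤-refl
... | no i≢j = ℕₚ.<⇒≤ (rank-mono n i∈ j∈ (ℤₚ.≤∧≢⇒< i≤j i≢j))

module WireMax {n : ℕ} {cs : List Iv} (zz : ZigZag n cs) where

  zig : Zig cs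
  zig = ZigZag⇒Zig {n} zz

  private
    R̂ : ℕ → ℕ → Set
    R̂ p q = Reach cs (wireAt n p) (wireAt n q)

    toℕ-Down : ∀ {R : ℤ → ℤ → Set} {x y₀} → x < n + n → y₀ ∈ wires n → y₀ ℤ.≤ wireAt n x →
               Down R (wireAt n x) y₀ → Downᴺ (λ p q → R (wireAt n p) (wireAt n q)) x (rank n y₀)
    toℕ-Down {R} {x} {y₀} x<2n y∈ y₀≤x dn = record
      { y₀≤x = subst (rank n y₀ ≤_) (rank-wireAt n x) (rank-mono-≤ n y∈ x∈ y₀≤x)
      ; col⁻ = λ {y} y≤x r → subst (rank n y₀ ≤_) (rank-wireAt n y)
          (rank-mono-≤ n y∈ (wireAt-∈ n (ℕₚ.≤-<-trans y≤x x<2n)) (col⁻ (wireAt-mono-≤ n y≤x x<2n) r))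
      ; col⁺ = λ y₀≤y y≤x → col⁺ (low y₀≤y (ℕₚ.≤-<-trans y≤x x<2n)) (wireAt-mono-≤ n y≤x x<2n)
      ; row = λ y₀≤y y≤x y₀≤y′ y′≤x z≤x r →
          row⁺ (low y₀≤y′ (ℕₚ.≤-<-trans y′≤x x<2n)) (wireAt-mono-≤ n y′≤x x<2n) (wireAt-mono-≤ n z≤x x<2n)
            (row⁻ (low y₀≤y (ℕₚ.≤-<-trans y≤x x<2n)) (wireAt-mono-≤ n y≤x x<2n) (wireAt-mono-≤ n z≤x x<2n) r)
      ; triv = λ e z<x → triv (trans (sym (wireAt-rank n y∈)) (cong (wireAt n) e)) (wireAt-mono n z<x x<2n) }
      where
      open Down dn
      x∈ = wireAt-∈ n x<2n
      low : ∀ {y} → rank n y₀ ≤ y → y < n + n → y₀ ℤ.≤ wireAt n y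
      low le y<2n = subst (ℤ._≤ _) (wireAt-rank n y∈) (wireAt-mono-≤ n le y<2n)

    shape : ∀ {x} → x < n + n → Shapeᴺ R̂ x
    shape {x} x<2n = rank n y₀ , (case sh of λ
        { (inj₁ dn) → inj₁ (toℕ-Down x<2n y∈ y₀≤x dn) ; (inj₂ up) → inj₂ (toℕ-Down x<2n y∈ y₀≤x up) })
      where
      open Dichotomy (dichotomy zig (wireAt n x)) renaming (shape to sh)
      y∈ : y₀ ∈ wires n
      y∈ with y₀-end
      ... | inj₁ e = subst (_∈ wires n) (sym e) (wireAt-∈ n x<2n)
      ... | inj₂ (K , K∈ , e) = subst (_∈ wires n) (sym e) (proj₁ (All.lookup (proj₁ zz) K∈))

  record Maximal (u : ℤ → ℤ) : Set where
    field
      perm   : IsPermOn (wires n) u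
      compat : ∀ {i} → i ∈ wires n → Reach cs i (u i)
      locMax : LocMax n cs u

  private
    module Ranked {u : ℤ → ℤ} (mx : Maximal u) where
      open Maximal mx
      f g : ℕ → ℕ
      f p = rank n (u (wireAt n p))
      g p with p ℕ.<? n + n
      ... | yes p<2n = rank n (proj₁ (proj₂ (proj₂ perm) (wireAt n p) (wireAt-∈ n p<2n)))
      ... | no _     = 0
      u∈ : ∀ {i} → i ∈ wires n → u i ∈ wires n
      u∈ = proj₁ perm _
      wf : ∀ {p} → p < n + n → wireAt n (f p) ≡ u (wireAt n p)
      wf p<2n = wireAt-rank n (u∈ (wireAt-∈ n p<2n))
      g< : ∀ {p} → p < n + n → g p < n + n
      g< {p} p<2n with p ℕ.<? n + n
      ... | yes q = rank-< n (proj₁ (proj₂ (proj₂ (proj₂ perm) (wireAt n p) (wireAt-∈ n q))))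
      ... | no ¬q = contradiction p<2n ¬q
      fg : ∀ {p} → p < n + n → f (g p) ≡ p
      fg {p} p<2n with p ℕ.<? n + n
      ... | no ¬q = contradiction p<2n ¬q
      ... | yes q with k , k∈ , e ← proj₂ (proj₂ perm) (wireAt n p) (wireAt-∈ n q) =
        trans (cong (rank n ∘ u) (wireAt-rank n k∈)) (trans (cong (rank n) e) (rank-wireAt n p))
      f< : ∀ {p} → p < n + n → f p < n + n
      f< p<2n = rank-< n (u∈ (wireAt-∈ n p<2n))
      f-inj : ∀ {p q} → p < n + n → q < n + n → f p ≡ f q → p ≡ q
      f-inj {p} {q} p<2n q<2n e = trans (sym (rank-wireAt n p)) (trans (cong (rank n) (proj₁ (proj₂ perm) _ _ (wireAt-∈ n p<2n) (wireAt-∈ n q<2n)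
        (rank-injective n (u∈ (wireAt-∈ n p<2n)) (u∈ (wireAt-∈ n q<2n)) e))) (rank-wireAt n q))
      lm : LocMaxᴺ R̂ (n + n) f g
      lm = record
        { f< = f< ; g< = g< ; fg = fg
        ; gf = λ p<2n → f-inj (g< (f< p<2n)) p<2n (fg (f< p<2n))
        ; compat = λ p<2n → subst (Reach cs _) (sym (wf p<2n)) (compat (wireAt-∈ n p<2n))
        ; loc = λ i<j j<2n lt r r′ → let i<2n = ℕₚ.<-trans i<j j<2n in
            locMax (wireAt-∈ n i<2n) (wireAt-∈ n j<2n) (wireAt-mono n i<j j<2n)
              (rank-reflects-< n (u∈ (wireAt-∈ n i<2n)) (u∈ (wireAt-∈ n j<2n)) lt)
              (subst (Reach cs _) (wf j<2n) r) (subst (Reach cs _) (wf i<2n) r′) }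

  maximal-unique : ∀ {u v} → Maximal u → Maximal v → ∀ {i} → i ∈ wires n → u i ≡ v i
  maximal-unique {u} {v} mu mv {i} i∈ = rank-injective n (Ranked.u∈ mu i∈) (Ranked.u∈ mv i∈)
    (subst (λ k → rank n (u k) ≡ rank n (v k)) (wireAt-rank n i∈)
      (LocMaxᴺ-unique (n + n) shape (Ranked.lm mu) (Ranked.lm mv) (rank-< n i∈)))

  maximal-hull : ∀ {u} → Maximal u → ∀ {i j} → i ∈ wires n → j ∈ wires n → Reach cs i j →
    (∃ λ k → k ∈ wires n × k ℤ.≤ i × j ℤ.≤ u k) × (∃ λ l → l ∈ wires n × i ℤ.≤ l × u l ℤ.≤ j)
  maximal-hull {u} mu {i} {j} i∈ j∈ r
    with (k , k≤i , j≤fk) , (l , l<2n , i≤l , fl≤j) ←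
      LocMaxᴺ-hull (n + n) shape (Ranked.lm mu) (rank-< n i∈) (rank-< n j∈)
        (subst₂ (Reach cs) (sym (wireAt-rank n i∈)) (sym (wireAt-rank n j∈)) r) =
    (wireAt n k , wireAt-∈ n k<2n , subst (wireAt n k ℤ.≤_) (wireAt-rank n i∈) (wireAt-mono-≤ n k≤i (rank-< n i∈)) ,
       subst₂ ℤ._≤_ (wireAt-rank n j∈) (wf k<2n) (wireAt-mono-≤ n j≤fk (f< k<2n))) ,
    (wireAt n l , wireAt-∈ n l<2n , subst (ℤ._≤ wireAt n l) (wireAt-rank n i∈) (wireAt-mono-≤ n i≤l l<2n) ,
       subst₂ ℤ._≤_ (wf l<2n) (wireAt-rank n j∈) (wireAt-mono-≤ n fl≤j (rank-< n j∈)))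
    where
    open Ranked mu
    k<2n = ℕₚ.≤-<-trans k≤i (rank-< n i∈)

  -- The route `k → a` is uncrossed with the straight route `i → i`, and the resulting route `i → a`
  -- with `j → j`.
  Reach-convex↑ : ∀ {k a i j} → Reach cs k a → k ℤ.≤ i → i ℤ.≤ j → j ℤ.≤ a → Reach cs i j
  Reach-convex↑ {k} {a} {i} {j} r k≤i i≤j j≤a = ij ia
    where
    ia : Reach cs i a
    ia with k ℤₚ.≟ i
    ... | yes refl = r
    ... | no k≢i = proj₂ (uncross cs (ℤₚ.≤∧≢⇒< k≤i k≢i) (ℤₚ.≤-trans i≤j j≤a) r (Reach-refl cs))
    ij : Reach cs i a → Reach cs i j
    ij r′ with i ℤₚ.≟ j
    ... | yes refl = Reach-refl cs
    ... | no i≢j = proj₁ (uncross cs (ℤₚ.≤∧≢⇒< i≤j i≢j) j≤a r′ (Reach-refl cs))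

  Reach-convex↓ : ∀ {l b i j} → Reach cs l b → i ℤ.≤ l → j ℤ.≤ i → b ℤ.≤ j → Reach cs i j
  Reach-convex↓ {l} {b} {i} {j} r i≤l j≤i b≤j = ij ib
    where
    ib : Reach cs i b
    ib with i ℤₚ.≟ l
    ... | yes refl = r
    ... | no i≢l = proj₁ (uncross cs (ℤₚ.≤∧≢⇒< i≤l i≢l) (ℤₚ.≤-trans b≤j j≤i) (Reach-refl cs) r)
    ij : Reach cs i b → Reach cs i j
    ij r′ with j ℤₚ.≟ i
    ... | yes refl = Reach-refl cs
    ... | no j≢i = proj₂ (uncross cs (ℤₚ.≤∧≢⇒< j≤i j≢i) b≤j (Reach-refl cs) r′)

  -- The hull of an odd permutation is symmetric under negation, and a pair squeezed between a point
  -- of the diagram of `u` and the diagonal is related by convexity.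
  Reach-neg : ∀ {u} → Maximal u → (∀ {i} → i ∈ wires n → u (ℤ.- i) ≡ ℤ.- u i) →
              ∀ {i j} → i ∈ wires n → j ∈ wires n → Reach cs i j → Reach cs (ℤ.- i) (ℤ.- j)
  Reach-neg {u} mu odd {i} {j} i∈ j∈ r
    with (k , k∈ , k≤i , j≤uk) , (l , l∈ , i≤l , ul≤j) ← maximal-hull mu i∈ j∈ r with ℤₚ.≤-total i j
  ... | inj₁ i≤j = Reach-convex↓ (subst (Reach cs _) (odd k∈) (Maximal.compat mu (wires-neg n k∈)))
                     (ℤₚ.neg-mono-≤ k≤i) (ℤₚ.neg-mono-≤ i≤j) (ℤₚ.neg-mono-≤ j≤uk)
  ... | inj₂ j≤i = Reach-convex↑ (subst (Reach cs _) (odd l∈) (Maximal.compat mu (wires-neg n l∈)))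
                     (ℤₚ.neg-mono-≤ i≤l) (ℤₚ.neg-mono-≤ j≤i) (ℤₚ.neg-mono-≤ ul≤j)

-- Signed permutations and their length

at-map : ∀ {A B : Set} (f : A → B) d xs k → at (f d) (map f xs) k ≡ f (at d xs k)
at-map f d []       k             = refl
at-map f d (x ∷ xs) zero          = refl
at-map f d (x ∷ xs) (suc zero)    = refl
at-map f d (x ∷ xs) (suc (suc k)) = at-map f d xs (suc k)

at-ext : ∀ {A : Set} {d : A} xs ys → length xs ≡ length ys →
         (∀ {k} → k < length xs → at d xs (suc k) ≡ at d ys (suc k)) → xs ≡ ys
at-ext []       []       _ _ = refl
at-ext (x ∷ xs) (y ∷ ys) l e = cong₂ _∷_ (e (s≤s z≤n)) (at-ext xs ys (ℕₚ.suc-injective l) (λ k< → e (s≤s k<)))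

at-∈ : ∀ {A : Set} {d : A} xs {k} → k < length xs → at d xs (suc k) ∈ xs
at-∈ (x ∷ xs) {zero}  _        = here refl
at-∈ (x ∷ xs) {suc k} (s≤s k<) = there (at-∈ xs k<)

∈-at : ∀ {A : Set} {d : A} {xs x} → x ∈ xs → ∃ λ k → k < length xs × at d xs (suc k) ≡ x
∈-at (here refl) = 0 , s≤s z≤n , refl
∈-at (there x∈) with k , k< , e ← ∈-at x∈ = suc k , s≤s k< , e

at-irrelevant : ∀ {A : Set} {d d′ : A} xs {k} → k < length xs → at d xs (suc k) ≡ at d′ xs (suc k)
at-irrelevant (x ∷ xs) {zero}  _        = refl
at-irrelevant (x ∷ xs) {suc k} (s≤s k<) = at-irrelevant xs k<

at-injective : ∀ {A : Set} {d : A} {xs k l} → Unique xs → k < length xs → l < length xs →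
               at d xs (suc k) ≡ at d xs (suc l) → k ≡ l
at-injective {xs = x ∷ xs} {zero}  {zero}  _ _ _ _ = refl
at-injective {xs = x ∷ xs} {zero}  {suc l} (x∉ ∷ _) _ (s≤s l<) e = contradiction e (All.lookup x∉ (at-∈ xs l<))
at-injective {xs = x ∷ xs} {suc k} {zero}  (x∉ ∷ _) (s≤s k<) _ e = contradiction (sym e) (All.lookup x∉ (at-∈ xs k<))
at-injective {xs = x ∷ xs} {suc k} {suc l} (_ ∷ u) (s≤s k<) (s≤s l<) e = cong suc (at-injective u k< l< e)

at-applyUpTo : ∀ {A : Set} {d : A} (h : ℕ → A) m {k} → k < m → at d (applyUpTo h m) (suc k) ≡ h k
at-applyUpTo h (suc m) {zero}  _        = refl
at-applyUpTo h (suc m) {suc k} (s≤s k<) = at-applyUpTo (h ∘ suc) m k<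

range1-length : ∀ m → length (range1 m) ≡ m
range1-length m = trans (Listₚ.length-map suc (upTo m)) (Listₚ.length-upTo m)

range1-applyUpTo : ∀ m → range1 m ≡ applyUpTo suc m
range1-applyUpTo m = Listₚ.map-upTo suc m

map-range1-at : ∀ {A : Set} {d : A} (f : ℕ → A) m {k} → k < m → at d (map f (range1 m)) (suc k) ≡ f (suc k)
map-range1-at {d = d} f m {k} k<m =
  trans (cong (λ l → at d l (suc k)) (trans (cong (map f) (range1-applyUpTo m)) (Listₚ.map-applyUpTo suc f m)))
        (at-applyUpTo (f ∘ suc) m k<m)

∈-range1⁻ : ∀ {m j} → j ∈ range1 m → ∃ λ k → k < m × j ≡ suc k
∈-range1⁻ j∈ with k , k∈ , e ← ∈ₚ.∈-map⁻ suc j∈ = k , ∈ₚ.∈-upTo⁻ k∈ , e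

∈-range1⁺ : ∀ {m k} → k < m → suc k ∈ range1 m
∈-range1⁺ k<m = ∈ₚ.∈-map⁺ suc (∈ₚ.∈-upTo⁺ k<m)

range1-unique : ∀ m → Unique (range1 m)
range1-unique m = Uniqueₚ.map⁺ ℕₚ.suc-injective (Uniqueₚ.upTo⁺ m)

tabulate-at : ∀ {A : Set} {d : A} xs {m} → length xs ≡ m → map (at d xs) (range1 m) ≡ xs
tabulate-at {d = d} xs refl = at-ext {d = d} _ xs len λ k< → map-range1-at (at d xs) (length xs) (subst (_ <_) len k<)
  where
  len : length (map (at d xs) (range1 (length xs))) ≡ length xs
  len = trans (Listₚ.length-map (at d xs) (range1 (length xs))) (range1-length (length xs))

unique-⊆-↭ : ∀ {A : Set} {xs ys : List A} → Unique xs → (∀ {x} → x ∈ xs → x ∈ ys) →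
             length ys ≤ length xs → xs ↭ ys
unique-⊆-↭ {xs = []}     {[]}    _        _   _  = ↭-refl
unique-⊆-↭ {xs = x ∷ xs} {ys} (x∉ ∷ u) sub le with as , bs , refl ← ∈ₚ.∈-∃++ (sub (here refl)) =
  ↭-trans (prep x (unique-⊆-↭ u sub′ le′)) (↭-sym (↭ₚ.shift x as bs))
  where
  sub′ : ∀ {y} → y ∈ xs → y ∈ as ++ bs
  sub′ y∈ with ↭ₚ.∈-resp-↭ (↭ₚ.shift x as bs) (sub (there y∈))
  ... | here refl = contradiction refl (All.lookup x∉ y∈)
  ... | there p   = p
  le′ : length (as ++ bs) ≤ length xs
  le′ = ℕₚ.≤-pred (subst (_≤ suc (length xs)) (↭ₚ.↭-length (↭ₚ.shift x as bs)) le)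

appB-odd : ∀ v a → appB v (ℤ.- a) ≡ ℤ.- appB v a
appB-odd v (+ zero)  = refl
appB-odd v (+ suc k) = refl
appB-odd v -[1+ k ]  = sym (ℤₚ.neg-involutive _)

appB-mulB : ∀ x y a → appB (mulB x y) a ≡ appB x (appB y a)
appB-mulB x y (+ zero)  = refl
appB-mulB x y (+ suc k) = at-map (appB x) (+ 0) y (suc k)
appB-mulB x y -[1+ k ]  = trans (cong ℤ.-_ (at-map (appB x) (+ 0) y (suc k))) (sym (appB-odd x (at (+ 0) y (suc k))))

mulB-assoc : ∀ x y z → mulB (mulB x y) z ≡ mulB x (mulB y z)
mulB-assoc x y z = trans (Listₚ.map-cong (appB-mulB x y) z) (Listₚ.map-∘ z)

appB-ext : ∀ {n v v′} → length v ≡ n → length v′ ≡ n → (∀ {i} → i ∈ wires n → appB v i ≡ appB v′ i) → v ≡ v′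
appB-ext {v = v} {v′} refl l e = at-ext {d = + 0} v v′ (sym l) (λ k< → e (pos∈wires k<))

abs∈⇒wire : ∀ {n a} → ∣ a ∣ ∈ range1 n → a ∈ wires n
abs∈⇒wire {a = a} a∈ with k , k<n , e ← ∈-range1⁻ a∈ with a | e
... | + suc _  | refl = pos∈wires k<n
... | -[1+ _ ] | refl = neg∈wires k<n

wire⇒abs∈ : ∀ n {a} → a ∈ wires n → ∣ a ∣ ∈ range1 n
wire⇒abs∈ n a∈ with wireView n a∈
... | pos k<n = ∈-range1⁺ k<n
... | neg k<n = ∈-range1⁺ k<n

abs-≡⇒± : ∀ i j → ∣ i ∣ ≡ ∣ j ∣ → i ≡ j ⊎ i ≡ ℤ.- j
abs-≡⇒± (+ _)    (+ _)     refl = inj₁ refl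
abs-≡⇒± (+ _)    -[1+ _ ]  refl = inj₂ refl
abs-≡⇒± -[1+ _ ] (+ suc _) refl = inj₂ refl
abs-≡⇒± -[1+ _ ] -[1+ _ ]  refl = inj₁ refl

wire≢neg : ∀ n {a} → a ∈ wires n → a ≢ ℤ.- a
wire≢neg n a∈ e with wireView n a∈
wire≢neg n a∈ () | pos _
wire≢neg n a∈ () | neg _

module _ {n : ℕ} where

  IsBn-∈ : ∀ {v a} → IsBn n v → a ∈ v → a ∈ wires n
  IsBn-∈ (_ , p) a∈ = abs∈⇒wire (↭ₚ.∈-resp-↭ p (∈ₚ.∈-map⁺ ∣_∣ a∈))

  appB-wire : ∀ {v} → IsBn n v → ∀ {i} → i ∈ wires n → appB v i ∈ wires n
  appB-wire {v} bv@(l , _) i∈ with wireView n i∈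
  ... | pos k<n = IsBn-∈ bv (at-∈ v (subst (_ <_) (sym l) k<n))
  ... | neg k<n = wires-neg n (IsBn-∈ bv (at-∈ v (subst (_ <_) (sym l) k<n)))

  IsBn-abs-unique : ∀ {v} → IsBn n v → Unique (map ∣_∣ v)
  IsBn-abs-unique (_ , p) = Unique-↭ (↭-sym p) (range1-unique n)

  private
    abs-at-injective : ∀ {v} → IsBn n v → ∀ {k l} → k < n → l < n →
      ∣ at (+ 0) v (suc k) ∣ ≡ ∣ at (+ 0) v (suc l) ∣ → k ≡ l
    abs-at-injective {v} bv@(len , _) {k} {l} k<n l<n e =
      at-injective {d = 0} (IsBn-abs-unique bv) (bound k<n) (bound l<n)
        (trans (at-map ∣_∣ (+ 0) v (suc k)) (trans e (sym (at-map ∣_∣ (+ 0) v (suc l)))))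
      where
      bound : ∀ {k} → k < n → k < length (map ∣_∣ v)
      bound = subst (_ <_) (sym (trans (Listₚ.length-map ∣_∣ v) len))

  appB-injective : ∀ {v} → IsBn n v → ∀ {i j} → i ∈ wires n → j ∈ wires n → appB v i ≡ appB v j → i ≡ j
  appB-injective {v} bv i∈ j∈ e with wireView n i∈ | wireView n j∈
  ... | pos p | pos q = cong (λ k → + suc k) (abs-at-injective {v} bv p q (cong ∣_∣ e))
  ... | neg p | neg q = cong -[1+_] (abs-at-injective {v} bv p q (cong ∣_∣ (ℤₚ.neg-injective e)))
  ... | pos {k} p | neg {l} q with refl ← abs-at-injective {v} bv p q (trans (cong ∣_∣ e) (ℤₚ.∣-i∣≡∣i∣ (at (+ 0) v (suc l)))) =
    contradiction e (wire≢neg n (appB-wire {v} bv i∈))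
  ... | neg {k} p | pos {l} q with refl ← abs-at-injective {v} bv p q (trans (sym (ℤₚ.∣-i∣≡∣i∣ (at (+ 0) v (suc k)))) (cong ∣_∣ e)) =
    contradiction (sym e) (wire≢neg n (appB-wire {v} bv j∈))

  appB-surjective : ∀ {v} → IsBn n v → ∀ {j} → j ∈ wires n → ∃ λ i → i ∈ wires n × appB v i ≡ j
  appB-surjective {v} (len , p) {j} j∈
    with a , a∈ , e ← ∈ₚ.∈-map⁻ ∣_∣ (↭ₚ.∈-resp-↭ (↭-sym p) (wire⇒abs∈ n j∈))
    with k , k< , refl ← ∈-at {d = + 0} a∈ with abs-≡⇒± j (at (+ 0) v (suc k)) e
  ... | inj₁ e′ = + suc k , pos∈wires (subst (k <_) len k<) , sym e′
  ... | inj₂ e′ = -[1+ k ] , neg∈wires (subst (k <_) len k<) , sym e′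

  IsBn⇒perm : ∀ {v} → IsBn n v → IsPermOn (wires n) (appB v)
  IsBn⇒perm {v} bv = (λ i → appB-wire {v} bv) , (λ i j → appB-injective {v} bv) , (λ j → appB-surjective {v} bv)

  abs-appB : ∀ v a → ∣ appB v a ∣ ≡ at 0 (map ∣_∣ v) ∣ a ∣
  abs-appB []      (+ zero)  = refl
  abs-appB (x ∷ v) (+ zero)  = refl
  abs-appB v (+ suc k) = sym (at-map ∣_∣ (+ 0) v (suc k))
  abs-appB v -[1+ k ]  = trans (ℤₚ.∣-i∣≡∣i∣ (at (+ 0) v (suc k))) (sym (at-map ∣_∣ (+ 0) v (suc k)))

  IsBn-mulB : ∀ {x y} → IsBn n x → IsBn n y → IsBn n (mulB x y)
  IsBn-mulB {x} {y} (lx , px) (ly , py) =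
    trans (Listₚ.length-map (appB x) y) ly ,
    ↭-trans (↭-reflexive (trans (sym (Listₚ.map-∘ y)) (trans (Listₚ.map-cong (abs-appB x) y) (Listₚ.map-∘ y))))
      (↭-trans (↭ₚ.map⁺ (at 0 (map ∣_∣ x)) py)
        (↭-trans (↭-reflexive (tabulate-at (map ∣_∣ x) (trans (Listₚ.length-map ∣_∣ x) lx))) px))

  appB-idB : ∀ {i} → i ∈ wires n → appB (idB n) i ≡ i
  appB-idB i∈ with wireView n i∈
  ... | pos k<n = map-range1-at +_ n k<n
  ... | neg k<n = cong ℤ.-_ (map-range1-at +_ n k<n)

  IsBn-idB : IsBn n (idB n)
  IsBn-idB = trans (Listₚ.length-map +_ (range1 n)) (range1-length n) ,
             ↭-reflexive (trans (sym (Listₚ.map-∘ (range1 n))) (Listₚ.map-id (range1 n)))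

  mulB-idʳ : ∀ {v} → IsBn n v → mulB v (idB n) ≡ v
  mulB-idʳ {v} (l , _) = trans (sym (Listₚ.map-∘ (range1 n)))
    (trans (cong (map (λ k → appB v (+ k))) (range1-applyUpTo n))
    (trans (Listₚ.map-cong-local {f = λ k → appB v (+ k)} {g = at (+ 0) v} (All.tabulate λ k∈ → case ∈ₚ.∈-applyUpTo⁻ suc k∈ of λ { (_ , _ , refl) → refl }))
    (trans (cong (map (at (+ 0) v)) (sym (range1-applyUpTo n))) (tabulate-at v l))))

  mulB-idˡ : ∀ {v} → IsBn n v → mulB (idB n) v ≡ v
  mulB-idˡ {v} bv = trans (Listₚ.map-cong-local (All.tabulate λ a∈ → appB-idB (IsBn-∈ {v} bv a∈))) (Listₚ.map-id v)

posB-spec : ∀ j x → j ≢ 0 → j ∈ map ∣_∣ x → posB j x ≢ + 0 × appB x (posB j x) ≡ + j × ∣ posB j x ∣ ∈ range1 (length x)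
posB-spec j (y ∷ ys) j≢0 j∈ with ∣ y ∣ ℕ.≡ᵇ j in eq
... | true with refl ← ℕₚ.≡ᵇ⇒≡ ∣ y ∣ j (subst T (sym eq) tt) with y ℤ.<? + 0
...   | yes y<0 = (λ ()) , negative y y<0 , ∈-range1⁺ {m = suc (length ys)} (s≤s z≤n)
  where
  negative : ∀ y → y ℤ.< + 0 → ℤ.- y ≡ + ∣ y ∣
  negative -[1+ _ ] _ = refl
  negative (+ _) (ℤ.+<+ ())
...   | no y≮0 = (λ ()) , nonneg y y≮0 , ∈-range1⁺ {m = suc (length ys)} (s≤s z≤n)
  where
  nonneg : ∀ y → ¬ y ℤ.< + 0 → y ≡ + ∣ y ∣
  nonneg (+ _)    _ = refl
  nonneg -[1+ _ ] h = contradiction ℤ.-<+ h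
posB-spec j (y ∷ ys) j≢0 j∈ | false with j∈
... | here e = contradiction (subst T eq (ℕₚ.≡⇒≡ᵇ ∣ y ∣ j (sym e))) id
... | there j∈′ with nz , e , r ← posB-spec j ys j≢0 j∈′ with posB j ys
...   | + zero  = contradiction refl nz
...   | + suc k = (λ ()) , e , bump r
  where
  bump : suc k ∈ range1 (length ys) → suc (suc k) ∈ range1 (suc (length ys))
  bump m with k , k< , refl ← ∈-range1⁻ m = ∈-range1⁺ (s≤s k<)
...   | -[1+ k ] = (λ ()) , e , bump r
  where
  bump : suc k ∈ range1 (length ys) → suc (suc k) ∈ range1 (suc (length ys))
  bump m with k , k< , refl ← ∈-range1⁻ m = ∈-range1⁺ (s≤s k<)

module _ {n : ℕ} {x : List ℤ} (bx : IsBn n x) where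

  private
    spec : ∀ {k} → k < n → posB (suc k) x ≢ + 0 × appB x (posB (suc k) x) ≡ + suc k × ∣ posB (suc k) x ∣ ∈ range1 (length x)
    spec {k} k<n = posB-spec (suc k) x (λ ()) (↭ₚ.∈-resp-↭ (↭-sym (proj₂ bx)) (∈-range1⁺ k<n))

    at-inv : ∀ {k} → k < n → at (+ 0) (invB x) (suc k) ≡ posB (suc k) x
    at-inv {k} k<n = map-range1-at (λ j → posB j x) (length x) (subst (k <_) (sym (proj₁ bx)) k<n)

  appB-invʳ : ∀ {i} → i ∈ wires n → appB x (appB (invB x) i) ≡ i
  appB-invʳ i∈ with wireView n i∈
  ... | pos k<n = trans (cong (appB x) (at-inv k<n)) (proj₁ (proj₂ (spec k<n)))
  ... | neg {k} k<n = trans (appB-odd x (at (+ 0) (invB x) (suc k))) (cong ℤ.-_ (trans (cong (appB x) (at-inv k<n)) (proj₁ (proj₂ (spec k<n)))))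

  private
    inv-length : length (invB x) ≡ n
    inv-length = trans (Listₚ.length-map _ (range1 (length x))) (trans (range1-length (length x)) (proj₁ bx))

  IsBn-invB : IsBn n (invB x)
  IsBn-invB = inv-length , ↭-trans (↭-reflexive (sym (Listₚ.map-∘ _))) (subst (λ m → map h (range1 m) ↭ range1 n) (sym (proj₁ bx))
      (unique-⊆-↭ uniq sub (ℕₚ.≤-reflexive (sym (Listₚ.length-map h (range1 n))))))
    where
    h : ℕ → ℕ
    h j = ∣ posB j x ∣
    wire : ∀ {k} → k < n → posB (suc k) x ∈ wires n
    wire k<n = abs∈⇒wire (subst (λ m → _ ∈ range1 m) (proj₁ bx) (proj₂ (proj₂ (spec k<n))))
    uniq : Unique (map h (range1 n))
    uniq = unique-map-on (range1-unique n) inj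
      where
      inj : ∀ {a b} → a ∈ range1 n → b ∈ range1 n → h a ≡ h b → a ≡ b
      inj a∈ b∈ e with k , k<n , refl ← ∈-range1⁻ a∈ | l , l<n , refl ← ∈-range1⁻ b∈
        with abs-≡⇒± (posB (suc k) x) (posB (suc l) x) e
      ... | inj₁ e′ = ℤₚ.+-injective (trans (sym (proj₁ (proj₂ (spec k<n)))) (trans (cong (appB x) e′) (proj₁ (proj₂ (spec l<n)))))
      ... | inj₂ e′ with () ← trans (sym (proj₁ (proj₂ (spec k<n)))) (trans (cong (appB x) e′) (trans (appB-odd x (posB (suc l) x)) (cong ℤ.-_ (proj₁ (proj₂ (spec l<n))))))
      unique-map-on : ∀ {xs} → Unique xs → (∀ {a b} → a ∈ xs → b ∈ xs → h a ≡ h b → a ≡ b) → Unique (map h xs)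
      unique-map-on [] _ = []
      unique-map-on (a∉ ∷ u) inj = Allₚ.map⁺ (All.tabulate λ b∈ e → All.lookup a∉ b∈ (inj (here refl) (there b∈) e))
                                   ∷ unique-map-on u (λ p q → inj (there p) (there q))
    sub : ∀ {j} → j ∈ map h (range1 n) → j ∈ range1 n
    sub j∈ with a , a∈ , refl ← ∈ₚ.∈-map⁻ h j∈ with k , k<n , refl ← ∈-range1⁻ a∈ = wire⇒abs∈ n (wire k<n)

  appB-invˡ : ∀ {i} → i ∈ wires n → appB (invB x) (appB x i) ≡ i
  appB-invˡ i∈ = appB-injective {n} {x} bx (appB-wire {n} {invB x} IsBn-invB (appB-wire {n} {x} bx i∈)) i∈
                   (appB-invʳ (appB-wire {n} {x} bx i∈))

χ-cong : ∀ {P Q : Set} (P? : Dec P) (Q? : Dec Q) → (P → Q) → (Q → P) → ⌊ P? ⌋ ≡ ⌊ Q? ⌋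
χ-cong (yes p) (yes q) _ _ = refl
χ-cong (no ¬p) (no ¬q) _ _ = refl
χ-cong (yes p) (no ¬q) f _ = contradiction (f p) ¬q
χ-cong (no ¬p) (yes q) _ g = contradiction (g q) ¬p

⌊⌋-true : ∀ {P : Set} (P? : Dec P) → P → ⌊ P? ⌋ ≡ true
⌊⌋-true (yes _) _ = refl
⌊⌋-true (no ¬p) p = contradiction p ¬p

⌊⌋-false : ∀ {P : Set} (P? : Dec P) → ¬ P → ⌊ P? ⌋ ≡ false
⌊⌋-false (yes p) ¬p = contradiction p ¬p
⌊⌋-false (no _)  _  = refl

neg-< : ∀ {i j} → ℤ.- i ℤ.< ℤ.- j → j ℤ.< i
neg-< {i} {j} lt = subst₂ ℤ._<_ (ℤₚ.neg-involutive j) (ℤₚ.neg-involutive i) (ℤₚ.neg-mono-< lt)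

<-neg-swap : ∀ {x y} → y ℤ.< ℤ.- x → x ℤ.< ℤ.- y
<-neg-swap {x} {y} lt = subst (ℤ._< ℤ.- y) (ℤₚ.neg-involutive x) (ℤₚ.neg-mono-< lt)

-- Length in type B by reduced words

row-count : ℤ → List ℤ → ℕ
row-count x = sumOf (λ y → χ ⌊ y ℤ.<? x ⌋ + χ ⌊ y ℤ.<? ℤ.- x ⌋)

-- #{i<j : v_i > v_j} + #{i≤j : -v_i > v_j}, the Coxeter length in type B.
lenB : List ℤ → ℕ
lenB []       = 0
lenB (x ∷ xs) = row-count x xs + (χ ⌊ x ℤ.<? + 0 ⌋ + lenB xs)

swapAt-↭ : ∀ i xs → swapAt i xs ↭ xs
swapAt-↭ i       []           = ↭-refl
swapAt-↭ zero    (x ∷ [])     = ↭-refl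
swapAt-↭ (suc i) (x ∷ [])     = ↭-refl
swapAt-↭ zero    (x ∷ y ∷ xs) = swap y x ↭-refl
swapAt-↭ (suc i) (x ∷ y ∷ xs) = prep x (swapAt-↭ i (y ∷ xs))

map-swapAt : ∀ (f : ℤ → ℤ) i xs → map f (swapAt i xs) ≡ swapAt i (map f xs)
map-swapAt f i       []           = refl
map-swapAt f zero    (x ∷ [])     = refl
map-swapAt f (suc i) (x ∷ [])     = refl
map-swapAt f zero    (x ∷ y ∷ xs) = refl
map-swapAt f (suc i) (x ∷ y ∷ xs) = cong (f x ∷_) (map-swapAt f i (y ∷ xs))

lenB-swap : ∀ i v → suc i < length v → at (+ 0) v (suc (suc i)) ℤ.< at (+ 0) v (suc i) →
            lenB v ≡ suc (lenB (swapAt i v))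
lenB-swap zero (x ∷ y ∷ zs) _ y<x
  rewrite ⌊⌋-true (y ℤ.<? x) y<x | ⌊⌋-false (x ℤ.<? y) (ℤₚ.<-asym y<x)
        | χ-cong (x ℤ.<? ℤ.- y) (y ℤ.<? ℤ.- x) <-neg-swap <-neg-swap =
  arrange (χ ⌊ y ℤ.<? ℤ.- x ⌋) (row-count x zs) (χ ⌊ x ℤ.<? + 0 ⌋) (row-count y zs) (χ ⌊ y ℤ.<? + 0 ⌋) (lenB zs)
  where
  arrange : ∀ a b c d e f → suc (a + b + (c + (d + (e + f)))) ≡ suc (a + d + (e + (b + (c + f))))
  arrange = ℕ-solve-∀
lenB-swap zero (x ∷ []) (s≤s ())
lenB-swap (suc i) (x ∷ []) (s≤s ())
lenB-swap (suc i) (x ∷ y ∷ zs) (s≤s i<) d = begin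
  row-count x (y ∷ zs) + (χ ⌊ x ℤ.<? + 0 ⌋ + lenB (y ∷ zs))
    ≡⟨ cong₂ _+_ (sumOf-↭ _ (↭-sym (swapAt-↭ i (y ∷ zs)))) (cong (_+_ (χ ⌊ x ℤ.<? + 0 ⌋)) (lenB-swap i (y ∷ zs) i< d)) ⟩
  row-count x (swapAt i (y ∷ zs)) + (χ ⌊ x ℤ.<? + 0 ⌋ + suc (lenB (swapAt i (y ∷ zs))))
    ≡⟨ arrange (row-count x (swapAt i (y ∷ zs))) (χ ⌊ x ℤ.<? + 0 ⌋) _ ⟩
  suc (lenB (x ∷ swapAt i (y ∷ zs))) ∎
  where
  open ≡-Reasoning
  arrange : ∀ a b c → a + (b + suc c) ≡ suc (a + (b + c))
  arrange = ℕ-solve-∀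

swapAt-at : ∀ i v → suc i < length v →
            at (+ 0) (swapAt i v) (suc i) ≡ at (+ 0) v (suc (suc i)) × at (+ 0) (swapAt i v) (suc (suc i)) ≡ at (+ 0) v (suc i)
swapAt-at zero    (x ∷ y ∷ zs) _ = refl , refl
swapAt-at zero    (x ∷ []) (s≤s ())
swapAt-at (suc i) (x ∷ []) (s≤s ())
swapAt-at (suc i) (x ∷ y ∷ zs) (s≤s i<) = swapAt-at i (y ∷ zs) i<

swapAt-involutive : ∀ i xs → swapAt i (swapAt i xs) ≡ xs
swapAt-involutive i       []           = refl
swapAt-involutive zero    (x ∷ [])     = refl
swapAt-involutive (suc i) (x ∷ [])     = refl
swapAt-involutive zero    (x ∷ y ∷ xs) = refl
swapAt-involutive (suc zero)    (x ∷ y ∷ [])     = refl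
swapAt-involutive (suc (suc i)) (x ∷ y ∷ [])     = refl
swapAt-involutive (suc zero)    (x ∷ y ∷ z ∷ xs) = refl
swapAt-involutive (suc (suc i)) (x ∷ y ∷ z ∷ xs) = cong (x ∷_) (swapAt-involutive (suc i) (y ∷ z ∷ xs))

-- Negating the first entry exchanges the two summands of `row-count`, so only the contribution of
-- its own sign is lost.
lenB-negate : ∀ x xs → x ℤ.< + 0 → lenB (x ∷ xs) ≡ suc (lenB (ℤ.- x ∷ xs))
lenB-negate x xs x<0
  rewrite ⌊⌋-true (x ℤ.<? + 0) x<0 | ⌊⌋-false (ℤ.- x ℤ.<? + 0) (ℤₚ.<-asym (ℤₚ.neg-mono-< x<0)) =
  trans (cong (_+ suc (lenB xs)) (sumOf-cong xs λ {y} _ →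
          trans (ℕₚ.+-comm (χ ⌊ y ℤ.<? x ⌋) _) (cong (λ z → χ ⌊ y ℤ.<? ℤ.- x ⌋ + χ ⌊ y ℤ.<? z ⌋) (sym (ℤₚ.neg-involutive x)))))
        (ℕₚ.+-suc _ _)

lenB-negate-≤ : ∀ x xs → x ≢ + 0 → lenB (ℤ.- x ∷ xs) ≤ suc (lenB (x ∷ xs))
lenB-negate-≤ x xs x≢0 with ℤₚ.<-cmp x (+ 0)
... | tri< x<0 _ _ = ℕₚ.≤-trans (ℕₚ.n≤1+n _) (ℕₚ.≤-trans (ℕₚ.≤-reflexive (sym (lenB-negate x xs x<0))) (ℕₚ.n≤1+n _))
... | tri≈ _ e _   = contradiction e x≢0
... | tri> _ _ 0<x = ℕₚ.≤-reflexive (trans (lenB-negate (ℤ.- x) xs (ℤₚ.neg-mono-< 0<x)) (cong (λ z → suc (lenB (z ∷ xs))) (ℤₚ.neg-involutive x)))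

idB-suc : ∀ m → idB (suc m) ≡ + 1 ∷ map +_ (map suc (range1 m))
idB-suc m = cong (λ l → + 1 ∷ map +_ (map suc l)) (sym (range1-applyUpTo m))

data GenView (n : ℕ) : List ℤ → Set where
  flip₁  : ∀ {m} → n ≡ suc m → GenView n (-[1+ 0 ] ∷ map +_ (map suc (range1 m)))
  swapᵢ  : ∀ {i} → suc i < n → GenView n (swapAt i (idB n))

genView : ∀ n {g} → g ∈ gensB n → GenView n g
genView (suc m) (here refl) = flip₁ refl
genView (suc m) (there g∈) with i , i∈ , refl ← ∈ₚ.∈-map⁻ (λ i → swapAt i (idB (suc m))) g∈ = swapᵢ (s≤s (∈ₚ.∈-upTo⁻ i∈))

flip₁∈ : ∀ m → (-[1+ 0 ] ∷ map +_ (map suc (range1 m))) ∈ gensB (suc m)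
flip₁∈ m = here refl

swapᵢ∈ : ∀ n {i} → suc i < n → swapAt i (idB n) ∈ gensB n
swapᵢ∈ (suc m) (s≤s i<m) = there (∈ₚ.∈-map⁺ (λ i → swapAt i (idB (suc m))) (∈ₚ.∈-upTo⁺ i<m))

IsBn-gen : ∀ n {g} → g ∈ gensB n → IsBn n g
IsBn-gen n g∈ with genView n g∈
... | swapᵢ {i} i< = trans (↭ₚ.↭-length (swapAt-↭ i (idB n))) (proj₁ (IsBn-idB {n})) ,
                     ↭-trans (↭ₚ.map⁺ ∣_∣ (swapAt-↭ i (idB n))) (proj₂ (IsBn-idB {n}))
... | flip₁ {m} refl with l , p ← IsBn-idB {suc m} =
  trans (cong length (sym (idB-suc m))) l , ↭-trans (↭-reflexive (cong (map ∣_∣) (sym (idB-suc m)))) p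

mulB-swap : ∀ {n v i} → IsBn n v → mulB v (swapAt i (idB n)) ≡ swapAt i v
mulB-swap {n} {v} {i} bv = trans (map-swapAt (appB v) i (idB n)) (cong (swapAt i) (mulB-idʳ {n} {v} bv))

mulB-flip : ∀ {m x xs} → IsBn (suc m) (x ∷ xs) → mulB (x ∷ xs) (-[1+ 0 ] ∷ map +_ (map suc (range1 m))) ≡ ℤ.- x ∷ xs
mulB-flip {m} {x} {xs} bv = cong (ℤ.- x ∷_) (Listₚ.∷-injectiveʳ
  (trans (cong (mulB (x ∷ xs)) (sym (idB-suc m))) (mulB-idʳ {suc m} {x ∷ xs} bv)))

IsBn-unique : ∀ {n v} → IsBn n v → Unique v
IsBn-unique {n} {v} bv = unique-map⁻ (IsBn-abs-unique {n} {v} bv)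
  where
  unique-map⁻ : ∀ {xs : List ℤ} → Unique (map ∣_∣ xs) → Unique xs
  unique-map⁻ {[]}     _ = []
  unique-map⁻ {x ∷ xs} (a ∷ u) = All.map (λ ne e → ne (cong ∣_∣ e)) (Allₚ.map⁻ a) ∷ unique-map⁻ u

lenB-gen-≤ : ∀ {n u g} → IsBn n u → g ∈ gensB n → lenB (mulB u g) ≤ suc (lenB u)
lenB-gen-≤ {n} {u} bu g∈ with genView n g∈
... | swapᵢ {i} i< rewrite mulB-swap {n} {u} {i} bu with ℤₚ.<-cmp (at (+ 0) u (suc i)) (at (+ 0) u (suc (suc i)))
...   | tri> _ _ d = ℕₚ.≤-trans (ℕₚ.n≤1+n _) (ℕₚ.≤-trans (ℕₚ.≤-reflexive (sym (lenB-swap i u (subst (suc i <_) (sym (proj₁ bu)) i<) d))) (ℕₚ.n≤1+n _))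
...   | tri≈ _ e _ = contradiction (at-injective {d = + 0} (IsBn-unique {n} {u} bu) (ℕₚ.<-trans (ℕₚ.n<1+n i) b) b e) (ℕₚ.<⇒≢ (ℕₚ.n<1+n i))
  where b = subst (suc i <_) (sym (proj₁ bu)) i<
...   | tri< a _ _ = ℕₚ.≤-reflexive (trans (lenB-swap i (swapAt i u) b′
        (subst₂ ℤ._<_ (sym (proj₂ (swapAt-at i u b))) (sym (proj₁ (swapAt-at i u b))) a)) (cong (suc ∘ lenB) (swapAt-involutive i u)))
  where
  b = subst (suc i <_) (sym (proj₁ bu)) i<
  b′ = subst (suc i <_) (sym (↭ₚ.↭-length (swapAt-↭ i u))) b
lenB-gen-≤ {n} {x ∷ xs} bu g∈ | flip₁ refl =
  subst (λ l → lenB l ≤ suc (lenB (x ∷ xs))) (sym (mulB-flip {x = x} {xs} bu)) (lenB-negate-≤ x xs x≢0)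
  where
  x≢0 : x ≢ + 0
  x≢0 e = case wireView n (IsBn-∈ {n} {x ∷ xs} bu (here (sym e))) of λ ()

lenB-idB : ∀ n → lenB (idB n) ≡ 0
lenB-idB n = go (range1 n) incr
  where
  incr : AllPairs _<_ (range1 n)
  incr = subst (AllPairs _<_) (sym (range1-applyUpTo n)) (AllPairsₚ.applyUpTo⁺₁ suc n (λ i<j _ → s≤s i<j))
  go : ∀ xs → AllPairs _<_ xs → lenB (map +_ xs) ≡ 0
  go []       _ = refl
  go (x ∷ xs) (a ∷ ap) = cong₂ _+_ (trans (sumOf-map _ +_ xs) (trans (sumOf-cong xs zeros) (sumOf-zero xs))) (cong₂ _+_ (cong χ (⌊⌋-false (+ x ℤ.<? + 0) λ { (ℤ.+<+ ()) })) (go xs ap))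
    where
    zeros : ∀ {y} → y ∈ xs → χ ⌊ + y ℤ.<? + x ⌋ + χ ⌊ + y ℤ.<? ℤ.- (+ x) ⌋ ≡ 0
    zeros {y} y∈ = cong₂ (λ a b → χ a + χ b)
      (⌊⌋-false (+ y ℤ.<? + x) λ { (ℤ.+<+ lt) → ℕₚ.<-asym lt (All.lookup a y∈) })
      (⌊⌋-false (+ y ℤ.<? ℤ.- (+ x)) λ lt → ℤₚ.<⇒≱ lt (ℤₚ.neg-≤-pos {x} {y}))

word-bound : ∀ n ws {u} → IsBn n u → All (_∈ gensB n) ws → lenB (mulB u (prodB n ws)) ≤ lenB u + length ws
word-bound n []       {u} bu [] rewrite mulB-idʳ {n} {u} bu | ℕₚ.+-identityʳ (lenB u) = ℕₚ.≤-refl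
word-bound n (g ∷ ws) {u} bu (g∈ ∷ gs) rewrite sym (mulB-assoc u g (prodB n ws)) = begin
  lenB (mulB (mulB u g) (prodB n ws)) ≤⟨ word-bound n ws (IsBn-mulB {n} {u} {g} bu (IsBn-gen n g∈)) gs ⟩
  lenB (mulB u g) + length ws         ≤⟨ ℕₚ.+-monoˡ-≤ (length ws) (lenB-gen-≤ {n} {u} bu g∈) ⟩
  suc (lenB u) + length ws            ≡⟨ sym (ℕₚ.+-suc (lenB u) (length ws)) ⟩
  lenB u + suc (length ws)            ∎
  where open ℕₚ.≤-Reasoning

IsBn-prodB : ∀ n {ws} → All (_∈ gensB n) ws → IsBn n (prodB n ws)
IsBn-prodB n [] = IsBn-idB
IsBn-prodB n {g ∷ ws} (g∈ ∷ gs) = IsBn-mulB {n} {g} {prodB n ws} (IsBn-gen n g∈) (IsBn-prodB n gs)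

prodB-snoc : ∀ n {ws s} → All (_∈ gensB n) ws → s ∈ gensB n → prodB n (ws ++ s ∷ []) ≡ mulB (prodB n ws) s
prodB-snoc n {s = s} [] s∈ = trans (mulB-idʳ {n} {s} (IsBn-gen n s∈)) (sym (mulB-idˡ {n} {s} (IsBn-gen n s∈)))
prodB-snoc n {g ∷ ws} {s} (_ ∷ gs) s∈ = trans (cong (mulB g) (prodB-snoc n gs s∈)) (sym (mulB-assoc g (prodB n ws) s))

sorted-↭-≡ : ∀ {xs ys : List ℕ} → AllPairs _<_ xs → AllPairs _<_ ys → xs ↭ ys → xs ≡ ys
sorted-↭-≡ {[]}     {ys}     _ _ p = sym (↭ₚ.↭-empty-inv (↭-sym p))
sorted-↭-≡ {x ∷ xs} {[]}     _ _ p = contradiction (↭ₚ.↭-empty-inv p) λ ()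
sorted-↭-≡ {x ∷ xs} {y ∷ ys} (ax ∷ sx) (ay ∷ sy) p with x≡y
  where
  x≡y : x ≡ y
  x≡y with ↭ₚ.∈-resp-↭ p (here refl) | ↭ₚ.∈-resp-↭ (↭-sym p) (here refl)
  ... | here e   | _        = e
  ... | there _  | here e   = sym e
  ... | there x∈ | there y∈ = contradiction (All.lookup ax y∈) (ℕₚ.<-asym (All.lookup ay x∈))
... | refl = cong (x ∷_) (sorted-↭-≡ sx sy (↭ₚ.drop-∷ p))

descent? : ∀ v → Unique v → Linked ℤ._<_ v ⊎ ∃ λ i → suc i < length v × at (+ 0) v (suc (suc i)) ℤ.< at (+ 0) v (suc i)
descent? []           _ = inj₁ []
descent? (x ∷ [])     _ = inj₁ [-]
descent? (x ∷ y ∷ zs) ((x≢y ∷ _) ∷ u) with ℤₚ.<-cmp x y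
... | tri≈ _ e _ = contradiction e x≢y
... | tri> _ _ y<x = inj₂ (0 , s≤s (s≤s z≤n) , y<x)
... | tri< x<y _ _ with descent? (y ∷ zs) u
...   | inj₁ l = inj₁ (x<y ∷ l)
...   | inj₂ (i , i< , d) = inj₂ (suc i , s≤s i< , d)

increasing⇒id : ∀ {n x xs} → IsBn n (x ∷ xs) → + 0 ℤ.< x → Linked ℤ._<_ (x ∷ xs) → x ∷ xs ≡ idB n
increasing⇒id {n} {x} {xs} bv 0<x l =
  trans (sym (trans (sym (Listₚ.map-∘ v)) (trans (Listₚ.map-cong-local (All.map abs-pos positive)) (Listₚ.map-id v))))
        (cong (map (+_)) (sorted-↭-≡ sorted (subst (AllPairs _<_) (sym (range1-applyUpTo n)) (AllPairsₚ.applyUpTo⁺₁ suc n (λ i<j _ → s≤s i<j))) (proj₂ bv)))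
  where
  v = x ∷ xs
  ap : AllPairs ℤ._<_ v
  ap = Linkedₚ.Linked⇒AllPairs ℤₚ.<-trans l
  positive : All (+ 0 ℤ.<_) v
  positive = 0<x ∷ All.map (ℤₚ.<-trans 0<x) (AllPairs.head ap)
  abs-pos : ∀ {a} → + 0 ℤ.< a → + ∣ a ∣ ≡ a
  abs-pos {+ _} _ = refl
  abs-< : ∀ {a b} → + 0 ℤ.< a → a ℤ.< b → ∣ a ∣ < ∣ b ∣
  abs-< {+ _} {+ _} _ (ℤ.+<+ lt) = lt
  toAbs : ∀ {ys} → All (+ 0 ℤ.<_) ys → AllPairs ℤ._<_ ys → AllPairs _<_ (map ∣_∣ ys)
  toAbs []       []       = []
  toAbs (p ∷ ps) (a ∷ as) = Allₚ.map⁺ (All.map (abs-< p) a) ∷ toAbs ps as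
  sorted : AllPairs _<_ (map ∣_∣ v)
  sorted = toAbs positive ap

-- Without descents and with a positive first entry, `v` is increasing and positive, hence the
-- identity. Otherwise the sign change or the swap at the descent shortens `v`.
descending-gen : ∀ {n v} → IsBn n v → v ≡ idB n ⊎ ∃ λ g → g ∈ gensB n × lenB v ≡ suc (lenB (mulB v g)) × mulB (mulB v g) g ≡ v
descending-gen {n} {[]} (refl , _) = inj₁ refl
descending-gen {suc m} {x ∷ xs} bv with ℤₚ.<-cmp x (+ 0)
... | tri< x<0 _ _ = inj₂ (_ , flip₁∈ m , trans (lenB-negate x xs x<0) (cong (suc ∘ lenB) (sym e)) , trans (cong (λ l → mulB l s₀) e) (trans (mulB-flip {x = ℤ.- x} {xs} (subst (IsBn (suc m)) e (IsBn-mulB {suc m} {x ∷ xs} {s₀} bv (IsBn-gen (suc m) (flip₁∈ m))))) (cong (_∷ xs) (ℤₚ.neg-involutive x))))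
  where
  s₀ = -[1+ 0 ] ∷ map +_ (map suc (range1 m))
  e = mulB-flip {x = x} {xs} bv
... | tri≈ _ refl _ = case wireView (suc m) (IsBn-∈ {suc m} {x ∷ xs} bv (here refl)) of λ ()
... | tri> _ _ 0<x with descent? (x ∷ xs) (IsBn-unique {suc m} {x ∷ xs} bv)
...   | inj₁ l = inj₁ (increasing⇒id bv 0<x l)
...   | inj₂ (i , i< , d) = inj₂ (sᵢ , s∈ , trans (lenB-swap i (x ∷ xs) i< d) (cong (suc ∘ lenB) (sym e)) ,
        trans (mulB-swap {suc m} {mulB (x ∷ xs) sᵢ} {i} (IsBn-mulB {suc m} {x ∷ xs} {sᵢ} bv (IsBn-gen (suc m) s∈))) (trans (cong (swapAt i) e) (swapAt-involutive i (x ∷ xs))))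
  where
  sᵢ = swapAt i (idB (suc m))
  s∈ : sᵢ ∈ gensB (suc m)
  s∈ = swapᵢ∈ (suc m) (subst (suc i <_) (proj₁ bv) i<)
  e = mulB-swap {suc m} {x ∷ xs} {i} bv

reduced-word : ∀ {n} k {v} → IsBn n v → lenB v ≡ k → ∃ λ ws → All (_∈ gensB n) ws × length ws ≡ k × prodB n ws ≡ v
reduced-word {n} k {v} bv e with descending-gen bv
... | inj₁ refl = [] , [] , trans (sym (lenB-idB n)) e , refl
reduced-word {n} zero bv e | inj₂ (g , g∈ , dec , _) = contradiction (trans (sym e) dec) λ ()
reduced-word {n} (suc k) {v} bv e | inj₂ (g , g∈ , dec , back)
  with ws , ws∈ , l , p ← reduced-word k (IsBn-mulB {n} {v} {g} bv (IsBn-gen n g∈)) (ℕₚ.suc-injective (trans (sym dec) e)) =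
  ws ++ g ∷ [] , Allₚ.++⁺ ws∈ (g∈ ∷ []) ,
  trans (Listₚ.length-++ ws) (trans (ℕₚ.+-comm (length ws) 1) (cong suc l)) ,
  trans (prodB-snoc n ws∈ g∈) (trans (cong (λ l → mulB l g) p) back)

Len-lenB : ∀ {n v} → IsBn n v → Len n v (lenB v)
Len-lenB {n} {v} bv = reduced-word (lenB v) bv refl , λ ws ws∈ e →
  subst₂ _≤_ (cong lenB (trans (mulB-idˡ {n} {prodB n ws} (IsBn-prodB n ws∈)) e)) (cong (_+ length ws) (lenB-idB n)) (word-bound n ws (IsBn-idB {n}) ws∈)

Len-unique : ∀ {n v a} → IsBn n v → Len n v a → a ≡ lenB v
Len-unique bv ((ws , ws∈ , l , e) , min) with (ws′ , ws′∈ , l′ , e′) , min′ ← Len-lenB bv =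
  ℕₚ.≤-antisym (subst (_ ≤_) l′ (min ws′ ws′∈ e′)) (subst (_ ≤_) l (min′ ws ws∈ e))

-- Length in type B from inversions on the wires

positives : ℕ → List ℤ
positives n = map (λ k → + suc k) (upTo n)

wires-↭ : ∀ n → wires n ↭ map ℤ.-_ (positives n) ++ positives n
wires-↭ n = ↭ₚ.++⁺ʳ (positives n) (↭-trans (↭ₚ.map⁺ -[1+_] (↭ₚ.↭-reverse (upTo n))) (↭-reflexive (Listₚ.map-∘ (upTo n))))

positives-increasing : ∀ n → AllPairs ℤ._<_ (positives n)
positives-increasing n = subst (AllPairs ℤ._<_) (sym (Listₚ.map-upTo (λ k → + suc k) n))
  (AllPairsₚ.applyUpTo⁺₁ (λ k → + suc k) n (λ i<j _ → ℤ.+<+ (s≤s i<j)))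

positives-positive : ∀ n {p} → p ∈ positives n → + 0 ℤ.< p
positives-positive n p∈ with _ , _ , refl ← ∈ₚ.∈-map⁻ (λ k → + suc k) p∈ = ℤ.+<+ (s≤s z≤n)

map-appB-positives : ∀ {n v} → IsBn n v → map (appB v) (positives n) ≡ v
map-appB-positives {n} {v} bv = trans (cong (map (appB v)) (Listₚ.map-∘ (upTo n))) (mulB-idʳ {n} {v} bv)

pairSum : (ℤ → ℤ → ℕ) → List ℤ → ℕ
pairSum f []       = 0
pairSum f (x ∷ xs) = sumOf (f x) xs + pairSum f xs

below above : ℤ → ℤ → ℕ
below x y = χ ⌊ y ℤ.<? x ⌋
above x y = χ ⌊ y ℤ.<? ℤ.- x ⌋

lenB-pairSum : ∀ v → lenB v ≡ pairSum below v + pairSum above v + sumOf (λ x → χ ⌊ x ℤ.<? + 0 ⌋) v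
lenB-pairSum []       = refl
lenB-pairSum (x ∷ xs) rewrite lenB-pairSum xs | sumOf-+ (below x) (above x) xs =
  arrange (sumOf (below x) xs) (sumOf (above x) xs) (χ ⌊ x ℤ.<? + 0 ⌋) (pairSum below xs) (pairSum above xs) _
  where
  arrange : ∀ a b c d e f → a + b + (c + (d + e + f)) ≡ a + d + (b + e) + (c + f)
  arrange = ℕ-solve-∀

module FourLengths {n : ℕ} {v : List ℤ} (bv : IsBn n v) where
  private
    u = appB v
    P = positives n
    G H : ℤ → ℤ → ℕ
    G p q = χ (inverted u p q)
    H p q = above (u p) (u q)
    A = pairSum below v
    B = pairSum above v
    N = sumOf (λ x → χ ⌊ x ℤ.<? + 0 ⌋) v
    W′ = map ℤ.-_ P ++ P

    double : ∀ (F : ℤ → ℕ) → sumOf F W′ ≡ sumOf (λ p → F (ℤ.- p) + F p) P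
    double F = trans (sumOf-++ F (map ℤ.-_ P) P)
      (trans (cong (_+ sumOf F P) (sumOf-map F ℤ.-_ P)) (sym (sumOf-+ (F ∘ ℤ.-_) F P)))

    sumG : ∀ {P} → AllPairs ℤ._<_ P → sumOf (λ p → sumOf (G p) P) P ≡ pairSum below (map u P)
    sumG {[]} [] = refl
    sumG {p ∷ P} (a ∷ ap) = begin
      (G p p + sumOf (G p) P) + sumOf (λ q → G q p + sumOf (G q) P) P
        ≡⟨ cong₂ _+_ (cong₂ _+_ diag (trans (sumOf-cong P up) (sym (sumOf-map (below (u p)) u P))))
             (trans (sumOf-+ (λ q → G q p) _ P) (cong₂ _+_ (trans (sumOf-cong P down) (sumOf-zero P)) (sumG ap))) ⟩
      sumOf (below (u p)) (map u P) + pairSum below (map u P) ∎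
      where
      open ≡-Reasoning
      diag : G p p ≡ 0
      diag rewrite ⌊⌋-false (p ℤ.<? p) (ℤₚ.<-irrefl refl) = refl
      up : ∀ {q} → q ∈ P → G p q ≡ below (u p) (u q)
      up {q} q∈ rewrite ⌊⌋-true (p ℤ.<? q) (All.lookup a q∈) = refl
      down : ∀ {q} → q ∈ P → G q p ≡ 0
      down {q} q∈ rewrite ⌊⌋-false (q ℤ.<? p) (ℤₚ.<-asym (All.lookup a q∈)) = refl

    H-sym : ∀ p q → H p q ≡ H q p
    H-sym p q = cong χ (χ-cong (u q ℤ.<? ℤ.- u p) (u p ℤ.<? ℤ.- u q) <-neg-swap <-neg-swap)

    sumH : ∀ P → sumOf (λ p → sumOf (H p) P) P ≡ 2 * pairSum above (map u P) + sumOf (λ p → H p p) P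
    sumH [] = refl
    sumH (p ∷ P) = begin
      (H p p + sumOf (H p) P) + sumOf (λ q → H q p + sumOf (H q) P) P
        ≡⟨ cong (_+_ (H p p + sumOf (H p) P)) (trans (sumOf-+ (λ q → H q p) _ P) (cong₂ _+_ (sumOf-cong P (λ {q} _ → H-sym q p)) (sumH P))) ⟩
      (H p p + sumOf (H p) P) + (sumOf (H p) P + (2 * pairSum above (map u P) + sumOf (λ p → H p p) P))
        ≡⟨ arrange (H p p) (sumOf (H p) P) (pairSum above (map u P)) _ ⟩
      2 * (sumOf (H p) P + pairSum above (map u P)) + (H p p + sumOf (λ p → H p p) P)
        ≡⟨ cong (λ s → 2 * (s + pairSum above (map u P)) + (H p p + sumOf (λ p → H p p) P)) (sym (sumOf-map (above (u p)) u P)) ⟩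
      2 * (sumOf (above (u p)) (map u P) + pairSum above (map u P)) + (H p p + sumOf (λ p → H p p) P) ∎
      where
      open ≡-Reasoning
      arrange : ∀ a b c d → (a + b) + (b + (2 * c + d)) ≡ 2 * (b + c) + (a + d)
      arrange = ℕ-solve-∀

    diagN : sumOf (λ p → H p p) P ≡ N
    diagN = trans (sumOf-cong P (λ {p} _ → cong χ (χ-cong (u p ℤ.<? ℤ.- u p) (u p ℤ.<? + 0) (to (u p)) (from (u p)))))
              (trans (sym (sumOf-map (λ x → χ ⌊ x ℤ.<? + 0 ⌋) u P)) (cong (sumOf (λ x → χ ⌊ x ℤ.<? + 0 ⌋)) (map-appB-positives {n} {v} bv)))
      where
      to : ∀ x → x ℤ.< ℤ.- x → x ℤ.< + 0
      to (+ zero)  (ℤ.+<+ ())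
      to (+ suc _) ()
      to -[1+ _ ]  _ = ℤ.-<+
      from : ∀ x → x ℤ.< + 0 → x ℤ.< ℤ.- x
      from (+ _)    (ℤ.+<+ ())
      from -[1+ _ ] _ = ℤ.-<+

    -- Of the four sign choices, two negative signs mirror the pair with `p` and `q` exchanged, and
    -- mixed signs contribute only when the negative position comes first.
    quad : ∀ {p q} → p ∈ P → q ∈ P →
           (χ (inverted u (ℤ.- p) (ℤ.- q)) + χ (inverted u (ℤ.- p) q)) + (χ (inverted u p (ℤ.- q)) + χ (inverted u p q)) ≡ G q p + (H p q + G p q)
    quad {p} {q} p∈ q∈ = trans (cong₂ _+_ (cong₂ _+_ (cong χ (cong₂ _∧_ e₁ e₂)) e₃) (cong (_+ G p q) e₄)) (ℕₚ.+-assoc (G q p) (H p q) (G p q))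
      where
      0<p = positives-positive n p∈
      0<q = positives-positive n q∈
      e₁ = χ-cong (ℤ.- p ℤ.<? ℤ.- q) (q ℤ.<? p) neg-< ℤₚ.neg-mono-<
      e₂ : ⌊ u (ℤ.- q) ℤ.<? u (ℤ.- p) ⌋ ≡ ⌊ u p ℤ.<? u q ⌋
      e₂ rewrite appB-odd v p | appB-odd v q = χ-cong (ℤ.- u q ℤ.<? ℤ.- u p) (u p ℤ.<? u q) neg-< ℤₚ.neg-mono-<
      e₃ : χ (inverted u (ℤ.- p) q) ≡ H p q
      e₃ rewrite ⌊⌋-true (ℤ.- p ℤ.<? q) (ℤₚ.<-trans (ℤₚ.neg-mono-< 0<p) 0<q) | appB-odd v p = refl
      e₄ : χ (inverted u p (ℤ.- q)) ≡ 0
      e₄ rewrite ⌊⌋-false (p ℤ.<? ℤ.- q) (ℤₚ.<-asym (ℤₚ.<-trans (ℤₚ.neg-mono-< 0<q) 0<p)) = refl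

    inv-W : inversions u W′ ≡ 2 * A + (2 * B + N)
    inv-W = begin
      sumOf (λ a → sumOf (λ b → χ (inverted u a b)) W′) W′
        ≡⟨ double _ ⟩
      sumOf (λ p → sumOf (λ b → χ (inverted u (ℤ.- p) b)) W′ + sumOf (λ b → χ (inverted u p b)) W′) P
        ≡⟨ sumOf-cong P (λ {p} p∈ → trans (cong₂ _+_ (double (λ b → χ (inverted u (ℤ.- p) b))) (double (λ b → χ (inverted u p b))))
             (trans (sym (sumOf-+ _ _ P)) (trans (sumOf-cong P (quad p∈)) (trans (sumOf-+ (λ q → G q p) _ P) (cong (_+_ (sumOf (λ q → G q p) P)) (sumOf-+ (H p) (G p) P)))))) ⟩
      sumOf (λ p → sumOf (λ q → G q p) P + (sumOf (H p) P + sumOf (G p) P)) P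
        ≡⟨ trans (sumOf-+ _ _ P) (cong₂ _+_ (sym (sumOf-swap G P P)) (sumOf-+ _ _ P)) ⟩
      ΣG + (sumOf (λ p → sumOf (H p) P) P + ΣG)
        ≡⟨ cong₂ (λ g h → g + (h + g)) (trans (sumG (positives-increasing n)) (cong (pairSum below) mv)) (trans (sumH P) (cong₂ _+_ (cong (λ l → 2 * pairSum above l) mv) diagN)) ⟩
      A + ((2 * B + N) + A)
        ≡⟨ arrange A B N ⟩
      2 * A + (2 * B + N) ∎
      where
      open ≡-Reasoning
      ΣG = sumOf (λ p → sumOf (G p) P) P
      mv = map-appB-positives {n} {v} bv
      arrange : ∀ a b c → a + ((2 * b + c) + a) ≡ 2 * a + (2 * b + c)
      arrange = ℕ-solve-∀

    inv-W₀ : inversions u (+ 0 ∷ W′) ≡ 2 * N + inversions u W′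
    inv-W₀ = begin
      (χ (inverted u (+ 0) (+ 0)) + sumOf (λ b → χ (inverted u (+ 0) b)) W′) + sumOf (λ a → χ (inverted u a (+ 0)) + sumOf (λ b → χ (inverted u a b)) W′) W′
        ≡⟨ cong₂ _+_ (trans (double (λ b → χ (inverted u (+ 0) b))) (sumOf-cong P from0)) (trans (sumOf-+ (λ a → χ (inverted u a (+ 0))) _ W′) (cong (_+ inversions u W′) (trans (double (λ a → χ (inverted u a (+ 0)))) (sumOf-cong P to0)))) ⟩
      N′ + (N′ + inversions u W′)
        ≡⟨ cong₂ (λ a b → a + (b + inversions u W′)) N′≡ N′≡ ⟩
      N + (N + inversions u W′)
        ≡⟨ arrange N _ ⟩
      2 * N + inversions u W′ ∎
      where
      open ≡-Reasoning
      N′ = sumOf (λ p → χ ⌊ u p ℤ.<? + 0 ⌋) P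
      N′≡ : N′ ≡ N
      N′≡ = trans (sym (sumOf-map (λ x → χ ⌊ x ℤ.<? + 0 ⌋) u P)) (cong (sumOf (λ x → χ ⌊ x ℤ.<? + 0 ⌋)) (map-appB-positives {n} {v} bv))
      arrange : ∀ a b → a + (a + b) ≡ 2 * a + b
      arrange = ℕ-solve-∀
      from0 : ∀ {p} → p ∈ P → χ (inverted u (+ 0) (ℤ.- p)) + χ (inverted u (+ 0) p) ≡ χ ⌊ u p ℤ.<? + 0 ⌋
      from0 {p} p∈ rewrite ⌊⌋-false (+ 0 ℤ.<? ℤ.- p) (ℤₚ.<-asym (ℤₚ.neg-mono-< (positives-positive n p∈)))
                         | ⌊⌋-true (+ 0 ℤ.<? p) (positives-positive n p∈) = refl
      to0 : ∀ {p} → p ∈ P → χ (inverted u (ℤ.- p) (+ 0)) + χ (inverted u p (+ 0)) ≡ χ ⌊ u p ℤ.<? + 0 ⌋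
      to0 {p} p∈ rewrite ⌊⌋-false (p ℤ.<? + 0) (ℤₚ.<-asym (positives-positive n p∈))
                       | ⌊⌋-true (ℤ.- p ℤ.<? + 0) (ℤₚ.neg-mono-< (positives-positive n p∈)) | appB-odd v p =
        trans (ℕₚ.+-identityʳ _) (cong χ (χ-cong (+ 0 ℤ.<? ℤ.- u p) (u p ℤ.<? + 0) (λ lt → neg-< {+ 0} {u p} lt) ℤₚ.neg-mono-<))

  -- With `A` inversions, `B` pairs of negative sum and `N` negative entries, there are
  -- `2A + 2B + N` inversions on the wires, and adjoining 0 adds `2N`. Only the sum of both counts
  -- weighs the three kinds equally.
  four-lengths : inversions u (wires n) + inversions u (+ 0 ∷ wires n) ≡ 4 * lenB v
  four-lengths = begin
    inversions u (wires n) + inversions u (+ 0 ∷ wires n)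
      ≡⟨ cong₂ _+_ (inversions-↭ u (wires-↭ n)) (trans (inversions-↭ u (prep (+ 0) (wires-↭ n))) inv-W₀) ⟩
    inversions u W′ + (2 * N + inversions u W′)
      ≡⟨ cong (λ i → i + (2 * N + i)) inv-W ⟩
    (2 * A + (2 * B + N)) + (2 * N + (2 * A + (2 * B + N)))
      ≡⟨ arrange A B N ⟩
    4 * (A + B + N)
      ≡⟨ cong (4 *_) (sym (lenB-pairSum v)) ⟩
    4 * lenB v ∎
    where
    open ≡-Reasoning
    arrange : ∀ a b c → (2 * a + (2 * b + c)) + (2 * c + (2 * a + (2 * b + c))) ≡ 4 * (a + b + c)
    arrange = ℕ-solve-∀
open FourLengths using (four-lengths)

-- Reflections as exchanges of wires

-- For distinct wires this is a single transposition when `j ≡ - i`, and otherwise a product of two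
-- commuting ones.
reflB : ℤ → ℤ → ℤ → ℤ
reflB i j k = if ⌊ k ℤₚ.≟ i ⌋ then j else if ⌊ k ℤₚ.≟ j ⌋ then i else
              if ⌊ k ℤₚ.≟ ℤ.- i ⌋ then ℤ.- j else if ⌊ k ℤₚ.≟ ℤ.- j ⌋ then ℤ.- i else k

data ReflView (i j k : ℤ) : ℤ → Set where
  at-i  : k ≡ i → ReflView i j k j
  at-j  : k ≡ j → ReflView i j k i
  at-ī  : k ≡ ℤ.- i → ReflView i j k (ℤ.- j)
  at-j̄  : k ≡ ℤ.- j → ReflView i j k (ℤ.- i)
  other : k ≢ i → k ≢ j → k ≢ ℤ.- i → k ≢ ℤ.- j → ReflView i j k k

reflView : ∀ i j k → ReflView i j k (reflB i j k)
reflView i j k with k ℤₚ.≟ i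
... | yes e = at-i e
... | no a with k ℤₚ.≟ j
...   | yes e = at-j e
...   | no b with k ℤₚ.≟ ℤ.- i
...     | yes e = at-ī e
...     | no c with k ℤₚ.≟ ℤ.- j
...       | yes e = at-j̄ e
...       | no d = other a b c d

-- The cases of `ReflView` overlap when `j ≡ - i`. As they then agree, a value of `reflB` may be
-- computed in any case that applies.
Views-agree : ∀ {n i j k a b} → i ∈ wires n → j ∈ wires n → i ≢ j → ReflView i j k a → ReflView i j k b → a ≡ b
Views-agree {n} iw jw i≢j v v′ = go v v′
  where
  i≢ī = wire≢neg n iw
  j≢j̄ = wire≢neg n jw
  go : ∀ {a b} → ReflView _ _ _ a → ReflView _ _ _ b → a ≡ b
  go (at-i _) (at-i _) = refl
  go (at-i refl) (at-j e) = contradiction e i≢j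
  go (at-i refl) (at-ī e) = contradiction e i≢ī
  go (at-i refl) (at-j̄ refl) = sym (ℤₚ.neg-involutive _)
  go (at-i e) (other ¬a _ _ _) = contradiction e ¬a
  go (at-j refl) (at-i e) = contradiction (sym e) i≢j
  go (at-j _) (at-j _) = refl
  go (at-j refl) (at-ī refl) = sym (ℤₚ.neg-involutive _)
  go (at-j refl) (at-j̄ e) = contradiction e j≢j̄
  go (at-j e) (other _ ¬b _ _) = contradiction e ¬b
  go (at-ī refl) (at-i e) = contradiction (sym e) i≢ī
  go (at-ī refl) (at-j refl) = ℤₚ.neg-involutive _
  go (at-ī _) (at-ī _) = refl
  go (at-ī refl) (at-j̄ e) = contradiction (ℤₚ.neg-injective e) i≢j
  go (at-ī e) (other _ _ ¬c _) = contradiction e ¬c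
  go (at-j̄ refl) (at-i refl) = ℤₚ.neg-involutive _
  go (at-j̄ refl) (at-j e) = contradiction (sym e) j≢j̄
  go (at-j̄ refl) (at-ī e) = contradiction (sym (ℤₚ.neg-injective e)) i≢j
  go (at-j̄ _) (at-j̄ _) = refl
  go (at-j̄ e) (other _ _ _ ¬d) = contradiction e ¬d
  go (other ¬a _ _ _) (at-i e) = contradiction e ¬a
  go (other _ ¬b _ _) (at-j e) = contradiction e ¬b
  go (other _ _ ¬c _) (at-ī e) = contradiction e ¬c
  go (other _ _ _ ¬d) (at-j̄ e) = contradiction e ¬d
  go (other _ _ _ _) (other _ _ _ _) = refl

reflB-comm : ∀ {n i j} → i ∈ wires n → j ∈ wires n → i ≢ j → ∀ k → reflB i j k ≡ reflB j i k
reflB-comm {n} {i} {j} iw jw i≢j k with reflB j i k | reflView j i k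
... | _ | at-i e = Views-agree {n} iw jw i≢j (reflView i j k) (at-j e)
... | _ | at-j e = Views-agree {n} iw jw i≢j (reflView i j k) (at-i e)
... | _ | at-ī e = Views-agree {n} iw jw i≢j (reflView i j k) (at-j̄ e)
... | _ | at-j̄ e = Views-agree {n} iw jw i≢j (reflView i j k) (at-ī e)
... | _ | other a b c d = Views-agree {n} iw jw i≢j (reflView i j k) (other b a d c)

inversions-cong : ∀ {u u′} W → (∀ {k} → k ∈ W → u k ≡ u′ k) → inversions u W ≡ inversions u′ W
inversions-cong W e = sumOf-cong W λ {a} a∈ → sumOf-cong W λ {b} b∈ →
  cong₂ (λ s t → χ (⌊ a ℤ.<? b ⌋ ∧ ⌊ s ℤ.<? t ⌋)) (e b∈) (e a∈)

-- For `j ≢ - i` the wires `-j` and `-i` are exchanged first, then `i` and `j`. Oddness of `u` makes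
-- the first exchange create an inversion, and as it leaves the values at `i` and `j` alone, so does
-- the second.
inversions-reflB : ∀ {n u W i j} → (∀ a → u (ℤ.- a) ≡ ℤ.- u a) → Unique W → (∀ {k} → k ∈ wires n → k ∈ W) →
  i ∈ wires n → j ∈ wires n → i ℤ.< j → u i ℤ.< u j → inversions u W < inversions (u ∘ reflB i j) W
inversions-reflB {n} {u} {W} {i} {j} odd uniq sub iw jw i<j ui<uj with j ℤₚ.≟ ℤ.- i
... | yes refl = subst (inversions u W <_) (inversions-cong W λ {k} _ → cong u (agree k))
                   (inversions-transp u uniq (sub iw) (sub jw) i<j ui<uj)
  where
  agree : ∀ k → transp i (ℤ.- i) k ≡ reflB i (ℤ.- i) k
  agree k with k ℤₚ.≟ i | k ℤₚ.≟ ℤ.- i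
  ... | yes _ | _     = refl
  ... | no _  | yes _ = refl
  ... | no ¬a | no _ with k ℤₚ.≟ ℤ.- (ℤ.- i)
  ...   | yes e = contradiction (trans e (ℤₚ.neg-involutive i)) ¬a
  ...   | no _  = refl
... | no j≢ī = ℕₚ.<-trans (inversions-transp u uniq (sub (wires-neg n jw)) (sub (wires-neg n iw)) (ℤₚ.neg-mono-< i<j)
                  (subst₂ ℤ._<_ (sym (odd j)) (sym (odd i)) (ℤₚ.neg-mono-< ui<uj)))
                (subst (inversions u₁ W <_) (inversions-cong W λ {k} _ → cong u (agree k))
                  (inversions-transp u₁ uniq (sub iw) (sub jw) i<j
                    (subst₂ ℤ._<_ (cong u (sym (transp-other i≢j̄ i≢ī))) (cong u (sym (transp-other j≢j̄ j≢ī))) ui<uj)))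
  where
  u₁ = u ∘ transp (ℤ.- j) (ℤ.- i)
  i≢ī = wire≢neg n iw
  j≢j̄ = wire≢neg n jw
  i≢j̄ : i ≢ ℤ.- j
  i≢j̄ e = j≢ī (trans (sym (ℤₚ.neg-involutive j)) (cong ℤ.-_ (sym e)))
  agree : ∀ k → transp (ℤ.- j) (ℤ.- i) (transp i j k) ≡ reflB i j k
  agree k with k ℤₚ.≟ i
  ... | yes _ = transp-other j≢j̄ j≢ī
  ... | no _ with k ℤₚ.≟ j
  ...   | yes _ = transp-other i≢j̄ i≢ī
  ...   | no _ with k ℤₚ.≟ ℤ.- j
  ...     | yes refl with ℤ.- j ℤₚ.≟ ℤ.- i
  ...       | yes e = sym e
  ...       | no _ = refl
  agree k | no _ | no _ | no _ with k ℤₚ.≟ ℤ.- i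
  ...       | yes _ = refl
  ...       | no _ = refl

-- The exchange argument is applied on the wires and on the wires with 0 adjoined; `four-lengths`
-- combines the two.
lenB-refl-< : ∀ {n v v′ i j} → IsBn n v → IsBn n v′ → i ∈ wires n → j ∈ wires n → i ℤ.< j →
  (∀ {k} → k ∈ wires n → appB v′ k ≡ appB v (reflB i j k)) → appB v i ℤ.< appB v j → lenB v < lenB v′
lenB-refl-< {n} {v} {v′} {i} {j} bv bv′ iw jw i<j eq lt =
  ℕₚ.*-cancelˡ-< 4 (lenB v) (lenB v′) (subst₂ _<_ (four-lengths {n} {v} bv) (four-lengths {n} {v′} bv′)
    (ℕₚ.+-mono-< (step (wires n) (wires-unique n) id eq)
                 (step (+ 0 ∷ wires n) (All.tabulate (λ {k} k∈ e → zero∉ (subst (_∈ wires n) (sym e) k∈)) ∷ wires-unique n) there eq₀)))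
  where
  zero∉ : + 0 ∉ wires n
  zero∉ z with () ← wireView n z
  step : ∀ W → Unique W → (∀ {k} → k ∈ wires n → k ∈ W) → (∀ {k} → k ∈ W → appB v′ k ≡ appB v (reflB i j k)) →
         inversions (appB v) W < inversions (appB v′) W
  step W u sub e = subst (inversions (appB v) W <_) (sym (inversions-cong W e))
    (inversions-reflB {n} (appB-odd v) u sub iw jw i<j lt)
  eq₀ : ∀ {k} → k ∈ + 0 ∷ wires n → appB v′ k ≡ appB v (reflB i j k)
  eq₀ (there k∈) = eq k∈
  eq₀ (here refl) with reflB i j (+ 0) | reflView i j (+ 0)
  ... | _ | at-i refl = contradiction iw zero∉
  ... | _ | at-j refl = contradiction jw zero∉
  ... | _ | at-ī e = contradiction (subst (_∈ wires n) (sym e) (wires-neg n iw)) zero∉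
  ... | _ | at-j̄ e = contradiction (subst (_∈ wires n) (sym e) (wires-neg n jw)) zero∉
  ... | _ | other _ _ _ _ = refl

-- The Bruhat interval below w

reflB-i : ∀ {n i j} → i ∈ wires n → j ∈ wires n → i ≢ j → reflB i j i ≡ j
reflB-i {n} {i} {j} iw jw i≢j = Views-agree {n} iw jw i≢j (reflView i j i) (at-i refl)

reflB-j : ∀ {n i j} → i ∈ wires n → j ∈ wires n → i ≢ j → reflB i j j ≡ i
reflB-j {n} {i} {j} iw jw i≢j = Views-agree {n} iw jw i≢j (reflView i j j) (at-j refl)

reflB-odd : ∀ {n i j} → i ∈ wires n → j ∈ wires n → i ≢ j → ∀ k → reflB i j (ℤ.- k) ≡ ℤ.- reflB i j k
reflB-odd {n} {i} {j} iw jw i≢j k with reflB i j k | reflView i j k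
... | _ | at-i e = Views-agree {n} iw jw i≢j (reflView i j (ℤ.- k)) (at-ī (cong ℤ.-_ e))
... | _ | at-j e = Views-agree {n} iw jw i≢j (reflView i j (ℤ.- k)) (at-j̄ (cong ℤ.-_ e))
... | _ | at-ī e = trans (Views-agree {n} iw jw i≢j (reflView i j (ℤ.- k)) (at-i (trans (cong ℤ.-_ e) (ℤₚ.neg-involutive i)))) (sym (ℤₚ.neg-involutive j))
... | _ | at-j̄ e = trans (Views-agree {n} iw jw i≢j (reflView i j (ℤ.- k)) (at-j (trans (cong ℤ.-_ e) (ℤₚ.neg-involutive j)))) (sym (ℤₚ.neg-involutive i))
... | _ | other a b c d = Views-agree {n} iw jw i≢j (reflView i j (ℤ.- k))
  (other (λ e → c (trans (sym (ℤₚ.neg-involutive k)) (cong ℤ.-_ e))) (λ e → d (trans (sym (ℤₚ.neg-involutive k)) (cong ℤ.-_ e)))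
         (λ e → a (ℤₚ.neg-injective e)) (λ e → b (ℤₚ.neg-injective e)))

reflB-wire : ∀ {n i j k} → i ∈ wires n → j ∈ wires n → k ∈ wires n → reflB i j k ∈ wires n
reflB-wire {n} {i} {j} {k} iw jw kw with reflB i j k | reflView i j k
... | _ | at-i _ = jw
... | _ | at-j _ = iw
... | _ | at-ī _ = wires-neg n jw
... | _ | at-j̄ _ = wires-neg n iw
... | _ | other _ _ _ _ = kw

reflB-involutive : ∀ {n i j} → i ∈ wires n → j ∈ wires n → i ≢ j → ∀ k → reflB i j (reflB i j k) ≡ k
reflB-involutive {n} {i} {j} iw jw i≢j k with reflB i j k | reflView i j k
... | _ | at-i refl = reflB-j {n} iw jw i≢j
... | _ | at-j refl = reflB-i {n} iw jw i≢j
... | _ | at-ī refl = Views-agree {n} iw jw i≢j (reflView i j _) (at-j̄ refl)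
... | _ | at-j̄ refl = Views-agree {n} iw jw i≢j (reflView i j _) (at-ī refl)
... | _ | other a b c d = Views-agree {n} iw jw i≢j (reflView i j k) (other a b c d)

appB-ext-odd : ∀ {n} v (f : ℤ → ℤ) → (∀ k → f (ℤ.- k) ≡ ℤ.- f k) → (∀ {k} → k < n → appB v (+ suc k) ≡ f (+ suc k)) →
               ∀ {i} → i ∈ wires n → appB v i ≡ f i
appB-ext-odd {n} v f odd e i∈ with wireView n i∈
... | pos k<n = e k<n
... | neg {k} k<n = trans (cong ℤ.-_ (e k<n)) (sym (odd (+ suc k)))

swapAt-other : ∀ i v k → k ≢ i → k ≢ suc i → at (+ 0) (swapAt i v) (suc k) ≡ at (+ 0) v (suc k)
swapAt-other i       []           k a b = refl
swapAt-other zero    (x ∷ [])     k a b = refl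
swapAt-other (suc i) (x ∷ [])     k a b = refl
swapAt-other zero    (x ∷ y ∷ xs) zero          a b = contradiction refl a
swapAt-other zero    (x ∷ y ∷ xs) (suc zero)    a b = contradiction refl b
swapAt-other zero    (x ∷ y ∷ xs) (suc (suc k)) a b = refl
swapAt-other (suc i) (x ∷ y ∷ xs) zero          a b = refl
swapAt-other (suc i) (x ∷ y ∷ xs) (suc k)       a b = swapAt-other i (y ∷ xs) k (a ∘ cong suc) (b ∘ cong suc)

-- Reflections are defined as conjugates of generators; the comparison of lengths and of
-- compatibility uses only this description of their action.
record ActsAsRefl (n : ℕ) (g : List ℤ) (i j : ℤ) : Set where
  constructor actsAs
  field
    iw     : i ∈ wires n
    jw     : j ∈ wires n
    i≢j    : i ≢ j
    action : ∀ {k} → k ∈ wires n → appB g k ≡ reflB i j k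

swapᵢ-acts : ∀ n {i} → suc i < n → ActsAsRefl n (swapAt i (idB n)) (+ suc i) (+ suc (suc i))
swapᵢ-acts n {i} i< = actsAs iw jw (λ ()) (appB-ext-odd (swapAt i (idB n)) (reflB (+ suc i) (+ suc (suc i))) (reflB-odd {n} iw jw (λ ())) act)
  where
  iw = pos∈wires {n} (ℕₚ.<-trans (ℕₚ.n<1+n i) i<)
  jw = pos∈wires {n} i<
  b : suc i < length (idB n)
  b = subst (suc i <_) (sym (proj₁ (IsBn-idB {n}))) i<
  act : ∀ {k} → k < n → at (+ 0) (swapAt i (idB n)) (suc k) ≡ reflB (+ suc i) (+ suc (suc i)) (+ suc k)
  act {k} k<n with k ℕ.≟ i | k ℕ.≟ suc i
  ... | yes refl | _ = trans (proj₁ (swapAt-at k (idB n) b)) (trans (map-range1-at +_ n i<) (sym (reflB-i {n} iw jw (λ ()))))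
  ... | no _ | yes refl = trans (proj₂ (swapAt-at i (idB n) b)) (trans (map-range1-at +_ n (ℕₚ.<-trans (ℕₚ.n<1+n i) i<)) (sym (reflB-j {n} iw jw (λ ()))))
  ... | no p | no q = trans (swapAt-other i (idB n) k p q) (trans (map-range1-at +_ n k<n)
          (sym (Views-agree {n} iw jw (λ ()) (reflView (+ suc i) (+ suc (suc i)) (+ suc k)) (other (λ { refl → p refl }) (λ { refl → q refl }) (λ ()) (λ ())))))

flip₁-acts : ∀ m → ActsAsRefl (suc m) (-[1+ 0 ] ∷ map +_ (map suc (range1 m))) -[1+ 0 ] (+ 1)
flip₁-acts m = actsAs iw jw (λ ()) (appB-ext-odd s₀ (reflB -[1+ 0 ] (+ 1)) (reflB-odd {suc m} iw jw (λ ())) act)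
  where
  s₀ = -[1+ 0 ] ∷ map +_ (map suc (range1 m))
  iw = neg∈wires {suc m} {0} (s≤s z≤n)
  jw = pos∈wires {suc m} {0} (s≤s z≤n)
  act : ∀ {k} → k < suc m → at (+ 0) s₀ (suc k) ≡ reflB -[1+ 0 ] (+ 1) (+ suc k)
  act {zero} _ = refl
  act {suc k} k<m = trans (cong (λ l → at (+ 0) l (suc (suc k))) (sym (idB-suc m))) (trans (map-range1-at +_ (suc m) k<m)
    (sym (Views-agree {suc m} iw jw (λ ()) (reflView -[1+ 0 ] (+ 1) (+ suc (suc k))) (other (λ ()) (λ ()) (λ ()) (λ ())))))

gen-acts : ∀ n {g} → g ∈ gensB n → ∃₂ λ i j → ActsAsRefl n g i j
gen-acts n g∈ with genView n g∈
... | swapᵢ i<   = _ , _ , swapᵢ-acts n i<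
... | flip₁ {m} refl = _ , _ , flip₁-acts m

conj-acts : ∀ {n x s a b} → IsBn n x → ActsAsRefl n s a b → ActsAsRefl n (mulB (mulB x s) (invB x)) (appB x a) (appB x b)
conj-acts {n} {x} {s} {a} {b} bx (actsAs aw bw a≢b act) = actsAs xaw xbw xa≢xb λ {k} kw →
  trans (appB-mulB (mulB x s) (invB x) k) (trans (appB-mulB x s (appB (invB x) k))
  (trans (cong (appB x) (act (inv-w kw)))
  (trans (equivariant (inv-w kw)) (cong (reflB (appB x a) (appB x b)) (appB-invʳ {n} {x} bx kw)))))
  where
  xaw = appB-wire {n} {x} bx aw
  xbw = appB-wire {n} {x} bx bw
  inj : ∀ {i j} → i ∈ wires n → j ∈ wires n → appB x i ≡ appB x j → i ≡ j
  inj = appB-injective {n} {x} bx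
  xa≢xb : appB x a ≢ appB x b
  xa≢xb e = a≢b (inj aw bw e)
  inv-w : ∀ {k} → k ∈ wires n → appB (invB x) k ∈ wires n
  inv-w = appB-wire {n} {invB x} (IsBn-invB {n} {x} bx)
  equivariant : ∀ {m} → m ∈ wires n → appB x (reflB a b m) ≡ reflB (appB x a) (appB x b) (appB x m)
  equivariant {m} mw with reflB a b m | reflView a b m
  ... | _ | at-i e = sym (Views-agree {n} xaw xbw xa≢xb (reflView _ _ _) (at-i (cong (appB x) e)))
  ... | _ | at-j e = sym (Views-agree {n} xaw xbw xa≢xb (reflView _ _ _) (at-j (cong (appB x) e)))
  ... | _ | at-ī e = trans (appB-odd x b) (sym (Views-agree {n} xaw xbw xa≢xb (reflView _ _ _) (at-ī (trans (cong (appB x) e) (appB-odd x a)))))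
  ... | _ | at-j̄ e = trans (appB-odd x a) (sym (Views-agree {n} xaw xbw xa≢xb (reflView _ _ _) (at-j̄ (trans (cong (appB x) e) (appB-odd x b)))))
  ... | _ | other p q r s′ = sym (Views-agree {n} xaw xbw xa≢xb (reflView _ _ _)
    (other (λ e → p (inj mw aw e)) (λ e → q (inj mw bw e))
           (λ e → r (inj mw (wires-neg n aw) (trans e (sym (appB-odd x a))))) (λ e → s′ (inj mw (wires-neg n bw) (trans e (sym (appB-odd x b)))))))

IsRefl-IsBn : ∀ {n t} → IsRefl n t → IsBn n t
IsRefl-IsBn {n} (x , bx , s , s∈ , refl) =
  IsBn-mulB {n} {mulB x s} {invB x} (IsBn-mulB {n} {x} {s} bx (IsBn-gen n s∈)) (IsBn-invB {n} {x} bx)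

IsRefl-acts : ∀ {n t} → IsRefl n t → ∃₂ λ i j → i ℤ.< j × ActsAsRefl n t i j
IsRefl-acts {n} (x , bx , s , s∈ , refl) with a , b , acts ← gen-acts n s∈
  with actsAs iw jw i≢j act ← conj-acts {n} {x} {s} bx acts with ℤₚ.<-cmp (appB x a) (appB x b)
... | tri< lt _ _ = _ , _ , lt , actsAs iw jw i≢j act
... | tri≈ _ e _  = contradiction e i≢j
... | tri> _ _ gt = _ , _ , gt , actsAs jw iw (i≢j ∘ sym) λ {k} kw → trans (act kw) (reflB-comm {n} iw jw i≢j k)

remove∈ : ∀ {A : Set} {a : A} {xs} → a ∈ xs → ∃ λ ys → xs ↭ a ∷ ys
remove∈ a∈ with as , bs , refl ← ∈ₚ.∈-∃++ a∈ = as ++ bs , ↭ₚ.shift _ as bs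

IsBn-fromAbs : ∀ {n x} → map ∣_∣ x ↭ range1 n → IsBn n x
IsBn-fromAbs {n} {x} p = trans (sym (Listₚ.length-map ∣_∣ x)) (trans (↭ₚ.↭-length p) (range1-length n)) , p

map-abs-+ : ∀ xs → map ∣_∣ (map +_ xs) ≡ xs
map-abs-+ xs = trans (sym (Listₚ.map-∘ xs)) (Listₚ.map-id xs)

-- Conjugation by `x` carries the pair exchanged by a generator to its image under `x`. So `x`
-- starts with `j` when the sign change of 1 is conjugated, and with `i`, `j` when the swap of 1 and
-- 2 is.
reflection : ∀ n {i j} → i ∈ wires n → j ∈ wires n → i ℤ.< j → ∃ λ t → IsRefl n t × ActsAsRefl n t i j
reflection n {i} {j} iw jw i<j with ∣ i ∣ ℕ.≟ ∣ j ∣ | remove∈ (wire⇒abs∈ n jw)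
... | yes e | ys , p with n | IsBn-fromAbs {n} {j ∷ map +_ ys} (↭-trans (↭-reflexive (cong (∣ j ∣ ∷_) (map-abs-+ ys))) (↭-sym p))
...   | suc m | bx = _ , (x , bx , _ , flip₁∈ m , refl) , subst (λ i → ActsAsRefl (suc m) (mulB (mulB x s₀) (invB x)) i j) -j≡i (conj-acts {suc m} {x} {s₀} bx (flip₁-acts m))
  where
  x = j ∷ map +_ ys
  s₀ = -[1+ 0 ] ∷ map +_ (map suc (range1 m))
  -j≡i : ℤ.- j ≡ i
  -j≡i with abs-≡⇒± i j e
  ... | inj₁ i≡j = contradiction i<j (ℤₚ.<-irrefl i≡j)
  ... | inj₂ i≡-j = sym i≡-j
reflection n {i} {j} iw jw i<j | no ne | ys , p with remove∈ i∈
  where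
  i∈ : ∣ i ∣ ∈ ys
  i∈ with ↭ₚ.∈-resp-↭ p (wire⇒abs∈ n iw)
  ... | here e = contradiction e ne
  ... | there m = m
... | zs , q = _ , (x , bx , _ , swapᵢ∈ n 1<n , refl) , conj-acts {n} {x} bx (swapᵢ-acts n 1<n)
  where
  x = i ∷ j ∷ map +_ zs
  bx : IsBn n x
  bx = IsBn-fromAbs {n} {x} (↭-trans (↭-reflexive (cong (λ l → ∣ i ∣ ∷ ∣ j ∣ ∷ l) (map-abs-+ zs)))
         (↭-trans (swap ∣ i ∣ ∣ j ∣ ↭-refl) (↭-trans (prep ∣ j ∣ (↭-sym q)) (↭-sym p))))
  1<n : 1 < n
  1<n = subst (1 <_) (proj₁ bx) (s≤s (s≤s z≤n))

BruhatLe-trans : ∀ {n u v w} → BruhatLe n u v → BruhatLe n v w → BruhatLe n u w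
BruhatLe-trans p (bru-refl _) = p
BruhatLe-trans p (bru-step q r a b la lb a<b) = bru-step (BruhatLe-trans p q) r a b la lb a<b

BruhatLe-IsBn : ∀ {n u v} → BruhatLe n u v → IsBn n v
BruhatLe-IsBn (bru-refl b) = b
BruhatLe-IsBn {n} (bru-step {v = v} {t} p r _ _ _ _ _) = IsBn-mulB {n} {v} {t} (BruhatLe-IsBn p) (IsRefl-IsBn {n} {t} r)

-- In closed form the square of its argument, the length of the longest element.
lenBound : ℕ → ℕ
lenBound zero    = 0
lenBound (suc m) = (m + m) + (1 + lenBound m)

lenB-≤ : ∀ v → lenB v ≤ lenBound (length v)
lenB-≤ []       = z≤n
lenB-≤ (x ∷ xs) = ℕₚ.+-mono-≤ (rows xs) (ℕₚ.+-mono-≤ (χ≤1 ⌊ x ℤ.<? + 0 ⌋) (lenB-≤ xs))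
  where
  χ≤1 : ∀ b → χ b ≤ 1
  χ≤1 true  = s≤s z≤n
  χ≤1 false = z≤n
  rows : ∀ ys → row-count x ys ≤ length ys + length ys
  rows []       = z≤n
  rows (y ∷ ys) = ℕₚ.≤-trans (ℕₚ.+-mono-≤ (ℕₚ.+-mono-≤ (χ≤1 ⌊ y ℤ.<? x ⌋) (χ≤1 ⌊ y ℤ.<? ℤ.- x ⌋)) (rows ys))
                    (ℕₚ.≤-reflexive (arrange (length ys)))
    where
    arrange : ∀ a → 2 + (a + a) ≡ suc a + suc a
    arrange = ℕ-solve-∀

module BruhatInterval {n : ℕ} {w : List ℤ} {cs : List Iv} (bw : IsBn n w) (zz : ZigZag n cs)
                      (mct : MaxCoverType n cs (appB w)) where
  open WireMax {n} {cs} zz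

  Compat : List ℤ → Set
  Compat v = ∀ {i} → i ∈ wires n → Reach cs i (appB v i)

  w-maximal : Maximal (appB w)
  w-maximal = record
    { perm   = IsBn⇒perm {n} {w} bw
    ; compat = maxCover-Reach {n} {cs} {appB w} zig mct
    ; locMax = maxCover-LocMax {n} {cs} {appB w} zig mct }

  Reach-sym : ∀ {i j} → i ∈ wires n → j ∈ wires n → Reach cs i j → Reach cs (ℤ.- i) (ℤ.- j)
  Reach-sym = Reach-neg w-maximal (λ {i} _ → appB-odd w i)

  private
    module Move {v t i j} (bv : IsBn n v) (i<j : i ℤ.< j) (acts : ActsAsRefl n t i j) where
      open ActsAsRefl acts public
      v′ = mulB v t
      value : ∀ {k} → k ∈ wires n → appB v′ k ≡ appB v (reflB i j k)
      value {k} kw = trans (appB-mulB v t k) (cong (appB v) (action kw))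
      value-i : appB v′ i ≡ appB v j
      value-i = trans (value iw) (cong (appB v) (reflB-i {n} iw jw i≢j))
      value-j : appB v′ j ≡ appB v i
      value-j = trans (value jw) (cong (appB v) (reflB-j {n} iw jw i≢j))

      -- The values at `i` and `j` in `v′` give two routes with inverted ends, which uncross. The
      -- positions `-i` and `-j` follow by `Reach-sym`.
      down-compat : appB v i ℤ.< appB v j → Compat v′ → Compat v
      down-compat lt c {k} kw with reflB i j k | reflView i j k | value kw
      ... | _ | at-i refl | _ = proj₁ pair
        where pair = uncross cs i<j (ℤₚ.<⇒≤ lt) (subst (Reach cs i) value-i (c iw)) (subst (Reach cs j) value-j (c jw))
      ... | _ | at-j refl | _ = proj₂ (uncross cs i<j (ℤₚ.<⇒≤ lt) (subst (Reach cs i) value-i (c iw)) (subst (Reach cs j) value-j (c jw)))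
      ... | _ | at-ī refl | _ = subst (Reach cs (ℤ.- i)) (sym (appB-odd v i)) (Reach-sym iw (appB-wire {n} {v} bv iw)
              (proj₁ (uncross cs i<j (ℤₚ.<⇒≤ lt) (subst (Reach cs i) value-i (c iw)) (subst (Reach cs j) value-j (c jw)))))
      ... | _ | at-j̄ refl | _ = subst (Reach cs (ℤ.- j)) (sym (appB-odd v j)) (Reach-sym jw (appB-wire {n} {v} bv jw)
              (proj₂ (uncross cs i<j (ℤₚ.<⇒≤ lt) (subst (Reach cs i) value-i (c iw)) (subst (Reach cs j) value-j (c jw)))))
      ... | _ | other _ _ _ _ | e = subst (Reach cs k) e (c kw)

      up-compat : Reach cs i (appB v j) → Reach cs j (appB v i) → Compat v → Compat v′
      up-compat r r′ c {k} kw with reflB i j k | reflView i j k | value kw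
      ... | _ | at-i refl | e = subst (Reach cs _) (sym e) r
      ... | _ | at-j refl | e = subst (Reach cs _) (sym e) r′
      ... | _ | at-ī refl | e = subst (Reach cs _) (sym (trans e (appB-odd v j))) (Reach-sym iw (appB-wire {n} {v} bv jw) r)
      ... | _ | at-j̄ refl | e = subst (Reach cs _) (sym (trans e (appB-odd v i))) (Reach-sym jw (appB-wire {n} {v} bv iw) r′)
      ... | _ | other _ _ _ _ | e = subst (Reach cs k) (sym e) (c kw)

  Bruhat⇒Compat : ∀ {v u} → BruhatLe n v u → Compat u → IsBn n v × Compat v
  Bruhat⇒Compat (bru-refl bv) c = bv , c
  Bruhat⇒Compat (bru-step {v = v} {t} p r a b la lb a<b) c with i , j , i<j , acts ← IsRefl-acts r =
    Bruhat⇒Compat p (down-compat vi<vj c)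
    where
    bv = BruhatLe-IsBn p
    bv′ = IsBn-mulB {n} {v} {t} bv (IsRefl-IsBn {n} {t} r)
    open Move {v} {t} {i} {j} bv i<j acts
    longer : lenB v < lenB v′
    longer = subst₂ _<_ (Len-unique bv la) (Len-unique bv′ lb) a<b
    back : ∀ {k} → k ∈ wires n → appB v k ≡ appB v′ (reflB i j k)
    back {k} kw = sym (trans (value (reflB-wire {n} iw jw kw)) (cong (appB v) (reflB-involutive {n} iw jw i≢j k)))
    vi<vj : appB v i ℤ.< appB v j
    -- If the pair were already inverted in `v`, the reflection would lower the length.
    vi<vj with ℤₚ.<-cmp (appB v i) (appB v j)
    ... | tri< lt _ _ = lt
    ... | tri≈ _ e _ = contradiction (appB-injective {n} {v} bv iw jw e) i≢j
    ... | tri> _ _ gt = contradiction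
      (lenB-refl-< {n} {v′} {v} bv′ bv iw jw i<j back (subst₂ ℤ._<_ (sym value-i) (sym value-j) gt)) (ℕₚ.<-asym longer)

  Improvable : List ℤ → Set
  Improvable v = Any (λ i → Any (λ j → i ℤ.< j × appB v i ℤ.< appB v j × Reach cs i (appB v j) × Reach cs j (appB v i)) (wires n)) (wires n)

  improvable? : ∀ v → Dec (Improvable v)
  improvable? v = Any.any? (λ i → Any.any? (λ j → (i ℤ.<? j) ×-dec ((appB v i ℤ.<? appB v j) ×-dec
    (Reach? cs proper i (appB v j) ×-dec Reach? cs proper j (appB v i)))) (wires n)) (wires n)
    where open Zig zig

  -- As long as some exchange is allowed it is performed: the element stays compatible and its
  -- length grows, which the bound on lengths lets happen only finitely often. Once none is left,
  -- `v` is locally maximal, and uniqueness identifies it with `w`.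
  Compat⇒Bruhat : ∀ fuel {v} → IsBn n v → Compat v → lenBound n ≤ lenB v + fuel → BruhatLe n v w
  Compat⇒Bruhat fuel {v} bv c le with improvable? v
  ... | no stuck = subst (λ u → BruhatLe n u w) (sym v≡w) (bru-refl bw)
    where
    v-maximal : Maximal (appB v)
    v-maximal = record { perm = IsBn⇒perm {n} {v} bv ; compat = c
      ; locMax = λ iw jw i<j lt r r′ → stuck (lose iw (lose jw (i<j , lt , r , r′))) }
    v≡w : v ≡ w
    v≡w = appB-ext {n} (proj₁ bv) (proj₁ bw) (maximal-unique v-maximal w-maximal)
  ... | yes imp with i , iw , q ← find imp with j , jw , i<j , lt , r , r′ ← find q
    with t , rt , acts ← reflection n iw jw i<j = climb fuel le
    where
    bv′ = IsBn-mulB {n} {v} {t} bv (IsRefl-IsBn {n} {t} rt)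
    module M = Move {v} {t} {i} {j} bv i<j acts
    longer : lenB v < lenB (mulB v t)
    longer = lenB-refl-< {n} {v} {mulB v t} bv bv′ iw jw i<j M.value lt
    climb : ∀ fuel → lenBound n ≤ lenB v + fuel → BruhatLe n v w
    climb zero le₀ = contradiction
      (ℕₚ.≤-trans (subst (λ m → lenB (mulB v t) ≤ lenBound m) (proj₁ bv′) (lenB-≤ (mulB v t))) (ℕₚ.≤-trans le₀ (ℕₚ.≤-reflexive (ℕₚ.+-identityʳ (lenB v)))))
      (ℕₚ.<⇒≱ longer)
    climb (suc f) le₁ = BruhatLe-trans
      (bru-step (bru-refl bv) rt (lenB v) (lenB (mulB v t)) (Len-lenB bv) (Len-lenB bv′) longer)
      (Compat⇒Bruhat f bv′ (M.up-compat r r′ c) (ℕₚ.≤-trans le₁ (ℕₚ.≤-trans (ℕₚ.≤-reflexive (ℕₚ.+-suc (lenB v) f)) (ℕₚ.+-monoˡ-≤ f longer))))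

  Bruhat⇔Compat : ∀ v → BruhatLe n v w ⇔ (IsBn n v × Compat v)
  Bruhat⇔Compat v = mk⇔ (λ p → Bruhat⇒Compat p (Maximal.compat w-maximal))
    (λ (bv , c) → Compat⇒Bruhat (lenBound n) bv c (ℕₚ.m≤n+m (lenBound n) (lenB v)))

-- Colourings and permutations

∑ : {A : Set} → List A → (A → ℤ) → ℤ
∑ xs f = sumℤ (map f xs)

∑-cong : ∀ {A : Set} {f g : A → ℤ} xs → (∀ {x} → x ∈ xs → f x ≡ g x) → ∑ xs f ≡ ∑ xs g
∑-cong []       _  = refl
∑-cong (x ∷ xs) eq = cong₂ ℤ._+_ (eq (here refl)) (∑-cong xs (eq ∘ there))

∑-++ : ∀ {A : Set} (f : A → ℤ) xs ys → ∑ (xs ++ ys) f ≡ ∑ xs f ℤ.+ ∑ ys f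
∑-++ f []       ys = sym (ℤₚ.+-identityˡ _)
∑-++ f (x ∷ xs) ys = trans (cong (ℤ._+_ (f x)) (∑-++ f xs ys)) (sym (ℤₚ.+-assoc (f x) _ _))

∑-map : ∀ {A B : Set} (f : B → ℤ) (g : A → B) xs → ∑ (map g xs) f ≡ ∑ xs (f ∘ g)
∑-map f g xs = cong sumℤ (sym (Listₚ.map-∘ xs))

∑-concatMap : ∀ {A B : Set} (f : B → ℤ) (g : A → List B) xs → ∑ (concatMap g xs) f ≡ ∑ xs (λ x → ∑ (g x) f)
∑-concatMap f g []       = refl
∑-concatMap f g (x ∷ xs) = trans (∑-++ f (g x) (concatMap g xs)) (cong (ℤ._+_ (∑ (g x) f)) (∑-concatMap f g xs))

∑-+ : ∀ {A : Set} (f g : A → ℤ) xs → ∑ xs (λ x → f x ℤ.+ g x) ≡ ∑ xs f ℤ.+ ∑ xs g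
∑-+ f g []       = refl
∑-+ f g (x ∷ xs) = trans (cong (ℤ._+_ (f x ℤ.+ g x)) (∑-+ f g xs)) (interchange (f x) (g x) _ _)
  where
  interchange : ∀ a b c d → (a ℤ.+ b) ℤ.+ (c ℤ.+ d) ≡ (a ℤ.+ c) ℤ.+ (b ℤ.+ d)
  interchange = ℤ-solve-∀

∑-*ˡ : ∀ {A : Set} c (f : A → ℤ) xs → ∑ xs (λ x → c ℤ.* f x) ≡ c ℤ.* ∑ xs f
∑-*ˡ c f []       = sym (ℤₚ.*-zeroʳ c)
∑-*ˡ c f (x ∷ xs) = trans (cong (ℤ._+_ (c ℤ.* f x)) (∑-*ˡ c f xs)) (sym (ℤₚ.*-distribˡ-+ c (f x) _))

∑-*ʳ : ∀ {A : Set} c (f : A → ℤ) xs → ∑ xs (λ x → f x ℤ.* c) ≡ ∑ xs f ℤ.* c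
∑-*ʳ c f xs = trans (∑-cong xs (λ {x} _ → ℤₚ.*-comm (f x) c)) (trans (∑-*ˡ c f xs) (ℤₚ.*-comm c _))

∑-zero : ∀ {A : Set} (xs : List A) → ∑ xs (λ _ → + 0) ≡ + 0
∑-zero []       = refl
∑-zero (x ∷ xs) = trans (ℤₚ.+-identityˡ _) (∑-zero xs)

∑-const : ∀ {A : Set} c (xs : List A) → ∑ xs (λ _ → c) ≡ + length xs ℤ.* c
∑-const c []       = sym (ℤₚ.*-zeroˡ c)
∑-const c (x ∷ xs) = trans (cong (ℤ._+_ c) (∑-const c xs)) (sym (ℤₚ.suc-* (+ length xs) c))

∑-swap : ∀ {A B : Set} (f : A → B → ℤ) xs ys → ∑ xs (λ x → ∑ ys (f x)) ≡ ∑ ys (λ y → ∑ xs (λ x → f x y))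
∑-swap f []       ys = sym (∑-zero ys)
∑-swap f (x ∷ xs) ys = trans (cong (ℤ._+_ (∑ ys (f x))) (∑-swap f xs ys)) (sym (∑-+ (f x) (λ y → ∑ xs (λ x → f x y)) ys))

∑-↭ : ∀ {A : Set} (f : A → ℤ) {xs ys} → xs ↭ ys → ∑ xs f ≡ ∑ ys f
∑-↭ f Perm.refl = refl
∑-↭ f (prep x p) = cong (ℤ._+_ (f x)) (∑-↭ f p)
∑-↭ f (swap x y p) = trans (cong (λ s → f x ℤ.+ (f y ℤ.+ s)) (∑-↭ f p)) (exchange (f x) (f y) _)
  where
  exchange : ∀ a b c → a ℤ.+ (b ℤ.+ c) ≡ b ℤ.+ (a ℤ.+ c)
  exchange = ℤ-solve-∀
∑-↭ f (Perm.trans p q) = trans (∑-↭ f p) (∑-↭ f q)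

δ : ∀ {P : Set} → Dec P → ℤ
δ P? = if ⌊ P? ⌋ then + 1 else + 0

δ-yes : ∀ {P : Set} (P? : Dec P) → P → δ P? ≡ + 1
δ-yes P? p rewrite ⌊⌋-true P? p = refl

δ-no : ∀ {P : Set} (P? : Dec P) → ¬ P → δ P? ≡ + 0
δ-no P? ¬p rewrite ⌊⌋-false P? ¬p = refl

δ-cong : ∀ {P Q : Set} (P? : Dec P) (Q? : Dec Q) → (P → Q) → (Q → P) → δ P? ≡ δ Q?
δ-cong P? Q? f g rewrite χ-cong P? Q? f g = refl

∑-δ : ∀ {b} (H : ℕ → ℤ) xs → Unique xs → b ∈ xs → ∑ xs (λ a → δ (a ℕ.≟ b) ℤ.* H a) ≡ H b
∑-δ {b} H (x ∷ xs) (x∉ ∷ u) b∈ with x ℕ.≟ b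
... | yes refl = trans (cong₂ ℤ._+_ (ℤₚ.*-identityˡ (H x)) (trans (∑-cong xs λ {a} a∈ → trans (cong (ℤ._* H a) (δ-no (a ℕ.≟ x) (λ e → All.lookup x∉ a∈ (sym e)))) (ℤₚ.*-zeroˡ (H a))) (∑-zero xs))) (ℤₚ.+-identityʳ (H x))
... | no x≢b with b∈
...   | here e = contradiction (sym e) x≢b
...   | there b∈′ = trans (cong₂ ℤ._+_ (ℤₚ.*-zeroˡ (H x)) (∑-δ H xs u b∈′)) (ℤₚ.+-identityˡ (H b))

words : ℕ → ℕ → List (List ℕ)
words q zero    = [] ∷ []
words q (suc n) = concatMap (λ a → map (a ∷_) (words q n)) (upTo q)

∑-words : ∀ q n (F : List ℕ → ℤ) → ∑ (words q (suc n)) F ≡ ∑ (upTo q) (λ a → ∑ (words q n) (λ κ → F (a ∷ κ)))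
∑-words q n F = trans (∑-concatMap F _ (upTo q)) (∑-cong (upTo q) λ {a} _ → ∑-map F (a ∷_) (words q n))

-- One item for each occurrence of `b`; equal results are repeated on purpose.
deletions : ℕ → List ℕ → List (List ℕ)
deletions b []      = []
deletions b (a ∷ κ) = (if ⌊ a ℕ.≟ b ⌋ then κ ∷ [] else []) ++ map (a ∷_) (deletions b κ)

∑-deletions : ∀ b a κ (g : List ℕ → ℤ) → ∑ (deletions b (a ∷ κ)) g ≡ δ (a ℕ.≟ b) ℤ.* g κ ℤ.+ ∑ (deletions b κ) (λ κ′ → g (a ∷ κ′))
∑-deletions b a κ g = trans (∑-++ g (if ⌊ a ℕ.≟ b ⌋ then κ ∷ [] else []) _) (cong₂ ℤ._+_ first (∑-map g (a ∷_) (deletions b κ)))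
  where
  first : ∑ (if ⌊ a ℕ.≟ b ⌋ then κ ∷ [] else []) g ≡ δ (a ℕ.≟ b) ℤ.* g κ
  first with a ℕ.≟ b
  ... | yes _ = trans (ℤₚ.+-identityʳ (g κ)) (sym (ℤₚ.*-identityˡ (g κ)))
  ... | no _  = sym (ℤₚ.*-zeroˡ (g κ))

-- Insertion and deletion of `b` are adjoint: both sides sum over words with one marked occurrence
-- of `b`.
insert-adjoint : ∀ {q b} → b < q → ∀ n (g F : List ℕ → ℤ) →
  ∑ (words q n) (λ κ → g κ ℤ.* ∑ (insertAll b κ) F) ≡ ∑ (words q (suc n)) (λ κ → F κ ℤ.* ∑ (deletions b κ) g)
insert-adjoint {q} {b} b<q zero g F = begin
  g [] ℤ.* (F (b ∷ []) ℤ.+ + 0) ℤ.+ + 0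
    ≡⟨ arrange (g []) (F (b ∷ [])) ⟩
  F (b ∷ []) ℤ.* g []
    ≡⟨ sym (∑-δ (λ a → F (a ∷ []) ℤ.* g []) (upTo q) (Uniqueₚ.upTo⁺ q) (∈ₚ.∈-upTo⁺ b<q)) ⟩
  ∑ (upTo q) (λ a → δ (a ℕ.≟ b) ℤ.* (F (a ∷ []) ℤ.* g []))
    ≡⟨ ∑-cong (upTo q) (λ {a} _ → trans (arrange₂ (δ (a ℕ.≟ b)) (F (a ∷ [])) (g [])) (cong (λ s → F (a ∷ []) ℤ.* s ℤ.+ + 0) (sym (∑-deletions b a [] g)))) ⟩
  ∑ (upTo q) (λ a → ∑ (words q 0) (λ κ → F (a ∷ κ) ℤ.* ∑ (deletions b (a ∷ κ)) g))
    ≡⟨ sym (∑-words q 0 (λ κ → F κ ℤ.* ∑ (deletions b κ) g)) ⟩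
  ∑ (words q 1) (λ κ → F κ ℤ.* ∑ (deletions b κ) g) ∎
  where
  open ≡-Reasoning
  arrange : ∀ x y → x ℤ.* (y ℤ.+ + 0) ℤ.+ + 0 ≡ y ℤ.* x
  arrange = ℤ-solve-∀
  arrange₂ : ∀ d x y → d ℤ.* (x ℤ.* y) ≡ x ℤ.* (d ℤ.* y ℤ.+ + 0) ℤ.+ + 0
  arrange₂ = ℤ-solve-∀
insert-adjoint {q} {b} b<q (suc n) g F = begin
  ∑ (words q (suc n)) (λ κ → g κ ℤ.* ∑ (insertAll b κ) F)
    ≡⟨ ∑-words q n _ ⟩
  ∑ (upTo q) (λ a → ∑ W (λ κ → g (a ∷ κ) ℤ.* (F (b ∷ a ∷ κ) ℤ.+ ∑ (map (a ∷_) (insertAll b κ)) F)))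
    ≡⟨ ∑-cong (upTo q) (λ {a} _ → trans (∑-cong W (λ {κ} _ → trans (ℤₚ.*-distribˡ-+ (g (a ∷ κ)) (F (b ∷ a ∷ κ)) _) (cong (λ s → g (a ∷ κ) ℤ.* F (b ∷ a ∷ κ) ℤ.+ g (a ∷ κ) ℤ.* s) (∑-map F (a ∷_) (insertAll b κ))))) (∑-+ _ _ W)) ⟩
  ∑ (upTo q) (λ a → ∑ W (λ κ → g (a ∷ κ) ℤ.* F (b ∷ a ∷ κ)) ℤ.+ ∑ W (λ κ → g (a ∷ κ) ℤ.* ∑ (insertAll b κ) (λ κ′ → F (a ∷ κ′))))
    ≡⟨ ∑-+ _ _ (upTo q) ⟩
  ∑ (upTo q) (λ a → ∑ W (λ κ → g (a ∷ κ) ℤ.* F (b ∷ a ∷ κ))) ℤ.+ ∑ (upTo q) (λ a → ∑ W (λ κ → g (a ∷ κ) ℤ.* ∑ (insertAll b κ) (λ κ′ → F (a ∷ κ′))))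
    ≡⟨ cong₂ ℤ._+_ (trans (sym (∑-words q n (λ κ → g κ ℤ.* F (b ∷ κ)))) (trans (∑-cong W′ (λ {κ} _ → ℤₚ.*-comm (g κ) (F (b ∷ κ)))) (sym (∑-δ (λ a → ∑ W′ (λ κ → F (a ∷ κ) ℤ.* g κ)) (upTo q) (Uniqueₚ.upTo⁺ q) (∈ₚ.∈-upTo⁺ b<q)))))
         (∑-cong (upTo q) (λ {a} _ → insert-adjoint b<q n (λ κ → g (a ∷ κ)) (λ κ → F (a ∷ κ)))) ⟩
  ∑ (upTo q) (λ a → δ (a ℕ.≟ b) ℤ.* ∑ W′ (λ κ → F (a ∷ κ) ℤ.* g κ)) ℤ.+ ∑ (upTo q) (λ a → ∑ W′ (λ κ → F (a ∷ κ) ℤ.* ∑ (deletions b κ) (λ κ′ → g (a ∷ κ′))))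
    ≡⟨ sym (∑-+ _ _ (upTo q)) ⟩
  ∑ (upTo q) (λ a → δ (a ℕ.≟ b) ℤ.* ∑ W′ (λ κ → F (a ∷ κ) ℤ.* g κ) ℤ.+ ∑ W′ (λ κ → F (a ∷ κ) ℤ.* ∑ (deletions b κ) (λ κ′ → g (a ∷ κ′))))
    ≡⟨ ∑-cong (upTo q) (λ {a} _ → trans (cong (ℤ._+ ∑ W′ (λ κ → F (a ∷ κ) ℤ.* ∑ (deletions b κ) (λ κ′ → g (a ∷ κ′)))) (sym (∑-*ˡ (δ (a ℕ.≟ b)) _ W′)))
         (trans (sym (∑-+ _ _ W′)) (∑-cong W′ (λ {κ} _ → trans (collect (δ (a ℕ.≟ b)) (F (a ∷ κ)) (g κ) _) (cong (F (a ∷ κ) ℤ.*_) (sym (∑-deletions b a κ g))))))) ⟩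
  ∑ (upTo q) (λ a → ∑ W′ (λ κ → F (a ∷ κ) ℤ.* ∑ (deletions b (a ∷ κ)) g))
    ≡⟨ sym (∑-words q (suc n) _) ⟩
  ∑ (words q (suc (suc n))) (λ κ → F κ ℤ.* ∑ (deletions b κ) g) ∎
  where
  open ≡-Reasoning
  W  = words q n
  W′ = words q (suc n)
  collect : ∀ d x y z → d ℤ.* (x ℤ.* y) ℤ.+ x ℤ.* z ≡ x ℤ.* (d ℤ.* y ℤ.+ z)
  collect = ℤ-solve-∀

count : ℕ → List ℕ → ℕ
count b = sumOf (λ a → χ ⌊ a ℕ.≟ b ⌋)

content : ℕ → List ℕ → List ℕ
content q κ = map (λ b → count b κ) (upTo q)

_≟ᴸ_ : (xs ys : List ℕ) → Dec (xs ≡ ys)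
_≟ᴸ_ = Listₚ.≡-dec ℕ._≟_

content-≡ : ∀ q {κ κ′} → content q κ ≡ content q κ′ → ∀ {b} → b < q → count b κ ≡ count b κ′
content-≡ q {κ} {κ′} e {b} b<q = trans (sym (look κ)) (trans (cong (λ l → at 0 l (suc b)) e) (look κ′))
  where
  look : ∀ κ → at 0 (content q κ) (suc b) ≡ count b κ
  look κ = trans (cong (λ l → at 0 l (suc b)) (Listₚ.map-upTo (λ b → count b κ) q)) (at-applyUpTo (λ b → count b κ) q b<q)

content-ext : ∀ q {κ κ′} → (∀ {b} → b < q → count b κ ≡ count b κ′) → content q κ ≡ content q κ′
content-ext q e = Listₚ.map-cong-local (All.tabulate λ b∈ → e (∈ₚ.∈-upTo⁻ b∈))

deletion-count : ∀ b κ {κ′} → κ′ ∈ deletions b κ → ∀ a → count a κ ≡ χ ⌊ b ℕ.≟ a ⌋ + count a κ′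
deletion-count b (c ∷ κ) κ′∈ a with c ℕ.≟ b | κ′∈
... | yes refl | here refl = refl
... | yes refl | there m   = later m
  where
  later : ∀ {κ′} → κ′ ∈ map (c ∷_) (deletions b κ) → count a (c ∷ κ) ≡ χ ⌊ b ℕ.≟ a ⌋ + count a κ′
  later m with κ″ , m′ , refl ← ∈ₚ.∈-map⁻ (c ∷_) m =
    trans (cong (_+_ (χ ⌊ c ℕ.≟ a ⌋)) (deletion-count b κ m′ a)) (exch (χ ⌊ c ℕ.≟ a ⌋) (χ ⌊ b ℕ.≟ a ⌋) _)
    where
    exch : ∀ x y z → x + (y + z) ≡ y + (x + z)
    exch = ℕ-solve-∀
... | no _ | m with κ″ , m′ , refl ← ∈ₚ.∈-map⁻ (c ∷_) m =
  trans (cong (_+_ (χ ⌊ c ℕ.≟ a ⌋)) (deletion-count b κ m′ a)) (exch (χ ⌊ c ℕ.≟ a ⌋) (χ ⌊ b ℕ.≟ a ⌋) _)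
  where
  exch : ∀ x y z → x + (y + z) ≡ y + (x + z)
  exch = ℕ-solve-∀

deletions-length : ∀ b κ → length (deletions b κ) ≡ count b κ
deletions-length b []      = refl
deletions-length b (a ∷ κ) = trans (Listₚ.length-++ (if ⌊ a ℕ.≟ b ⌋ then κ ∷ [] else []))
  (cong₂ _+_ first (trans (Listₚ.length-map (a ∷_) (deletions b κ)) (deletions-length b κ)))
  where
  first : length (if ⌊ a ℕ.≟ b ⌋ then κ ∷ [] else []) ≡ χ ⌊ a ℕ.≟ b ⌋
  first with a ℕ.≟ b
  ... | yes _ = refl
  ... | no _  = refl

-- All deletions of `κ` have the same content, so the sum counts the occurrences of `b`, whose
-- number is fixed by the content required of `κ`.
∑-deletions-content : ∀ {q b} → b < q → ∀ cs κ →
  ∑ (deletions b κ) (λ κ′ → δ (content q κ′ ≟ᴸ content q cs)) ≡ + suc (count b cs) ℤ.* δ (content q κ ≟ᴸ content q (b ∷ cs))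
∑-deletions-content {q} {b} b<q cs κ =
  trans (∑-cong (deletions b κ) (λ {κ′} m → δ-cong (content q κ′ ≟ᴸ content q cs) (content q κ ≟ᴸ content q (b ∷ cs))
          (λ e → content-ext q {κ} {b ∷ cs} λ {a} a<q → trans (deletion-count b κ m a) (cong (_+_ (χ ⌊ b ℕ.≟ a ⌋)) (content-≡ q {κ′} {cs} e a<q)))
          (λ e → content-ext q {κ′} {cs} λ {a} a<q → ℕₚ.+-cancelˡ-≡ (χ ⌊ b ℕ.≟ a ⌋) _ _ (trans (sym (deletion-count b κ m a)) (content-≡ q {κ} {b ∷ cs} e a<q)))))
  (trans (∑-const _ (deletions b κ)) (trans (cong (λ l → + l ℤ.* δ (content q κ ≟ᴸ content q (b ∷ cs))) (deletions-length b κ)) same))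
  where
  same : + count b κ ℤ.* δ (content q κ ≟ᴸ content q (b ∷ cs)) ≡ + suc (count b cs) ℤ.* δ (content q κ ≟ᴸ content q (b ∷ cs))
  same with content q κ ≟ᴸ content q (b ∷ cs)
  ... | no _ = trans (ℤₚ.*-zeroʳ (+ count b κ)) (sym (ℤₚ.*-zeroʳ (+ suc (count b cs))))
  ... | yes e = cong (λ l → + l ℤ.* + 1) (trans (content-≡ q {κ} {b ∷ cs} e b<q) (cong (λ t → χ t + count b cs) (⌊⌋-true (b ℕ.≟ b) refl)))

-- The product of the factorials of the multiplicities, accumulated one letter at a time.
mult : List ℕ → ℕ
mult []       = 1
mult (b ∷ cs) = suc (count b cs) * mult cs

downFrom1 : ℕ → List ℕ
downFrom1 zero    = []
downFrom1 (suc m) = suc m ∷ downFrom1 m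

map-insertAll : ∀ (c : ℕ → ℕ) x σ → map (map c) (insertAll x σ) ≡ insertAll (c x) (map c σ)
map-insertAll c x []      = refl
map-insertAll c x (y ∷ σ) = cong ((c x ∷ c y ∷ map c σ) ∷_)
  (trans (sym (Listₚ.map-∘ (insertAll x σ))) (trans (Listₚ.map-∘ (insertAll x σ)) (cong (map (c y ∷_)) (map-insertAll c x σ))))

-- The order of `downFrom1` follows `perms`, which inserts the largest number last. `insert-adjoint`
-- turns each insertion into deletions, and their numbers accumulate in `mult`.
∑-perms-content : ∀ {q} (c : ℕ → ℕ) n → (∀ {j} → j ∈ downFrom1 n → c j < q) → ∀ (F : List ℕ → ℤ) →
  ∑ (perms n) (λ τ → F (map c τ)) ≡
  + mult (map c (downFrom1 n)) ℤ.* ∑ (words q n) (λ κ → δ (content q κ ≟ᴸ content q (map c (downFrom1 n))) ℤ.* F κ)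
∑-perms-content {q} c zero _ F = trans (sym (ℤₚ.*-identityˡ _)) (cong (ℤ._*_ (+ 1)) (cong (ℤ._+ + 0)
  (sym (trans (cong (ℤ._* F []) (δ-yes (content q [] ≟ᴸ content q []) refl)) (ℤₚ.*-identityˡ (F []))))))
∑-perms-content {q} c (suc m) c< F = begin
  ∑ (perms (suc m)) (λ τ → F (map c τ))
    ≡⟨ ∑-concatMap (λ τ → F (map c τ)) (insertAll (suc m)) (perms m) ⟩
  ∑ (perms m) (λ σ → ∑ (insertAll (suc m) σ) (λ τ → F (map c τ)))
    ≡⟨ ∑-cong (perms m) (λ {σ} _ → trans (sym (∑-map F (map c) (insertAll (suc m) σ))) (cong (λ l → ∑ l F) (map-insertAll c (suc m) σ))) ⟩
  ∑ (perms m) (λ σ → ∑ (insertAll b (map c σ)) F)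
    ≡⟨ ∑-perms-content c m (c< ∘ there) (λ κ → ∑ (insertAll b κ) F) ⟩
  + M ℤ.* ∑ (words q m) (λ κ → δ (content q κ ≟ᴸ content q cs) ℤ.* ∑ (insertAll b κ) F)
    ≡⟨ cong (+ M ℤ.*_) (insert-adjoint (c< (here refl)) m _ F) ⟩
  + M ℤ.* ∑ (words q (suc m)) (λ κ → F κ ℤ.* ∑ (deletions b κ) (λ κ′ → δ (content q κ′ ≟ᴸ content q cs)))
    ≡⟨ cong (+ M ℤ.*_) (trans (∑-cong (words q (suc m)) (λ {κ} _ → trans (cong (F κ ℤ.*_) (∑-deletions-content (c< (here refl)) cs κ)) (arrange (F κ) (+ suc (count b cs)) _))) (∑-*ˡ (+ suc (count b cs)) _ (words q (suc m)))) ⟩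
  + M ℤ.* (+ suc (count b cs) ℤ.* ∑ (words q (suc m)) (λ κ → δ (content q κ ≟ᴸ content q (b ∷ cs)) ℤ.* F κ))
    ≡⟨ trans (sym (ℤₚ.*-assoc (+ M) (+ suc (count b cs)) _)) (cong (ℤ._* ∑ (words q (suc m)) (λ κ → δ (content q κ ≟ᴸ content q (b ∷ cs)) ℤ.* F κ)) (trans (ℤₚ.*-comm (+ M) _) (sym (ℤₚ.pos-* (suc (count b cs)) M)))) ⟩
  + (suc (count b cs) * M) ℤ.* ∑ (words q (suc m)) (λ κ → δ (content q κ ≟ᴸ content q (b ∷ cs)) ℤ.* F κ) ∎
  where
  open ≡-Reasoning
  b  = c (suc m)
  cs = map c (downFrom1 m)
  M  = mult cs
  arrange : ∀ x k d → x ℤ.* (k ℤ.* d) ≡ k ℤ.* (d ℤ.* x)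
  arrange = ℤ-solve-∀

-- Adding one element of colour `b` changes only the factor of `b`; this serves both the orders of
-- Young subgroups and the numbers of fillings.
product-update : ∀ (f g : ℕ → ℕ) k {b} xs → Unique xs → b ∈ xs → f b ≡ k * g b → (∀ {a} → a ≢ b → f a ≡ g a) →
                 product (map f xs) ≡ k * product (map g xs)
product-update f g k {b} (x ∷ xs) (x∉ ∷ u) (here refl) e o = trans (cong₂ _*_ e (cong product (Listₚ.map-cong-local (All.map (λ ne → o (ne ∘ sym)) x∉)))) (ℕₚ.*-assoc k (g x) _)
product-update f g k {b} (x ∷ xs) (x∉ ∷ u) (there b∈) e o = trans (cong₂ _*_ (o (All.lookup x∉ b∈)) (product-update f g k xs u b∈ e o)) (exch (g x) k _)
  where
  exch : ∀ a b c → a * (b * c) ≡ b * (a * c)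
  exch = ℕ-solve-∀

mult-youngOrder : ∀ {q} cs → (∀ {b} → b ∈ cs → b < q) → mult cs ≡ youngOrder (content q cs)
mult-youngOrder {q} [] _ = sym (ones (upTo q))
  where
  ones : ∀ bs → product (map factorial (map (λ b → count b []) bs)) ≡ 1
  ones []       = refl
  ones (b ∷ bs) = trans (ℕₚ.+-identityʳ _) (ones bs)
mult-youngOrder {q} (b ∷ cs) c< = trans (cong (suc (count b cs) *_) (trans (mult-youngOrder cs (c< ∘ there)) (cong product (sym (Listₚ.map-∘ (upTo q))))))
  (trans (sym (product-update (λ a → factorial (count a (b ∷ cs))) (λ a → factorial (count a cs)) (suc (count b cs)) (upTo q) (Uniqueₚ.upTo⁺ q) (∈ₚ.∈-upTo⁺ (c< (here refl)))
     (cong factorial (cong (λ t → χ t + count b cs) (⌊⌋-true (b ℕ.≟ b) refl)))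
     (λ {a} a≢b → cong factorial (cong (λ t → χ t + count a cs) (⌊⌋-false (b ℕ.≟ a) (a≢b ∘ sym))))))
  (cong product (Listₚ.map-∘ (upTo q))))

downFrom1-↭ : ∀ n → downFrom1 n ↭ range1 n
downFrom1-↭ zero    = ↭-refl
downFrom1-↭ (suc m) = ↭-trans (prep (suc m) (downFrom1-↭ m)) (↭-trans (↭-sym (↭ₚ.++-comm (range1 m) (suc m ∷ [])))
  (↭-reflexive (sym (trans (cong (map suc) (sym (Listₚ.upTo-∷ʳ m))) (Listₚ.map-++ suc (upTo m) (m ∷ []))))))

content-↭ : ∀ q {κ κ′} → κ ↭ κ′ → content q κ ≡ content q κ′
content-↭ q p = Listₚ.map-cong (λ b → sumOf-↭ _ p) (upTo q)

∑-perms-coloring : ∀ {q n ν} (c : ℕ → ℕ) → (∀ {j} → j ∈ range1 n → c j < q) → content q (map c (range1 n)) ≡ ν →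
  ∀ (F : List ℕ → ℤ) → ∑ (perms n) (λ τ → F (map c τ)) ≡ + youngOrder ν ℤ.* ∑ (words q n) (λ κ → δ (content q κ ≟ᴸ ν) ℤ.* F κ)
∑-perms-coloring {q} {n} {ν} c c< e F = trans (∑-perms-content c n (λ j∈ → c< (↭ₚ.∈-resp-↭ (downFrom1-↭ n) j∈)) F)
  (cong₂ (λ m ν → + m ℤ.* ∑ (words q n) (λ κ → δ (content q κ ≟ᴸ ν) ℤ.* F κ)) (trans (mult-youngOrder {q} (map c (downFrom1 n)) bound) (cong youngOrder e′)) e′)
  where
  e′ : content q (map c (downFrom1 n)) ≡ ν
  e′ = trans (content-↭ q (↭ₚ.map⁺ c (downFrom1-↭ n))) e
  bound : ∀ {b} → b ∈ map c (downFrom1 n) → b < q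
  bound b∈ with j , j∈ , refl ← ∈ₚ.∈-map⁻ c b∈ = c< (↭ₚ.∈-resp-↭ (downFrom1-↭ n) j∈)

-- Enumeration of the symmetric group

-- `h` recovers from an element the index of the list that it came from, so different lists are
-- disjoint.
unique-concatMap : ∀ {A B : Set} (f : A → List B) (h : B → A) {xs} → Unique xs →
  (∀ {x} → x ∈ xs → Unique (f x)) → (∀ {x z} → x ∈ xs → z ∈ f x → h z ≡ x) → Unique (concatMap f xs)
unique-concatMap f h [] _ _ = []
unique-concatMap f h {x ∷ xs} (x∉ ∷ u) uf ret = Uniqueₚ.++⁺ (uf (here refl))
  (unique-concatMap f h u (uf ∘ there) (ret ∘ there))
  λ (p , q) → case find (∈ₚ.∈-concatMap⁻ f {xs = xs} q) of λ (y , y∈ , z∈) →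
    All.lookup x∉ y∈ (trans (sym (ret (here refl) p)) (ret (there y∈) z∈))

insertAll-↭ : ∀ x σ {τ} → τ ∈ insertAll x σ → τ ↭ x ∷ σ
insertAll-↭ x []      (here refl) = ↭-refl
insertAll-↭ x (y ∷ σ) (here refl) = ↭-refl
insertAll-↭ x (y ∷ σ) (there m) with τ , m′ , refl ← ∈ₚ.∈-map⁻ (y ∷_) m =
  ↭-trans (prep y (insertAll-↭ x σ m′)) (swap y x ↭-refl)

∈-insertAll : ∀ x as bs → as ++ x ∷ bs ∈ insertAll x (as ++ bs)
∈-insertAll x []       []      = here refl
∈-insertAll x []       (b ∷ bs) = here refl
∈-insertAll x (a ∷ as) bs      = there (∈ₚ.∈-map⁺ (a ∷_) (∈-insertAll x as bs))

range1-suc-↭ : ∀ m → suc m ∷ range1 m ↭ range1 (suc m)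
range1-suc-↭ m = ↭-trans (↭-sym (↭ₚ.++-comm (range1 m) (suc m ∷ [])))
  (↭-reflexive (sym (trans (cong (map suc) (sym (Listₚ.upTo-∷ʳ m))) (Listₚ.map-++ suc (upTo m) (m ∷ [])))))

perms-sound : ∀ n {τ} → τ ∈ perms n → τ ↭ range1 n
perms-sound zero    (here refl) = ↭-refl
perms-sound (suc m) τ∈ with σ , σ∈ , m∈ ← find (∈ₚ.∈-concatMap⁻ (insertAll (suc m)) {xs = perms m} τ∈) =
  ↭-trans (insertAll-↭ (suc m) σ m∈) (↭-trans (prep (suc m) (perms-sound m σ∈)) (range1-suc-↭ m))

perms-complete : ∀ n {τ} → τ ↭ range1 n → τ ∈ perms n
perms-complete zero    p with refl ← ↭ₚ.↭-empty-inv p = here refl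
perms-complete (suc m) p with as , bs , refl ← ∈ₚ.∈-∃++ (↭ₚ.∈-resp-↭ (↭-sym p) (∈-range1⁺ ℕₚ.≤-refl)) =
  ∈ₚ.∈-concatMap⁺ (insertAll (suc m)) {xs = perms m} (lose (perms-complete m (↭ₚ.drop-∷ (↭-trans (↭-sym (↭ₚ.shift (suc m) as bs)) (↭-trans p (↭-sym (range1-suc-↭ m))))))
    (∈-insertAll (suc m) as bs))

without : ℕ → List ℕ → List ℕ
without x = filterᵇ (λ y → not ⌊ y ℕ.≟ x ⌋)

without-∉ : ∀ x σ → x ∉ σ → without x σ ≡ σ
without-∉ x []      _ = refl
without-∉ x (y ∷ σ) x∉ with y ℕ.≟ x
... | yes e = contradiction (here (sym e)) x∉
... | no _  = cong (y ∷_) (without-∉ x σ (x∉ ∘ there))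

without-drop : ∀ x σ → without x (x ∷ σ) ≡ without x σ
without-drop x σ with x ℕ.≟ x
... | yes _ = refl
... | no ¬e = contradiction refl ¬e

without-keep : ∀ x {y} σ → y ≢ x → without x (y ∷ σ) ≡ y ∷ without x σ
without-keep x {y} σ y≢x with y ℕ.≟ x
... | yes e = contradiction e y≢x
... | no _  = refl

without-insertAll : ∀ x σ {τ} → x ∉ σ → τ ∈ insertAll x σ → without x τ ≡ σ
without-insertAll x []      x∉ (here refl) = without-drop x []
without-insertAll x (y ∷ σ) x∉ (here refl) = trans (without-drop x (y ∷ σ)) (without-∉ x (y ∷ σ) x∉)
without-insertAll x (y ∷ σ) x∉ (there m) with τ , m′ , refl ← ∈ₚ.∈-map⁻ (y ∷_) m =
  trans (without-keep x τ (λ e → x∉ (here (sym e)))) (cong (y ∷_) (without-insertAll x σ (x∉ ∘ there) m′))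

insertAll-unique : ∀ x σ → x ∉ σ → Unique (insertAll x σ)
insertAll-unique x []      _  = [] ∷ []
insertAll-unique x (y ∷ σ) x∉ = All.tabulate (λ τ∈ e → case ∈ₚ.∈-map⁻ (y ∷_) τ∈ of λ (_ , _ , e′) → x∉ (here (Listₚ.∷-injectiveˡ (trans e e′))))
  ∷ Uniqueₚ.map⁺ Listₚ.∷-injectiveʳ (insertAll-unique x σ (x∉ ∘ there))

suc∉range1 : ∀ m → suc m ∉ range1 m
suc∉range1 m s∈ with k , k<m , refl ← ∈-range1⁻ s∈ = ℕₚ.<-irrefl refl k<m

perms-unique : ∀ n → Unique (perms n)
perms-unique zero    = [] ∷ []
perms-unique (suc m) = unique-concatMap (insertAll (suc m)) (without (suc m)) (perms-unique m)
  (λ {σ} σ∈ → insertAll-unique (suc m) σ (new σ∈)) (λ {σ} σ∈ τ∈ → without-insertAll (suc m) σ (new σ∈) τ∈)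
  where
  new : ∀ {σ} → σ ∈ perms m → suc m ∉ σ
  new σ∈ s∈ = suc∉range1 m (↭ₚ.∈-resp-↭ (perms-sound m σ∈) s∈)

perms-length : ∀ n → length (perms n) ≡ factorial n
perms-length zero    = refl
perms-length (suc m) = trans (go (perms m) (λ σ∈ → trans (↭ₚ.↭-length (perms-sound m σ∈)) (range1-length m))) (cong (suc m *_) (perms-length m))
  where
  ins : ∀ x σ → length (insertAll x σ) ≡ suc (length σ)
  ins x []      = refl
  ins x (y ∷ σ) = cong suc (trans (Listₚ.length-map (y ∷_) (insertAll x σ)) (ins x σ))
  go : ∀ σs → (∀ {σ} → σ ∈ σs → length σ ≡ m) → length (concatMap (insertAll (suc m)) σs) ≡ suc m * length σs
  go []       _ = sym (ℕₚ.*-zeroʳ (suc m))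
  go (σ ∷ σs) l = trans (Listₚ.length-++ (insertAll (suc m) σ)) (trans (cong₂ _+_ (trans (ins (suc m) σ) (cong suc (l (here refl)))) (go σs (l ∘ there))) (sym (ℕₚ.*-suc (suc m) (length σs))))

-- Signs of permutations restricted to a set

∏ : {A : Set} → List A → (A → ℤ) → ℤ
∏ []       f = + 1
∏ (x ∷ xs) f = f x ℤ.* ∏ xs f

∏-cong : ∀ {A : Set} {f g : A → ℤ} xs → (∀ {x} → x ∈ xs → f x ≡ g x) → ∏ xs f ≡ ∏ xs g
∏-cong []       _ = refl
∏-cong (x ∷ xs) e = cong₂ ℤ._*_ (e (here refl)) (∏-cong xs (e ∘ there))

∏-* : ∀ {A : Set} (f g : A → ℤ) xs → ∏ xs (λ x → f x ℤ.* g x) ≡ ∏ xs f ℤ.* ∏ xs g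
∏-* f g []       = refl
∏-* f g (x ∷ xs) = trans (cong (ℤ._*_ (f x ℤ.* g x)) (∏-* f g xs)) (interchange (f x) (g x) _ _)
  where
  interchange : ∀ a b c d → (a ℤ.* b) ℤ.* (c ℤ.* d) ≡ (a ℤ.* c) ℤ.* (b ℤ.* d)
  interchange = ℤ-solve-∀

∏-map : ∀ {A B : Set} (f : B → ℤ) (g : A → B) xs → ∏ (map g xs) f ≡ ∏ xs (f ∘ g)
∏-map f g []       = refl
∏-map f g (x ∷ xs) = cong (f (g x) ℤ.*_) (∏-map f g xs)

∏-++ : ∀ {A : Set} (f : A → ℤ) xs ys → ∏ (xs ++ ys) f ≡ ∏ xs f ℤ.* ∏ ys f
∏-++ f []       ys = sym (ℤₚ.*-identityˡ _)
∏-++ f (x ∷ xs) ys = trans (cong (f x ℤ.*_) (∏-++ f xs ys)) (sym (ℤₚ.*-assoc (f x) _ _))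

∏-one : ∀ {A : Set} (xs : List A) → ∏ xs (λ _ → + 1) ≡ + 1
∏-one []       = refl
∏-one (x ∷ xs) = trans (ℤₚ.*-identityˡ _) (∏-one xs)

∏-↭ : ∀ {A : Set} (f : A → ℤ) {xs ys} → xs ↭ ys → ∏ xs f ≡ ∏ ys f
∏-↭ f Perm.refl = refl
∏-↭ f (prep x p) = cong (f x ℤ.*_) (∏-↭ f p)
∏-↭ f (swap x y p) = trans (cong (λ s → f x ℤ.* (f y ℤ.* s)) (∏-↭ f p)) (exchange (f x) (f y) _)
  where
  exchange : ∀ a b c → a ℤ.* (b ℤ.* c) ≡ b ℤ.* (a ℤ.* c)
  exchange = ℤ-solve-∀
∏-↭ f (Perm.trans p q) = trans (∏-↭ f p) (∏-↭ f q)

pairProd : {A : Set} → (A → A → ℤ) → List A → ℤ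
pairProd h []       = + 1
pairProd h (x ∷ xs) = ∏ xs (h x) ℤ.* pairProd h xs

pairProd-cong : ∀ {A : Set} {h h′ : A → A → ℤ} {L} → AllPairs (λ a b → h a b ≡ h′ a b) L → pairProd h L ≡ pairProd h′ L
pairProd-cong [] = refl
pairProd-cong {L = x ∷ L} (a ∷ ap) = cong₂ ℤ._*_ (∏-cong L (All.lookup a)) (pairProd-cong ap)

pairProd-* : ∀ {A : Set} (h h′ : A → A → ℤ) L → pairProd (λ a b → h a b ℤ.* h′ a b) L ≡ pairProd h L ℤ.* pairProd h′ L
pairProd-* h h′ []      = refl
pairProd-* h h′ (x ∷ L) = trans (cong₂ ℤ._*_ (∏-* (h x) (h′ x) L) (pairProd-* h h′ L)) (interchange (∏ L (h x)) _ _ _)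
  where
  interchange : ∀ a b c d → (a ℤ.* b) ℤ.* (c ℤ.* d) ≡ (a ℤ.* c) ℤ.* (b ℤ.* d)
  interchange = ℤ-solve-∀

pairProd-map : ∀ {A B : Set} (h : B → B → ℤ) (f : A → B) L → pairProd h (map f L) ≡ pairProd (λ a b → h (f a) (f b)) L
pairProd-map h f []      = refl
pairProd-map h f (x ∷ L) = cong₂ ℤ._*_ (∏-map (h (f x)) f L) (pairProd-map h f L)

pairProd-one : ∀ {A : Set} (L : List A) → pairProd (λ _ _ → + 1) L ≡ + 1
pairProd-one []      = refl
pairProd-one (x ∷ L) = cong₂ ℤ._*_ (∏-one L) (pairProd-one L)

pairProd-↭ : ∀ {A : Set} {h : A → A → ℤ} {L L′} → (∀ {a b} → a ∈ L → b ∈ L → a ≢ b → h a b ≡ h b a) →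
             Unique L → L ↭ L′ → pairProd h L ≡ pairProd h L′
pairProd-↭ _ _ Perm.refl = refl
pairProd-↭ {h = h} sy (x∉ ∷ u) (prep x p) = cong₂ ℤ._*_ (∏-↭ (h x) p) (pairProd-↭ (λ a b → sy (there a) (there b)) u p)
pairProd-↭ {h = h} sy ((x≢y ∷ x∉) ∷ y∉ ∷ u) (swap {xs} {ys} x y p) =
  trans (cong₂ (λ s t → (h x y ℤ.* s) ℤ.* (∏ xs (h y) ℤ.* t)) (∏-↭ (h x) p) (pairProd-↭ (λ a b → sy (there (there a)) (there (there b))) u p))
  (trans (cong₂ (λ e s → (e ℤ.* ∏ ys (h x)) ℤ.* (s ℤ.* pairProd h ys)) (sy (here refl) (there (here refl)) x≢y) (∏-↭ (h y) p)) (exchange (h y x) (∏ ys (h x)) (∏ ys (h y)) (pairProd h ys)))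
  where
  exchange : ∀ e a b c → (e ℤ.* a) ℤ.* (b ℤ.* c) ≡ (e ℤ.* b) ℤ.* (a ℤ.* c)
  exchange = ℤ-solve-∀
pairProd-↭ sy u (Perm.trans p q) = trans (pairProd-↭ sy u p)
  (pairProd-↭ (λ a b → sy (↭ₚ.∈-resp-↭ (↭-sym p) a) (↭ₚ.∈-resp-↭ (↭-sym p) b)) (Unique-↭ p u) q)

ord : ℕ → ℕ → ℤ
ord a b = if b ℕ.<ᵇ a then -[1+ 0 ] else + 1

ord-< : ∀ {a b} → a < b → ord a b ≡ + 1
ord-< {a} {b} a<b with b ℕ.<ᵇ a in eq
... | false = refl
... | true  = contradiction (ℕₚ.<ᵇ⇒< b a (subst T (sym eq) tt)) (ℕₚ.<-asym a<b)

ord-> : ∀ {a b} → b < a → ord a b ≡ -[1+ 0 ]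
ord-> {a} {b} b<a with b ℕ.<ᵇ a | ℕₚ.<⇒<ᵇ b<a
... | true | _ = refl

ord-anti : ∀ {a b} → a ≢ b → ord a b ≡ ℤ.- ord b a
ord-anti {a} {b} a≢b with ℕₚ.<-cmp a b
... | tri< lt _ _ = trans (ord-< lt) (cong ℤ.-_ (sym (ord-> lt)))
... | tri≈ _ e _  = contradiction e a≢b
... | tri> _ _ gt = trans (ord-> gt) (cong ℤ.-_ (sym (ord-< gt)))

ord² : ∀ a b → ord a b ℤ.* ord a b ≡ + 1
ord² a b with b ℕ.<ᵇ a
... | true  = refl
... | false = refl

-- The sign of f restricted to the set L; the second factor makes it independent
-- of the order in which L is listed.
sg : (ℕ → ℕ) → List ℕ → ℤ
sg f = pairProd (λ a b → ord a b ℤ.* ord (f a) (f b))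

InjOn : (ℕ → ℕ) → List ℕ → Set
InjOn f L = ∀ {a b} → a ∈ L → b ∈ L → f a ≡ f b → a ≡ b

MapsInto : (ℕ → ℕ) → List ℕ → Set
MapsInto f L = ∀ {a} → a ∈ L → f a ∈ L

unique-map-on : ∀ {A B : Set} {f : A → B} {L} → Unique L → (∀ {a b} → a ∈ L → b ∈ L → f a ≡ f b → a ≡ b) → Unique (map f L)
unique-map-on [] _ = []
unique-map-on (a∉ ∷ u) inj = Allₚ.map⁺ (All.tabulate λ b∈ e → All.lookup a∉ b∈ (inj (here refl) (there b∈) e))
                             ∷ unique-map-on u (λ p q → inj (there p) (there q))

stable-↭ : ∀ {f L} → Unique L → InjOn f L → MapsInto f L → map f L ↭ L
stable-↭ {f} {L} u inj into = unique-⊆-↭ (unique-map-on u inj)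
  (λ b∈ → case ∈ₚ.∈-map⁻ f b∈ of λ { (_ , a∈ , refl) → into a∈ }) (ℕₚ.≤-reflexive (sym (Listₚ.length-map f L)))

sg-↭ : ∀ {f L L′} → Unique L → InjOn f L → L ↭ L′ → sg f L ≡ sg f L′
sg-↭ {f} u inj p = pairProd-↭ (λ {a} {b} a∈ b∈ a≢b →
  trans (cong₂ ℤ._*_ (ord-anti a≢b) (ord-anti (λ e → a≢b (inj a∈ b∈ e)))) (neg-neg (ord b a) (ord (f b) (f a)))) u p
  where
  neg-neg : ∀ x y → (ℤ.- x) ℤ.* (ℤ.- y) ≡ x ℤ.* y
  neg-neg = ℤ-solve-∀

-- The factor `ord (t a) (t b)` occurs twice on the right and cancels.
sg-comp : ∀ f t L → sg (f ∘ t) L ≡ sg t L ℤ.* sg f (map t L)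
sg-comp f t L = trans (pairProd-cong (all-pairs L)) (trans (pairProd-* _ _ L) (cong (sg t L ℤ.*_) (sym (pairProd-map _ t L))))
  where
  all-pairs : ∀ L → AllPairs (λ a b → ord a b ℤ.* ord (f (t a)) (f (t b)) ≡ (ord a b ℤ.* ord (t a) (t b)) ℤ.* (ord (t a) (t b) ℤ.* ord (f (t a)) (f (t b)))) L
  all-pairs []      = []
  all-pairs (a ∷ L) = All.tabulate (λ {b} _ → sym (trans (assoc (ord a b) (ord (t a) (t b)) (ord (f (t a)) (f (t b))))
      (trans (cong (λ z → ord a b ℤ.* (z ℤ.* ord (f (t a)) (f (t b)))) (ord² (t a) (t b))) (cong (ord a b ℤ.*_) (ℤₚ.*-identityˡ _))))) ∷ all-pairs L
    where
    assoc : ∀ x y z → (x ℤ.* y) ℤ.* (y ℤ.* z) ≡ x ℤ.* ((y ℤ.* y) ℤ.* z)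
    assoc = ℤ-solve-∀

sg² : ∀ f L → sg f L ℤ.* sg f L ≡ + 1
sg² f L = trans (sym (pairProd-* _ _ L)) (trans (pairProd-cong (all-pairs L)) (pairProd-one L))
  where
  all-pairs : ∀ L → AllPairs (λ a b → (ord a b ℤ.* ord (f a) (f b)) ℤ.* (ord a b ℤ.* ord (f a) (f b)) ≡ + 1) L
  all-pairs []      = []
  all-pairs (a ∷ L) = All.tabulate (λ {b} _ → trans (square (ord a b) (ord (f a) (f b))) (cong₂ ℤ._*_ (ord² a b) (ord² (f a) (f b)))) ∷ all-pairs L
    where
    square : ∀ x y → (x ℤ.* y) ℤ.* (x ℤ.* y) ≡ (x ℤ.* x) ℤ.* (y ℤ.* y)
    square = ℤ-solve-∀

sg-cong : ∀ {f f′} L → (∀ {a} → a ∈ L → f a ≡ f′ a) → sg f L ≡ sg f′ L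
sg-cong []      e = refl
sg-cong (a ∷ L) e = cong₂ ℤ._*_ (∏-cong L λ {b} b∈ → cong₂ (λ s t → ord a b ℤ.* ord s t) (e (here refl)) (e (there b∈))) (sg-cong L (e ∘ there))

-- f′ x = x f gives sg x · sg f′ = sg (f′ x) = sg (x f) = sg f · sg x.
sg-conj : ∀ {f f′ x L} → Unique L → InjOn f L → MapsInto f L → InjOn x L → (∀ {a} → a ∈ L → f′ (x a) ≡ x (f a)) →
          sg f′ (map x L) ≡ sg f L
sg-conj {f} {f′} {x} {L} u inj into injx eq = cancel (sg x L) (sg f′ (map x L)) (sg f L) (sg² x L) (begin
  sg x L ℤ.* sg f′ (map x L) ≡⟨ sym (sg-comp f′ x L) ⟩
  sg (f′ ∘ x) L              ≡⟨ sg-cong L eq ⟩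
  sg (x ∘ f) L               ≡⟨ sg-comp x f L ⟩
  sg f L ℤ.* sg x (map f L)  ≡⟨ cong (sg f L ℤ.*_) (sym (sg-↭ u injx (↭-sym (stable-↭ u inj into)))) ⟩
  sg f L ℤ.* sg x L          ∎)
  where
  open ≡-Reasoning
  cancel : ∀ a b c → a ℤ.* a ≡ + 1 → a ℤ.* b ≡ c ℤ.* a → b ≡ c
  cancel a b c a² e = trans (sym (ℤₚ.*-identityˡ b)) (trans (cong (ℤ._* b) (sym a²)) (trans (ℤₚ.*-assoc a a b) (trans (cong (a ℤ.*_) e)
    (trans (rot a c) (trans (cong (c ℤ.*_) a²) (ℤₚ.*-identityʳ c))))))
    where
    rot : ∀ a c → a ℤ.* (c ℤ.* a) ≡ c ℤ.* (a ℤ.* a)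
    rot = ℤ-solve-∀

negPow-+ : ∀ a b → negPow (a + b) ≡ negPow a ℤ.* negPow b
negPow-+ zero    b = sym (ℤₚ.*-identityˡ _)
negPow-+ (suc a) b = trans (cong ℤ.-_ (negPow-+ a b)) (ℤₚ.neg-distribˡ-* (negPow a) (negPow b))

sgnS-pairProd : ∀ σ → sgnS σ ≡ pairProd ord σ
sgnS-pairProd []      = refl
sgnS-pairProd (x ∷ σ) = trans (negPow-+ (length (filterᵇ (ℕ._<ᵇ x) σ)) (invCount σ)) (cong₂ ℤ._*_ (row σ) (sgnS-pairProd σ))
  where
  row : ∀ σ → negPow (length (filterᵇ (ℕ._<ᵇ x) σ)) ≡ ∏ σ (ord x)
  row []      = refl
  row (y ∷ σ) with y ℕ.<ᵇ x
  ... | true  = trans (cong ℤ.-_ (row σ)) (sym (ℤₚ.-1*i≡-i (∏ σ (ord x))))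
  ... | false = trans (row σ) (sym (ℤₚ.*-identityˡ _))

range1-increasing : ∀ n → AllPairs _<_ (range1 n)
range1-increasing n = subst (AllPairs _<_) (sym (range1-applyUpTo n)) (AllPairsₚ.applyUpTo⁺₁ suc n (λ i<j _ → s≤s i<j))

sg-sorted : ∀ f {L} → AllPairs _<_ L → sg f L ≡ pairProd ord (map f L)
sg-sorted f {L} inc = trans (pairProd-cong (AllPairs.map (λ {a} {b} a<b → trans (cong (ℤ._* ord (f a) (f b)) (ord-< a<b)) (ℤₚ.*-identityˡ _)) inc))
  (sym (pairProd-map ord f L))

-- Characters as sums over colourings

divN-exact : ∀ d z → d ≢ 0 → divN (+ d ℤ.* z) d ≡ z
divN-exact zero    z d≢0 = contradiction refl d≢0
divN-exact (suc d) z _   = ℤₚ.≤-antisym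
  (ℤₚ.*-cancelʳ-≤-pos Q z D (subst (Q ℤ.* D ℤ.≤_) (ℤₚ.*-comm D z) (ℤ÷.[n/ℕd]*d≤n (D ℤ.* z) (suc d))))
  (subst (z ℤ.≤_) (ℤₚ.pred-suc Q) (ℤₚ.i<j⇒i≤pred[j] (ℤₚ.*-cancelʳ-<-nonNeg {i = z} {j = ℤ.suc Q} D (subst (ℤ._< ℤ.suc Q ℤ.* D) (ℤₚ.*-comm D z) (ℤ÷.n<s[n/ℕd]*d (D ℤ.* z) (suc d))))))
  where
  D = + suc d
  Q = (D ℤ.* z) ℤ./ℕ suc d

factorial≢0 : ∀ k → factorial k ≢ 0
factorial≢0 zero    ()
factorial≢0 (suc k) e with ℕₚ.m*n≡0⇒m≡0∨n≡0 (suc k) e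
... | inj₂ e′ = factorial≢0 k e′

youngOrder≢0 : ∀ ν → youngOrder ν ≢ 0
youngOrder≢0 []      ()
youngOrder≢0 (l ∷ ν) e with ℕₚ.m*n≡0⇒m≡0∨n≡0 (factorial l) e
... | inj₁ e′ = factorial≢0 l e′
... | inj₂ e′ = youngOrder≢0 ν e′

if-δ : ∀ {P : Set} (b : Bool) (P? : Dec P) a → (b ≡ true → P) → (P → b ≡ true) → (if b then a else + 0) ≡ δ P? ℤ.* a
if-δ true  P? a f g = sym (trans (cong (ℤ._* a) (δ-yes P? (f refl))) (ℤₚ.*-identityˡ a))
if-δ false P? a f g = sym (trans (cong (ℤ._* a) (δ-no P? (λ p → contradiction (g p) λ ()))) (ℤₚ.*-zeroˡ a))

allB⁻ : ∀ {A : Set} (p : A → Bool) xs → allB p xs ≡ true → ∀ {x} → x ∈ xs → p x ≡ true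
allB⁻ p (x ∷ xs) e (here refl) with p x
... | true = refl
allB⁻ p (x ∷ xs) e (there m) with p x
... | true = allB⁻ p xs e m

allB⁺ : ∀ {A : Set} (p : A → Bool) xs → (∀ {x} → x ∈ xs → p x ≡ true) → allB p xs ≡ true
allB⁺ p []       _ = refl
allB⁺ p (x ∷ xs) h rewrite h (here refl) = allB⁺ p xs (h ∘ there)

Fixes : ℕ → List ℕ → (ℕ → ℕ) → Set
Fixes n κ f = All (λ i → at 0 κ (f i) ≡ at 0 κ i) (range1 n)

fixes? : ∀ n κ f → Dec (Fixes n κ f)
fixes? n κ f = All.all? (λ i → at 0 κ (f i) ℕ.≟ at 0 κ i) (range1 n)

at-appS : ∀ x {i} → i ∈ range1 (length x) → appS x i ≡ at 0 x i
at-appS x i∈ with k , k< , refl ← ∈-range1⁻ i∈ = at-irrelevant x k<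

at-range : ∀ {n x} → x ↭ range1 n → MapsInto (at 0 x) (range1 n)
at-range {n} {x} p i∈ with k , k< , refl ← ∈-range1⁻ i∈ =
  ↭ₚ.∈-resp-↭ p (at-∈ x (subst (k <_) (sym (trans (↭ₚ.↭-length p) (range1-length n))) k<))

at-inj : ∀ {n x} → x ↭ range1 n → InjOn (at 0 x) (range1 n)
at-inj {n} {x} p a∈ b∈ e with k , k< , refl ← ∈-range1⁻ a∈ | l , l< , refl ← ∈-range1⁻ b∈ =
  cong suc (at-injective (Unique-↭ (↭-sym p) (range1-unique n)) (bound k<) (bound l<) e)
  where
  bound : ∀ {k} → k < n → k < length x
  bound {k} = subst (k <_) (sym (trans (↭ₚ.↭-length p) (range1-length n)))

posOf-spec : ∀ {j xs} → j ∈ xs → posOf j xs ∈ range1 (length xs) × at 0 xs (posOf j xs) ≡ j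
posOf-spec {j} {x ∷ xs} j∈ with x ℕ.≡ᵇ j in eq
... | true  = ∈-range1⁺ {suc (length xs)} (s≤s z≤n) , ℕₚ.≡ᵇ⇒≡ x j (subst T (sym eq) tt)
... | false with j∈
...   | here refl = contradiction (subst T eq (ℕₚ.≡⇒≡ᵇ x j refl)) id
...   | there m with r , e ← posOf-spec m with posOf j xs | ∈-range1⁻ r
...     | _ | k , k< , refl = ∈-range1⁺ (s≤s k<) , e

module _ {k : ℕ} {x σ : List ℕ} (px : x ↭ range1 k) (pσ : σ ↭ range1 k) where
  private
    lx : length x ≡ k
    lx = trans (↭ₚ.↭-length px) (range1-length k)
    lσ : length σ ≡ k
    lσ = trans (↭ₚ.↭-length pσ) (range1-length k)

    conjS-map : conjS x σ ≡ map (λ i → appS (mulS x σ) (posOf i x)) (range1 k)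
    conjS-map = trans (sym (Listₚ.map-∘ (range1 (length x)))) (cong (λ m → map (λ i → appS (mulS x σ) (posOf i x)) (range1 m)) lx)

    mulS-at : ∀ {j} → j ∈ range1 k → appS (mulS x σ) j ≡ at 0 x (at 0 σ j)
    mulS-at j∈ with j , j< , refl ← ∈-range1⁻ j∈ =
      trans (at-irrelevant {d′ = appS x 0} (map (appS x) σ) (subst (j <_) (sym (trans (Listₚ.length-map (appS x) σ) lσ)) j<))
      (trans (at-map (appS x) 0 σ (suc j)) (at-appS x (subst (λ m → at 0 σ (suc j) ∈ range1 m) (sym lx) (at-range pσ j∈))))

  conjS-length : length (conjS x σ) ≡ k
  conjS-length = trans (cong length conjS-map) (trans (Listₚ.length-map _ (range1 k)) (range1-length k))

  conjS-at : ∀ {j} → j ∈ range1 k → at 0 (conjS x σ) (at 0 x j) ≡ at 0 x (at 0 σ j)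
  conjS-at {j} j∈ = trans (cong (λ l → at 0 l (at 0 x j)) conjS-map) (trans (look (at-range px j∈)) (trans (cong (appS (mulS x σ)) back) (mulS-at j∈)))
    where
    look : ∀ {i} → i ∈ range1 k → at 0 (map (λ i → appS (mulS x σ) (posOf i x)) (range1 k)) i ≡ appS (mulS x σ) (posOf i x)
    look i∈ with i , i< , refl ← ∈-range1⁻ i∈ = map-range1-at _ k i<
    spec = posOf-spec (↭ₚ.∈-resp-↭ (↭-sym px) (at-range px j∈))
    back : posOf (at 0 x j) x ≡ j
    back = at-inj px (subst (λ m → posOf (at 0 x j) x ∈ range1 m) lx (proj₁ spec)) j∈ (proj₂ spec)

  private
    ρ = conjS x σ
    preimage : ∀ {a} → a ∈ range1 k → ∃ λ j → j ∈ range1 k × a ≡ at 0 x j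
    preimage a∈ with j , j< , e ← ∈-at {d = 0} (↭ₚ.∈-resp-↭ (↭-sym px) a∈) = suc j , ∈-range1⁺ (subst (j <_) lx j<) , sym e
    ρ-inj : InjOn (at 0 ρ) (range1 k)
    ρ-inj a∈ b∈ e with i , i∈ , refl ← preimage a∈ | j , j∈ , refl ← preimage b∈ =
      cong (at 0 x) (at-inj pσ i∈ j∈ (at-inj px (at-range pσ i∈) (at-range pσ j∈) (trans (sym (conjS-at i∈)) (trans e (conjS-at j∈)))))

  sgnS-conjS : sgnS (conjS x σ) ≡ sgnS σ
  sgnS-conjS = begin
    sgnS ρ                                   ≡⟨ sgnS-pairProd ρ ⟩
    pairProd ord ρ                           ≡⟨ cong (pairProd ord) (sym (tabulate-at ρ conjS-length)) ⟩
    pairProd ord (map (at 0 ρ) (range1 k))   ≡⟨ sym (sg-sorted (at 0 ρ) (range1-increasing k)) ⟩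
    sg (at 0 ρ) (range1 k)                   ≡⟨ sg-↭ {f = at 0 ρ} (range1-unique k) ρ-inj (↭-sym x-list) ⟩
    sg (at 0 ρ) (map (at 0 x) (range1 k))    ≡⟨ sg-conj {f = at 0 σ} {f′ = at 0 ρ} {x = at 0 x} (range1-unique k) (at-inj pσ) (at-range pσ) (at-inj px) conjS-at ⟩
    sg (at 0 σ) (range1 k)                   ≡⟨ sg-sorted (at 0 σ) (range1-increasing k) ⟩
    pairProd ord (map (at 0 σ) (range1 k))   ≡⟨ cong (pairProd ord) (tabulate-at σ lσ) ⟩
    pairProd ord σ                           ≡⟨ sym (sgnS-pairProd σ) ⟩
    sgnS σ                                   ∎
    where
    open ≡-Reasoning
    x-list : map (at 0 x) (range1 k) ↭ range1 k
    x-list = ↭-trans (↭-reflexive (tabulate-at x lx)) px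

  color-at : ∀ (c : ℕ → ℕ) {j} → j ∈ range1 k → at 0 (map c x) j ≡ c (at 0 x j)
  color-at c j∈ with j , j< , refl ← ∈-range1⁻ j∈ =
    trans (at-irrelevant {d′ = c 0} (map c x) (subst (j <_) (sym (trans (Listₚ.length-map c x) lx)) j<)) (at-map c 0 x (suc j))

  -- Conjugation by `x` is absorbed into the colouring that gives `j` the block of its image under
  -- `x`; the Young subgroup is from here on seen only through colourings.
  inYoung⇒Fixes : ∀ ν → inYoung ν ρ ≡ true → Fixes k (map (block ν) x) (at 0 σ)
  inYoung⇒Fixes ν e = All.tabulate λ {j} j∈ → trans (color-at (block ν) (at-range pσ j∈)) (trans (cong (block ν) (sym (conjS-at j∈)))
    (trans (cong (block ν) (sym (at-appS ρ (r (at-range px j∈))))) (trans (ℕₚ.≡ᵇ⇒≡ _ _ (subst T (sym (allB⁻ _ _ e (r (at-range px j∈)))) tt)) (sym (color-at (block ν) j∈)))))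
    where
    r : ∀ {i} → i ∈ range1 k → i ∈ range1 (length ρ)
    r {i} = subst (λ m → i ∈ range1 m) (sym conjS-length)

  Fixes⇒inYoung : ∀ ν → Fixes k (map (block ν) x) (at 0 σ) → inYoung ν ρ ≡ true
  Fixes⇒inYoung ν fx = allB⁺ _ _ λ {i} i∈ → check (subst (λ m → i ∈ range1 m) conjS-length i∈)
    where
    check : ∀ {i} → i ∈ range1 k → (block ν (appS ρ i) ℕ.≡ᵇ block ν i) ≡ true
    check i∈ with j , j∈ , refl ← preimage i∈ = T⇒true (ℕₚ.≡⇒≡ᵇ _ _
      (trans (cong (block ν) (trans (at-appS ρ (subst (λ m → at 0 x j ∈ range1 m) (sym conjS-length) (at-range px j∈))) (conjS-at j∈)))
      (trans (sym (color-at (block ν) (at-range pσ j∈))) (trans (All.lookup fx j∈) (color-at (block ν) j∈)))))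
      where
      T⇒true : ∀ {b} → T b → b ≡ true
      T⇒true {true} _ = refl

upTo-suc : ∀ q → upTo (suc q) ≡ 0 ∷ map suc (upTo q)
upTo-suc q = cong (0 ∷_) (sym (Listₚ.map-upTo suc q))

range1-+ : ∀ l s → range1 (l + s) ≡ range1 l ++ map (_+_ l) (range1 s)
range1-+ zero    s = sym (Listₚ.map-id (range1 s))
range1-+ (suc l) s = cong (1 ∷_) (begin
  map suc (applyUpTo suc (l + s))                   ≡⟨ cong (map suc) (sym (range1-applyUpTo (l + s))) ⟩
  map suc (range1 (l + s))                                    ≡⟨ cong (map suc) (range1-+ l s) ⟩
  map suc (range1 l ++ map (_+_ l) (range1 s))                ≡⟨ Listₚ.map-++ suc (range1 l) _ ⟩
  map suc (range1 l) ++ map suc (map (_+_ l) (range1 s))      ≡⟨ cong₂ _++_ (cong (map suc) (range1-applyUpTo l)) (sym (Listₚ.map-∘ (range1 s))) ⟩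
  map suc (applyUpTo suc l) ++ map (_+_ (suc l)) (range1 s) ∎)
  where open ≡-Reasoning

block-first : ∀ l ls {j} → j ∈ range1 l → block (l ∷ ls) j ≡ 0
block-first l ls j∈ with k , k< , refl ← ∈-range1⁻ j∈ with suc k ℕ.≤ᵇ l | ℕₚ.≤⇒≤ᵇ k<
... | true | _ = refl

block-rest : ∀ l ls {s j} → j ∈ range1 s → block (l ∷ ls) (l + j) ≡ suc (block ls j)
block-rest l ls {s} j∈ with k , k< , refl ← ∈-range1⁻ j∈ with l + suc k ℕ.≤ᵇ l in eq
... | true  = contradiction (ℕₚ.≤ᵇ⇒≤ (l + suc k) l (subst T (sym eq) tt)) (ℕₚ.m+1+n≰m l)
... | false = cong (suc ∘ block ls) (ℕₚ.m+n∸m≡n l (suc k))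

map-const : ∀ {A : Set} (xs : List A) → map (λ _ → 0) xs ≡ replicate (length xs) 0
map-const []       = refl
map-const (x ∷ xs) = cong (0 ∷_) (map-const xs)

standard-coloring : ∀ l ls → map (block (l ∷ ls)) (range1 (l + sum ls)) ≡ replicate l 0 ++ map suc (map (block ls) (range1 (sum ls)))
standard-coloring l ls = trans (cong (map (block (l ∷ ls))) (range1-+ l (sum ls))) (trans (Listₚ.map-++ _ (range1 l) _)
  (cong₂ _++_ (trans (Listₚ.map-cong-local (All.tabulate (block-first l ls))) (trans (map-const (range1 l)) (cong (λ m → replicate m 0) (range1-length l))))
    (trans (sym (Listₚ.map-∘ (range1 (sum ls)))) (trans (Listₚ.map-cong-local (All.tabulate (block-rest l ls {sum ls}))) (Listₚ.map-∘ (range1 (sum ls)))))))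

count-++ : ∀ b xs ys → count b (xs ++ ys) ≡ count b xs + count b ys
count-++ b = sumOf-++ _

count-suc : ∀ b xs → count (suc b) (map suc xs) ≡ count b xs
count-suc b xs = trans (sumOf-map _ suc xs) (sumOf-cong xs λ {a} _ → cong χ (χ-cong (suc a ℕ.≟ suc b) (a ℕ.≟ b) ℕₚ.suc-injective (cong suc)))

count-zero-suc : ∀ xs → count 0 (map suc xs) ≡ 0
count-zero-suc xs = trans (sumOf-map _ suc xs) (sumOf-zero xs)

count-replicate : ∀ b l → count b (replicate l b) ≡ l
count-replicate b zero    = refl
count-replicate b (suc l) = cong₂ _+_ (cong χ (⌊⌋-true (b ℕ.≟ b) refl)) (count-replicate b l)

count-replicate-≢ : ∀ {a b} l → a ≢ b → count b (replicate l a) ≡ 0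
count-replicate-≢ zero    _  = refl
count-replicate-≢ {a} {b} (suc l) ne = cong₂ _+_ (cong χ (⌊⌋-false (a ℕ.≟ b) ne)) (count-replicate-≢ l ne)

content-suc : ∀ q l κ → content (suc q) (replicate l 0 ++ map suc κ) ≡ l ∷ content q κ
content-suc q l κ = trans (cong (map _) (upTo-suc q)) (cong₂ _∷_
  (trans (count-++ 0 (replicate l 0) (map suc κ)) (trans (cong₂ _+_ (count-replicate 0 l) (count-zero-suc κ)) (ℕₚ.+-identityʳ l)))
  (trans (sym (Listₚ.map-∘ (upTo q))) (Listₚ.map-cong (λ b → trans (count-++ (suc b) (replicate l 0) (map suc κ)) (cong₂ _+_ (count-replicate-≢ l (λ ())) (count-suc b κ))) (upTo q))))

content-standard : ∀ ν → content (length ν) (map (block ν) (range1 (sum ν))) ≡ ν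
content-standard []       = refl
content-standard (l ∷ ls) = trans (cong (content (suc (length ls))) (standard-coloring l ls))
  (trans (content-suc (length ls) l _) (cong (l ∷_) (content-standard ls)))

block-< : ∀ ν {j} → j ∈ range1 (sum ν) → block ν j < length ν
block-< []       ()
block-< (l ∷ ls) {j} j∈ with ∈ₚ.∈-++⁻ (range1 l) (subst (j ∈_) (range1-+ l (sum ls)) j∈)
... | inj₁ m rewrite block-first l ls m = s≤s z≤n
... | inj₂ m with i , i∈ , refl ← ∈ₚ.∈-map⁻ (_+_ l) m rewrite block-rest l ls {sum ls} i∈ = s≤s (block-< ls i∈)

-- The filling condition doubles as the label of the character, ε for column-strict and η for
-- row-semistrict, so that the four identities become one.
charOf : FillCond → List ℕ → List ℕ → ℤ
charOf colStrict     = epsChar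
charOf rowSemistrict = etaChar

sgnT : FillCond → List ℕ → ℤ
sgnT colStrict     σ = sgnS σ
sgnT rowSemistrict σ = + 1

∑col : ℕ → ℕ → List ℕ → (List ℕ → ℤ) → ℤ
∑col q n ν F = ∑ (words q n) (λ κ → δ (content q κ ≟ᴸ ν) ℤ.* F κ)

charOf-divN : ∀ t ν σ → charOf t ν σ ≡
  divN (∑ (perms (length σ)) (λ x → if inYoung ν (conjS x σ) then sgnT t (conjS x σ) else + 0)) (youngOrder ν)
charOf-divN colStrict     ν σ = refl
charOf-divN rowSemistrict ν σ = refl

-- The summand of the induced character depends on `x` only through the colouring, and each
-- colouring of content `ν` arises from `youngOrder ν` permutations, which cancels the denominator.
charOf-formula : ∀ t ν {σ} → σ ↭ range1 (sum ν) →
  charOf t ν σ ≡ ∑col (length ν) (sum ν) ν (λ κ → δ (fixes? (sum ν) κ (at 0 σ)) ℤ.* sgnT t σ)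
charOf-formula t ν {σ} p = trans (charOf-divN t ν σ) (trans (cong (λ z → divN z (youngOrder ν)) total) (divN-exact (youngOrder ν) _ (youngOrder≢0 ν)))
  where
  k = sum ν
  F : List ℕ → ℤ
  F κ = δ (fixes? k κ (at 0 σ)) ℤ.* sgnT t σ
  sign : ∀ t {x} → x ∈ perms k → sgnT t (conjS x σ) ≡ sgnT t σ
  sign colStrict     x∈ = sgnS-conjS (perms-sound k x∈) p
  sign rowSemistrict x∈ = refl
  total : ∑ (perms (length σ)) (λ x → if inYoung ν (conjS x σ) then sgnT t (conjS x σ) else + 0) ≡ + youngOrder ν ℤ.* ∑col (length ν) k ν F
  total = trans (cong (λ m → ∑ (perms m) (λ x → if inYoung ν (conjS x σ) then sgnT t (conjS x σ) else + 0)) (trans (↭ₚ.↭-length p) (range1-length k)))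
    (trans (∑-cong (perms k) λ {x} x∈ → trans (cong (λ z → if inYoung ν (conjS x σ) then z else + 0) (sign t x∈))
        (if-δ (inYoung ν (conjS x σ)) (fixes? k (map (block ν) x) (at 0 σ)) (sgnT t σ) (inYoung⇒Fixes (perms-sound k x∈) p ν) (Fixes⇒inYoung (perms-sound k x∈) p ν)))
      (∑-perms-coloring (block ν) (block-< ν) (content-standard ν) F))

words-sound : ∀ q n {κ} → κ ∈ words q n → length κ ≡ n × All (_< q) κ
words-sound q zero    (here refl) = refl , []
words-sound q (suc n) κ∈ with a , a∈ , m ← find (∈ₚ.∈-concatMap⁻ (λ a → map (a ∷_) (words q n)) {xs = upTo q} κ∈)
  with κ′ , m′ , refl ← ∈ₚ.∈-map⁻ (a ∷_) m with l , b ← words-sound q n m′ = cong suc l , ∈ₚ.∈-upTo⁻ a∈ ∷ b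

words-complete : ∀ q {κ} → All (_< q) κ → κ ∈ words q (length κ)
words-complete q []       = here refl
words-complete q {a ∷ κ} (a< ∷ b) = ∈ₚ.∈-concatMap⁺ (λ a → map (a ∷_) (words q (length κ))) {xs = upTo q} (lose (∈ₚ.∈-upTo⁺ a<) (∈ₚ.∈-map⁺ (a ∷_) (words-complete q b)))

filterᵇ-↭ : ∀ {A : Set} (p : A → Bool) {xs ys} → xs ↭ ys → filterᵇ p xs ↭ filterᵇ p ys
filterᵇ-↭ p = ↭ₚ.filter-↭ (λ x → 𝔹ₚ.T? (p x))

filterᵇ-map : ∀ {A B : Set} (p : B → Bool) (f : A → B) xs → filterᵇ p (map f xs) ≡ map f (filterᵇ (p ∘ f) xs)
filterᵇ-map p f []       = refl
filterᵇ-map p f (x ∷ xs) with p (f x)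
... | true  = cong (f x ∷_) (filterᵇ-map p f xs)
... | false = filterᵇ-map p f xs

filterᵇ-cong : ∀ {A : Set} {p p′ : A → Bool} xs → (∀ {x} → x ∈ xs → p x ≡ p′ x) → filterᵇ p xs ≡ filterᵇ p′ xs
filterᵇ-cong []       _ = refl
filterᵇ-cong {p = p} {p′} (x ∷ xs) e with p x | p′ x | e (here refl)
... | true  | _ | refl = cong (x ∷_) (filterᵇ-cong xs (e ∘ there))
... | false | _ | refl = filterᵇ-cong xs (e ∘ there)

filterᵇ-∈⁻ : ∀ {A : Set} (p : A → Bool) xs {x} → x ∈ filterᵇ p xs → x ∈ xs × p x ≡ true
filterᵇ-∈⁻ p (y ∷ xs) x∈ with p y in eq
filterᵇ-∈⁻ p (y ∷ xs) (here refl) | true = here refl , eq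
filterᵇ-∈⁻ p (y ∷ xs) (there m)   | true with a , b ← filterᵇ-∈⁻ p xs m = there a , b
filterᵇ-∈⁻ p (y ∷ xs) m | false with a , b ← filterᵇ-∈⁻ p xs m = there a , b

filterᵇ-∈⁺ : ∀ {A : Set} (p : A → Bool) xs {x} → x ∈ xs → p x ≡ true → x ∈ filterᵇ p xs
filterᵇ-∈⁺ p (y ∷ xs) (here refl) e with p y
filterᵇ-∈⁺ p (y ∷ xs) (here refl) refl | true = here refl
filterᵇ-∈⁺ p (y ∷ xs) (there m) e with p y
... | true  = there (filterᵇ-∈⁺ p xs m e)
... | false = filterᵇ-∈⁺ p xs m e

filterᵇ-unique : ∀ {A : Set} (p : A → Bool) {xs} → Unique xs → Unique (filterᵇ p xs)
filterᵇ-unique p [] = []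
filterᵇ-unique p {x ∷ xs} (x∉ ∷ u) with p x
... | true  = All.tabulate (λ m → All.lookup x∉ (proj₁ (filterᵇ-∈⁻ p xs m))) ∷ filterᵇ-unique p u
... | false = filterᵇ-unique p u

-- Weights of colourings at a signed permutation

low? : ℕ → List ℕ → ℕ → Bool
low? r κ i = at 0 κ i ℕ.<ᵇ r

Low High : ℕ → ℕ → List ℕ → List ℕ
Low  r n κ = filterᵇ (low? r κ) (range1 n)
High r n κ = filterᵇ (not ∘ low? r κ) (range1 n)

sgT : FillCond → (ℕ → ℕ) → List ℕ → ℤ
sgT colStrict     f L = sg f L
sgT rowSemistrict f L = + 1

sgnZ : ℤ → ℤ
sgnZ a = if ⌊ a ℤ.<? + 0 ⌋ then -[1+ 0 ] else + 1

absOf : List ℤ → ℕ → ℕ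
absOf v = at 0 (map ∣_∣ v)

-- Contribution of the colouring κ to the character value at v; colours below r
-- belong to λ, the others to μ.
wt : ℕ → ℕ → FillCond → FillCond → List ℤ → List ℕ → ℤ
wt n r tU tV v κ = δ (fixes? n κ (absOf v)) ℤ.*
  (sgT tU (absOf v) (Low r n κ) ℤ.* (sgT tV (absOf v) (High r n κ) ℤ.* ∏ (High r n κ) (λ i → sgnZ (appB v (+ i)))))

sgnZ² : ∀ a → sgnZ a ℤ.* sgnZ a ≡ + 1
sgnZ² a with a ℤ.<? + 0
... | yes _ = refl
... | no _  = refl

sgnZ-neg : ∀ {n a} → a ∈ wires n → sgnZ (ℤ.- a) ≡ ℤ.- sgnZ a
sgnZ-neg {n} a∈ with wireView n a∈
... | pos _ = refl
... | neg _ = refl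

sgnZ-appB : ∀ {n v a} → IsBn n v → a ∈ wires n → sgnZ (appB v a) ≡ sgnZ a ℤ.* sgnZ (appB v (+ ∣ a ∣))
sgnZ-appB {n} {v} bv a∈ with wireView n a∈
... | pos _ = sym (ℤₚ.*-identityˡ _)
... | neg k<n = trans (sgnZ-neg {n} (appB-wire {n} {v} bv (pos∈wires k<n))) (sym (ℤₚ.-1*i≡-i _))

range1-wire : ∀ {n i} → i ∈ range1 n → + i ∈ wires n
range1-wire i∈ with k , k< , refl ← ∈-range1⁻ i∈ = pos∈wires k<

absOf-appB : ∀ v i → absOf v i ≡ ∣ appB v (+ i) ∣
absOf-appB v i = sym (abs-appB {0} v (+ i))

absOf-abs : ∀ v a → ∣ appB v a ∣ ≡ absOf v ∣ a ∣
absOf-abs v a = abs-appB {0} v a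

module Conj {n : ℕ} {x g : List ℤ} (bx : IsBn n x) (bg : IsBn n g) where
  private
    u = conjB x g
    bu : IsBn n u
    bu = IsBn-mulB {n} {mulB x g} {invB x} (IsBn-mulB {n} {x} {g} bx bg) (IsBn-invB {n} {x} bx)
    X = range1 n

  conj-app : ∀ {i} → i ∈ X → appB u (appB x (+ i)) ≡ appB x (appB g (+ i))
  conj-app {i} i∈ = trans (appB-mulB (mulB x g) (invB x) (appB x (+ i))) (trans (appB-mulB x g (appB (invB x) (appB x (+ i))))
    (cong (appB x ∘ appB g) (appB-invˡ {n} {x} bx (range1-wire i∈))))

  conj-abs : ∀ {i} → i ∈ X → absOf u (absOf x i) ≡ absOf x (absOf g i)
  conj-abs {i} i∈ = trans (cong (absOf u) (absOf-appB x i)) (trans (sym (absOf-abs u (appB x (+ i)))) (trans (cong ∣_∣ (conj-app i∈))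
    (trans (absOf-abs x (appB g (+ i))) (cong (absOf x) (sym (absOf-appB g i))))))

  private
    injx : InjOn (absOf x) X
    injx = at-inj (proj₂ bx)
    intox : MapsInto (absOf x) X
    intox = at-range (proj₂ bx)
    listx : map (absOf x) X ↭ X
    listx = stable-↭ (range1-unique n) injx intox
    preimage : ∀ {a} → a ∈ X → ∃ λ j → j ∈ X × a ≡ absOf x j
    preimage a∈ = ∈ₚ.∈-map⁻ (absOf x) (↭ₚ.∈-resp-↭ (↭-sym listx) a∈)

  module _ (κ₀ : List ℕ) where
    private
      κ = map (at 0 κ₀) (map ∣_∣ x)
      κ-at : ∀ {i} → i ∈ X → at 0 κ i ≡ at 0 κ₀ (absOf x i)
      κ-at = color-at (proj₂ bx) (proj₂ bx) (at 0 κ₀)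
      intog : MapsInto (absOf g) X
      intog = at-range (proj₂ bg)

      fixes⇒ : Fixes n κ₀ (absOf u) → Fixes n κ (absOf g)
      fixes⇒ fx = All.tabulate λ {i} i∈ → trans (κ-at (intog i∈)) (trans (cong (at 0 κ₀) (sym (conj-abs i∈))) (trans (All.lookup fx (intox i∈)) (sym (κ-at i∈))))

      fixes⇐ : Fixes n κ (absOf g) → Fixes n κ₀ (absOf u)
      fixes⇐ fx = All.tabulate λ {a} a∈ → case preimage a∈ of λ { (i , i∈ , refl) →
        trans (cong (at 0 κ₀) (conj-abs i∈)) (trans (sym (κ-at (intog i∈))) (trans (All.lookup fx i∈) (κ-at i∈))) }

      transport : ∀ p → filterᵇ (λ i → p (at 0 κ₀ i)) X ↭ map (absOf x) (filterᵇ (λ i → p (at 0 κ i)) X)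
      transport p = ↭-trans (filterᵇ-↭ (λ i → p (at 0 κ₀ i)) (↭-sym listx)) (↭-reflexive (trans (filterᵇ-map (λ i → p (at 0 κ₀ i)) (absOf x) X)
        (cong (map (absOf x)) (filterᵇ-cong X (λ i∈ → cong p (sym (κ-at i∈)))))))

      module OnSet (p : ℕ → Bool) (fx : Fixes n κ (absOf g)) where
        L₀ = filterᵇ (λ i → p (at 0 κ₀ i)) X
        L  = filterᵇ (λ i → p (at 0 κ i)) X
        L⊆ : ∀ {i} → i ∈ L → i ∈ X
        L⊆ m = proj₁ (filterᵇ-∈⁻ _ X m)
        L₀⊆ : ∀ {i} → i ∈ L₀ → i ∈ X
        L₀⊆ m = proj₁ (filterᵇ-∈⁻ _ X m)
        perm : L₀ ↭ map (absOf x) L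
        perm = transport p
        intoL : MapsInto (absOf g) L
        intoL m with i∈ , e ← filterᵇ-∈⁻ _ X m = filterᵇ-∈⁺ _ X (intog i∈) (trans (cong p (All.lookup fx i∈)) e)
        injL : InjOn (absOf g) L
        injL a b = at-inj (proj₂ bg) (L⊆ a) (L⊆ b)
        uL = filterᵇ-unique (λ i → p (at 0 κ i)) (range1-unique n)
        sgT-conj : ∀ t → sgT t (absOf u) L₀ ≡ sgT t (absOf g) L
        sgT-conj rowSemistrict = refl
        sgT-conj colStrict = trans (sg-↭ {f = absOf u} (filterᵇ-unique _ (range1-unique n)) (λ a b → at-inj (proj₂ bu) (L₀⊆ a) (L₀⊆ b)) perm)
          (sg-conj {f = absOf g} {f′ = absOf u} {x = absOf x} uL injL intoL (λ a b → injx (L⊆ a) (L⊆ b)) (λ m → conj-abs (L⊆ m)))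
        signs-conj : ∏ L₀ (λ i → sgnZ (appB u (+ i))) ≡ ∏ L (λ i → sgnZ (appB g (+ i)))
        signs-conj = begin
          ∏ L₀ (λ i → sgnZ (appB u (+ i)))
            ≡⟨ trans (∏-↭ _ perm) (∏-map (λ i → sgnZ (appB u (+ i))) (absOf x) L) ⟩
          ∏ L (λ i → sgnZ (appB u (+ absOf x i)))
            ≡⟨ ∏-cong L (λ m → entry-sign (L⊆ m)) ⟩
          ∏ L (λ i → sx i ℤ.* (sgnZ (appB g (+ i)) ℤ.* sx (absOf g i)))
            ≡⟨ trans (∏-* _ _ L) (cong (∏ L sx ℤ.*_) (trans (∏-* _ _ L) (cong (∏ L (λ i → sgnZ (appB g (+ i))) ℤ.*_) (trans (sym (∏-map sx (absOf g) L)) (∏-↭ sx (stable-↭ uL injL intoL)))))) ⟩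
          ∏ L sx ℤ.* (∏ L (λ i → sgnZ (appB g (+ i))) ℤ.* ∏ L sx)
            ≡⟨ trans (rot (∏ L sx) (∏ L (λ i → sgnZ (appB g (+ i))))) (trans (cong (∏ L (λ i → sgnZ (appB g (+ i))) ℤ.*_) (trans (sym (∏-* sx sx L)) (trans (∏-cong L (λ {i} _ → sgnZ² (appB x (+ i)))) (∏-one L)))) (ℤₚ.*-identityʳ _)) ⟩
          ∏ L (λ i → sgnZ (appB g (+ i))) ∎
          where
          open ≡-Reasoning
          sx : ℕ → ℤ
          sx i = sgnZ (appB x (+ i))
          rot : ∀ a b → a ℤ.* (b ℤ.* a) ≡ b ℤ.* (a ℤ.* a)
          rot = ℤ-solve-∀
          cancel : ∀ a s c → a ℤ.* a ≡ + 1 → a ℤ.* s ≡ c → s ≡ a ℤ.* c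
          cancel a s c a² e = trans (sym (ℤₚ.*-identityˡ s)) (trans (cong (ℤ._* s) (sym a²)) (trans (ℤₚ.*-assoc a a s) (cong (a ℤ.*_) e)))
          entry-sign : ∀ {i} → i ∈ X → sgnZ (appB u (+ absOf x i)) ≡ sx i ℤ.* (sgnZ (appB g (+ i)) ℤ.* sx (absOf g i))
          entry-sign {i} i∈ = cancel (sx i) (sgnZ (appB u (+ absOf x i))) (sgnZ (appB g (+ i)) ℤ.* sx (absOf g i)) (sgnZ² (appB x (+ i)))
            (trans (cong (λ j → sx i ℤ.* sgnZ (appB u (+ j))) (absOf-appB x i))
            (trans (sym (sgnZ-appB {n} {u} bu (appB-wire {n} {x} bx (range1-wire i∈))))
            (trans (cong sgnZ (conj-app i∈))
            (trans (sgnZ-appB {n} {x} bx (appB-wire {n} {g} bg (range1-wire i∈)))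
            (cong (λ j → sgnZ (appB g (+ i)) ℤ.* sx j) (sym (absOf-appB g i)))))))

    -- Conjugation relabels the elements, so the colouring is pulled back along the absolute values
    -- of `x`. Each sign of `x` enters once at a position and once at an image under `g`; over a set
    -- stable under `g` these signs cancel.
    wt-conj : ∀ r tU tV → wt n r tU tV u κ₀ ≡ wt n r tU tV g κ
    wt-conj r tU tV with fixes? n κ₀ (absOf u) | fixes? n κ (absOf g)
    ... | no _   | no _  = refl
    ... | yes p  | no ¬q = contradiction (fixes⇒ p) ¬q
    ... | no ¬p  | yes q = contradiction (fixes⇐ q) ¬p
    ... | yes _  | yes q = cong (+ 1 ℤ.*_) (cong₂ ℤ._*_ (OnSet.sgT-conj (ℕ._<ᵇ r) q tU)
            (cong₂ ℤ._*_ (OnSet.sgT-conj (λ c → not (c ℕ.<ᵇ r)) q tV) (OnSet.signs-conj (λ c → not (c ℕ.<ᵇ r)) q)))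

at-++ˡ : ∀ {A : Set} {d : A} xs {ys i} → i ∈ range1 (length xs) → at d (xs ++ ys) i ≡ at d xs i
at-++ˡ {d = d} xs {ys} i∈ with k , k< , refl ← ∈-range1⁻ i∈ = go xs k<
  where
  go : ∀ xs {k} → k < length xs → at d (xs ++ ys) (suc k) ≡ at d xs (suc k)
  go (x ∷ xs) {zero}  _        = refl
  go (x ∷ xs) {suc k} (s≤s k<) = go xs k<

at-++ʳ : ∀ {A : Set} {d : A} xs {ys i l} → i ∈ range1 l → at d (xs ++ ys) (length xs + i) ≡ at d ys i
at-++ʳ {d = d} xs {ys} i∈ with k , k< , refl ← ∈-range1⁻ i∈ = trans (cong (at d (xs ++ ys)) (ℕₚ.+-suc (length xs) k)) (go xs)
  where
  go : ∀ xs → at d (xs ++ ys) (suc (length xs + k)) ≡ at d ys (suc k)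
  go []       = refl
  go (x ∷ xs) = go xs

++-cancelˡ-↭ : ∀ {A : Set} (xs : List A) {ys zs} → xs ++ ys ↭ xs ++ zs → ys ↭ zs
++-cancelˡ-↭ []       p = p
++-cancelˡ-↭ (x ∷ xs) p = ++-cancelˡ-↭ xs (↭ₚ.drop-∷ p)

filterᵇ-all : ∀ {A : Set} (p : A → Bool) xs → (∀ {x} → x ∈ xs → p x ≡ true) → filterᵇ p xs ≡ xs
filterᵇ-all p []       _ = refl
filterᵇ-all p (x ∷ xs) h with p x | h (here refl)
... | true | _ = cong (x ∷_) (filterᵇ-all p xs (h ∘ there))

filterᵇ-none : ∀ {A : Set} (p : A → Bool) xs → (∀ {x} → x ∈ xs → p x ≡ false) → filterᵇ p xs ≡ []
filterᵇ-none p []       _ = refl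
filterᵇ-none p (x ∷ xs) h with p x | h (here refl)
... | false | _ = filterᵇ-none p xs (h ∘ there)

filterᵇ-++ : ∀ {A : Set} (p : A → Bool) xs ys → filterᵇ p (xs ++ ys) ≡ filterᵇ p xs ++ filterᵇ p ys
filterᵇ-++ p = Listₚ.filter-++ (λ x → 𝔹ₚ.T? (p x))

<⇒<ᵇ≡true : ∀ {a b} → a < b → (a ℕ.<ᵇ b) ≡ true
<⇒<ᵇ≡true {a} {b} lt with a ℕ.<ᵇ b | ℕₚ.<⇒<ᵇ lt
... | true | _ = refl

≥⇒<ᵇ≡false : ∀ {a b} → b ≤ a → (a ℕ.<ᵇ b) ≡ false
≥⇒<ᵇ≡false {a} {b} le with a ℕ.<ᵇ b in eq
... | false = refl
... | true  = contradiction (ℕₚ.<ᵇ⇒< a b (subst T (sym eq) tt)) (ℕₚ.≤⇒≯ le)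

allB-false : ∀ {A : Set} (p : A → Bool) xs → allB p xs ≡ false → ∃ λ x → x ∈ xs × p x ≡ false
allB-false p (x ∷ xs) e with p x in eq
... | false = x , here refl , eq
... | true with y , y∈ , e′ ← allB-false p xs e = y , there y∈ , e′

ord-shift : ∀ k a b → ord (k + a) (k + b) ≡ ord a b
ord-shift k a b with ℕₚ.<-cmp a b
... | tri< lt _ _   = trans (ord-< (ℕₚ.+-monoʳ-< k lt)) (sym (ord-< lt))
... | tri> _ _ gt   = trans (ord-> (ℕₚ.+-monoʳ-< k gt)) (sym (ord-> gt))
... | tri≈ _ refl _ = trans (same (k + a)) (sym (same a))
  where
  same : ∀ a → ord a a ≡ + 1
  same a rewrite ≥⇒<ᵇ≡false {a} {a} ℕₚ.≤-refl = refl

∏-sgnZ-negPow : ∀ v → ∏ v sgnZ ≡ negPow (negCount v)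
∏-sgnZ-negPow []      = refl
∏-sgnZ-negPow (a ∷ v) with a ℤ.<? + 0
... | yes _ = trans (ℤₚ.-1*i≡-i _) (cong ℤ.-_ (∏-sgnZ-negPow v))
... | no _  = trans (ℤₚ.*-identityˡ _) (∏-sgnZ-negPow v)

∑col-cong : ∀ q n ν {F G : List ℕ → ℤ} → (∀ {κ} → κ ∈ words q n → content q κ ≡ ν → F κ ≡ G κ) → ∑col q n ν F ≡ ∑col q n ν G
∑col-cong q n ν {F} {G} e = ∑-cong (words q n) go
  where
  go : ∀ {κ} → κ ∈ words q n → δ (content q κ ≟ᴸ ν) ℤ.* F κ ≡ δ (content q κ ≟ᴸ ν) ℤ.* G κ
  go {κ} κ∈ with content q κ ≟ᴸ ν
  ... | yes c = cong (+ 1 ℤ.*_) (e κ∈ c)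
  ... | no _  = trans (ℤₚ.*-zeroˡ (F κ)) (sym (ℤₚ.*-zeroˡ (G κ)))

∑col-*ʳ : ∀ q n ν F c → ∑col q n ν (λ κ → F κ ℤ.* c) ≡ ∑col q n ν F ℤ.* c
∑col-*ʳ q n ν F c = trans (∑-cong (words q n) (λ {κ} _ → sym (ℤₚ.*-assoc (δ (content q κ ≟ᴸ ν)) (F κ) c))) (∑-*ʳ c _ (words q n))

∑col-*ˡ : ∀ q n ν c F → ∑col q n ν (λ κ → c ℤ.* F κ) ≡ c ℤ.* ∑col q n ν F
∑col-*ˡ q n ν c F = trans (∑-cong (words q n) (λ {κ} _ → exch (δ (content q κ ≟ᴸ ν)) c (F κ))) (∑-*ˡ c _ (words q n))
  where
  exch : ∀ a b c → a ℤ.* (b ℤ.* c) ≡ b ℤ.* (a ℤ.* c)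
  exch = ℤ-solve-∀

∑col-zero : ∀ q n ν → ∑col q n ν (λ _ → + 0) ≡ + 0
∑col-zero q n ν = trans (∑-cong (words q n) (λ {κ} _ → ℤₚ.*-zeroʳ (δ (content q κ ≟ᴸ ν)))) (∑-zero (words q n))

∑col-swap : ∀ {A : Set} (xs : List A) q n ν (F : A → List ℕ → ℤ) →
            ∑ xs (λ x → ∑col q n ν (F x)) ≡ ∑col q n ν (λ κ → ∑ xs (λ x → F x κ))
∑col-swap xs q n ν F = trans (∑-swap _ xs (words q n)) (∑-cong (words q n) (λ {κ} _ → ∑-*ˡ (δ (content q κ ≟ᴸ ν)) (λ x → F x κ) xs))

-- Product characters as sums over pairs of colourings

module ProdChar (λ′ μ : List ℕ) (tU tV : FillCond) where
  k = sum λ′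
  l = sum μ
  r = length λ′
  s = length μ
  n = k + l

  _⊞_ : List ℕ → List ℕ → List ℕ
  κ₁ ⊞ κ₂ = κ₁ ++ map (_+_ r) κ₂

  module Glue {κ₁ κ₂ : List ℕ} (m₁ : κ₁ ∈ words r k) (m₂ : κ₂ ∈ words s l) where
    private
      len₁ = proj₁ (words-sound r k m₁)
      len₂ = proj₁ (words-sound s l m₂)
    K = κ₁ ⊞ κ₂
    K-low : ∀ {i} → i ∈ range1 k → at 0 K i ≡ at 0 κ₁ i
    K-low {i} i∈ = at-++ˡ κ₁ (subst (λ m → i ∈ range1 m) (sym len₁) i∈)
    κ₁-< : ∀ {i} → i ∈ range1 k → at 0 κ₁ i < r
    κ₁-< i∈ with j , j< , refl ← ∈-range1⁻ i∈ = All.lookup (proj₂ (words-sound r k m₁)) (at-∈ κ₁ (subst (j <_) (sym len₁) j<))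
    K-high : ∀ {j} → j ∈ range1 l → at 0 K (k + j) ≡ r + at 0 κ₂ j
    K-high {j} j∈ = trans (cong (λ m → at 0 K (m + j)) (sym len₁)) (trans (at-++ʳ κ₁ j∈) (go j∈))
      where
      go : ∀ {j} → j ∈ range1 l → at 0 (map (_+_ r) κ₂) j ≡ r + at 0 κ₂ j
      go j∈ with j , j< , refl ← ∈-range1⁻ j∈ =
        trans (at-irrelevant {d′ = r + 0} (map (_+_ r) κ₂) (subst (j <_) (sym (trans (Listₚ.length-map (_+_ r) κ₂) len₂)) j<)) (at-map (_+_ r) 0 κ₂ (suc j))
    low-true : ∀ {i} → i ∈ range1 k → low? r K i ≡ true
    low-true i∈ = trans (cong (ℕ._<ᵇ r) (K-low i∈)) (<⇒<ᵇ≡true (κ₁-< i∈))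
    low-false : ∀ {i} → i ∈ map (_+_ k) (range1 l) → low? r K i ≡ false
    low-false i∈ with j , j∈ , refl ← ∈ₚ.∈-map⁻ (_+_ k) i∈ = trans (cong (ℕ._<ᵇ r) (K-high j∈)) (≥⇒<ᵇ≡false (ℕₚ.m≤m+n r _))
    Low-K : Low r n K ≡ range1 k
    Low-K = trans (cong (filterᵇ (low? r K)) (range1-+ k l)) (trans (filterᵇ-++ (low? r K) (range1 k) _)
      (trans (cong₂ _++_ (filterᵇ-all _ (range1 k) low-true) (filterᵇ-none _ _ low-false)) (Listₚ.++-identityʳ (range1 k))))
    High-K : High r n K ≡ map (_+_ k) (range1 l)
    High-K = trans (cong (filterᵇ (not ∘ low? r K)) (range1-+ k l)) (trans (filterᵇ-++ (not ∘ low? r K) (range1 k) _)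
      (cong₂ _++_ (filterᵇ-none _ (range1 k) (λ i∈ → cong not (low-true i∈))) (filterᵇ-all _ _ (λ i∈ → cong not (low-false i∈)))))

  module Element {u : List ℤ} (bu : IsBn n u) where
    private
      P  = map ∣_∣ u
      P₁ = map ∣_∣ (take k u)
      P₂ = map ∣_∣ (drop k u)
      P-split : P ≡ P₁ ++ P₂
      P-split = trans (cong (map ∣_∣) (sym (Listₚ.take++drop≡id k u))) (Listₚ.map-++ ∣_∣ (take k u) (drop k u))
      len₁ : length P₁ ≡ k
      len₁ = trans (Listₚ.length-map ∣_∣ (take k u)) (trans (Listₚ.length-take k u) (ℕₚ.m≤n⇒m⊓n≡m (subst (k ≤_) (sym (proj₁ bu)) (ℕₚ.m≤m+n k l))))
      f = absOf u
      f-low : ∀ {i} → i ∈ range1 k → f i ≡ at 0 P₁ i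
      f-low {i} i∈ = trans (cong (λ p → at 0 p i) P-split) (at-++ˡ P₁ (subst (λ m → i ∈ range1 m) (sym len₁) i∈))
      f-high : ∀ {j} → j ∈ range1 l → f (k + j) ≡ at 0 P₂ j
      f-high {j} j∈ = trans (cong₂ (λ p m → at 0 p (m + j)) P-split (sym len₁)) (at-++ʳ P₁ j∈)
      P∈ : ∀ {a} → a ∈ P₁ ⊎ a ∈ P₂ → a ∈ range1 n
      P∈ {a} (inj₁ m) = ↭ₚ.∈-resp-↭ (proj₂ bu) (subst (a ∈_) (sym P-split) (∈ₚ.∈-++⁺ˡ m))
      P∈ {a} (inj₂ m) = ↭ₚ.∈-resp-↭ (proj₂ bu) (subst (a ∈_) (sym P-split) (∈ₚ.∈-++⁺ʳ P₁ m))

    module Inside (inside : inBkBnk k u ≡ true) where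
      σ₁ = P₁
      σ₂ = map (λ a → ∣ a ∣ ∸ k) (drop k u)
      private
        small : ∀ {a} → a ∈ P₁ → a ∈ range1 k
        small m with a , a∈ , refl ← ∈ₚ.∈-map⁻ ∣_∣ m with j , j< , e ← ∈-range1⁻ (P∈ (inj₁ m)) =
          subst (_∈ range1 k) (sym e) (∈-range1⁺ (subst (_≤ k) e (ℕₚ.≤ᵇ⇒≤ ∣ a ∣ k (subst T (sym (allB⁻ (λ a → ∣ a ∣ ℕ.≤ᵇ k) (take k u) inside a∈)) tt))))
        unique₁ : Unique P₁
        unique₁ = prefix P₁ (subst Unique P-split (IsBn-abs-unique {n} {u} bu))
          where
          prefix : ∀ {A : Set} (xs : List A) {ys} → Unique (xs ++ ys) → Unique xs
          prefix []       _ = []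
          prefix (x ∷ xs) (a ∷ u) = Allₚ.++⁻ˡ xs a ∷ prefix xs u
      σ₁-perm : σ₁ ↭ range1 k
      σ₁-perm = unique-⊆-↭ unique₁ small (ℕₚ.≤-reflexive (trans (range1-length k) (sym len₁)))
      private
        P₂-perm : P₂ ↭ map (_+_ k) (range1 l)
        P₂-perm = ++-cancelˡ-↭ (range1 k) (↭-trans (↭ₚ.++⁺ʳ P₂ (↭-sym σ₁-perm)) (↭-trans (↭-reflexive (sym P-split)) (↭-trans (proj₂ bu) (↭-reflexive (range1-+ k l)))))
        σ₂-alt : σ₂ ≡ map (_∸ k) P₂
        σ₂-alt = Listₚ.map-∘ (drop k u)
      σ₂-perm : σ₂ ↭ range1 l
      σ₂-perm = ↭-trans (↭-reflexive σ₂-alt) (↭-trans (↭ₚ.map⁺ (_∸ k) P₂-perm) (↭-reflexive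
        (trans (sym (Listₚ.map-∘ (range1 l))) (trans (Listₚ.map-cong (ℕₚ.m+n∸m≡n k) (range1 l)) (Listₚ.map-id (range1 l))))))
      private
        P₂-shift : P₂ ≡ map (_+_ k) σ₂
        P₂-shift = sym (trans (cong (map (_+_ k)) σ₂-alt) (trans (sym (Listₚ.map-∘ P₂)) (trans (Listₚ.map-cong-local (All.tabulate back)) (Listₚ.map-id P₂))))
          where
          back : ∀ {a} → a ∈ P₂ → k + (a ∸ k) ≡ a
          back a∈ with j , _ , refl ← ∈ₚ.∈-map⁻ (_+_ k) (↭ₚ.∈-resp-↭ P₂-perm a∈) = cong (_+_ k) (ℕₚ.m+n∸m≡n k j)
        len₂ : length σ₂ ≡ l
        len₂ = trans (↭ₚ.↭-length σ₂-perm) (range1-length l)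
        f-high′ : ∀ {j} → j ∈ range1 l → f (k + j) ≡ k + at 0 σ₂ j
        f-high′ {j} j∈ = trans (f-high j∈) (trans (cong (λ p → at 0 p j) P₂-shift) (go j∈))
          where
          go : ∀ {j} → j ∈ range1 l → at 0 (map (_+_ k) σ₂) j ≡ k + at 0 σ₂ j
          go j∈ with j , j< , refl ← ∈-range1⁻ j∈ =
            trans (at-irrelevant {d′ = k + 0} (map (_+_ k) σ₂) (subst (j <_) (sym (trans (Listₚ.length-map (_+_ k) σ₂) len₂)) j<)) (at-map (_+_ k) 0 σ₂ (suc j))
        sign₁ : ∀ t → sgT t f (range1 k) ≡ sgnT t σ₁
        sign₁ rowSemistrict = refl
        sign₁ colStrict = trans (sg-cong (range1 k) f-low) (trans (sg-sorted (at 0 σ₁) (range1-increasing k)) (trans (cong (pairProd ord) (tabulate-at σ₁ len₁)) (sym (sgnS-pairProd σ₁))))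
        sign₂ : ∀ t → sgT t f (map (_+_ k) (range1 l)) ≡ sgnT t σ₂
        sign₂ rowSemistrict = refl
        sign₂ colStrict = begin
          sg f (map (_+_ k) (range1 l))
            ≡⟨ sg-sorted f (AllPairsₚ.map⁺ (AllPairs.map (ℕₚ.+-monoʳ-< k) (range1-increasing l))) ⟩
          pairProd ord (map f (map (_+_ k) (range1 l)))
            ≡⟨ cong (pairProd ord) (trans (sym (Listₚ.map-∘ (range1 l))) (trans (Listₚ.map-cong-local (All.tabulate f-high′)) (Listₚ.map-∘ (range1 l)))) ⟩
          pairProd ord (map (_+_ k) (map (at 0 σ₂) (range1 l)))
            ≡⟨ cong (λ p → pairProd ord (map (_+_ k) p)) (tabulate-at σ₂ len₂) ⟩
          pairProd ord (map (_+_ k) σ₂)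
            ≡⟨ trans (pairProd-map ord (_+_ k) σ₂) (pairProd-cong (all-pairs σ₂)) ⟩
          pairProd ord σ₂
            ≡⟨ sym (sgnS-pairProd σ₂) ⟩
          sgnS σ₂ ∎
          where
          open ≡-Reasoning
          all-pairs : ∀ L → AllPairs (λ a b → ord (k + a) (k + b) ≡ ord a b) L
          all-pairs []      = []
          all-pairs (a ∷ L) = All.tabulate (λ {b} _ → ord-shift k a b) ∷ all-pairs L
        negs : ∏ (map (_+_ k) (range1 l)) (λ i → sgnZ (appB u (+ i))) ≡ negPow (negCount (drop k u))
        negs = trans (∏-map (λ i → sgnZ (appB u (+ i))) (_+_ k) (range1 l)) (trans (∏-cong (range1 l) (λ j∈ → cong sgnZ (value j∈)))
          (trans (sym (∏-map sgnZ (at (+ 0) (drop k u)) (range1 l))) (trans (cong (λ v → ∏ v sgnZ) (tabulate-at (drop k u) len-drop)) (∏-sgnZ-negPow (drop k u)))))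
          where
          len-take : length (take k u) ≡ k
          len-take = trans (sym (Listₚ.length-map ∣_∣ (take k u))) len₁
          len-drop : length (drop k u) ≡ l
          len-drop = trans (sym (Listₚ.length-map _ (drop k u))) len₂
          value : ∀ {j} → j ∈ range1 l → appB u (+ (k + j)) ≡ at (+ 0) (drop k u) j
          value {j} j∈ = trans (pos-app j∈) (trans (cong₂ (λ p m → at (+ 0) p (m + j)) (sym (Listₚ.take++drop≡id k u)) (sym len-take)) (at-++ʳ (take k u) j∈))
            where
            pos-app : ∀ {j} → j ∈ range1 l → appB u (+ (k + j)) ≡ at (+ 0) u (k + j)
            pos-app j∈ with j , _ , refl ← ∈-range1⁻ j∈ rewrite ℕₚ.+-suc k j = refl

      module _ {κ₁ κ₂} (m₁ : κ₁ ∈ words r k) (m₂ : κ₂ ∈ words s l) where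
        open Glue m₁ m₂
        private
          fixes⇒ : Fixes n K f → Fixes k κ₁ (at 0 σ₁) × Fixes l κ₂ (at 0 σ₂)
          fixes⇒ fx = All.tabulate (λ {i} i∈ → trans (sym (K-low (at-range σ₁-perm i∈))) (trans (cong (at 0 K) (sym (f-low i∈))) (trans (lk (∈ₚ.∈-++⁺ˡ i∈)) (K-low i∈)))) ,
            All.tabulate (λ {j} j∈ → ℕₚ.+-cancelˡ-≡ r _ _ (trans (sym (K-high (at-range σ₂-perm j∈))) (trans (cong (at 0 K) (sym (f-high′ j∈))) (trans (lk (∈ₚ.∈-++⁺ʳ (range1 k) (∈ₚ.∈-map⁺ (_+_ k) j∈))) (K-high j∈)))))
            where
            lk : ∀ {i} → i ∈ range1 k ++ map (_+_ k) (range1 l) → at 0 K (f i) ≡ at 0 K i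
            lk {i} i∈ = All.lookup fx (subst (i ∈_) (sym (range1-+ k l)) i∈)
          fixes⇐ : Fixes k κ₁ (at 0 σ₁) → Fixes l κ₂ (at 0 σ₂) → Fixes n K f
          fixes⇐ fx₁ fx₂ = All.tabulate λ {i} i∈ → case ∈ₚ.∈-++⁻ (range1 k) (subst (i ∈_) (range1-+ k l) i∈) of λ
            { (inj₁ m) → trans (cong (at 0 K) (f-low m)) (trans (K-low (at-range σ₁-perm m)) (trans (All.lookup fx₁ m) (sym (K-low m))))
            ; (inj₂ m) → case ∈ₚ.∈-map⁻ (_+_ k) m of λ { (j , j∈ , refl) →
                trans (cong (at 0 K) (f-high′ j∈)) (trans (K-high (at-range σ₂-perm j∈)) (trans (cong (_+_ r) (All.lookup fx₂ j∈)) (sym (K-high j∈)))) } }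
          δ-fixes : δ (fixes? n K f) ≡ δ (fixes? k κ₁ (at 0 σ₁)) ℤ.* δ (fixes? l κ₂ (at 0 σ₂))
          δ-fixes with fixes? k κ₁ (at 0 σ₁) | fixes? l κ₂ (at 0 σ₂)
          ... | yes p | yes q = δ-yes (fixes? n K f) (fixes⇐ p q)
          ... | yes _ | no ¬q = δ-no (fixes? n K f) (¬q ∘ proj₂ ∘ fixes⇒)
          ... | no ¬p | q?    = trans (δ-no (fixes? n K f) (¬p ∘ proj₁ ∘ fixes⇒)) (sym (ℤₚ.*-zeroˡ (δ q?)))
        wt-inside : wt n r tU tV u K ≡ (δ (fixes? k κ₁ (at 0 σ₁)) ℤ.* sgnT tU σ₁) ℤ.* (negPow (negCount (drop k u)) ℤ.* (δ (fixes? l κ₂ (at 0 σ₂)) ℤ.* sgnT tV σ₂))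
        wt-inside = trans (cong₂ ℤ._*_ δ-fixes (cong₂ ℤ._*_ (trans (cong (sgT tU f) Low-K) (sign₁ tU))
            (cong₂ ℤ._*_ (trans (cong (sgT tV f) High-K) (sign₂ tV)) (trans (cong (λ L → ∏ L (λ i → sgnZ (appB u (+ i)))) High-K) negs))))
          (arrange (δ (fixes? k κ₁ (at 0 σ₁))) (δ (fixes? l κ₂ (at 0 σ₂))) (sgnT tU σ₁) (sgnT tV σ₂) (negPow (negCount (drop k u))))
          where
          arrange : ∀ d e a b c → (d ℤ.* e) ℤ.* (a ℤ.* (b ℤ.* c)) ≡ (d ℤ.* a) ℤ.* (c ℤ.* (e ℤ.* b))
          arrange = ℤ-solve-∀

    -- An element sent out of `[k]` would have to keep a colour below `r` while landing among the
    -- elements with colours from `r` on.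
    wt-outside : inBkBnk k u ≡ false → ∀ {κ₁ κ₂} → κ₁ ∈ words r k → κ₂ ∈ words s l → wt n r tU tV u (κ₁ ⊞ κ₂) ≡ + 0
    wt-outside out {κ₁} {κ₂} m₁ m₂ = cong (ℤ._* (sgT tU f (Low r n K) ℤ.* (sgT tV f (High r n K) ℤ.* ∏ (High r n K) (λ i → sgnZ (appB u (+ i)))))) (δ-no (fixes? n K f) broken)
      where
      open Glue m₁ m₂
      broken : ¬ Fixes n K f
      broken fx with a , a∈ , e ← allB-false (λ a → ∣ a ∣ ℕ.≤ᵇ k) (take k u) out
        with i , i< , ea ← ∈-at {d = 0} (∈ₚ.∈-map⁺ ∣_∣ a∈)
        with i∈ ← ∈-range1⁺ {k} (subst (i <_) len₁ i<)
        with ∈ₚ.∈-++⁻ (range1 k) (subst (∣ a ∣ ∈_) (range1-+ k l) (P∈ (inj₁ (∈ₚ.∈-map⁺ ∣_∣ a∈))))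
      ... | inj₁ m with j , j< , ej ← ∈-range1⁻ m = contradiction (trans (sym e) (≤ᵇ-true (subst (_≤ k) (sym ej) j<))) (λ ())
        where
        ≤ᵇ-true : ∀ {a b} → a ≤ b → (a ℕ.≤ᵇ b) ≡ true
        ≤ᵇ-true {a} {b} le with a ℕ.≤ᵇ b | ℕₚ.≤⇒≤ᵇ le
        ... | true | _ = refl
      ... | inj₂ m with j , j∈ , ej ← ∈ₚ.∈-map⁻ (_+_ k) m =
        ℕₚ.<⇒≱ (κ₁-< i∈) (subst (r ≤_) chain (ℕₚ.m≤m+n r (at 0 κ₂ j)))
        where
        chain : r + at 0 κ₂ j ≡ at 0 κ₁ (suc i)
        chain = trans (sym (K-high j∈)) (trans (cong (at 0 K) (trans (sym ej) (trans (sym ea) (sym (f-low i∈)))))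
          (trans (All.lookup fx (subst (suc i ∈_) (sym (range1-+ k l)) (∈ₚ.∈-++⁺ˡ i∈))) (K-low i∈)))

    -- Inside the subgroup the weight of a glued colouring is a product of two weights, one for each
    -- factor; outside, every weight vanishes.
    prodChar-formula : (if inBkBnk k u then prodChar k (charOf tU λ′) (charOf tV μ) u else + 0) ≡
                       ∑col r k λ′ (λ κ₁ → ∑col s l μ (λ κ₂ → wt n r tU tV u (κ₁ ⊞ κ₂)))
    prodChar-formula with inBkBnk k u in eq
    ... | false = sym (trans (∑col-cong r k λ′ (λ m₁ _ → trans (∑col-cong s l μ (λ m₂ _ → wt-outside eq m₁ m₂)) (∑col-zero s l μ))) (∑col-zero r k λ′))
    ... | true  = sym (begin
      ∑col r k λ′ (λ κ₁ → ∑col s l μ (λ κ₂ → wt n r tU tV u (κ₁ ⊞ κ₂)))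
        ≡⟨ ∑col-cong r k λ′ (λ {κ₁} m₁ _ → trans (∑col-cong s l μ (λ {κ₂} m₂ _ → wt-inside m₁ m₂)) (trans (∑col-*ˡ s l μ (F₁ κ₁) (λ κ₂ → B ℤ.* F₂ κ₂)) (cong (F₁ κ₁ ℤ.*_) (∑col-*ˡ s l μ B F₂)))) ⟩
      ∑col r k λ′ (λ κ₁ → F₁ κ₁ ℤ.* (B ℤ.* ∑col s l μ F₂))
        ≡⟨ ∑col-*ʳ r k λ′ F₁ (B ℤ.* ∑col s l μ F₂) ⟩
      ∑col r k λ′ F₁ ℤ.* (B ℤ.* ∑col s l μ F₂)
        ≡⟨ cong₂ (λ a b → a ℤ.* (B ℤ.* b)) (sym (charOf-formula tU λ′ σ₁-perm)) (sym (charOf-formula tV μ σ₂-perm)) ⟩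
      charOf tU λ′ σ₁ ℤ.* (B ℤ.* charOf tV μ σ₂) ∎)
      where
      open ≡-Reasoning
      open Inside eq
      B = negPow (negCount (drop k u))
      F₁ F₂ : List ℕ → ℤ
      F₁ κ₁ = δ (fixes? k κ₁ (at 0 σ₁)) ℤ.* sgnT tU σ₁
      F₂ κ₂ = δ (fixes? l κ₂ (at 0 σ₂)) ℤ.* sgnT tV σ₂

  content-⊞ : ∀ {κ₁ κ₂} → κ₁ ∈ words r k → content r κ₁ ≡ λ′ → content s κ₂ ≡ μ → content (r + s) (κ₁ ⊞ κ₂) ≡ λ′ ++ μ
  content-⊞ {κ₁} {κ₂} m₁ refl₁ refl₂ = begin
    map cnt (upTo (r + s))
      ≡⟨ cong (map cnt) (upTo-+ r s) ⟩
    map cnt (upTo r ++ map (_+_ r) (upTo s))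
      ≡⟨ trans (Listₚ.map-++ cnt (upTo r) _) (cong₂ _++_ (Listₚ.map-cong-local (All.tabulate lows)) (trans (sym (Listₚ.map-∘ (upTo s))) (Listₚ.map-cong highs (upTo s)))) ⟩
    content r κ₁ ++ content s κ₂
      ≡⟨ cong₂ _++_ refl₁ refl₂ ⟩
    λ′ ++ μ ∎
    where
    open ≡-Reasoning
    cnt = λ b → count b (κ₁ ⊞ κ₂)
    bound = proj₂ (words-sound r k m₁)
    upTo-+ : ∀ a b → upTo (a + b) ≡ upTo a ++ map (_+_ a) (upTo b)
    upTo-+ zero    b = sym (Listₚ.map-id (upTo b))
    upTo-+ (suc a) b = trans (upTo-suc (a + b)) (cong (0 ∷_) (trans (cong (map suc) (upTo-+ a b)) (trans (Listₚ.map-++ suc (upTo a) _) (cong₂ _++_ (Listₚ.map-upTo suc a) (sym (Listₚ.map-∘ (upTo b)))))))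
    lows : ∀ {b} → b ∈ upTo r → cnt b ≡ count b κ₁
    lows {b} b∈ = trans (count-++ b κ₁ _) (trans (cong (_+_ (count b κ₁)) (trans (sumOf-map _ (_+_ r) κ₂) (trans (sumOf-cong κ₂ (λ {a} _ → cong χ (⌊⌋-false (r + a ℕ.≟ b) (λ e → ℕₚ.<⇒≱ (∈ₚ.∈-upTo⁻ b∈) (subst (r ≤_) e (ℕₚ.m≤m+n r a)))))) (sumOf-zero κ₂)))) (ℕₚ.+-identityʳ _))
    highs : ∀ b → cnt (r + b) ≡ count b κ₂
    highs b = trans (count-++ (r + b) κ₁ _) (cong₂ _+_ (trans (sumOf-cong κ₁ (λ {a} a∈ → cong χ (⌊⌋-false (a ℕ.≟ r + b) (λ e → ℕₚ.<⇒≱ (All.lookup bound a∈) (subst (r ≤_) (sym e) (ℕₚ.m≤m+n r b)))))) (sumOf-zero κ₁))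
      (trans (sumOf-map _ (_+_ r) κ₂) (sumOf-cong κ₂ (λ {a} _ → cong χ (χ-cong (r + a ℕ.≟ r + b) (a ℕ.≟ b) (ℕₚ.+-cancelˡ-≡ r a b) (cong (_+_ r)))))))

-- Averaging over the hyperoctahedral group

signs-abs : ∀ τ {x} → x ∈ signs τ → map ∣_∣ x ≡ τ
signs-abs []      (here refl) = refl
signs-abs (a ∷ τ) x∈ with y , y∈ , m ← find (∈ₚ.∈-concatMap⁻ (λ y → (+ a ∷ y) ∷ (ℤ.- (+ a) ∷ y) ∷ []) {xs = signs τ} x∈) with m
... | here refl         = cong (a ∷_) (signs-abs τ y∈)
... | there (here refl) = cong₂ _∷_ (ℤₚ.∣-i∣≡∣i∣ (+ a)) (signs-abs τ y∈)

∑-signs : ∀ (τ : List ℕ) (F : List ℕ → ℤ) → ∑ (signs τ) (λ x → F (map ∣_∣ x)) ≡ + (2 ^ length τ) ℤ.* F τ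
∑-signs τ F = trans (∑-cong (signs τ) (λ x∈ → cong F (signs-abs τ x∈))) (trans (∑-const (F τ) (signs τ)) (cong (λ m → + m ℤ.* F τ) (len τ)))
  where
  twice : ∀ {A B : Set} (f g : A → B) xs → length (concatMap (λ y → f y ∷ g y ∷ []) xs) ≡ 2 * length xs
  twice f g []       = refl
  twice f g (x ∷ xs) = trans (cong (_+_ 2) (twice f g xs)) (sym (ℕₚ.*-suc 2 (length xs)))
  len : ∀ τ → length (signs τ) ≡ 2 ^ length τ
  len []      = refl
  len (a ∷ τ) = trans (twice (+ a ∷_) (ℤ.- (+ a) ∷_) (signs τ)) (cong (2 *_) (len τ))

∑-BnList : ∀ n (F : List ℕ → ℤ) → ∑ (BnList n) (λ x → F (map ∣_∣ x)) ≡ + (2 ^ n) ℤ.* ∑ (perms n) F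
∑-BnList n F = trans (∑-concatMap _ signs (perms n)) (trans (∑-cong (perms n) (λ {τ} τ∈ → trans (∑-signs τ F)
  (cong (λ m → + (2 ^ m) ℤ.* F τ) (trans (↭ₚ.↭-length (perms-sound n τ∈)) (range1-length n))))) (∑-*ˡ (+ (2 ^ n)) F (perms n)))

BnList-sound : ∀ n {x} → x ∈ BnList n → IsBn n x
BnList-sound n x∈ with τ , τ∈ , m ← find (∈ₚ.∈-concatMap⁻ signs {xs = perms n} x∈) =
  IsBn-fromAbs {n} (↭-trans (↭-reflexive (signs-abs τ m)) (perms-sound n τ∈))

product-++ : ∀ xs ys → product (xs ++ ys) ≡ product xs * product ys
product-++ []       ys = sym (ℕₚ.+-identityʳ _)
product-++ (x ∷ xs) ys = trans (cong (x *_) (product-++ xs ys)) (sym (ℕₚ.*-assoc x _ _))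

-- Once conjugation is absorbed, the sum over `x` is the same number `c` for every pair of
-- colourings. There are `N₁ * N₂` pairs, and the orbit counts `k! = youngOrder λ′ * N₁` and
-- `l! = youngOrder μ * N₂` turn the total into `D * S`, where `D` is the order of the subgroup.
bichar-formula : ∀ λ′ μ tU tV {g} → IsBn (sum λ′ + sum μ) g →
  bichar (sum λ′ + sum μ) (sum λ′) (charOf tU λ′) (charOf tV μ) g ≡
  ∑col (length λ′ + length μ) (sum λ′ + sum μ) (λ′ ++ μ) (wt (sum λ′ + sum μ) (length λ′) tU tV g)
bichar-formula λ′ μ tU tV {g} bg = trans (cong₂ divN total denominator) (divN-exact D S D≢0)
  where
  open ProdChar λ′ μ tU tV
  open ≡-Reasoning
  S = ∑col (r + s) n (λ′ ++ μ) (wt n r tU tV g)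
  D = 2 ^ n * (factorial k * factorial l)
  denominator : 2 ^ n * (factorial k * factorial (n ∸ k)) ≡ D
  denominator = cong (λ m → 2 ^ n * (factorial k * factorial m)) (ℕₚ.m+n∸m≡n k l)
  D≢0 : D ≢ 0
  D≢0 e with ℕₚ.m*n≡0⇒m≡0∨n≡0 (2 ^ n) e
  ... | inj₁ p = pow≢0 n p
    where
    pow≢0 : ∀ n → 2 ^ n ≢ 0
    pow≢0 zero ()
    pow≢0 (suc n) e = pow≢0 n (ℕₚ.m+n≡0⇒m≡0 (2 ^ n) e)
  ... | inj₂ q with ℕₚ.m*n≡0⇒m≡0∨n≡0 (factorial k) q
  ...   | inj₁ p = factorial≢0 k p
  ...   | inj₂ p = factorial≢0 l p
  number : ∀ ν → + factorial (sum ν) ≡ + youngOrder ν ℤ.* ∑col (length ν) (sum ν) ν (λ _ → + 1)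
  number ν = trans (sym (trans (∑-const (+ 1) (perms (sum ν))) (trans (ℤₚ.*-identityʳ _) (cong +_ (perms-length (sum ν))))))
    (∑-perms-coloring (block ν) (block-< ν) (content-standard ν) (λ _ → + 1))
  N₁ = ∑col r k λ′ (λ _ → + 1)
  N₂ = ∑col s l μ (λ _ → + 1)
  c = + (2 ^ n) ℤ.* ((+ youngOrder λ′ ℤ.* + youngOrder μ) ℤ.* S)
  inner : ∀ {κ₁ κ₂} → κ₁ ∈ words r k → content r κ₁ ≡ λ′ → κ₂ ∈ words s l → content s κ₂ ≡ μ →
          ∑ (BnList n) (λ x → wt n r tU tV (conjB x g) (κ₁ ⊞ κ₂)) ≡ c
  inner {κ₁} {κ₂} m₁ e₁ m₂ e₂ = begin
    ∑ (BnList n) (λ x → wt n r tU tV (conjB x g) K)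
      ≡⟨ ∑-cong (BnList n) (λ {x} x∈ → Conj.wt-conj {n} {x} {g} (BnList-sound n x∈) bg K r tU tV) ⟩
    ∑ (BnList n) (λ x → wt n r tU tV g (map (at 0 K) (map ∣_∣ x)))
      ≡⟨ ∑-BnList n (λ τ → wt n r tU tV g (map (at 0 K) τ)) ⟩
    + (2 ^ n) ℤ.* ∑ (perms n) (λ τ → wt n r tU tV g (map (at 0 K) τ))
      ≡⟨ cong (+ (2 ^ n) ℤ.*_) (trans (∑-perms-coloring {r + s} {n} {λ′ ++ μ} (at 0 K) bound (trans (cong (content (r + s)) (tabulate-at K lenK)) (content-⊞ m₁ e₁ e₂)) (wt n r tU tV g))
           (cong (ℤ._* S) (trans (cong +_ (trans (cong product (Listₚ.map-++ factorial λ′ μ)) (product-++ (map factorial λ′) (map factorial μ)))) (ℤₚ.pos-* (youngOrder λ′) (youngOrder μ))))) ⟩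
    c ∎
    where
    K = κ₁ ⊞ κ₂
    lenK : length K ≡ n
    lenK = trans (Listₚ.length-++ κ₁) (cong₂ _+_ (proj₁ (words-sound r k m₁)) (trans (Listₚ.length-map (_+_ r) κ₂) (proj₁ (words-sound s l m₂))))
    all-< : ∀ {b} → b ∈ K → b < r + s
    all-< b∈ with ∈ₚ.∈-++⁻ κ₁ b∈
    ... | inj₁ m = ℕₚ.<-≤-trans (All.lookup (proj₂ (words-sound r k m₁)) m) (ℕₚ.m≤m+n r s)
    ... | inj₂ m with a , a∈ , refl ← ∈ₚ.∈-map⁻ (_+_ r) m = ℕₚ.+-monoʳ-< r (All.lookup (proj₂ (words-sound s l m₂)) a∈)
    bound : ∀ {j} → j ∈ range1 n → at 0 K j < r + s
    bound j∈ with i , i< , refl ← ∈-range1⁻ j∈ = all-< (at-∈ K (subst (i <_) (sym lenK) i<))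
  total : ∑ (BnList n) (λ x → if inBkBnk k (conjB x g) then prodChar k (charOf tU λ′) (charOf tV μ) (conjB x g) else + 0) ≡ + D ℤ.* S
  total = begin
    ∑ (BnList n) (λ x → if inBkBnk k (conjB x g) then prodChar k (charOf tU λ′) (charOf tV μ) (conjB x g) else + 0)
      ≡⟨ ∑-cong (BnList n) (λ {x} x∈ → Element.prodChar-formula {conjB x g} (conj-IsBn x (BnList-sound n x∈))) ⟩
    ∑ (BnList n) (λ x → ∑col r k λ′ (λ κ₁ → ∑col s l μ (λ κ₂ → wt n r tU tV (conjB x g) (κ₁ ⊞ κ₂))))
      ≡⟨ ∑col-swap (BnList n) r k λ′ (λ x κ₁ → ∑col s l μ (λ κ₂ → wt n r tU tV (conjB x g) (κ₁ ⊞ κ₂))) ⟩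
    ∑col r k λ′ (λ κ₁ → ∑ (BnList n) (λ x → ∑col s l μ (λ κ₂ → wt n r tU tV (conjB x g) (κ₁ ⊞ κ₂))))
      ≡⟨ ∑col-cong r k λ′ (λ {κ₁} m₁ e₁ → trans (∑col-swap (BnList n) s l μ (λ x κ₂ → wt n r tU tV (conjB x g) (κ₁ ⊞ κ₂)))
           (∑col-cong s l μ (λ m₂ e₂ → trans (inner m₁ e₁ m₂ e₂) (sym (ℤₚ.*-identityˡ c))))) ⟩
    ∑col r k λ′ (λ _ → ∑col s l μ (λ _ → + 1 ℤ.* c))
      ≡⟨ ∑col-cong r k λ′ (λ _ _ → trans (∑col-*ʳ s l μ (λ _ → + 1) c) (sym (ℤₚ.*-identityˡ (N₂ ℤ.* c)))) ⟩
    ∑col r k λ′ (λ _ → + 1 ℤ.* (N₂ ℤ.* c))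
      ≡⟨ ∑col-*ʳ r k λ′ (λ _ → + 1) (N₂ ℤ.* c) ⟩
    N₁ ℤ.* (N₂ ℤ.* c)
      ≡⟨ arrange N₁ N₂ (+ (2 ^ n)) (+ youngOrder λ′) (+ youngOrder μ) S ⟩
    (+ (2 ^ n) ℤ.* ((+ youngOrder λ′ ℤ.* N₁) ℤ.* (+ youngOrder μ ℤ.* N₂))) ℤ.* S
      ≡⟨ cong (ℤ._* S) (trans (cong (+ (2 ^ n) ℤ.*_) (trans (cong₂ ℤ._*_ (sym (number λ′)) (sym (number μ))) (sym (ℤₚ.pos-* (factorial k) (factorial l))))) (sym (ℤₚ.pos-* (2 ^ n) (factorial k * factorial l)))) ⟩
    + D ℤ.* S ∎
    where
    arrange : ∀ a b t x y z → a ℤ.* (b ℤ.* (t ℤ.* ((x ℤ.* y) ℤ.* z))) ≡ (t ℤ.* ((x ℤ.* a) ℤ.* (y ℤ.* b))) ℤ.* z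
    arrange = ℤ-solve-∀
    conj-IsBn : ∀ x → IsBn n x → IsBn n (conjB x g)
    conj-IsBn x bx = IsBn-mulB {n} {mulB x g} {invB x} (IsBn-mulB {n} {x} {g} bx bg) (IsBn-invB {n} {x} bx)

-- Expansion along the largest element

transpℕ : ℕ → ℕ → ℕ → ℕ
transpℕ k x i = if ⌊ i ℕ.≟ k ⌋ then x else if ⌊ i ℕ.≟ x ⌋ then k else i

transpℕ-k : ∀ k x → transpℕ k x k ≡ x
transpℕ-k k x rewrite ⌊⌋-true (k ℕ.≟ k) refl = refl

transpℕ-x : ∀ k x → transpℕ k x x ≡ k
transpℕ-x k x with x ℕ.≟ k
... | yes e = e
... | no _ rewrite ⌊⌋-true (x ℕ.≟ x) refl = refl

transpℕ-other : ∀ {k x i} → i ≢ k → i ≢ x → transpℕ k x i ≡ i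
transpℕ-other {k} {x} {i} a b rewrite ⌊⌋-false (i ℕ.≟ k) a | ⌊⌋-false (i ℕ.≟ x) b = refl

transpℕ-same : ∀ x i → transpℕ x x i ≡ i
transpℕ-same x i with i ℕ.≟ x
... | yes e = sym e
... | no _  = refl

transpℕ-involutive : ∀ k x i → transpℕ k x (transpℕ k x i) ≡ i
transpℕ-involutive k x i with i ℕ.≟ k | i ℕ.≟ x
... | yes refl | _      = transpℕ-x k x
... | no _  | yes refl  = transpℕ-k k x
... | no a  | no b      = transpℕ-other a b

transpℕ-inj : ∀ k x {i j} → transpℕ k x i ≡ transpℕ k x j → i ≡ j
transpℕ-inj k x {i} {j} e = trans (sym (transpℕ-involutive k x i)) (trans (cong (transpℕ k x) e) (transpℕ-involutive k x j))

transpℕ-into : ∀ {k x L} → k ∈ L → x ∈ L → MapsInto (transpℕ k x) L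
transpℕ-into {k} {x} k∈ x∈ {i} i∈ with i ℕ.≟ k | i ℕ.≟ x
... | yes _ | _     = x∈
... | no _  | yes _ = k∈
... | no _  | no _  = i∈

-- Extends `σ` by the fixed point `x`, where the list alone would return the default 0.
hat : ℕ → List ℕ → ℕ → ℕ
hat x σ i = if ⌊ i ℕ.≟ x ⌋ then x else at 0 σ i

hat-x : ∀ x σ → hat x σ x ≡ x
hat-x x σ rewrite ⌊⌋-true (x ℕ.≟ x) refl = refl

hat-other : ∀ {x i} σ → i ≢ x → hat x σ i ≡ at 0 σ i
hat-other {x} {i} σ ne rewrite ⌊⌋-false (i ℕ.≟ x) ne = refl

extend : ℕ → List ℕ → ℕ → List ℕ
extend m σ k = map (λ i → hat (suc m) σ (transpℕ k (suc m) i)) (range1 (suc m))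

-- A second enumeration, adapted to the expansion. Unlike insertion into a word, `extend` changes
-- only the values at `k` and at the new position, so signs, colours and matrix entries change in a
-- controlled way.
permsR : ℕ → List (List ℕ)
permsR zero    = [] ∷ []
permsR (suc m) = concatMap (λ σ → map (extend m σ) (range1 (suc m))) (permsR m)

range1≢suc : ∀ {m i} → i ∈ range1 m → i ≢ suc m
range1≢suc {m} i∈ refl = suc∉range1 m i∈

range1-weaken : ∀ {m i} → i ∈ range1 m → i ∈ range1 (suc m)
range1-weaken i∈ with k , k< , refl ← ∈-range1⁻ i∈ = ∈-range1⁺ (ℕₚ.m<n⇒m<1+n k<)

range1-strengthen : ∀ {m i} → i ∈ range1 (suc m) → i ≢ suc m → i ∈ range1 m
range1-strengthen i∈ ne with k , k< , refl ← ∈-range1⁻ i∈ = ∈-range1⁺ (ℕₚ.≤∧≢⇒< (ℕₚ.≤-pred k<) (ne ∘ cong suc))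

map-range1-∈ : ∀ (f : ℕ → ℕ) m {i} → i ∈ range1 m → at 0 (map f (range1 m)) i ≡ f i
map-range1-∈ f m i∈ with k , k< , refl ← ∈-range1⁻ i∈ = map-range1-at f m k<

module Hat {m : ℕ} {σ : List ℕ} (p : σ ↭ range1 m) where
  private x = suc m
  hat-into : MapsInto (hat x σ) (range1 x)
  hat-into {i} i∈ with i ℕ.≟ x
  ... | yes _ = ∈-range1⁺ ℕₚ.≤-refl
  ... | no ne = range1-weaken (at-range p (range1-strengthen i∈ ne))
  hat-inj : InjOn (hat x σ) (range1 x)
  hat-inj {a} {b} a∈ b∈ e with a ℕ.≟ x | b ℕ.≟ x
  ... | yes refl | yes refl = refl
  ... | yes refl | no nb = contradiction (sym e) (range1≢suc (at-range p (range1-strengthen b∈ nb)))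
  ... | no na | yes refl = contradiction e (range1≢suc (at-range p (range1-strengthen a∈ na)))
  ... | no na | no nb = at-inj p (range1-strengthen a∈ na) (range1-strengthen b∈ nb) e

extend-sound : ∀ {m σ k} → σ ↭ range1 m → k ∈ range1 (suc m) → extend m σ k ↭ range1 (suc m)
extend-sound {m} {σ} {k} p k∈ = stable-↭ (range1-unique (suc m))
  (λ a b e → transpℕ-inj k (suc m) (Hat.hat-inj p (t a) (t b) e)) (λ a → Hat.hat-into p (t a))
  where
  t : MapsInto (transpℕ k (suc m)) (range1 (suc m))
  t = transpℕ-into k∈ (∈-range1⁺ ℕₚ.≤-refl)

permsR-sound : ∀ m {σ} → σ ∈ permsR m → σ ↭ range1 m
permsR-sound zero    (here refl) = ↭-refl
permsR-sound (suc m) τ∈ with σ , σ∈ , m∈ ← find (∈ₚ.∈-concatMap⁻ (λ σ → map (extend m σ) (range1 (suc m))) {xs = permsR m} τ∈)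
  with k , k∈ , refl ← ∈ₚ.∈-map⁻ (extend m σ) m∈ = extend-sound (permsR-sound m σ∈) k∈

at-surjective : ∀ {n τ} → τ ↭ range1 n → ∀ {a} → a ∈ range1 n → ∃ λ k → k ∈ range1 n × at 0 τ k ≡ a
at-surjective {n} p a∈ with k , k< , e ← ∈-at {d = 0} (↭ₚ.∈-resp-↭ (↭-sym p) a∈) =
  suc k , ∈-range1⁺ (subst (k <_) (trans (↭ₚ.↭-length p) (range1-length n)) k<) , e

permsR-complete : ∀ m {τ} → τ ↭ range1 m → τ ∈ permsR m
permsR-complete zero    p with refl ← ↭ₚ.↭-empty-inv p = here refl
permsR-complete (suc m) {τ} p with k , k∈ , e ← at-surjective p (∈-range1⁺ {suc m} ℕₚ.≤-refl) =
  ∈ₚ.∈-concatMap⁺ (λ σ → map (extend m σ) (range1 (suc m))) {xs = permsR m}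
      (lose (permsR-complete m σ-perm) (subst (_∈ map (extend m σ) (range1 (suc m))) rebuild (∈ₚ.∈-map⁺ (extend m σ) k∈)))
  where
  x = suc m
  t = transpℕ k x
  x∈ : x ∈ range1 x
  x∈ = ∈-range1⁺ ℕₚ.≤-refl
  σ = map (λ i → at 0 τ (t i)) (range1 m)
  t∈ : MapsInto t (range1 x)
  t∈ = transpℕ-into k∈ x∈
  into : MapsInto (λ i → at 0 τ (t i)) (range1 m)
  into {i} i∈ = range1-strengthen (at-range p (t∈ (range1-weaken i∈)))
    λ e′ → range1≢suc i∈ (trans (sym (transpℕ-involutive k x i)) (trans (cong t (at-inj p (t∈ (range1-weaken i∈)) k∈ (trans e′ (sym e)))) (transpℕ-k k x)))
  σ-perm : σ ↭ range1 m
  σ-perm = stable-↭ (range1-unique m) (λ a b e′ → transpℕ-inj k x (at-inj p (t∈ (range1-weaken a)) (t∈ (range1-weaken b)) e′)) into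
  hat-σ : ∀ {i} → i ∈ range1 x → hat x σ i ≡ at 0 τ (t i)
  hat-σ {i} i∈ = case i ℕ.≟ x of λ
    { (yes refl) → trans (hat-x x σ) (sym (trans (cong (at 0 τ) (transpℕ-x k x)) e))
    ; (no ne)    → trans (hat-other σ ne) (map-range1-∈ (λ i → at 0 τ (t i)) m (range1-strengthen i∈ ne)) }
  rebuild : extend m σ k ≡ τ
  rebuild = trans (Listₚ.map-cong-local (All.tabulate λ {i} i∈ → trans (hat-σ (t∈ i∈)) (cong (at 0 τ) (transpℕ-involutive k x i))))
    (tabulate-at τ (trans (↭ₚ.↭-length p) (range1-length x)))

permsR-length : ∀ n → length (permsR n) ≡ factorial n
permsR-length zero    = refl
permsR-length (suc m) = trans (go (permsR m)) (cong (suc m *_) (permsR-length m))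
  where
  go : ∀ σs → length (concatMap (λ σ → map (extend m σ) (range1 (suc m))) σs) ≡ suc m * length σs
  go []       = sym (ℕₚ.*-zeroʳ (suc m))
  go (σ ∷ σs) = trans (Listₚ.length-++ (map (extend m σ) (range1 (suc m)))) (trans (cong₂ _+_ (trans (Listₚ.length-map (extend m σ) (range1 (suc m))) (range1-length (suc m))) (go σs)) (sym (ℕₚ.*-suc (suc m) (length σs))))

perms-↭-permsR : ∀ n → perms n ↭ permsR n
perms-↭-permsR n = unique-⊆-↭ (perms-unique n) (λ τ∈ → permsR-complete n (perms-sound n τ∈))
  (ℕₚ.≤-reflexive (trans (permsR-length n) (sym (perms-length n))))

range1-snoc : ∀ m → range1 (suc m) ≡ range1 m ++ suc m ∷ []
range1-snoc m = trans (cong (map suc) (sym (Listₚ.upTo-∷ʳ m))) (Listₚ.map-++ suc (upTo m) (m ∷ []))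

δ-× : ∀ {P Q R : Set} (R? : Dec R) (P? : Dec P) (Q? : Dec Q) → (R → P × Q) → (P → Q → R) → δ R? ≡ δ P? ℤ.* δ Q?
δ-× R? (yes p) (yes q) f g = δ-yes R? (g p q)
δ-× R? (yes p) (no ¬q) f g = δ-no R? (¬q ∘ proj₂ ∘ f)
δ-× R? (no ¬p) Q?      f g = trans (δ-no R? (¬p ∘ proj₁ ∘ f)) (sym (ℤₚ.*-zeroˡ (δ Q?)))

∏-all-δ : ∀ {A : Set} {P : A → Set} (P? : ∀ a → Dec (P a)) xs → δ (All.all? P? xs) ≡ ∏ xs (λ a → δ (P? a))
∏-all-δ P? []       = refl
∏-all-δ P? (x ∷ xs) = trans (δ-× (All.all? P? (x ∷ xs)) (P? x) (All.all? P? xs) All.uncons _∷_) (cong (δ (P? x) ℤ.*_) (∏-all-δ P? xs))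

sg-snoc-max : ∀ f L {x} → (∀ {a} → a ∈ L → a < x) → (∀ {a} → a ∈ L → f a < x) → f x ≡ x → sg f (L ++ x ∷ []) ≡ sg f L
sg-snoc-max f []      _ _ _ = refl
sg-snoc-max f (a ∷ L) {x} lt flt fx = cong₂ ℤ._*_
  (trans (∏-++ _ L (x ∷ [])) (trans (cong (∏ L (λ b → ord a b ℤ.* ord (f a) (f b)) ℤ.*_) last-factor) (ℤₚ.*-identityʳ (∏ L (λ b → ord a b ℤ.* ord (f a) (f b))))))
  (sg-snoc-max f L (lt ∘ there) (flt ∘ there) fx)
  where
  last-factor : ∏ (x ∷ []) (λ b → ord a b ℤ.* ord (f a) (f b)) ≡ + 1
  last-factor rewrite fx | ord-< (lt (here refl)) | ord-< (flt (here refl)) = refl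

sg-id : ∀ L → sg id L ≡ + 1
sg-id []      = refl
sg-id (a ∷ L) = cong₂ ℤ._*_ (trans (∏-cong L (λ {b} _ → ord² a b)) (∏-one L)) (sg-id L)

∈-drop : ∀ {A : Set} {a b : A} {xs} → a ≢ b → a ∈ b ∷ xs → a ∈ xs
∈-drop ne (here e)  = contradiction e ne
∈-drop ne (there m) = m

-- The factors of a third element with `k` and with `x` cancel each other; the pair itself is
-- inverted.
sg-transp : ∀ {k x L} → Unique L → k ∈ L → x ∈ L → k ≢ x → sg (transpℕ k x) L ≡ -[1+ 0 ]
sg-transp {k} {x} {L} u k∈ x∈ k≢x with V , p ← remove∈ k∈ with V′ , q ← remove∈ (∈-drop (k≢x ∘ sym) (↭ₚ.∈-resp-↭ p x∈)) =
  trans (sg-↭ {f = t} u (λ _ _ → transpℕ-inj k x) p′) (begin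
      ((ord k x ℤ.* ord (t k) (t x)) ℤ.* ∏ V′ (row k)) ℤ.* (∏ V′ (row x) ℤ.* sg t V′)
        ≡⟨ cong₂ (λ a b → (a ℤ.* ∏ V′ (row k)) ℤ.* (∏ V′ (row x) ℤ.* b)) corner (trans (sg-cong V′ (λ m → transpℕ-other (≢k m) (≢x m))) (sg-id V′)) ⟩
      (-[1+ 0 ] ℤ.* ∏ V′ (row k)) ℤ.* (∏ V′ (row x) ℤ.* + 1)
        ≡⟨ arrange (∏ V′ (row k)) (∏ V′ (row x)) ⟩
      -[1+ 0 ] ℤ.* (∏ V′ (row k) ℤ.* ∏ V′ (row x))
        ≡⟨ cong (-[1+ 0 ] ℤ.*_) (trans (sym (∏-* (row k) (row x) V′)) (trans (∏-cong V′ cancels) (∏-one V′))) ⟩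
      -[1+ 0 ] ∎)
  where
  open ≡-Reasoning
  t = transpℕ k x
  row : ℕ → ℕ → ℤ
  row a b = ord a b ℤ.* ord (t a) (t b)
  p′ : L ↭ k ∷ x ∷ V′
  p′ = ↭-trans p (prep k q)
  u′ = Unique-↭ p′ u
  ≢k : ∀ {b} → b ∈ V′ → b ≢ k
  ≢k m e = All.lookup (All.tail (AllPairs.head u′)) m (sym e)
  ≢x : ∀ {b} → b ∈ V′ → b ≢ x
  ≢x m e = All.lookup (AllPairs.head (AllPairs.tail u′)) m (sym e)
  corner : ord k x ℤ.* ord (t k) (t x) ≡ -[1+ 0 ]
  corner rewrite transpℕ-k k x | transpℕ-x k x | ord-anti k≢x = trans (sym (ℤₚ.neg-distribˡ-* (ord x k) (ord x k))) (cong ℤ.-_ (ord² x k))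
  cancels : ∀ {b} → b ∈ V′ → row k b ℤ.* row x b ≡ + 1
  cancels {b} m rewrite transpℕ-k k x | transpℕ-x k x | transpℕ-other {k} {x} (≢k m) (≢x m) =
    trans (square (ord k b) (ord x b)) (cong₂ ℤ._*_ (ord² k b) (ord² x b))
    where
    square : ∀ a b → (a ℤ.* b) ℤ.* (b ℤ.* a) ≡ (a ℤ.* a) ℤ.* (b ℤ.* b)
    square = ℤ-solve-∀
  arrange : ∀ a b → (-[1+ 0 ] ℤ.* a) ℤ.* (b ℤ.* + 1) ≡ -[1+ 0 ] ℤ.* (a ℤ.* b)
  arrange = ℤ-solve-∀

signT : FillCond → ℤ
signT colStrict     = -[1+ 0 ]
signT rowSemistrict = + 1

moved : FillCond → ℕ → ℕ → ℤ
moved t k x = if ⌊ k ℕ.≟ x ⌋ then + 1 else signT t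

module Extend {m : ℕ} {σ : List ℕ} {k : ℕ} (p : σ ↭ range1 m) (k∈ : k ∈ range1 (suc m)) where
  x = suc m
  t = transpℕ k x
  f : ℕ → ℕ
  f i = hat x σ (t i)

  at-extend : ∀ {i} → i ∈ range1 x → at 0 (extend m σ k) i ≡ f i
  at-extend = map-range1-∈ f x

  f-k : f k ≡ x
  f-k = trans (cong (hat x σ) (transpℕ-k k x)) (hat-x x σ)

  f-x : k ≢ x → f x ≡ at 0 σ k
  f-x k≢x = trans (cong (hat x σ) (transpℕ-x k x)) (hat-other σ k≢x)

  f-other : ∀ {i} → i ≢ k → i ≢ x → f i ≡ at 0 σ i
  f-other a b = trans (cong (hat x σ) (transpℕ-other a b)) (hat-other σ b)

  module _ (q : ℕ → Bool) where
    private
      L  = filterᵇ q (range1 m)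
      L′ = filterᵇ q (range1 x)
      L⊆ : ∀ {a} → a ∈ L → a ∈ range1 m
      L⊆ = proj₁ ∘ filterᵇ-∈⁻ q (range1 m)
      L′-split : L′ ≡ L ++ filterᵇ q (x ∷ [])
      L′-split = trans (cong (filterᵇ q) (range1-snoc m)) (filterᵇ-++ q (range1 m) (x ∷ []))

    sgT-outside : ∀ tt → q x ≡ false → q k ≡ false → sgT tt (at 0 (extend m σ k)) L′ ≡ sgT tt (at 0 σ) L
    sgT-outside rowSemistrict _ _ = refl
    sgT-outside colStrict qx qk = trans (cong (sg (at 0 (extend m σ k))) (trans L′-split (trans (cong (L ++_) (filterᵇ-none q (x ∷ []) (λ { (here refl) → qx }))) (Listₚ.++-identityʳ L))))
      (sg-cong L λ {a} a∈ → trans (at-extend (range1-weaken (L⊆ a∈)))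
        (f-other (λ { refl → contradiction (trans (sym qk) (proj₂ (filterᵇ-∈⁻ q (range1 m) a∈))) λ () }) (range1≢suc (L⊆ a∈))))

    -- `moved` is the sign of the transposition of `k` and `x`. The other factor has `x` as a fixed
    -- largest element, which contributes nothing to the sign.
    sgT-inside : ∀ tt → q x ≡ true → q k ≡ true → sgT tt (at 0 (extend m σ k)) L′ ≡ moved tt k x ℤ.* sgT tt (at 0 σ) L
    sgT-inside rowSemistrict _ _ with k ℕ.≟ x
    ... | yes _ = refl
    ... | no _  = refl
    sgT-inside colStrict qx qk = begin
      sg (at 0 (extend m σ k)) L′
        ≡⟨ sg-cong L′ (λ a∈ → at-extend (proj₁ (filterᵇ-∈⁻ q (range1 x) a∈))) ⟩
      sg (hat x σ ∘ t) L′
        ≡⟨ sg-comp (hat x σ) t L′ ⟩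
      sg t L′ ℤ.* sg (hat x σ) (map t L′)
        ≡⟨ cong₂ ℤ._*_ sign-t (sym (sg-↭ {f = hat x σ} u′ (λ a b → Hat.hat-inj p (L′⊆ a) (L′⊆ b)) (↭-sym (stable-↭ u′ (λ _ _ → transpℕ-inj k x) (transpℕ-into kL xL))))) ⟩
      moved colStrict k x ℤ.* sg (hat x σ) L′
        ≡⟨ cong (moved colStrict k x ℤ.*_) (trans (cong (sg (hat x σ)) (trans L′-split (cong (L ++_) (filterᵇ-all q (x ∷ []) (λ { (here refl) → qx })))))
             (trans (sg-snoc-max (hat x σ) L (λ a∈ → bound (L⊆ a∈)) (λ {a} a∈ → subst (_< x) (sym (hat-other σ (range1≢suc (L⊆ a∈)))) (bound (at-range p (L⊆ a∈)))) (hat-x x σ))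
               (sg-cong L (λ a∈ → hat-other σ (range1≢suc (L⊆ a∈)))))) ⟩
      moved colStrict k x ℤ.* sg (at 0 σ) L ∎
      where
      open ≡-Reasoning
      u′ = filterᵇ-unique q (range1-unique x)
      L′⊆ : ∀ {a} → a ∈ L′ → a ∈ range1 x
      L′⊆ = proj₁ ∘ filterᵇ-∈⁻ q (range1 x)
      kL : k ∈ L′
      kL = filterᵇ-∈⁺ q (range1 x) k∈ qk
      xL : x ∈ L′
      xL = filterᵇ-∈⁺ q (range1 x) (∈-range1⁺ ℕₚ.≤-refl) qx
      bound : ∀ {a} → a ∈ range1 m → a < x
      bound a∈ with j , j< , refl ← ∈-range1⁻ a∈ = s≤s j<
      sign-t : sg t L′ ≡ moved colStrict k x
      sign-t with k ℕ.≟ x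
      ... | yes refl = trans (sg-cong L′ (λ {a} _ → transpℕ-same x a)) (sg-id L′)
      ... | no k≢x   = sg-transp u′ kL xL k≢x

module Expansion (κ : List ℕ) (r : ℕ) (tU tV : FillCond) (A : ℕ → ℕ → ℤ) where

  c : ℕ → ℕ
  c = at 0 κ

  typeOf : ℕ → FillCond
  typeOf b = if b ℕ.<ᵇ r then tU else tV

  sgs : ℕ → List ℕ → ℤ
  sgs m σ = sgT tU (at 0 σ) (Low r m κ) ℤ.* sgT tV (at 0 σ) (High r m κ)

  entries : ℕ → List ℕ → ℤ
  entries m σ = ∏ (range1 m) (λ i → A i (at 0 σ i))

  term : ℕ → List ℕ → ℤ
  term m σ = δ (fixes? m κ (at 0 σ)) ℤ.* (sgs m σ ℤ.* entries m σ)

  -- A product over the λ- and μ-blocks of determinants or permanents of A.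
  S : ℕ → ℤ
  S m = ∑ (permsR m) (term m)

  module Step {m : ℕ} {σ : List ℕ} {k : ℕ} (p : σ ↭ range1 m) (k∈ : k ∈ range1 (suc m)) where
    open Extend p k∈
    private σ′ = extend m σ k

    sgs-extend : c k ≡ c x → sgs x σ′ ≡ moved (typeOf (c x)) k x ℤ.* sgs m σ
    sgs-extend ck≡cx with c x ℕ.<ᵇ r in eq
    ... | true  = trans (cong₂ ℤ._*_ (sgT-inside (low? r κ) tU eq lk) (sgT-outside (not ∘ low? r κ) tV (cong not eq) (cong not lk)))
                    (ℤₚ.*-assoc (moved tU k x) (sgT tU (at 0 σ) (Low r m κ)) (sgT tV (at 0 σ) (High r m κ)))
      where lk = trans (cong (ℕ._<ᵇ r) ck≡cx) eq
    ... | false = trans (cong₂ ℤ._*_ (sgT-outside (low? r κ) tU eq lk) (sgT-inside (not ∘ low? r κ) tV (cong not eq) (cong not lk)))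
                    (exch (sgT tU (at 0 σ) (Low r m κ)) (moved tV k x) (sgT tV (at 0 σ) (High r m κ)))
      where
      lk = trans (cong (ℕ._<ᵇ r) ck≡cx) eq
      exch : ∀ a b c → a ℤ.* (b ℤ.* c) ≡ b ℤ.* (a ℤ.* c)
      exch = ℤ-solve-∀

    private
      x∈ : x ∈ range1 x
      x∈ = ∈-range1⁺ ℕₚ.≤-refl

    fixes⇒ : Fixes x κ (at 0 σ′) → Fixes m κ (at 0 σ) × c k ≡ c x
    fixes⇒ fx = All.tabulate old , sym (trans (cong c (sym (trans (at-extend k∈) f-k))) (All.lookup fx k∈))
      where
      old : ∀ {i} → i ∈ range1 m → c (at 0 σ i) ≡ c i
      old {i} i∈ with i ℕ.≟ k
      ... | no i≢k = trans (cong c (sym (trans (at-extend (range1-weaken i∈)) (f-other i≢k (range1≢suc i∈))))) (All.lookup fx (range1-weaken i∈))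
      ... | yes refl = trans (cong c (sym (trans (at-extend x∈) (f-x (range1≢suc i∈))))) (trans (All.lookup fx x∈) (trans (cong c (sym (trans (at-extend k∈) f-k))) (All.lookup fx k∈)))

    fixes⇐ : Fixes m κ (at 0 σ) → c k ≡ c x → Fixes x κ (at 0 σ′)
    fixes⇐ fx ck≡cx = All.tabulate λ {i} i∈ → trans (cong c (at-extend i∈)) (go i i∈)
      where
      go : ∀ i → i ∈ range1 x → c (f i) ≡ c i
      go i i∈ = case i ℕ.≟ k of λ
        { (yes refl) → trans (cong c f-k) (sym ck≡cx)
        ; (no i≢k) → case i ℕ.≟ x of λ
          { (yes refl) → trans (cong c (f-x (i≢k ∘ sym))) (trans (All.lookup fx (range1-strengthen k∈ (i≢k ∘ sym))) ck≡cx)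
          ; (no i≢x) → trans (cong c (f-other i≢k i≢x)) (All.lookup fx (range1-strengthen i∈ i≢x)) } }

    δ-fixes : δ (fixes? x κ (at 0 σ′)) ≡ δ (fixes? m κ (at 0 σ)) ℤ.* δ (c k ℕ.≟ c x)
    δ-fixes = δ-× (fixes? x κ (at 0 σ′)) (fixes? m κ (at 0 σ)) (c k ℕ.≟ c x) fixes⇒ fixes⇐

    entries-snoc : entries x σ′ ≡ ∏ (range1 m) (λ i → A i (f i)) ℤ.* A x (f x)
    entries-snoc = trans (∏-cong (range1 x) (λ {i} i∈ → cong (A i) (at-extend i∈))) (trans (cong (λ L → ∏ L (λ i → A i (f i))) (range1-snoc m))
      (trans (∏-++ (λ i → A i (f i)) (range1 m) (x ∷ [])) (cong (∏ (range1 m) (λ i → A i (f i)) ℤ.*_) (ℤₚ.*-identityʳ (A x (f x))))))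

    term-fixed : k ≡ x → term x σ′ ≡ A x x ℤ.* term m σ
    term-fixed refl = trans (cong₂ ℤ._*_ (trans δ-fixes (trans (cong (δ (fixes? m κ (at 0 σ)) ℤ.*_) (δ-yes (c x ℕ.≟ c x) refl)) (ℤₚ.*-identityʳ (δ (fixes? m κ (at 0 σ))))))
        (cong₂ ℤ._*_ (trans (sgs-extend refl) (trans (cong (ℤ._* sgs m σ) (cong (λ b → if b then + 1 else signT (typeOf (c x))) (⌊⌋-true (x ℕ.≟ x) refl))) (ℤₚ.*-identityˡ (sgs m σ))))
          (trans entries-snoc (cong₂ ℤ._*_ (∏-cong (range1 m) (λ {i} i∈ → cong (A i) (f-other (range1≢suc i∈) (range1≢suc i∈)))) (cong (A x) f-k)))))
      (arrange (δ (fixes? m κ (at 0 σ))) (sgs m σ) (entries m σ) (A x x))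
      where
      arrange : ∀ d s e a → d ℤ.* (s ℤ.* (e ℤ.* a)) ≡ a ℤ.* (d ℤ.* (s ℤ.* e))
      arrange = ℤ-solve-∀

    module _ (k∈m : k ∈ range1 m) where
      private
        y = at 0 σ k
        V = proj₁ (remove∈ k∈m)
        perm : range1 m ↭ k ∷ V
        perm = proj₂ (remove∈ k∈m)
        rest = ∏ V (λ i → A i (at 0 σ i))
        k∉V : ∀ {i} → i ∈ V → i ≢ k
        k∉V i∈ e = All.lookup (AllPairs.head (Unique-↭ perm (range1-unique m))) i∈ (sym e)
        V⊆ : ∀ {i} → i ∈ V → i ∈ range1 m
        V⊆ i∈ = ↭ₚ.∈-resp-↭ (↭-sym perm) (there i∈)

      entries-old : entries m σ ≡ A k y ℤ.* rest
      entries-old = ∏-↭ (λ i → A i (at 0 σ i)) perm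

      entries-new : entries x σ′ ≡ (A k x ℤ.* A x y) ℤ.* rest
      entries-new = trans entries-snoc (trans (cong₂ ℤ._*_ (trans (∏-↭ (λ i → A i (f i)) perm) (cong₂ ℤ._*_ (cong (A k) f-k) (∏-cong V (λ {i} i∈ → cong (A i) (f-other (k∉V i∈) (range1≢suc (V⊆ i∈)))))))
          (cong (A x) (f-x (range1≢suc k∈m)))) (exch (A k x) rest (A x y)))
        where
        exch : ∀ a b c → (a ℤ.* b) ℤ.* c ≡ (a ℤ.* c) ℤ.* b
        exch = ℤ-solve-∀

      -- Giving `k` the value `x` and `x` the old value `y` of `k` replaces the entry `A k y` by
      -- `A k x * A x y`, which `peel` rewrites as `b * A k y`. `z` is the index on which `b`
      -- depends, either `k` or `y`; both have the same colour when `σ` preserves the colouring.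
      term-moved : ∀ b z → (c y ≡ c k → c z ≡ c k) → (c k ≡ c x → c y ≡ c x → A k x ℤ.* A x y ≡ b ℤ.* A k y) →
                   term x σ′ ≡ (signT (typeOf (c x)) ℤ.* (δ (c z ℕ.≟ c x) ℤ.* b)) ℤ.* term m σ
      term-moved b z zk peel with fixes? m κ (at 0 σ) | c k ℕ.≟ c x
      ... | no ¬fx | _ = trans (cong (ℤ._* (sgs x σ′ ℤ.* entries x σ′)) (δ-no (fixes? x κ (at 0 σ′)) (¬fx ∘ proj₁ ∘ fixes⇒))) (sym (ℤₚ.*-zeroʳ (signT (typeOf (c x)) ℤ.* (δ (c z ℕ.≟ c x) ℤ.* b))))
      ... | yes fx | no ne = trans (cong (ℤ._* (sgs x σ′ ℤ.* entries x σ′)) (δ-no (fixes? x κ (at 0 σ′)) (ne ∘ proj₂ ∘ fixes⇒)))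
            (sym (trans (cong (λ d → (signT (typeOf (c x)) ℤ.* (d ℤ.* b)) ℤ.* (+ 1 ℤ.* (sgs m σ ℤ.* entries m σ))) (δ-no (c z ℕ.≟ c x) (λ e → ne (trans (sym (zk (All.lookup fx k∈m))) e))))
              (vanish (signT (typeOf (c x))) b (sgs m σ ℤ.* entries m σ))))
        where
        vanish : ∀ s b t → (s ℤ.* (+ 0 ℤ.* b)) ℤ.* (+ 1 ℤ.* t) ≡ + 0
        vanish = ℤ-solve-∀
      ... | yes fx | yes e = begin
        δ (fixes? x κ (at 0 σ′)) ℤ.* (sgs x σ′ ℤ.* entries x σ′)
          ≡⟨ cong₂ ℤ._*_ (δ-yes (fixes? x κ (at 0 σ′)) (fixes⇐ fx e)) (cong₂ ℤ._*_
               (trans (sgs-extend e) (cong (λ b → (if b then + 1 else signT (typeOf (c x))) ℤ.* sgs m σ) (⌊⌋-false (k ℕ.≟ x) (range1≢suc k∈m))))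
               (trans entries-new (trans (cong (ℤ._* rest) (peel e (trans (All.lookup fx k∈m) e))) (trans (ℤₚ.*-assoc b (A k y) rest) (cong (b ℤ.*_) (sym entries-old)))))) ⟩
        + 1 ℤ.* ((signT (typeOf (c x)) ℤ.* sgs m σ) ℤ.* (b ℤ.* entries m σ))
          ≡⟨ arrange (signT (typeOf (c x))) (sgs m σ) b (entries m σ) ⟩
        (signT (typeOf (c x)) ℤ.* (+ 1 ℤ.* b)) ℤ.* (+ 1 ℤ.* (sgs m σ ℤ.* entries m σ))
          ≡⟨ cong (λ d → (signT (typeOf (c x)) ℤ.* (d ℤ.* b)) ℤ.* (+ 1 ℤ.* (sgs m σ ℤ.* entries m σ))) (sym (δ-yes (c z ℕ.≟ c x) (trans (zk (All.lookup fx k∈m)) e))) ⟩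
        (signT (typeOf (c x)) ℤ.* (δ (c z ℕ.≟ c x) ℤ.* b)) ℤ.* (+ 1 ℤ.* (sgs m σ ℤ.* entries m σ)) ∎
        where
        open ≡-Reasoning
        arrange : ∀ s g b e → + 1 ℤ.* ((s ℤ.* g) ℤ.* (b ℤ.* e)) ≡ (s ℤ.* (+ 1 ℤ.* b)) ℤ.* (+ 1 ℤ.* (g ℤ.* e))
        arrange = ℤ-solve-∀

  -- Row x and column x of A can be peeled off: either the rows meeting column x agree
  -- with row x, or the columns meeting row x agree with column x.
  Peel↓ Peel↑ : ℕ → (ℕ → ℤ) → Set
  Peel↓ m B = ∀ {k y} → k ∈ range1 m → y ∈ range1 m → c k ≡ c (suc m) → c y ≡ c (suc m) →
              A k (suc m) ℤ.* A (suc m) y ≡ B k ℤ.* A k y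
  Peel↑ m B = ∀ {k y} → k ∈ range1 m → y ∈ range1 m → c k ≡ c (suc m) → c y ≡ c (suc m) →
              A k (suc m) ℤ.* A (suc m) y ≡ B y ℤ.* A k y

  -- For each `σ`, leaving `x` fixed contributes `A x x`, and every other extension a multiple of
  -- the same term. Under `Peel↑` the multiplier depends on the image of `k`, and the sum is
  -- reindexed along `σ`.
  S-step : ∀ m B → Peel↓ m B ⊎ Peel↑ m B →
           S (suc m) ≡ (A (suc m) (suc m) ℤ.+ signT (typeOf (c (suc m))) ℤ.* ∑ (range1 m) (λ y → δ (c y ℕ.≟ c (suc m)) ℤ.* B y)) ℤ.* S m
  S-step m B peel = trans (∑-concatMap (term x) (λ σ → map (extend m σ) (range1 x)) (permsR m))
    (trans (∑-cong (permsR m) (λ {σ} σ∈ → inner (permsR-sound m σ∈))) (∑-*ˡ factor (term m) (permsR m)))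
    where
    x = suc m
    e = signT (typeOf (c x))
    g : ℕ → ℤ
    g z = δ (c z ℕ.≟ c x) ℤ.* B z
    factor = A x x ℤ.+ e ℤ.* ∑ (range1 m) g
    x∈ : x ∈ range1 x
    x∈ = ∈-range1⁺ ℕₚ.≤-refl
    moving : ∀ {σ} → σ ↭ range1 m → ∑ (range1 m) (λ k → term x (extend m σ k)) ≡ (e ℤ.* ∑ (range1 m) g) ℤ.* term m σ
    moving {σ} p = [ moving↓ , moving↑ ]′ peel
      where
      moving↓ : Peel↓ m B → ∑ (range1 m) (λ k → term x (extend m σ k)) ≡ (e ℤ.* ∑ (range1 m) g) ℤ.* term m σ
      moving↓ pd = trans (∑-cong (range1 m) (λ {k} k∈ → Step.term-moved p (range1-weaken k∈) k∈ (B k) k (λ _ → refl) (pd k∈ (at-range p k∈))))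
                      (trans (∑-*ʳ (term m σ) (λ k → e ℤ.* g k) (range1 m)) (cong (ℤ._* term m σ) (∑-*ˡ e g (range1 m))))
      moving↑ : Peel↑ m B → ∑ (range1 m) (λ k → term x (extend m σ k)) ≡ (e ℤ.* ∑ (range1 m) g) ℤ.* term m σ
      moving↑ pu = trans (∑-cong (range1 m) (λ {k} k∈ → Step.term-moved p (range1-weaken k∈) k∈ (B (at 0 σ k)) (at 0 σ k) id (pu k∈ (at-range p k∈))))
                      (trans (∑-*ʳ (term m σ) (λ k → e ℤ.* g (at 0 σ k)) (range1 m)) (cong (ℤ._* term m σ) (trans (∑-*ˡ e (g ∘ at 0 σ) (range1 m))
                        (cong (e ℤ.*_) (trans (sym (∑-map g (at 0 σ) (range1 m))) (∑-↭ g (stable-↭ (range1-unique m) (at-inj p) (at-range p))))))))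
    inner : ∀ {σ} → σ ↭ range1 m → ∑ (map (extend m σ) (range1 x)) (term x) ≡ factor ℤ.* term m σ
    inner {σ} p = begin
      ∑ (map (extend m σ) (range1 x)) (term x)
        ≡⟨ trans (∑-map (term x) (extend m σ) (range1 x)) (trans (cong (λ L → ∑ L (λ k → term x (extend m σ k))) (range1-snoc m)) (∑-++ (λ k → term x (extend m σ k)) (range1 m) (x ∷ []))) ⟩
      ∑ (range1 m) (λ k → term x (extend m σ k)) ℤ.+ (term x (extend m σ x) ℤ.+ + 0)
        ≡⟨ cong₂ (λ a b → a ℤ.+ (b ℤ.+ + 0)) (moving p) (Step.term-fixed p x∈ refl) ⟩
      (e ℤ.* ∑ (range1 m) g) ℤ.* term m σ ℤ.+ (A x x ℤ.* term m σ ℤ.+ + 0)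
        ≡⟨ arrange (e ℤ.* ∑ (range1 m) g) (A x x) (term m σ) ⟩
      factor ℤ.* term m σ ∎
      where
      open ≡-Reasoning
      arrange : ∀ a b t → a ℤ.* t ℤ.+ (b ℤ.* t ℤ.+ + 0) ≡ (b ℤ.+ a) ℤ.* t
      arrange = ℤ-solve-∀

-- Sum of the weights over the Bruhat interval

signs-∋ : ∀ v → v ∈ signs (map ∣_∣ v)
signs-∋ []      = here refl
signs-∋ (a ∷ v) = ∈ₚ.∈-concatMap⁺ (λ y → (+ ∣ a ∣ ∷ y) ∷ (ℤ.- (+ ∣ a ∣) ∷ y) ∷ []) {xs = signs (map ∣_∣ v)} (lose (signs-∋ v) (which a))
  where
  which : ∀ a → a ∷ v ∈ (+ ∣ a ∣ ∷ v) ∷ (ℤ.- (+ ∣ a ∣) ∷ v) ∷ []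
  which (+ k)    = here refl
  which -[1+ k ] = there (here refl)

signs-unique : ∀ τ → All (_≢ 0) τ → Unique (signs τ)
signs-unique []      _ = [] ∷ []
signs-unique (a ∷ τ) (a≢0 ∷ nz) = unique-concatMap (λ y → (+ a ∷ y) ∷ (ℤ.- (+ a) ∷ y) ∷ []) (drop 1) (signs-unique τ nz)
  (λ _ → ((λ e → a≢0 (distinct a (Listₚ.∷-injectiveˡ e))) ∷ []) ∷ [] ∷ [])
  (λ { _ (here refl) → refl ; _ (there (here refl)) → refl })
  where
  distinct : ∀ a → + a ≡ ℤ.- (+ a) → a ≡ 0
  distinct zero    _ = refl

BnList-complete : ∀ {n v} → IsBn n v → v ∈ BnList n
BnList-complete {n} {v} (_ , p) = ∈ₚ.∈-concatMap⁺ signs {xs = perms n} (lose (perms-complete n p) (signs-∋ v))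

BnList-unique : ∀ n → Unique (BnList n)
BnList-unique n = unique-concatMap signs (map ∣_∣) (perms-unique n)
  (λ {τ} τ∈ → signs-unique τ (All.tabulate λ a∈ → case ∈-range1⁻ (↭ₚ.∈-resp-↭ (perms-sound n τ∈) a∈) of λ { (_ , _ , refl) () }))
  (λ {τ} _ z∈ → signs-abs τ z∈)

unique-set-↭ : ∀ {A : Set} {xs ys : List A} → Unique xs → Unique ys → (∀ {z} → z ∈ xs → z ∈ ys) → (∀ {z} → z ∈ ys → z ∈ xs) → xs ↭ ys
unique-set-↭ {xs = xs} {ys} u u′ f g = unique-⊆-↭ u f (shorter u′ g)
  where
  shorter : ∀ {A : Set} {xs ys : List A} → Unique ys → (∀ {z} → z ∈ ys → z ∈ xs) → length ys ≤ length xs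
  shorter {ys = []} _ _ = z≤n
  shorter {ys = y ∷ ys} (y∉ ∷ u) g with V , p ← remove∈ (g (here refl)) =
    subst (suc (length ys) ≤_) (sym (↭ₚ.↭-length p)) (s≤s (shorter u λ {z} z∈ → ∈-drop (λ e → All.lookup y∉ z∈ (sym e)) (↭ₚ.∈-resp-↭ p (g (there z∈)))))

∑-filterᵇ : ∀ {A : Set} (p : A → Bool) (F : A → ℤ) xs → ∑ (filterᵇ p xs) F ≡ ∑ xs (λ x → (if p x then + 1 else + 0) ℤ.* F x)
∑-filterᵇ p F []       = refl
∑-filterᵇ p F (x ∷ xs) with p x
... | true  = cong₂ ℤ._+_ (sym (ℤₚ.*-identityˡ (F x))) (∑-filterᵇ p F xs)
... | false = trans (∑-filterᵇ p F xs) (sym (trans (cong (ℤ._+ ∑ xs (λ x → (if p x then + 1 else + 0) ℤ.* F x)) (ℤₚ.*-zeroˡ (F x))) (ℤₚ.+-identityˡ _)))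

∏-filterᵇ : ∀ {A : Set} (p : A → Bool) (F : A → ℤ) xs → ∏ (filterᵇ (not ∘ p) xs) F ≡ ∏ xs (λ x → if p x then + 1 else F x)
∏-filterᵇ p F []       = refl
∏-filterᵇ p F (x ∷ xs) with p x
... | true  = trans (∏-filterᵇ p F xs) (sym (ℤₚ.*-identityˡ _))
... | false = cong (F x ℤ.*_) (∏-filterᵇ p F xs)

zipProd : {B : Set} → (ℕ → B → ℤ) → List B → ℤ
zipProd h []      = + 1
zipProd h (a ∷ v) = h 1 a ℤ.* zipProd (h ∘ suc) v

range1-cons : ∀ m → range1 (suc m) ≡ 1 ∷ map suc (range1 m)
range1-cons m = cong (λ l → 1 ∷ map suc l) (sym (range1-applyUpTo m))

∏-zip : ∀ {B : Set} (d : B) (h : ℕ → B → ℤ) v {m} → length v ≡ m → ∏ (range1 m) (λ i → h i (at d v i)) ≡ zipProd h v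
∏-zip d h []      refl = refl
∏-zip d h (a ∷ v) refl = trans (cong (λ l → ∏ l (λ i → h i (at d (a ∷ v) i))) (range1-cons (length v)))
  (cong (h 1 a ℤ.*_) (trans (∏-map (λ i → h i (at d (a ∷ v) i)) suc (range1 (length v)))
    (trans (∏-cong (range1 (length v)) (λ i∈ → shift i∈)) (∏-zip d (h ∘ suc) v refl))))
  where
  shift : ∀ {i} → i ∈ range1 (length v) → h (suc i) (at d (a ∷ v) (suc i)) ≡ h (suc i) (at d v i)
  shift i∈ with j , _ , refl ← ∈-range1⁻ i∈ = refl

-- Independent signs at the positions factor by distributivity; this is where the two summands of a
-- matrix entry come from.
∑-signs-zip : ∀ (h : ℕ → ℤ → ℤ) τ → ∑ (signs τ) (zipProd h) ≡ zipProd (λ i t → h i (+ t) ℤ.+ h i (ℤ.- (+ t))) τ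
∑-signs-zip h []      = refl
∑-signs-zip h (t ∷ τ) = trans (∑-concatMap (zipProd h) (λ y → (+ t ∷ y) ∷ (ℤ.- (+ t) ∷ y) ∷ []) (signs τ))
  (trans (∑-cong (signs τ) (λ {y} _ → collect (h 1 (+ t)) (h 1 (ℤ.- (+ t))) (zipProd (h ∘ suc) y)))
  (trans (∑-*ˡ (h 1 (+ t) ℤ.+ h 1 (ℤ.- (+ t))) (zipProd (h ∘ suc)) (signs τ)) (cong ((h 1 (+ t) ℤ.+ h 1 (ℤ.- (+ t))) ℤ.*_) (∑-signs-zip (h ∘ suc) τ))))
  where
  collect : ∀ a b z → a ℤ.* z ℤ.+ (b ℤ.* z ℤ.+ + 0) ≡ (a ℤ.+ b) ℤ.* z
  collect = ℤ-solve-∀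

module Trace-sum {n : ℕ} {w : List ℤ} {cs : List Iv} (bw : IsBn n w) (zz : ZigZag n cs)
                 (mct : MaxCoverType n cs (appB w)) where
  open BruhatInterval {n} {w} {cs} bw zz mct
  zig : Zig cs
  zig = WireMax.zig {n} {cs} zz

  R? : ∀ i a → Dec (Reach cs i a)
  R? = Reach? cs (Zig.proper zig)

  -- Only positive positions are tested; `Reach-sym` supplies the negative ones.
  compat? : ∀ v → Dec (All (λ i → Reach cs (+ i) (appB v (+ i))) (range1 n))
  compat? v = All.all? (λ i → R? (+ i) (appB v (+ i))) (range1 n)

  compat⇒Compat : ∀ {v} → IsBn n v → All (λ i → Reach cs (+ i) (appB v (+ i))) (range1 n) → Compat v
  compat⇒Compat {v} bv c {i} i∈ with wireView n i∈
  ... | pos k<n = All.lookup c (∈-range1⁺ k<n)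
  ... | neg {k} k<n = Reach-sym (pos∈wires k<n) (appB-wire {n} {v} bv (pos∈wires k<n)) (All.lookup c (∈-range1⁺ k<n))

  ∑-interval : ∀ L → Unique L → (∀ v → (v ∈ L) ⇔ BruhatLe n v w) → ∀ F → ∑ L F ≡ ∑ (BnList n) (λ v → δ (compat? v) ℤ.* F v)
  ∑-interval L u mem F = trans (∑-↭ F (unique-set-↭ u (filterᵇ-unique _ (BnList-unique n)) to from)) (∑-filterᵇ (λ v → ⌊ compat? v ⌋) F (BnList n))
    where
    to : ∀ {v} → v ∈ L → v ∈ filterᵇ (λ v → ⌊ compat? v ⌋) (BnList n)
    to {v} v∈ with bv , c ← Equivalence.to (Bruhat⇔Compat v) (Equivalence.to (mem v) v∈) =
      filterᵇ-∈⁺ _ (BnList n) (BnList-complete bv) (⌊⌋-true (compat? v) (All.tabulate λ i∈ → c (range1-wire i∈)))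
    from : ∀ {v} → v ∈ filterᵇ (λ v → ⌊ compat? v ⌋) (BnList n) → v ∈ L
    from {v} v∈ with v∈′ , e ← filterᵇ-∈⁻ _ (BnList n) v∈ with bv ← BnList-sound n v∈′ =
      Equivalence.from (mem v) (Equivalence.from (Bruhat⇔Compat v) (bv , compat⇒Compat {v} bv (toWitness′ (compat? v) e)))
      where
      toWitness′ : ∀ {P : Set} (P? : Dec P) → ⌊ P? ⌋ ≡ true → P
      toWitness′ (yes p) _ = p

  module _ (κ : List ℕ) (r : ℕ) (tU tV : FillCond) where
    h : ℕ → ℤ → ℤ
    h i a = δ (R? (+ i) a) ℤ.* (if low? r κ i then + 1 else sgnZ a)
    A : ℕ → ℕ → ℤ
    A i j = h i (+ j) ℤ.+ h i (ℤ.- (+ j))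
    open Expansion κ r tU tV A

    private
      pos-app : ∀ v {i m} → i ∈ range1 m → appB v (+ i) ≡ at (+ 0) v i
      pos-app v i∈ with j , _ , refl ← ∈-range1⁻ i∈ = refl

      summand : ∀ τ {v} → length τ ≡ n → map ∣_∣ v ≡ τ →
        δ (compat? v) ℤ.* wt n r tU tV v κ ≡ (δ (fixes? n κ (at 0 τ)) ℤ.* sgs n τ) ℤ.* zipProd h v
      summand τ {v} lτ refl = begin
        δ (compat? v) ℤ.* (δ (fixes? n κ (at 0 τ)) ℤ.* (sU ℤ.* (sV ℤ.* ∏ (High r n κ) (λ i → sgnZ (appB v (+ i))))))
          ≡⟨ cong₂ (λ a b → a ℤ.* (δ (fixes? n κ (at 0 τ)) ℤ.* (sU ℤ.* (sV ℤ.* b)))) (∏-all-δ (λ i → R? (+ i) (appB v (+ i))) (range1 n)) (∏-filterᵇ (low? r κ) (λ i → sgnZ (appB v (+ i))) (range1 n)) ⟩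
        P₁ ℤ.* (δ (fixes? n κ (at 0 τ)) ℤ.* (sU ℤ.* (sV ℤ.* P₂)))
          ≡⟨ arrange P₁ (δ (fixes? n κ (at 0 τ))) sU sV P₂ ⟩
        (δ (fixes? n κ (at 0 τ)) ℤ.* sgs n τ) ℤ.* (P₁ ℤ.* P₂)
          ≡⟨ cong ((δ (fixes? n κ (at 0 τ)) ℤ.* sgs n τ) ℤ.*_) (trans (sym (∏-* (λ i → δ (R? (+ i) (appB v (+ i)))) _ (range1 n))) (trans (∏-cong (range1 n) (λ {i} i∈ → cong (h i) (pos-app v i∈))) (∏-zip (+ 0) h v (trans (sym (Listₚ.length-map ∣_∣ v)) lτ)))) ⟩
        (δ (fixes? n κ (at 0 τ)) ℤ.* sgs n τ) ℤ.* zipProd h v ∎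
        where
        open ≡-Reasoning
        sU = sgT tU (at 0 τ) (Low r n κ)
        sV = sgT tV (at 0 τ) (High r n κ)
        P₁ = ∏ (range1 n) (λ i → δ (R? (+ i) (appB v (+ i))))
        P₂ = ∏ (range1 n) (λ i → if low? r κ i then + 1 else sgnZ (appB v (+ i)))
        arrange : ∀ p d u v q → p ℤ.* (d ℤ.* (u ℤ.* (v ℤ.* q))) ≡ (d ℤ.* (u ℤ.* v)) ℤ.* (p ℤ.* q)
        arrange = ℤ-solve-∀

    -- For fixed absolute values `τ`, the colouring condition and the permutation signs depend on
    -- `τ` alone. Summing over the signs of the entries leaves a product of entries of `A`, hence
    -- the term of `τ` in `S n`.
    ∑-wt : ∀ L → Unique L → (∀ v → (v ∈ L) ⇔ BruhatLe n v w) → ∑ L (λ v → wt n r tU tV v κ) ≡ S n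
    ∑-wt L u mem = begin
      ∑ L (λ v → wt n r tU tV v κ)
        ≡⟨ ∑-interval L u mem (λ v → wt n r tU tV v κ) ⟩
      ∑ (BnList n) (λ v → δ (compat? v) ℤ.* wt n r tU tV v κ)
        ≡⟨ ∑-concatMap _ signs (perms n) ⟩
      ∑ (perms n) (λ τ → ∑ (signs τ) (λ v → δ (compat? v) ℤ.* wt n r tU tV v κ))
        ≡⟨ ∑-cong (perms n) (λ {τ} τ∈ → inner τ (trans (↭ₚ.↭-length (perms-sound n τ∈)) (range1-length n))) ⟩
      ∑ (perms n) (term n)
        ≡⟨ ∑-↭ (term n) (perms-↭-permsR n) ⟩
      S n ∎
      where
      open ≡-Reasoning
      inner : ∀ τ → length τ ≡ n → ∑ (signs τ) (λ v → δ (compat? v) ℤ.* wt n r tU tV v κ) ≡ term n τ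
      inner τ lτ = trans (∑-cong (signs τ) (λ {v} v∈ → summand τ {v} lτ (signs-abs τ v∈)))
        (trans (∑-*ˡ (δ (fixes? n κ (at 0 τ)) ℤ.* sgs n τ) (zipProd h) (signs τ))
        (trans (cong ((δ (fixes? n κ (at 0 τ)) ℤ.* sgs n τ) ℤ.*_) (trans (∑-signs-zip h τ) (sym (∏-zip 0 (λ i t → h i (+ t) ℤ.+ h i (ℤ.- (+ t))) τ lτ))))
          (ℤₚ.*-assoc (δ (fixes? n κ (at 0 τ))) (sgs n τ) (entries n τ))))

-- Number of ways to place x, given the colours of the smaller elements: g counts
-- the markings of x, and the remaining factor the admissible positions in its block.
module Factor (cs : List Iv) (κ : List ℕ) (r : ℕ) (tU tV : FillCond) where

  grounded? : ∀ x → Dec (Shares cs (ℤ.- (+ x)) (+ x))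
  grounded? x = Shares? cs (ℤ.- (+ x)) (+ x)

  blockmate? : ℕ → ℕ → Bool
  blockmate? x y = ⌊ at 0 κ y ℕ.≟ at 0 κ x ⌋ ∧ ⌊ Shares? cs (+ y) (+ x) ⌋

  neighbours : ℕ → ℕ
  neighbours m = sumOf (λ y → χ (blockmate? (suc m) y)) (range1 m)

  markings : ℕ → ℕ
  markings x = if ⌊ grounded? x ⌋ then (if low? r κ x then 2 else 0) else 1

  -- In a column the largest element goes on top, and only if its path meets no other path of the
  -- block. In a row it goes to the end or directly before one of the `b` elements whose paths meet
  -- its own.
  positions : FillCond → ℕ → ℕ
  positions colStrict     zero    = 1
  positions colStrict     (suc _) = 0
  positions rowSemistrict b       = suc b

  blockType : ℕ → FillCond
  blockType x = if low? r κ x then tU else tV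

  factor : ℕ → ℕ
  factor m = markings (suc m) * positions (blockType (suc m)) (neighbours m)

  factors : ℕ → ℕ
  factors zero    = 1
  factors (suc m) = factor m * factors m

  factors-zero : ∀ {j} m → j < m → factor j ≡ 0 → factors m ≡ 0
  factors-zero {j} (suc m) j≤m e with ℕₚ.m≤n⇒m<n∨m≡n (ℕₚ.≤-pred j≤m)
  ... | inj₁ j<m  = trans (cong (factor m *_) (factors-zero m j<m e)) (ℕₚ.*-zeroʳ (factor m))
  ... | inj₂ refl = cong (_* factors m) e

  signed : ℕ → ℤ
  signed m = + markings (suc m) ℤ.* (+ 1 ℤ.+ signT (blockType (suc m)) ℤ.* + neighbours m)

  signeds : ℕ → ℤ
  signeds zero    = + 1
  signeds (suc m) = signed m ℤ.* signeds m

  private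
    some : ∀ (p : ℕ → Bool) xs {b} → sumOf (χ ∘ p) xs ≡ suc b → ∃ λ y → y ∈ xs × p y ≡ true
    some p (x ∷ xs) e with p x in eq
    ... | true = x , here refl , eq
    ... | false with y , y∈ , e′ ← some p xs e = y , there y∈ , e′

    two : ∀ (p : ℕ → Bool) {xs b} → AllPairs _<_ xs → sumOf (χ ∘ p) xs ≡ suc (suc b) →
          ∃₂ λ y z → y < z × y ∈ xs × z ∈ xs × p y ≡ true × p z ≡ true
    two p {x ∷ xs} (a ∷ ap) e with p x in eq
    ... | true with z , z∈ , e′ ← some p xs (ℕₚ.suc-injective e) = x , z , All.lookup a z∈ , here refl , there z∈ , eq , e′
    ... | false with y , z , lt , y∈ , z∈ , ey , ez ← two p ap e = y , z , lt , there y∈ , there z∈ , ey , ez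

    sumOf-positive : ∀ (p : ℕ → Bool) xs {y} → y ∈ xs → p y ≡ true → sumOf (χ ∘ p) xs ≢ 0
    sumOf-positive p (x ∷ xs) (here refl) e s rewrite e with () ← s
    sumOf-positive p (x ∷ xs) (there y∈)  e s = sumOf-positive p xs y∈ e (ℕₚ.m+n≡0⇒n≡0 (χ (p x)) s)

    blockmate⁻ : ∀ {x y} → blockmate? x y ≡ true → at 0 κ y ≡ at 0 κ x × Shares cs (+ y) (+ x)
    blockmate⁻ {x} {y} e with at 0 κ y ℕ.≟ at 0 κ x | Shares? cs (+ y) (+ x)
    ... | yes p | yes q = p , q

  -- Two blockmates y < z of x are blockmates of each other, so a factor 1 - b with
  -- b ≥ 2 is always accompanied by a vanishing factor.
  crowded : ∀ {m b} → blockType (suc m) ≡ colStrict → neighbours m ≡ suc (suc b) → factors m ≡ 0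
  crowded {m} {b} ct e with y , z , y<z , y∈ , z∈ , ey , ez ← two (blockmate? (suc m)) (range1-increasing m) e
    with j , j<m , refl ← ∈-range1⁻ z∈ | i , i<m , refl ← ∈-range1⁻ y∈
    with cy , sy ← blockmate⁻ {suc m} {suc i} ey | cz , _ ← blockmate⁻ {suc m} {suc j} ez =
    factors-zero m j<m (trans (cong (markings (suc j) *_) none) (ℕₚ.*-zeroʳ (markings (suc j))))
    where
    near : blockmate? (suc j) (suc i) ≡ true
    near = cong₂ _∧_ (⌊⌋-true (at 0 κ (suc i) ℕ.≟ at 0 κ (suc j)) (trans cy (sym cz)))
      (⌊⌋-true (Shares? cs (+ suc i) (+ suc j)) (proj₁ (Shares-convex sy (ℤ.+≤+ (ℕₚ.<⇒≤ y<z)) (ℤ.+≤+ (s≤s (ℕₚ.<⇒≤ j<m))))))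
    none : positions (blockType (suc j)) (neighbours j) ≡ 0
    none rewrite trans (cong (λ c → if c ℕ.<ᵇ r then tU else tV) cz) ct with neighbours j | sumOf-positive (blockmate? (suc j)) (range1 j) (∈-range1⁺ (ℕₚ.≤-pred y<z)) near
    ... | zero  | ne = contradiction refl ne
    ... | suc _ | _  = refl

  signeds-factors : ∀ m → signeds m ≡ + factors m
  signeds-factors zero    = refl
  signeds-factors (suc m) = trans (cong (signed m ℤ.*_) (signeds-factors m)) (trans (step (blockType (suc m)) refl (neighbours m) refl) (sym (ℤₚ.pos-* (factor m) (factors m))))
    where
    M = markings (suc m)
    step : ∀ t → blockType (suc m) ≡ t → ∀ b → neighbours m ≡ b → signed m ℤ.* + factors m ≡ + factor m ℤ.* + factors m
    step rowSemistrict et b eb rewrite et | eb = cong (ℤ._* + factors m) (trans (cong (+ M ℤ.*_) (cong (ℤ._+_ (+ 1)) (ℤₚ.*-identityˡ (+ b)))) (sym (ℤₚ.pos-* M (suc b))))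
    step colStrict et zero eb rewrite et | eb = cong (ℤ._* + factors m) (sym (ℤₚ.pos-* M 1))
    step colStrict et (suc zero) eb rewrite et | eb = cong (ℤ._* + factors m) (trans (ℤₚ.*-zeroʳ (+ M)) (sym (cong +_ (ℕₚ.*-zeroʳ M))))
    step colStrict et (suc (suc b)) eb rewrite crowded {m} {b} et eb = trans (ℤₚ.*-zeroʳ (signed m)) (sym (ℤₚ.*-zeroʳ (+ factor m)))

-- The factor contributed by the largest element

module Evaluate {n : ℕ} {w : List ℤ} {cs : List Iv} (bw : IsBn n w) (zz : ZigZag n cs)
                (mct : MaxCoverType n cs (appB w)) (κ : List ℕ) (r : ℕ) (tU tV : FillCond) where
  open Trace-sum {n} {w} {cs} bw zz mct
  open BruhatInterval {n} {w} {cs} bw zz mct using (Reach-sym)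
  open Factor cs κ r tU tV
  private
    𝔸 = A κ r tU tV
  open Expansion κ r tU tV 𝔸

  private
    eps : ℕ → ℤ
    eps i = if low? r κ i then + 1 else -[1+ 0 ]

    A-form : ∀ i {j m} → j ∈ range1 m → 𝔸 i j ≡ δ (R? (+ i) (+ j)) ℤ.+ δ (R? (+ i) (ℤ.- (+ j))) ℤ.* eps i
    A-form i j∈ with j , _ , refl ← ∈-range1⁻ j∈ with low? r κ i
    ... | true  = cong (ℤ._+ δ (R? (+ i) -[1+ j ]) ℤ.* + 1) (ℤₚ.*-identityʳ (δ (R? (+ i) (+ suc j))))
    ... | false = cong (ℤ._+ δ (R? (+ i) -[1+ j ]) ℤ.* -[1+ 0 ]) (ℤₚ.*-identityʳ (δ (R? (+ i) (+ suc j))))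

    module Top {m : ℕ} (m<n : m < n) where
      x = suc m
      X = + x
      xw : X ∈ wires n
      xw = pos∈wires m<n
      x∈ : x ∈ range1 n
      x∈ = ∈-range1⁺ m<n
      open Dichotomy (dichotomy zig X)

      zw : ∀ {z} → z ∈ range1 m → + z ∈ wires n
      zw z∈ with j , j<m , refl ← ∈-range1⁻ z∈ = pos∈wires (ℕₚ.<-trans j<m m<n)
      z<X : ∀ {z} → z ∈ range1 m → + z ℤ.< X
      z<X z∈ with j , j<m , refl ← ∈-range1⁻ z∈ = ℤ.+<+ (s≤s j<m)
      -z≤z : ∀ z → ℤ.- (+ z) ℤ.≤ + z
      -z≤z z = ℤₚ.neg-≤-pos {z} {z}
      -z≤X : ∀ {z} → z ∈ range1 m → ℤ.- (+ z) ℤ.≤ X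
      -z≤X {z} z∈ = ℤₚ.≤-trans (-z≤z z) (ℤₚ.<⇒≤ (z<X z∈))
      -X<X : ℤ.- X ℤ.< X
      -X<X = ℤ.-<+

      gr? = grounded? x
      sh? : ∀ z → Dec (Shares cs (+ z) X)
      sh? z = Shares? cs (+ z) X
      G = + markings x

      gr⇒y₀ : Shares cs (ℤ.- X) X → y₀ ℤ.≤ ℤ.- X
      gr⇒y₀ = share⁻ (ℤₚ.<⇒≤ -X<X)
      -- A star through `-x` and `x` contains all wires in between.
      gr⇒sh : ∀ {z} → z ∈ range1 m → Shares cs (ℤ.- X) X → Shares cs (+ z) X
      gr⇒sh z∈ g = share⁺ (ℤₚ.≤-trans (gr⇒y₀ g) (ℤₚ.≤-trans (ℤₚ.neg-mono-≤ (ℤₚ.<⇒≤ (z<X z∈))) (-z≤z _))) (z<X z∈)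

      module Core {R : ℤ → ℤ → Set} (dn : Down R X y₀)
                  (sy : ∀ {i j} → i ∈ wires n → j ∈ wires n → R i j → R (ℤ.- i) (ℤ.- j)) where
        open Down dn
        to-sh : ∀ {z} → z ∈ range1 m → R (+ z) X → Shares cs (+ z) X
        to-sh z∈ ρ = share⁺ (col⁻ (ℤₚ.<⇒≤ (z<X z∈)) ρ) (z<X z∈)
        from-sh : ∀ {z} → z ∈ range1 m → Shares cs (+ z) X → R (+ z) X
        from-sh z∈ s = col⁺ (share⁻ (ℤₚ.<⇒≤ (z<X z∈)) s) (ℤₚ.<⇒≤ (z<X z∈))
        xx : R X X
        xx = col⁺ y₀≤x ℤₚ.≤-refl
        x̄-gr : R (ℤ.- X) X → Shares cs (ℤ.- X) X
        x̄-gr ρ = share⁺ (col⁻ (ℤₚ.<⇒≤ -X<X) ρ) -X<X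
        gr-x̄ : Shares cs (ℤ.- X) X → R (ℤ.- X) X
        gr-x̄ g = col⁺ (gr⇒y₀ g) (ℤₚ.<⇒≤ -X<X)
        z̄⇒y₀≤z : ∀ {z} → z ∈ range1 m → R (ℤ.- (+ z)) X → y₀ ℤ.≤ + z
        z̄⇒y₀≤z {z} z∈ ρ = ℤₚ.≤-trans (col⁻ (-z≤X z∈) ρ) (-z≤z z)
        neg-neg : ∀ {z a} → R (ℤ.- (ℤ.- (+ z))) a → R (+ z) a
        neg-neg {z} {a} = subst (λ k → R k a) (ℤₚ.neg-involutive (+ z))
        -- If `-z` is related to `X`, then `z` lies in the range where rows agree. Negation relates
        -- `z` to `-X`, so `X` is related to `-X`, and by negation again `-X` to `X`: column `X`
        -- extends down to `-X`. `R` stands for reachability or its transpose.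
        z̄-gr : ∀ {z} → z ∈ range1 m → R (ℤ.- (+ z)) X → Shares cs (ℤ.- X) X
        z̄-gr {z} z∈ ρ = x̄-gr (sy-X̄ (row⁻ (z̄⇒y₀≤z z∈ ρ) (ℤₚ.<⇒≤ (z<X z∈)) (ℤₚ.<⇒≤ -X<X) (neg-neg {z} (sy (wires-neg n (zw z∈)) xw ρ))))
          where
          sy-X̄ : R X (ℤ.- X) → R (ℤ.- X) X
          sy-X̄ = sy xw (wires-neg n xw)
        gr-z̄ : ∀ {z} → z ∈ range1 m → Shares cs (ℤ.- X) X → R (ℤ.- (+ z)) X
        gr-z̄ z∈ g = col⁺ (ℤₚ.≤-trans (gr⇒y₀ g) (ℤₚ.neg-mono-≤ (ℤₚ.<⇒≤ (z<X z∈)))) (-z≤X z∈)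
        rows⁺ : ∀ {z a} → z ∈ range1 m → R (+ z) X ⊎ R (ℤ.- (+ z)) X → a ℤ.≤ X → R X a → R (+ z) a
        rows⁺ z∈ (inj₁ ρ) = row⁺ (col⁻ (ℤₚ.<⇒≤ (z<X z∈)) ρ) (ℤₚ.<⇒≤ (z<X z∈))
        rows⁺ z∈ (inj₂ ρ) = row⁺ (z̄⇒y₀≤z z∈ ρ) (ℤₚ.<⇒≤ (z<X z∈))
        rows⁻ : ∀ {z a} → z ∈ range1 m → R (+ z) X ⊎ R (ℤ.- (+ z)) X → a ℤ.≤ X → R (+ z) a → R X a
        rows⁻ z∈ (inj₁ ρ) = row⁻ (col⁻ (ℤₚ.<⇒≤ (z<X z∈)) ρ) (ℤₚ.<⇒≤ (z<X z∈))
        rows⁻ z∈ (inj₂ ρ) = row⁻ (z̄⇒y₀≤z z∈ ρ) (ℤₚ.<⇒≤ (z<X z∈))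

      -- If `x` is grounded, both parts of the matrix entry are present and `1 + eps i` is 2 or 0;
      -- otherwise only the first part survives.
      value : ∀ {P : Set} (P? : Dec P) i → at 0 κ i ≡ at 0 κ x → (Shares cs (ℤ.- X) X → P) →
              δ P? ℤ.+ δ gr? ℤ.* eps i ≡ G ℤ.* δ P?
      value P? i e gp with gr? | low? r κ x in eq
      ... | no _  | _     = trans (cong (ℤ._+_ (δ P?)) (ℤₚ.*-zeroˡ (eps i))) (trans (ℤₚ.+-identityʳ (δ P?)) (sym (ℤₚ.*-identityˡ (δ P?))))
      ... | yes g | true  rewrite δ-yes P? (gp g) | trans (cong (ℕ._<ᵇ r) e) eq = refl
      ... | yes g | false rewrite δ-yes P? (gp g) | trans (cong (ℕ._<ᵇ r) e) eq = refl

      vanish : ∀ i {j l} → j ∈ range1 l → ¬ Reach cs (+ i) (+ j) → ¬ Reach cs (+ i) (ℤ.- (+ j)) → 𝔸 i j ≡ + 0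
      vanish i {j} j∈ a b = trans (A-form i j∈) (cong₂ (λ s t → s ℤ.+ t ℤ.* eps i) (δ-no (R? (+ i) (+ j)) a) (δ-no (R? (+ i) (ℤ.- (+ j))) b))

      eps-cong : ∀ {k} → at 0 κ k ≡ at 0 κ x → eps k ≡ eps x
      eps-cong e = cong (λ b → if b ℕ.<ᵇ r then + 1 else -[1+ 0 ]) e

      Result : Set
      Result = 𝔸 x x ≡ G × ∃ λ B → (Peel↓ m B ⊎ Peel↑ m B) × (∀ {z} → z ∈ range1 m → at 0 κ z ≡ at 0 κ x → B z ≡ G ℤ.* δ (sh? z))

      -- If `A k x` vanishes, both sides of the peeling identity are 0; otherwise `k` lies in the
      -- range where rows agree with row `x`. The equality of colours enters through `eps`, which
      -- belongs to the row.
      down-case : Down (Reach cs) X y₀ → Result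
      down-case dn = diag , (λ k → 𝔸 k x) , inj₁ peel , values
        where
        open Core dn Reach-sym
        flip-neg : ∀ {z} → z ∈ range1 m → Reach cs (+ z) (ℤ.- X) → Reach cs (ℤ.- (+ z)) X
        flip-neg z∈ = Reach-sym (zw z∈) (wires-neg n xw)
        unflip-neg : ∀ {z} → z ∈ range1 m → Reach cs (ℤ.- (+ z)) X → Reach cs (+ z) (ℤ.- X)
        unflip-neg {z} z∈ ρ = neg-neg {z} (Reach-sym (wires-neg n (zw z∈)) xw ρ)
        diag : 𝔸 x x ≡ G
        diag = trans (A-form x x∈) (trans (cong (λ b → δ (R? X X) ℤ.+ b ℤ.* eps x) (δ-cong (R? X (ℤ.- X)) gr? (λ ρ → x̄-gr (Reach-sym xw (wires-neg n xw) ρ)) (λ g → Reach-sym (wires-neg n xw) xw (gr-x̄ g))))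
          (trans (value (R? X X) x refl (λ _ → xx)) (trans (cong (G ℤ.*_) (δ-yes (R? X X) xx)) (ℤₚ.*-identityʳ G))))
        values : ∀ {z} → z ∈ range1 m → at 0 κ z ≡ at 0 κ x → 𝔸 z x ≡ G ℤ.* δ (sh? z)
        values {z} z∈ e = trans (A-form z x∈) (trans (cong₂ (λ a b → a ℤ.+ b ℤ.* eps z) (δ-cong (R? (+ z) X) (sh? z) (to-sh z∈) (from-sh z∈))
            (δ-cong (R? (+ z) (ℤ.- X)) gr? (λ ρ → z̄-gr z∈ (flip-neg z∈ ρ)) (λ g → unflip-neg z∈ (gr-z̄ z∈ g)))) (value (sh? z) z e (gr⇒sh z∈)))
        peel : Peel↓ m (λ k → 𝔸 k x)
        peel {k} {y} k∈ y∈ ek ey = choose (R? (+ k) X) (R? (+ k) (ℤ.- X))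
          where
          row-eq : Reach cs (+ k) X ⊎ Reach cs (ℤ.- (+ k)) X → 𝔸 x y ≡ 𝔸 k y
          row-eq meet = trans (A-form x y∈) (trans (cong₂ ℤ._+_ (δ-cong (R? X (+ y)) (R? (+ k) (+ y)) (rows⁺ k∈ meet (ℤₚ.<⇒≤ (z<X y∈))) (rows⁻ k∈ meet (ℤₚ.<⇒≤ (z<X y∈))))
            (cong₂ ℤ._*_ (δ-cong (R? X (ℤ.- (+ y))) (R? (+ k) (ℤ.- (+ y))) (rows⁺ k∈ meet (-z≤X y∈)) (rows⁻ k∈ meet (-z≤X y∈))) (sym (eps-cong ek)))) (sym (A-form k y∈)))
          choose : Dec (Reach cs (+ k) X) → Dec (Reach cs (+ k) (ℤ.- X)) → 𝔸 k x ℤ.* 𝔸 x y ≡ 𝔸 k x ℤ.* 𝔸 k y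
          choose (yes a) _       = cong (𝔸 k x ℤ.*_) (row-eq (inj₁ a))
          choose (no _)  (yes b) = cong (𝔸 k x ℤ.*_) (row-eq (inj₂ (flip-neg k∈ b)))
          choose (no a)  (no b)  = trans (cong (ℤ._* 𝔸 x y) (vanish k x∈ a b)) (sym (cong (ℤ._* 𝔸 k y) (vanish k x∈ a b)))

      up-case : Down (flip (Reach cs)) X y₀ → Result
      up-case up = diag , (λ y → 𝔸 x y) , inj₂ peel , values
        where
        open Core up (λ iw jw → Reach-sym jw iw)
        diag : 𝔸 x x ≡ G
        diag = trans (A-form x x∈) (trans (cong (λ b → δ (R? X X) ℤ.+ b ℤ.* eps x) (δ-cong (R? X (ℤ.- X)) gr? x̄-gr gr-x̄))
          (trans (value (R? X X) x refl (λ _ → xx)) (trans (cong (G ℤ.*_) (δ-yes (R? X X) xx)) (ℤₚ.*-identityʳ G))))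
        values : ∀ {z} → z ∈ range1 m → at 0 κ z ≡ at 0 κ x → 𝔸 x z ≡ G ℤ.* δ (sh? z)
        values {z} z∈ e = trans (A-form x z∈) (trans (cong₂ (λ a b → a ℤ.+ b ℤ.* eps x) (δ-cong (R? X (+ z)) (sh? z) (to-sh z∈) (from-sh z∈))
            (δ-cong (R? X (ℤ.- (+ z))) gr? (z̄-gr z∈) (gr-z̄ z∈))) (value (sh? z) x refl (gr⇒sh z∈)))
        -- The dual shape compares sources `k` and `-k` into the sinks `x` and `y`. Entries at
        -- negative sinks are moved there by negating both ends.
        col-eq : ∀ {k y} → k ∈ range1 m → y ∈ range1 m → Reach cs X (+ y) ⊎ Reach cs X (ℤ.- (+ y)) → 𝔸 k x ≡ 𝔸 k y
        col-eq {k} {y} k∈ y∈ meet = trans (A-form k x∈) (trans (cong₂ ℤ._+_ (δ-cong (R? (+ k) X) (R? (+ k) (+ y)) (rows⁺ y∈ meet (ℤₚ.<⇒≤ (z<X k∈))) (rows⁻ y∈ meet (ℤₚ.<⇒≤ (z<X k∈))))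
            (cong (ℤ._* eps k) (δ-cong (R? (+ k) (ℤ.- X)) (R? (+ k) (ℤ.- (+ y)))
              (λ ρ → back k (Reach-sym (wires-neg n (zw k∈)) (zw y∈) (rows⁺ y∈ meet (-z≤X k∈) (Reach-sym (zw k∈) (wires-neg n xw) ρ))))
              (λ ρ → back k (Reach-sym (wires-neg n (zw k∈)) xw (rows⁻ y∈ meet (-z≤X k∈) (forth y (Reach-sym (zw k∈) (wires-neg n (zw y∈)) ρ)))))))) (sym (A-form k y∈)))
          where
          back : ∀ k {a} → Reach cs (ℤ.- (ℤ.- (+ k))) a → Reach cs (+ k) a
          back k {a} = subst (λ b → Reach cs b a) (ℤₚ.neg-involutive (+ k))
          forth : ∀ y {a} → Reach cs a (ℤ.- (ℤ.- (+ y))) → Reach cs a (+ y)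
          forth y {a} = subst (Reach cs a) (ℤₚ.neg-involutive (+ y))
        peel : Peel↑ m (λ y → 𝔸 x y)
        peel {k} {y} k∈ y∈ ek ey = choose (R? X (+ y)) (R? X (ℤ.- (+ y)))
          where
          choose : Dec (Reach cs X (+ y)) → Dec (Reach cs X (ℤ.- (+ y))) → 𝔸 k x ℤ.* 𝔸 x y ≡ 𝔸 x y ℤ.* 𝔸 k y
          choose (yes a) _       = trans (cong (ℤ._* 𝔸 x y) (col-eq k∈ y∈ (inj₁ a))) (ℤₚ.*-comm (𝔸 k y) (𝔸 x y))
          choose (no _)  (yes b) = trans (cong (ℤ._* 𝔸 x y) (col-eq k∈ y∈ (inj₂ b))) (ℤₚ.*-comm (𝔸 k y) (𝔸 x y))
          choose (no a)  (no b)  = trans (cong (𝔸 k x ℤ.*_) (vanish x y∈ a b)) (trans (ℤₚ.*-zeroʳ (𝔸 k x)) (sym (cong (ℤ._* 𝔸 k y) (vanish x y∈ a b))))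

      result : Result
      result = [ down-case , up-case ]′ shape

      ∑-neighbours : ∀ xs → ∑ xs (λ y → δ (c y ℕ.≟ c x) ℤ.* δ (sh? y)) ≡ + sumOf (λ y → χ (blockmate? x y)) xs
      ∑-neighbours []       = refl
      ∑-neighbours (y ∷ xs) = cong₂ ℤ._+_ (both (c y ℕ.≟ c x) (sh? y)) (∑-neighbours xs)
        where
        both : ∀ {P Q : Set} (P? : Dec P) (Q? : Dec Q) → δ P? ℤ.* δ Q? ≡ + χ (⌊ P? ⌋ ∧ ⌊ Q? ⌋)
        both (yes _) (yes _) = refl
        both (yes _) (no _)  = refl
        both (no _)  (yes _) = refl
        both (no _)  (no _)  = refl

      factor-from : Result → S (suc m) ≡ signed m ℤ.* S m
      factor-from (diag , B , peel , values) = trans (S-step m B peel) (cong (ℤ._* S m) (begin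
        𝔸 x x ℤ.+ e ℤ.* ∑ (range1 m) (λ y → δ (c y ℕ.≟ c x) ℤ.* B y)
          ≡⟨ cong₂ (λ a b → a ℤ.+ e ℤ.* b) diag (trans (∑-cong (range1 m) (λ {y} y∈ → pointwise B values y∈)) (trans (∑-*ˡ G (λ y → δ (c y ℕ.≟ c x) ℤ.* δ (sh? y)) (range1 m)) (cong (G ℤ.*_) (∑-neighbours (range1 m))))) ⟩
        G ℤ.+ e ℤ.* (G ℤ.* + neighbours m)
          ≡⟨ arrange G e (+ neighbours m) ⟩
        G ℤ.* (+ 1 ℤ.+ e ℤ.* + neighbours m) ∎))
        where
        open ≡-Reasoning
        e = signT (typeOf (c x))
        arrange : ∀ g e b → g ℤ.+ e ℤ.* (g ℤ.* b) ≡ g ℤ.* (+ 1 ℤ.+ e ℤ.* b)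
        arrange = ℤ-solve-∀
        pointwise : ∀ (B : ℕ → ℤ) → (∀ {z} → z ∈ range1 m → at 0 κ z ≡ at 0 κ x → B z ≡ G ℤ.* δ (sh? z)) →
                    ∀ {y} → y ∈ range1 m → δ (c y ℕ.≟ c x) ℤ.* B y ≡ G ℤ.* (δ (c y ℕ.≟ c x) ℤ.* δ (sh? y))
        pointwise B values {y} y∈ with c y ℕ.≟ c x
        ... | yes ey = trans (ℤₚ.*-identityˡ (B y)) (trans (values y∈ ey) (cong (G ℤ.*_) (sym (ℤₚ.*-identityˡ (δ (sh? y))))))
        ... | no _   = trans (ℤₚ.*-zeroˡ (B y)) (sym (trans (cong (G ℤ.*_) (ℤₚ.*-zeroˡ (δ (sh? y)))) (ℤₚ.*-zeroʳ G)))

      S-factor : S (suc m) ≡ signed m ℤ.* S m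
      S-factor = factor-from result

  S-signeds : ∀ {m} → m ≤ n → S m ≡ signeds m
  S-signeds {zero}  _   = base tU tV
    where
    base : ∀ s t → (+ 1 ℤ.* ((sgT s (at 0 []) [] ℤ.* sgT t (at 0 []) []) ℤ.* + 1)) ℤ.+ + 0 ≡ + 1
    base colStrict     colStrict     = refl
    base colStrict     rowSemistrict = refl
    base rowSemistrict colStrict     = refl
    base rowSemistrict rowSemistrict = refl
  S-signeds {suc m} m<n = trans (Top.S-factor m<n) (cong (signed m ℤ.*_) (S-signeds (ℕₚ.<⇒≤ m<n)))

  ∑-wt-factors : ∀ L → Unique L → (∀ v → (v ∈ L) ⇔ BruhatLe n v w) → ∑ L (λ v → wt n r tU tV v κ) ≡ + factors n
  ∑-wt-factors L u mem = trans (∑-wt κ r tU tV L u mem) (trans (S-signeds ℕₚ.≤-refl) (signeds-factors n))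

-- Fillings by insertion of the largest element

Entry : Set
Entry = ℕ × Bool

module Poset (cs : List Iv) where

  _<Q_ : ℕ → ℕ → Set
  a <Q a′ = a < a′ × ¬ Shares cs (+ a) (+ a′)

  Adj : FillCond → ℕ → ℕ → Set
  Adj colStrict     a a′ = a <Q a′
  Adj rowSemistrict a a′ = ¬ (a′ <Q a)

  Marked : Bool → Entry → Set
  Marked true  (x , f) = f ≡ true → Shares cs (ℤ.- (+ x)) (+ x)
  Marked false (x , f) = f ≡ false × ¬ Shares cs (ℤ.- (+ x)) (+ x)

kind : ℕ → FillCond → FillCond → ℕ → FillCond
kind r tU tV b = if b ℕ.<ᵇ r then tU else tV

module Block (cs : List Iv) (κ : List ℕ) (r : ℕ) (tU tV : FillCond) (b : ℕ) where
  open Factor cs κ r tU tV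

  open Poset cs

  low : Bool
  low = b ℕ.<ᵇ r

  type : FillCond
  type = kind r tU tV b

  mine : ℕ → Bool
  mine i = ⌊ at 0 κ i ℕ.≟ b ⌋

  members : ℕ → List ℕ
  members m = filterᵇ mine (range1 m)

  -- `W` is the part up to `m` of one colour class, read upwards as a column or from left to right
  -- as a row.
  record Good (m : ℕ) (W : List Entry) : Set where
    constructor good
    field
      perm   : map proj₁ W ↭ members m
      adj    : Linked (Adj type) (map proj₁ W)
      marked : All (Marked low) W

  near? : ∀ x y → Dec (Shares cs (+ y) (+ x))
  near? x y = Shares? cs (+ y) (+ x)

  nearCount : ℕ → List Entry → ℕ
  nearCount x W = sumOf (λ e → χ ⌊ near? x (proj₁ e) ⌋) W

  inserts : FillCond → Entry → List Entry → List (List Entry)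
  inserts colStrict     e W = if ⌊ nearCount (proj₁ e) W ℕ.≟ 0 ⌋ then (W ++ e ∷ []) ∷ [] else []
  inserts rowSemistrict e []      = (e ∷ []) ∷ []
  inserts rowSemistrict e (y ∷ W) = (if ⌊ near? (proj₁ e) (proj₁ y) ⌋ then (e ∷ y ∷ W) ∷ [] else []) ++ map (y ∷_) (inserts rowSemistrict e W)

  flags : ℕ → List Bool
  flags x = if ⌊ grounded? x ⌋ then (if low then false ∷ true ∷ [] else []) else false ∷ []

  place : ℕ → List Entry → List (List Entry)
  place x W = concatMap (λ f → inserts type (x , f) W) (flags x)

  fillings : ℕ → List (List Entry)
  fillings zero    = [] ∷ []
  fillings (suc m) = if ⌊ at 0 κ (suc m) ℕ.≟ b ⌋ then concatMap (place (suc m)) (fillings m) else fillings m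

  length-inserts : ∀ t e W → length (inserts t e W) ≡ positions t (nearCount (proj₁ e) W)
  length-inserts colStrict e W with nearCount (proj₁ e) W ℕ.≟ 0
  ... | yes z rewrite z = refl
  ... | no nz with nearCount (proj₁ e) W
  ...   | zero  = contradiction refl nz
  ...   | suc _ = refl
  length-inserts rowSemistrict e []      = refl
  length-inserts rowSemistrict e (y ∷ W) with near? (proj₁ e) (proj₁ y)
  ... | yes _ = cong suc (trans (Listₚ.length-map (y ∷_) (inserts rowSemistrict e W)) (length-inserts rowSemistrict e W))
  ... | no _  = trans (Listₚ.length-map (y ∷_) (inserts rowSemistrict e W)) (length-inserts rowSemistrict e W)

  length-flags : ∀ {x} → at 0 κ x ≡ b → length (flags x) ≡ markings x
  length-flags {x} refl with grounded? x
  ... | no _ = refl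
  ... | yes _ with at 0 κ x ℕ.<ᵇ r
  ...   | true  = refl
  ...   | false = refl

  sumOf-filterᵇ : ∀ {A : Set} (f : A → ℕ) (p : A → Bool) xs → sumOf f (filterᵇ p xs) ≡ sumOf (λ x → if p x then f x else 0) xs
  sumOf-filterᵇ f p []       = refl
  sumOf-filterᵇ f p (x ∷ xs) with p x
  ... | true  = cong (_+_ (f x)) (sumOf-filterᵇ f p xs)
  ... | false = sumOf-filterᵇ f p xs

  nearCount-neighbours : ∀ {m W} → at 0 κ (suc m) ≡ b → map proj₁ W ↭ members m → nearCount (suc m) W ≡ neighbours m
  nearCount-neighbours {m} {W} refl p = trans (sym (sumOf-map (λ y → χ ⌊ near? (suc m) y ⌋) proj₁ W)) (trans (sumOf-↭ (λ y → χ ⌊ near? (suc m) y ⌋) p)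
    (trans (sumOf-filterᵇ (λ y → χ ⌊ near? (suc m) y ⌋) _ (range1 m)) (sumOf-cong (range1 m) (λ {y} _ → fuse ⌊ at 0 κ y ℕ.≟ at 0 κ (suc m) ⌋ ⌊ near? (suc m) y ⌋))))
    where
    fuse : ∀ a c → (if a then χ c else 0) ≡ χ (a ∧ c)
    fuse true  c = refl
    fuse false c = refl

  length-concatMap : ∀ {A B : Set} (f : A → List B) k xs → (∀ {x} → x ∈ xs → length (f x) ≡ k) → length (concatMap f xs) ≡ length xs * k
  length-concatMap f k []       _ = refl
  length-concatMap f k (x ∷ xs) h = trans (Listₚ.length-++ (f x)) (cong₂ _+_ (h (here refl)) (length-concatMap f k xs (h ∘ there)))

  module Insert {x : ℕ} {W : List Entry} (big : All (λ e → proj₁ e < x) W) where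

    inserts-split : ∀ t f {W′} → W′ ∈ inserts t (x , f) W → ∃₂ λ as bs → W ≡ as ++ bs × W′ ≡ as ++ (x , f) ∷ bs
    inserts-split colStrict f W′∈ with nearCount x W ℕ.≟ 0
    inserts-split colStrict f (here refl) | yes _ = W , [] , sym (Listₚ.++-identityʳ W) , refl
    inserts-split rowSemistrict f W′∈ = go W W′∈
      where
      go : ∀ W {W′} → W′ ∈ inserts rowSemistrict (x , f) W → ∃₂ λ as bs → W ≡ as ++ bs × W′ ≡ as ++ (x , f) ∷ bs
      go [] (here refl) = [] , [] , refl , refl
      go (y ∷ W) W′∈ with near? x (proj₁ y) | W′∈
      ... | yes _ | here refl = [] , y ∷ W , refl , refl
      ... | yes _ | there m with W″ , m′ , refl ← ∈ₚ.∈-map⁻ (y ∷_) m with as , bs , refl , refl ← go W m′ = y ∷ as , bs , refl , refl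
      ... | no _  | m with W″ , m′ , refl ← ∈ₚ.∈-map⁻ (y ∷_) m with as , bs , refl , refl ← go W m′ = y ∷ as , bs , refl , refl

  -- `strip` and `flagOf` recover the old word and the mark from the result of an insertion, so no
  -- filling is produced twice.
  strip : ℕ → List Entry → List Entry
  strip x = filterᵇ (λ e → not ⌊ proj₁ e ℕ.≟ x ⌋)

  strip-small : ∀ x W → All (λ e → proj₁ e < x) W → strip x W ≡ W
  strip-small x W big = filterᵇ-all _ W λ {e} e∈ → cong not (⌊⌋-false (proj₁ e ℕ.≟ x) (ℕₚ.<⇒≢ (All.lookup big e∈)))

  strip-middle : ∀ x f as bs → All (λ e → proj₁ e < x) (as ++ bs) → strip x (as ++ (x , f) ∷ bs) ≡ as ++ bs
  strip-middle x f as bs big = trans (filterᵇ-++ _ as ((x , f) ∷ bs)) (trans (cong (strip x as ++_) drop-it)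
    (trans (sym (filterᵇ-++ _ as bs)) (strip-small x (as ++ bs) big)))
    where
    drop-it : strip x ((x , f) ∷ bs) ≡ strip x bs
    drop-it with x ℕ.≟ x
    ... | yes _ = refl
    ... | no ne = contradiction refl ne

  flagOf : ℕ → List Entry → Bool
  flagOf x []            = false
  flagOf x ((y , f) ∷ W) = if ⌊ y ℕ.≟ x ⌋ then f else flagOf x W

  flagOf-middle : ∀ x f as bs → All (λ e → proj₁ e < x) as → flagOf x (as ++ (x , f) ∷ bs) ≡ f
  flagOf-middle x f [] bs _ rewrite ⌊⌋-true (x ℕ.≟ x) refl = refl
  flagOf-middle x f ((y , _) ∷ as) bs (lt ∷ big) rewrite ⌊⌋-false (y ℕ.≟ x) (ℕₚ.<⇒≢ lt) = flagOf-middle x f as bs big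

  inserts-unique : ∀ t e W → All (λ y → proj₁ y < proj₁ e) W → Unique (inserts t e W)
  inserts-unique colStrict e W _ with nearCount (proj₁ e) W ℕ.≟ 0
  ... | yes _ = [] ∷ []
  ... | no _  = []
  inserts-unique rowSemistrict e []      _ = [] ∷ []
  inserts-unique rowSemistrict e (y ∷ W) (lt ∷ big) with near? (proj₁ e) (proj₁ y)
  ... | yes _ = All.tabulate (λ m eq → case ∈ₚ.∈-map⁻ (y ∷_) m of λ (_ , _ , eq′) → ℕₚ.<-irrefl (cong proj₁ (sym (Listₚ.∷-injectiveˡ (trans eq eq′)))) lt)
                ∷ Uniqueₚ.map⁺ Listₚ.∷-injectiveʳ (inserts-unique rowSemistrict e W big)
  ... | no _  = Uniqueₚ.map⁺ Listₚ.∷-injectiveʳ (inserts-unique rowSemistrict e W big)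

  flags-unique : ∀ x → Unique (flags x)
  flags-unique x with grounded? x
  ... | no _ = [] ∷ []
  ... | yes _ with low
  ...   | true  = ((λ ()) ∷ []) ∷ [] ∷ []
  ...   | false = []

  place-split : ∀ {x W W′} → All (λ e → proj₁ e < x) W → W′ ∈ place x W →
                ∃ λ f → f ∈ flags x × W′ ∈ inserts type (x , f) W × ∃₂ λ as bs → W ≡ as ++ bs × W′ ≡ as ++ (x , f) ∷ bs
  place-split {x} {W} big W′∈ with f , f∈ , m ← find (∈ₚ.∈-concatMap⁻ (λ f → inserts type (x , f) W) {xs = flags x} W′∈) =
    f , f∈ , m , Insert.inserts-split big type f m

  place-unique : ∀ {x W} → All (λ e → proj₁ e < x) W → Unique (place x W)
  place-unique {x} {W} big = unique-concatMap (λ f → inserts type (x , f) W) (flagOf x) (flags-unique x)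
    (λ {f} _ → inserts-unique type (x , f) W big)
    (λ {f} {W′} _ m → case Insert.inserts-split big type f m of λ { (as , bs , refl , refl) → flagOf-middle x f as bs (Allₚ.++⁻ˡ as big) })

  place-strip : ∀ {x W W′} → All (λ e → proj₁ e < x) W → W′ ∈ place x W → strip x W′ ≡ W
  place-strip {x} big W′∈ with f , _ , _ , as , bs , refl , refl ← place-split big W′∈ = strip-middle x f as bs big

  good-small : ∀ {m} {W : List Entry} → map proj₁ W ↭ members m → All (λ e → proj₁ e < suc m) W
  good-small {m} p = All.tabulate λ e∈ → case ∈-range1⁻ (proj₁ (filterᵇ-∈⁻ mine (range1 m) (↭ₚ.∈-resp-↭ p (∈ₚ.∈-map⁺ proj₁ e∈)))) of λ { (j , j< , e) → subst (_< suc m) (sym e) (s≤s j<) }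

  members-in : ∀ {m} → at 0 κ (suc m) ≡ b → members (suc m) ↭ suc m ∷ members m
  members-in {m} e = ↭-trans (↭-reflexive (trans (cong (filterᵇ mine) (range1-snoc m)) (trans (filterᵇ-++ mine (range1 m) (suc m ∷ [])) (cong (members m ++_) (filterᵇ-all mine (suc m ∷ []) (λ { (here refl) → ⌊⌋-true (at 0 κ (suc m) ℕ.≟ b) e }))))))
    (↭ₚ.++-comm (members m) (suc m ∷ []))

  members-out : ∀ {m} → at 0 κ (suc m) ≢ b → members (suc m) ≡ members m
  members-out {m} ne = trans (cong (filterᵇ mine) (range1-snoc m)) (trans (filterᵇ-++ mine (range1 m) (suc m ∷ []))
    (trans (cong (members m ++_) (filterᵇ-none mine (suc m ∷ []) (λ { (here refl) → ⌊⌋-false (at 0 κ (suc m) ℕ.≟ b) ne }))) (Listₚ.++-identityʳ (members m))))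

  <Q-trans : ∀ {x y z} → x <Q y → y <Q z → x <Q z
  <Q-trans (x<y , ¬s) (y<z , _) = ℕₚ.<-trans x<y y<z , λ s → ¬s (proj₁ (Shares-convex s (ℤ.+≤+ (ℕₚ.<⇒≤ x<y)) (ℤ.+≤+ (ℕₚ.<⇒≤ y<z))))

  Linked-snoc : ∀ {R : ℕ → ℕ → Set} {x} L → Linked R L → All (λ a → R a x) L → Linked R (L ++ x ∷ [])
  Linked-snoc []           _       _       = [-]
  Linked-snoc (a ∷ [])     [-]     (p ∷ _) = p ∷ [-]
  Linked-snoc (a ∷ c ∷ L)  (q ∷ l) (_ ∷ ps) = q ∷ Linked-snoc (c ∷ L) l ps

  nearCount-zero : ∀ {x} W → nearCount x W ≡ 0 → ∀ {y} → y ∈ map proj₁ W → ¬ Shares cs (+ y) (+ x)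
  nearCount-zero {x} (e ∷ W) z y∈ s with near? x (proj₁ e) | y∈
  ... | no ¬s | here refl = ¬s s
  ... | no _  | there m   = nearCount-zero W z m s

  zero-nearCount : ∀ {x} W → (∀ {y} → y ∈ map proj₁ W → ¬ Shares cs (+ y) (+ x)) → nearCount x W ≡ 0
  zero-nearCount []      _ = refl
  zero-nearCount {x} (e ∷ W) h with near? x (proj₁ e)
  ... | yes s = contradiction s (h (here refl))
  ... | no _  = zero-nearCount W (h ∘ there)

  row-cases : ∀ {x f} y W {V} → V ∈ inserts rowSemistrict (x , f) (y ∷ W) →
              (Shares cs (+ proj₁ y) (+ x) × V ≡ (x , f) ∷ y ∷ W) ⊎ ∃ λ V′ → V′ ∈ inserts rowSemistrict (x , f) W × V ≡ y ∷ V′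
  row-cases {x} y W V∈ with near? x (proj₁ y) | V∈
  ... | yes s | here e  = inj₁ (s , e)
  ... | yes _ | there m = inj₂ (∈ₚ.∈-map⁻ (y ∷_) m)
  ... | no _  | m       = inj₂ (∈ₚ.∈-map⁻ (y ∷_) m)

  -- The letter `y` before the insertion point is carried along. It is smaller than `x`, so placing
  -- `x` directly after it is always allowed.
  row-adj : ∀ {x f} y W → proj₁ y < x → All (λ e → proj₁ e < x) W → Linked (Adj rowSemistrict) (proj₁ y ∷ map proj₁ W) →
            ∀ {V} → V ∈ inserts rowSemistrict (x , f) W → Linked (Adj rowSemistrict) (proj₁ y ∷ map proj₁ V)
  row-adj y []      lt _ _ (here refl) = (λ (x<y , _) → ℕₚ.<-asym x<y lt) ∷ [-]
  row-adj y (z ∷ W) lt (lt′ ∷ big) (q ∷ l) m with row-cases z W m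
  ... | inj₁ (s , refl)      = (λ (x<y , _) → ℕₚ.<-asym x<y lt) ∷ (λ (_ , ¬s) → ¬s s) ∷ l
  ... | inj₂ (V′ , m′ , refl) = q ∷ row-adj z W lt′ big l m′

  inserts-adj : ∀ t {x f W W′} → All (λ e → proj₁ e < x) W → Linked (Adj t) (map proj₁ W) → W′ ∈ inserts t (x , f) W → Linked (Adj t) (map proj₁ W′)
  inserts-adj colStrict {x} {f} {W} big l W′∈ with nearCount x W ℕ.≟ 0
  inserts-adj colStrict {x} {f} {W} big l (here refl) | yes z =
    subst (Linked _<Q_) (sym (Listₚ.map-++ proj₁ W ((x , f) ∷ []))) (Linked-snoc (map proj₁ W) l (All.tabulate λ {y} y∈ → All.lookup (Allₚ.map⁺ big) y∈ , nearCount-zero W z y∈))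
  inserts-adj rowSemistrict {W = []} big l (here refl) = [-]
  inserts-adj rowSemistrict {W = y ∷ W} (lt ∷ big) l m with row-cases y W m
  ... | inj₁ (s , refl)      = (λ (_ , ¬s) → ¬s s) ∷ l
  ... | inj₂ (V′ , m′ , refl) = row-adj y W lt big l m′

  Linked-skip : ∀ {R : ℕ → ℕ → Set} as {x} bs → (∀ {a c} → a ∈ as → c ∈ bs → R a x → R x c → R a c) → Linked R (as ++ x ∷ bs) → Linked R (as ++ bs)
  Linked-skip []           []       h l           = []
  Linked-skip []           (c ∷ bs) h (_ ∷ l)     = l
  Linked-skip (a ∷ [])     []       h l           = [-]
  Linked-skip (a ∷ [])     (c ∷ bs) h (p ∷ q ∷ l) = h (here refl) (here refl) p q ∷ l
  Linked-skip (a ∷ c ∷ as) bs       h (p ∷ l)     = p ∷ Linked-skip (c ∷ as) bs (h ∘ there) l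

  -- In a column `x` is last, being the largest, and transitivity compares it with all other
  -- letters. In a row with consecutive `a`, `x`, `c`, the path of `c` meets that of `x`; by
  -- convexity `c <Q a` is impossible, so deleting `x` leaves an admissible row.
  inserts-complete : ∀ t {x f} as bs → All (λ e → proj₁ e < x) (as ++ bs) → Linked (Adj t) (map proj₁ (as ++ (x , f) ∷ bs)) →
    as ++ (x , f) ∷ bs ∈ inserts t (x , f) (as ++ bs) × Linked (Adj t) (map proj₁ (as ++ bs))
  inserts-complete colStrict {x} {f} as (c ∷ bs) big l =
    contradiction (proj₁ x<Qc) (ℕₚ.<-asym (All.head (Allₚ.++⁻ʳ as big)))
    where
    x<Qc : x <Q proj₁ c
    x<Qc with p ∷ _ ← proj₂ (Linked-split (map proj₁ as) (subst (Linked _<Q_) (Listₚ.map-++ proj₁ as ((x , f) ∷ c ∷ bs)) l)) = p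
  inserts-complete colStrict {x} {f} as [] big l rewrite Listₚ.++-identityʳ as =
    subst (λ t → as ++ (x , f) ∷ [] ∈ (if t then (as ++ (x , f) ∷ []) ∷ [] else [])) (sym (⌊⌋-true (nearCount x as ℕ.≟ 0) (zero-nearCount as far))) (here refl) ,
    subst (Linked _<Q_) (Listₚ.++-identityʳ (map proj₁ as)) (Linked-skip (map proj₁ as) [] (λ _ ()) l′)
    where
    l′ : Linked _<Q_ (map proj₁ as ++ x ∷ [])
    l′ = subst (Linked _<Q_) (Listₚ.map-++ proj₁ as ((x , f) ∷ [])) l
    before : ∀ L → AllPairs _<Q_ (L ++ x ∷ []) → ∀ {y} → y ∈ L → y <Q x
    before (y ∷ L) (a ∷ _)  (here refl) = All.lookup a (∈ₚ.∈-++⁺ʳ L (here refl))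
    before (y ∷ L) (_ ∷ ap) (there m)   = before L ap m
    far : ∀ {y} → y ∈ map proj₁ as → ¬ Shares cs (+ y) (+ x)
    far y∈ = proj₂ (before (map proj₁ as) (Linkedₚ.Linked⇒AllPairs <Q-trans l′) y∈)
  inserts-complete rowSemistrict {x} {f} as bs big l = found as bs (Allₚ.++⁻ʳ as big) l ,
    subst (Linked (Adj rowSemistrict)) (sym (Listₚ.map-++ proj₁ as bs))
      (Linked-skip (map proj₁ as) (map proj₁ bs) junction (subst (Linked (Adj rowSemistrict)) (Listₚ.map-++ proj₁ as ((x , f) ∷ bs)) l))
    where
    shares : ∀ {c} → c < x → ¬ (c <Q x) → Shares cs (+ c) (+ x)
    shares {c} c<x n = decidable-stable (near? x c) (λ ¬s → n (c<x , ¬s))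
    junction : ∀ {a c} → a ∈ map proj₁ as → c ∈ map proj₁ bs → Adj rowSemistrict a x → Adj rowSemistrict x c → Adj rowSemistrict a c
    junction a∈ c∈ ax xc (c<a , ¬s) = ¬s (proj₁ (Shares-convex (shares (All.lookup (Allₚ.map⁺ (Allₚ.++⁻ʳ as big)) c∈) xc)
      (ℤ.+≤+ (ℕₚ.<⇒≤ c<a)) (ℤ.+≤+ (ℕₚ.<⇒≤ (All.lookup (Allₚ.map⁺ (Allₚ.++⁻ˡ as big)) a∈)))))
    found : ∀ as bs → All (λ e → proj₁ e < x) bs → Linked (Adj rowSemistrict) (map proj₁ (as ++ (x , f) ∷ bs)) → as ++ (x , f) ∷ bs ∈ inserts rowSemistrict (x , f) (as ++ bs)
    found []       []       _ _ = here refl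
    found []       (c ∷ bs) (lt ∷ _) (p ∷ _) rewrite ⌊⌋-true (near? x (proj₁ c)) (shares lt p) = here refl
    found (a ∷ as) bs big l = ∈ₚ.∈-++⁺ʳ (if ⌊ near? x (proj₁ a) ⌋ then ((x , f) ∷ a ∷ as ++ bs) ∷ [] else []) (∈ₚ.∈-map⁺ (a ∷_) (found as bs big (tail-linked l)))
      where
      tail-linked : ∀ {c L} → Linked (Adj rowSemistrict) (c ∷ L) → Linked (Adj rowSemistrict) L
      tail-linked [-]     = []
      tail-linked (_ ∷ l) = l

  flags-sound : ∀ {x f} → f ∈ flags x → Marked low (x , f)
  flags-sound {x} f∈ with grounded? x | low | f∈
  ... | no ¬g | true  | here refl         = λ ()
  ... | no ¬g | false | here refl         = refl , ¬g
  ... | yes g | true  | here refl         = λ ()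
  ... | yes g | true  | there (here refl) = λ _ → g

  flags-complete : ∀ {x f} → Marked low (x , f) → f ∈ flags x
  flags-complete {x} {f} mk with grounded? x | low
  flags-complete {x} {true}  mk | no ¬g | true  = contradiction (mk refl) ¬g
  flags-complete {x} {false} mk | no ¬g | true  = here refl
  flags-complete {x} {f} (refl , _) | no ¬g | false = here refl
  flags-complete {x} {false} mk | yes g | true  = here refl
  flags-complete {x} {true}  mk | yes g | true  = there (here refl)
  flags-complete {x} {f} (_ , ¬g) | yes g | false = contradiction g ¬g

  place-good : ∀ {m W W′} → at 0 κ (suc m) ≡ b → Good m W → W′ ∈ place (suc m) W → Good (suc m) W′
  place-good {m} e (good p l mk) W′∈ with f , f∈ , i∈ , as , bs , refl , refl ← place-split (good-small p) W′∈ = good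
    (↭-trans (↭-reflexive (Listₚ.map-++ proj₁ as _)) (↭-trans (↭ₚ.shift (suc m) (map proj₁ as) (map proj₁ bs))
      (↭-trans (prep (suc m) (↭-trans (↭-reflexive (sym (Listₚ.map-++ proj₁ as bs))) p)) (↭-sym (members-in e)))))
    (inserts-adj type (good-small p) l i∈)
    (Allₚ.++⁺ (Allₚ.++⁻ˡ as mk) (flags-sound f∈ ∷ Allₚ.++⁻ʳ as mk))

  good-place : ∀ {m W′} → at 0 κ (suc m) ≡ b → Good (suc m) W′ → ∃ λ W → Good m W × W′ ∈ place (suc m) W
  good-place {m} {W′} e (good p l mk)
    with (.(suc m) , f) , e∈ , refl ← ∈ₚ.∈-map⁻ proj₁ (↭ₚ.∈-resp-↭ (↭-sym p) (↭ₚ.∈-resp-↭ (↭-sym (members-in e)) (here refl)))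
    with as , bs , refl ← ∈ₚ.∈-∃++ e∈ = as ++ bs , good p′ (proj₂ complete) (Allₚ.++⁺ (Allₚ.++⁻ˡ as mk) (All.tail (Allₚ.++⁻ʳ as mk))) ,
      ∈ₚ.∈-concatMap⁺ (λ f → inserts type (suc m , f) (as ++ bs)) {xs = flags (suc m)} (lose (flags-complete (All.head (Allₚ.++⁻ʳ as mk))) (proj₁ complete))
    where
    p′ : map proj₁ (as ++ bs) ↭ members m
    p′ = ↭-trans (↭-reflexive (Listₚ.map-++ proj₁ as bs)) (↭ₚ.drop-∷ (↭-trans (↭-sym (↭ₚ.shift (suc m) (map proj₁ as) (map proj₁ bs)))
           (↭-trans (↭-reflexive (sym (Listₚ.map-++ proj₁ as _))) (↭-trans p (members-in e)))))
    complete = inserts-complete type as bs (good-small p′) l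

  fillings-sound : ∀ m {W} → W ∈ fillings m → Good m W
  fillings-sound zero    (here refl) = good ↭-refl [] []
  fillings-sound (suc m) W∈ with at 0 κ (suc m) ℕ.≟ b
  ... | yes e with V , V∈ , m∈ ← find (∈ₚ.∈-concatMap⁻ (place (suc m)) {xs = fillings m} W∈) = place-good e (fillings-sound m V∈) m∈
  ... | no ne with good p l mk ← fillings-sound m W∈ = good (↭-trans p (↭-reflexive (sym (members-out ne)))) l mk

  fillings-complete : ∀ m {W} → Good m W → W ∈ fillings m
  fillings-complete zero {[]}    _ = here refl
  fillings-complete zero {e ∷ W} (good p _ _) = contradiction (↭ₚ.↭-empty-inv p) λ ()
  fillings-complete (suc m) g@(good p l mk) with at 0 κ (suc m) ℕ.≟ b
  ... | yes e with W , gW , m∈ ← good-place e g = ∈ₚ.∈-concatMap⁺ (place (suc m)) {xs = fillings m} (lose (fillings-complete m gW) m∈)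
  ... | no ne = fillings-complete m (good (↭-trans p (↭-reflexive (members-out ne))) l mk)

  fillings-unique : ∀ m → Unique (fillings m)
  fillings-unique zero    = [] ∷ []
  fillings-unique (suc m) with at 0 κ (suc m) ℕ.≟ b
  ... | no _  = fillings-unique m
  ... | yes _ = unique-concatMap (place (suc m)) (strip (suc m)) (fillings-unique m)
    (λ W∈ → place-unique (good-small (Good.perm (fillings-sound m W∈)))) (λ W∈ m∈ → place-strip (good-small (Good.perm (fillings-sound m W∈))) m∈)

  fillings-length-in : ∀ {m} → at 0 κ (suc m) ≡ b → length (fillings (suc m)) ≡ factor m * length (fillings m)
  fillings-length-in {m} refl rewrite ⌊⌋-true (at 0 κ (suc m) ℕ.≟ at 0 κ (suc m)) refl =
    trans (length-concatMap (place (suc m)) (factor m) (fillings m) (λ {W} W∈ →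
      trans (length-concatMap (λ f → inserts type (suc m , f) W) (positions type (neighbours m)) (flags (suc m))
        (λ {f} _ → trans (length-inserts type (suc m , f) W) (cong (positions type) (nearCount-neighbours {m} {W} refl (Good.perm (fillings-sound m W∈))))))
      (cong (_* positions type (neighbours m)) (length-flags {suc m} refl)))) (ℕₚ.*-comm (length (fillings m)) (factor m))

  fillings-length-out : ∀ {m} → at 0 κ (suc m) ≢ b → length (fillings (suc m)) ≡ length (fillings m)
  fillings-length-out {m} ne rewrite ⌊⌋-false (at 0 κ (suc m) ℕ.≟ b) ne = refl

-- Assembling the fillings of all blocks

choices : {A : Set} → List (List A) → List (List A)
choices []       = [] ∷ []
choices (L ∷ Ls) = concatMap (λ w → map (w ∷_) (choices Ls)) L

choices-length : ∀ {A : Set} (Ls : List (List A)) → length (choices Ls) ≡ product (map length Ls)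
choices-length []       = refl
choices-length (L ∷ Ls) = trans (go L) (cong (length L *_) (choices-length Ls))
  where
  go : ∀ L → length (concatMap (λ w → map (w ∷_) (choices Ls)) L) ≡ length L * length (choices Ls)
  go []      = refl
  go (w ∷ L) = trans (Listₚ.length-++ (map (w ∷_) (choices Ls))) (cong₂ _+_ (Listₚ.length-map (w ∷_) (choices Ls)) (go L))

choices-unique : ∀ {A : Set} {Ls : List (List A)} → All Unique Ls → Unique (choices Ls)
choices-unique [] = [] ∷ []
choices-unique {Ls = L ∷ Ls} (u ∷ us) = go u
  where
  cu = choices-unique us
  go : ∀ {L} → Unique L → Unique (concatMap (λ w → map (w ∷_) (choices Ls)) L)
  go [] = []
  go {w ∷ L} (w∉ ∷ u) = Uniqueₚ.++⁺ (Uniqueₚ.map⁺ Listₚ.∷-injectiveʳ cu) (go u) λ (p , q) →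
    case (∈ₚ.∈-map⁻ (w ∷_) p , find (∈ₚ.∈-concatMap⁻ (λ w → map (w ∷_) (choices Ls)) {xs = L} q)) of λ
      { ((_ , _ , refl) , (w′ , w′∈ , m)) → case ∈ₚ.∈-map⁻ (w′ ∷_) m of λ { (_ , _ , e) → All.lookup w∉ w′∈ (Listₚ.∷-injectiveˡ e) } }

choices⁻ : ∀ {A : Set} {d : A} (F : ℕ → List A) f q {B} → B ∈ choices (map F (applyUpTo f q)) →
           length B ≡ q × (∀ {b} → b < q → at d B (suc b) ∈ F (f b))
choices⁻ F f zero    (here refl) = refl , λ ()
choices⁻ {d = d} F f (suc q) B∈
  with w , w∈ , m ← find (∈ₚ.∈-concatMap⁻ (λ w → map (w ∷_) (choices (map F (applyUpTo (f ∘ suc) q)))) {xs = F (f 0)} B∈)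
  with B′ , m′ , refl ← ∈ₚ.∈-map⁻ (w ∷_) m with l , h ← choices⁻ {d = d} F (f ∘ suc) q m′ =
  cong suc l , λ { {zero} _ → w∈ ; {suc b} (s≤s b<) → h b< }

choices⁺ : ∀ {A : Set} {d : A} (F : ℕ → List A) f q {B} → length B ≡ q → (∀ {b} → b < q → at d B (suc b) ∈ F (f b)) →
           B ∈ choices (map F (applyUpTo f q))
choices⁺ F f zero    {[]}    _ _ = here refl
choices⁺ {d = d} F f (suc q) {w ∷ B} l h = ∈ₚ.∈-concatMap⁺ (λ w → map (w ∷_) (choices (map F (applyUpTo (f ∘ suc) q)))) {xs = F (f 0)}
  (lose (h (s≤s z≤n)) (∈ₚ.∈-map⁺ (w ∷_) (choices⁺ {d = d} F (f ∘ suc) q (ℕₚ.suc-injective l) (λ b< → h (s≤s b<)))))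

∑-length-concatMap : ∀ {A B : Set} (f : A → List B) xs → + length (concatMap f xs) ≡ ∑ xs (λ x → + length (f x))
∑-length-concatMap f []       = refl
∑-length-concatMap f (x ∷ xs) = trans (cong +_ (Listₚ.length-++ (f x))) (cong (ℤ._+_ (+ length (f x))) (∑-length-concatMap f xs))

words-unique : ∀ q n → Unique (words q n)
words-unique q zero    = [] ∷ []
words-unique q (suc n) = unique-concatMap (λ a → map (a ∷_) (words q n)) (λ κ → at 0 κ 1) (Uniqueₚ.upTo⁺ q)
  (λ _ → Uniqueₚ.map⁺ Listₚ.∷-injectiveʳ (words-unique q n)) (λ {a} _ m → case ∈ₚ.∈-map⁻ (a ∷_) m of λ { (_ , _ , refl) → refl })

findBlock : ℕ → List (List Entry) → ℕ
findBlock i []      = 0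
findBlock i (W ∷ A) = if ⌊ Any.any? (i ℕ.≟_) (map proj₁ W) ⌋ then 0 else suc (findBlock i A)

findBlock-sound : ∀ {i} A → i ∈ concat (vals A) → findBlock i A < length A × i ∈ map proj₁ (at [] A (suc (findBlock i A)))
findBlock-sound {i} (W ∷ A) i∈ with Any.any? (i ℕ.≟_) (map proj₁ W)
... | yes m = s≤s z≤n , m
... | no ¬m with ∈ₚ.∈-++⁻ (map proj₁ W) i∈
...   | inj₁ m = contradiction m ¬m
...   | inj₂ m with lt , h ← findBlock-sound A m = s≤s lt , h

at-concat : ∀ {A : Set} (Ws : List (List A)) {b i} → b < length Ws → i ∈ at [] Ws (suc b) → i ∈ concat Ws
at-concat (W ∷ Ws) {zero}  _        i∈ = ∈ₚ.∈-++⁺ˡ i∈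
at-concat (W ∷ Ws) {suc b} (s≤s b<) i∈ = ∈ₚ.∈-++⁺ʳ W (at-concat Ws b< i∈)

vals-at : ∀ A b → at [] (vals A) (suc b) ≡ map proj₁ (at [] A (suc b))
vals-at A b = at-map (map proj₁) [] A (suc b)

findBlock-unique : ∀ {i} A {b} → Unique (concat (vals A)) → b < length A → i ∈ map proj₁ (at [] A (suc b)) → findBlock i A ≡ b
findBlock-unique {i} (W ∷ A) {b} u b< i∈ with Any.any? (i ℕ.≟_) (map proj₁ W)
findBlock-unique {i} (W ∷ A) {zero}  u b< i∈ | yes _ = refl
findBlock-unique {i} (W ∷ A) {zero}  u b< i∈ | no ¬m = contradiction i∈ ¬m
findBlock-unique {i} (W ∷ A) {suc b} u (s≤s b<) i∈ | yes m = ⊥-elim (disjoint (map proj₁ W) u m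
    (at-concat (vals A) (subst (b <_) (sym (Listₚ.length-map (map proj₁) A)) b<) (subst (i ∈_) (sym (vals-at A b)) i∈)))
  where
  disjoint : ∀ {A : Set} (xs : List A) {ys i} → Unique (xs ++ ys) → i ∈ xs → i ∈ ys → ⊥
  disjoint (x ∷ xs) (a ∷ _) (here refl) m = All.lookup a (∈ₚ.∈-++⁺ʳ xs m) refl
  disjoint (x ∷ xs) (_ ∷ u) (there p)   m = disjoint xs u p m
findBlock-unique {i} (W ∷ A) {suc b} u (s≤s b<) i∈ | no _ = cong suc (findBlock-unique A (suffix (map proj₁ W) u) b< i∈)
  where
  suffix : ∀ {A : Set} (xs : List A) {ys} → Unique (xs ++ ys) → Unique ys
  suffix []       u       = u
  suffix (x ∷ xs) (_ ∷ u) = suffix xs u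

word-unique : ∀ A {b} → Unique (concat (vals A)) → Unique (map proj₁ (at [] A (suc b)))
word-unique []      _ = []
word-unique (W ∷ A) {zero}  u = prefix (map proj₁ W) u
  where
  prefix : ∀ {A : Set} (xs : List A) {ys} → Unique (xs ++ ys) → Unique xs
  prefix []       _       = []
  prefix (x ∷ xs) (a ∷ u) = Allₚ.++⁻ˡ xs a ∷ prefix xs u
word-unique (W ∷ A) {suc b} u = word-unique A {b} (suffix (map proj₁ W) u)
  where
  suffix : ∀ {A : Set} (xs : List A) {ys} → Unique (xs ++ ys) → Unique ys
  suffix []       u       = u
  suffix (x ∷ xs) (_ ∷ u) = suffix xs u

at-concatMap-↭ : ∀ {B : Set} (G : ℕ → List B) (A : List (List B)) f → (∀ {b} → b < length A → at [] A (suc b) ↭ G (f b)) →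
                 concat A ↭ concatMap G (applyUpTo f (length A))
at-concatMap-↭ G []      f h = ↭-refl
at-concatMap-↭ G (W ∷ A) f h = ↭ₚ.++⁺ (h (s≤s z≤n)) (at-concatMap-↭ G A (f ∘ suc) (λ b< → h (s≤s b<)))

at-map-≡ : ∀ {B C : Set} {d : B} (g : B → C) (G : ℕ → C) (A : List B) f → (∀ {b} → b < length A → g (at d A (suc b)) ≡ G (f b)) →
           map g A ≡ map G (applyUpTo f (length A))
at-map-≡ g G []      f h = refl
at-map-≡ g G (W ∷ A) f h = cong₂ _∷_ (h (s≤s z≤n)) (at-map-≡ g G A (f ∘ suc) (λ b< → h (s≤s b<)))

module Arrangements (cs : List Iv) (n r q : ℕ) (tU tV : FillCond) (ν : List ℕ) where
  open Poset cs

  blocks : List ℕ → List (List (List Entry))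
  blocks κ = map (λ b → Block.fillings cs κ r tU tV b n) (upTo q)

  colorings : List (List ℕ)
  colorings = filterᵇ (λ κ → ⌊ content q κ ≟ᴸ ν ⌋) (words q n)

  arrangements : List (List (List Entry))
  arrangements = concatMap (λ κ → choices (blocks κ)) colorings

  GoodWord : ℕ → List Entry → Set
  GoodWord b W = Linked (Adj (kind r tU tV b)) (map proj₁ W) × All (Marked (b ℕ.<ᵇ r)) W

  -- The colouring has been eliminated from the description: `findBlock` reads it off from the
  -- arrangement, which also keeps the lists of different colourings disjoint.
  record Arranged (A : List (List Entry)) : Set where
    constructor arranged
    field
      size  : length A ≡ q
      row   : ∀ {b} → b < q → GoodWord b (at [] A (suc b))
      uses  : concat (vals A) ↭ range1 n
      shape : map length A ≡ ν

  -- Passing from `m` to `suc m` changes the number of fillings of a single block, that of the new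
  -- element, and multiplies it by `factor m`.
  blocks-length : ∀ {κ} → κ ∈ words q n → length (choices (blocks κ)) ≡ Factor.factors cs κ r tU tV n
  blocks-length {κ} κ∈ = trans (choices-length (blocks κ)) (trans (cong product (sym (Listₚ.map-∘ (upTo q)))) (go n ℕₚ.≤-refl))
    where
    len : ℕ → ℕ → ℕ
    len m b = length (Block.fillings cs κ r tU tV b m)
    color< : ∀ {m} → m < n → at 0 κ (suc m) < q
    color< {m} m<n with l , b ← words-sound q n κ∈ = All.lookup b (at-∈ κ (subst (m <_) (sym l) m<n))
    go : ∀ m → m ≤ n → product (map (len m) (upTo q)) ≡ Factor.factors cs κ r tU tV m
    go zero    _   = ones (upTo q)
      where
      ones : ∀ bs → product (map (len 0) bs) ≡ 1
      ones []       = refl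
      ones (b ∷ bs) = trans (ℕₚ.+-identityʳ _) (ones bs)
    go (suc m) m<n = trans (product-update (len (suc m)) (len m) (Factor.factor cs κ r tU tV m) (upTo q) (Uniqueₚ.upTo⁺ q) (∈ₚ.∈-upTo⁺ (color< m<n))
        (Block.fillings-length-in cs κ r tU tV (at 0 κ (suc m)) refl) (λ {a} ne → Block.fillings-length-out cs κ r tU tV a (ne ∘ sym)))
      (cong (Factor.factor cs κ r tU tV m *_) (go m (ℕₚ.<⇒≤ m<n)))

  arrangements-length : + length arrangements ≡ ∑col q n ν (λ κ → + Factor.factors cs κ r tU tV n)
  arrangements-length = trans (∑-length-concatMap (λ κ → choices (blocks κ)) colorings) (trans (∑-filterᵇ (λ κ → ⌊ content q κ ≟ᴸ ν ⌋) _ (words q n))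
    (∑-cong (words q n) (λ {κ} κ∈ → cong (λ l → δ (content q κ ≟ᴸ ν) ℤ.* + l) (blocks-length κ∈))))

  private
    module Colored {κ} (κ∈ : κ ∈ words q n) {A} (A∈ : A ∈ choices (blocks κ)) where
      size : length A ≡ q
      size = proj₁ (choices⁻ {d = []} (λ b → Block.fillings cs κ r tU tV b n) id q A∈)
      word-good : ∀ {b} → b < q → Block.Good cs κ r tU tV b n (at [] A (suc b))
      word-good {b} b< = Block.fillings-sound cs κ r tU tV b n (proj₂ (choices⁻ {d = []} (λ b → Block.fillings cs κ r tU tV b n) id q A∈) b<)
      members = λ b → Block.members cs κ r tU tV b n
      κ< : ∀ {i} → i ∈ range1 n → at 0 κ i < q
      κ< i∈ with j , j< , refl ← ∈-range1⁻ i∈ with l , b ← words-sound q n κ∈ = All.lookup b (at-∈ κ (subst (j <_) (sym l) j<))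
      partition : concatMap members (upTo q) ↭ range1 n
      partition = unique-set-↭ (unique-concatMap members (at 0 κ) (Uniqueₚ.upTo⁺ q) (λ _ → filterᵇ-unique _ (range1-unique n)) (λ {b} _ z∈ → color z∈)) (range1-unique n)
        (λ z∈ → case find (∈ₚ.∈-concatMap⁻ members {xs = upTo q} z∈) of λ (b , _ , m) → proj₁ (filterᵇ-∈⁻ _ (range1 n) m))
        (λ {z} z∈ → ∈ₚ.∈-concatMap⁺ members {xs = upTo q} (lose (∈ₚ.∈-upTo⁺ (κ< z∈)) (filterᵇ-∈⁺ _ (range1 n) z∈ (⌊⌋-true (at 0 κ z ℕ.≟ at 0 κ z) refl))))
        where
        color : ∀ {b z} → z ∈ members b → at 0 κ z ≡ b
        color {b} {z} z∈ with at 0 κ z ℕ.≟ b | proj₂ (filterᵇ-∈⁻ (λ i → ⌊ at 0 κ i ℕ.≟ b ⌋) (range1 n) z∈)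
        ... | yes e | _ = e
      uses : concat (vals A) ↭ range1 n
      uses = ↭-trans (at-concatMap-↭ members (vals A) id (λ {b} b< → ↭-trans (↭-reflexive (vals-at A b)) (Block.Good.perm (word-good (subst (b <_) vsize b<)))))
        (↭-trans (↭-reflexive (cong (λ m → concatMap members (upTo m)) vsize)) partition)
        where
        vsize : length (vals A) ≡ q
        vsize = trans (Listₚ.length-map (map proj₁) A) size
      color-word : ∀ {b i} → b < q → i ∈ map proj₁ (at [] A (suc b)) → at 0 κ i ≡ b
      color-word {b} {i} b< i∈ with at 0 κ i ℕ.≟ b | proj₂ (filterᵇ-∈⁻ (λ i → ⌊ at 0 κ i ℕ.≟ b ⌋) (range1 n) (↭ₚ.∈-resp-↭ (Block.Good.perm (word-good b<)) i∈))
      ... | yes e | _ = e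
      recover : map (λ i → findBlock i A) (range1 n) ≡ κ
      recover = trans (Listₚ.map-cong-local (All.tabulate λ {i} i∈ → let lt , m = findBlock-sound A (↭ₚ.∈-resp-↭ (↭-sym uses) i∈) in sym (color-word (subst (_ <_) size lt) m)))
        (tabulate-at κ (proj₁ (words-sound q n κ∈)))

  length-members : ∀ κ b → length κ ≡ n → length (Block.members cs κ r tU tV b n) ≡ count b κ
  length-members κ b l = trans (length-filterᵇ (λ i → ⌊ at 0 κ i ℕ.≟ b ⌋) (range1 n)) (trans (sym (sumOf-map (λ a → χ ⌊ a ℕ.≟ b ⌋) (at 0 κ) (range1 n))) (cong (count b) (tabulate-at κ l)))

  arrangements-unique : Unique arrangements
  arrangements-unique = unique-concatMap (λ κ → choices (blocks κ)) (λ A → map (λ i → findBlock i A) (range1 n)) (filterᵇ-unique _ (words-unique q n))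
    (λ {κ} _ → choices-unique {Ls = blocks κ} (Allₚ.map⁺ {xs = upTo q} (All.tabulate λ {b} _ → Block.fillings-unique cs κ r tU tV b n)))
    (λ κ∈ A∈ → Colored.recover (proj₁ (filterᵇ-∈⁻ _ (words q n) κ∈)) A∈)

  arrangements-sound : ∀ {A} → A ∈ arrangements → Arranged A
  arrangements-sound {A} A∈ with κ , κ∈ , m ← find (∈ₚ.∈-concatMap⁻ (λ κ → choices (blocks κ)) {xs = colorings} A∈)
    with κ∈w , e ← filterᵇ-∈⁻ (λ κ → ⌊ content q κ ≟ᴸ ν ⌋) (words q n) κ∈ = arranged size
      (λ b< → let g = word-good b< in Block.Good.adj g , Block.Good.marked g) uses
      (trans (trans (at-map-≡ {d = []} length (λ b → count b κ) A id (λ {b} b< → let g = word-good (subst (b <_) size b<) in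
          trans (sym (Listₚ.length-map proj₁ (at [] A (suc b)))) (trans (↭ₚ.↭-length (Block.Good.perm g)) (length-members κ b (proj₁ (words-sound q n κ∈w))))))
        (cong (content′ κ) size)) (witness (content q κ ≟ᴸ ν) e))
    where
    open Colored κ∈w m
    content′ : List ℕ → ℕ → List ℕ
    content′ κ m = content m κ
    witness : ∀ {P : Set} (P? : Dec P) → ⌊ P? ⌋ ≡ true → P
    witness (yes p) _ = p

  arrangements-complete : ∀ {A} → Arranged A → A ∈ arrangements
  arrangements-complete {A} (arranged size gw uses shape) =
    ∈ₚ.∈-concatMap⁺ (λ κ → choices (blocks κ)) {xs = colorings} (lose (filterᵇ-∈⁺ _ (words q n) κ∈ (⌊⌋-true (content q κ ≟ᴸ ν) content≡))
      (choices⁺ {d = []} (λ b → Block.fillings cs κ r tU tV b n) id q size (λ {b} b< → Block.fillings-complete cs κ r tU tV b n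
        (Block.good (perm b<) (proj₁ (gw b<)) (proj₂ (gw b<))))))
    where
    κ = map (λ i → findBlock i A) (range1 n)
    lκ : length κ ≡ n
    lκ = trans (Listₚ.length-map _ (range1 n)) (range1-length n)
    uniq : Unique (concat (vals A))
    uniq = Unique-↭ (↭-sym uses) (range1-unique n)
    κ∈ : κ ∈ words q n
    κ∈ = subst (λ m → κ ∈ words q m) lκ (words-complete q (Allₚ.map⁺ (All.tabulate λ i∈ → subst (_ <_) size (proj₁ (findBlock-sound A (↭ₚ.∈-resp-↭ (↭-sym uses) i∈))))))
    κ-at : ∀ {i} → i ∈ range1 n → at 0 κ i ≡ findBlock i A
    κ-at = map-range1-∈ (λ i → findBlock i A) n
    perm : ∀ {b} → b < q → map proj₁ (at [] A (suc b)) ↭ Block.members cs κ r tU tV b n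
    perm {b} b< = unique-set-↭ (word-unique A {b} uniq) (filterᵇ-unique _ (range1-unique n))
      (λ {i} i∈ → let i∈n = in-range i∈ in filterᵇ-∈⁺ _ (range1 n) i∈n (⌊⌋-true (at 0 κ i ℕ.≟ b) (trans (κ-at i∈n) (findBlock-unique A uniq b<A i∈))))
      (λ {i} i∈ → let i∈n , e = filterᵇ-∈⁻ (λ i → ⌊ at 0 κ i ℕ.≟ b ⌋) (range1 n) i∈
                      eq = trans (sym (κ-at i∈n)) (witness (at 0 κ i ℕ.≟ b) e) in
        subst (λ c → i ∈ map proj₁ (at [] A (suc c))) eq (proj₂ (findBlock-sound A (↭ₚ.∈-resp-↭ (↭-sym uses) i∈n))))
      where
      b<A : b < length A
      b<A = subst (b <_) (sym size) b<
      in-range : ∀ {i} → i ∈ map proj₁ (at [] A (suc b)) → i ∈ range1 n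
      in-range {i} i∈ = ↭ₚ.∈-resp-↭ uses (at-concat (vals A) (subst (b <_) (sym (Listₚ.length-map (map proj₁) A)) b<A) (subst (i ∈_) (sym (vals-at A b)) i∈))
      witness : ∀ {P : Set} (P? : Dec P) → ⌊ P? ⌋ ≡ true → P
      witness (yes p) _ = p
    content≡ : content q κ ≡ ν
    content≡ = trans (cong (λ m → content m κ) (sym size)) (trans (sym (at-map-≡ {d = []} length (λ b → count b κ) A id (λ {b} b< →
        trans (sym (Listₚ.length-map proj₁ (at [] A (suc b)))) (trans (↭ₚ.↭-length (perm (subst (b <_) size b<))) (length-members κ b lκ))))) shape)

-- Transposition of fillings

module _ {A : Set} where

  -- `k` has to bound the lengths of the words, or entries are lost.
  tr : ℕ → List (List A) → List (List A)
  tr k C = map (λ i → mapMaybe (λ W → atM W i) C) (range1 k)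

  cell : List (List A) → ℕ → ℕ → Maybe A
  cell C i j = maybe′ (λ W → atM W j) nothing (atM C i)

  Decreasing : List (List A) → Set
  Decreasing = AllPairs (λ W W′ → length W′ ≤ length W)

  atM-nothing : ∀ (W : List A) {i} → length W ≤ i → atM W (suc i) ≡ nothing
  atM-nothing []      _ = refl
  atM-nothing (x ∷ W) {suc i} (s≤s le) = atM-nothing W le

  atM-just : ∀ (W : List A) {i} → i < length W → ∃ λ a → atM W (suc i) ≡ just a
  atM-just (x ∷ W) {zero}  _        = x , refl
  atM-just (x ∷ W) {suc i} (s≤s lt) = atM-just W lt

  atM-zero : ∀ (W : List A) → atM W 0 ≡ nothing
  atM-zero []      = refl
  atM-zero (x ∷ W) = refl

  cell-nothing : ∀ {C i} → All (λ W → length W ≤ i) C → ∀ j → cell C j (suc i) ≡ nothing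
  cell-nothing []         j             = refl
  cell-nothing (le ∷ les) zero          = refl
  cell-nothing {W ∷ C} (le ∷ les) (suc zero)    = atM-nothing W le
  cell-nothing (le ∷ les) (suc (suc j)) = cell-nothing les (suc j)

  mapMaybe-nothing : ∀ {C i} → All (λ W → length W ≤ i) C → mapMaybe (λ W → atM W (suc i)) C ≡ []
  mapMaybe-nothing [] = refl
  mapMaybe-nothing {W ∷ C} {i} (le ∷ les) rewrite atM-nothing W le = mapMaybe-nothing les

  -- The words of length > i form a prefix, so the i-th row has no gaps.
  cell-row : ∀ {C} → Decreasing C → ∀ i j → atM (mapMaybe (λ W → atM W (suc i)) C) j ≡ cell C j (suc i)
  cell-row {[]} [] i j = refl
  cell-row {W ∷ C} (le ∷ dec) i j with i ℕ.<? length W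
  ... | yes lt with a , e ← atM-just W lt rewrite e = go j
    where
    go : ∀ j → atM (a ∷ mapMaybe (λ W → atM W (suc i)) C) j ≡ cell (W ∷ C) j (suc i)
    go zero          = refl
    go (suc zero)    = sym e
    go (suc (suc j)) = cell-row dec i (suc j)
  ... | no ge with les ← All.map (λ le → ℕₚ.≤-trans le (ℕₚ.≮⇒≥ ge)) le =
    trans (cong (λ l → atM l j) (mapMaybe-nothing {W ∷ C} (ℕₚ.≮⇒≥ ge ∷ les))) (sym (cell-nothing {W ∷ C} (ℕₚ.≮⇒≥ ge ∷ les) j))

  atM-range1-map : ∀ {B : Set} (f : ℕ → B) k i → (i ∈ range1 k × atM (map f (range1 k)) i ≡ just (f i)) ⊎ ((i ≡ 0 ⊎ k < i) × atM (map f (range1 k)) i ≡ nothing)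
  atM-range1-map f k zero    = inj₂ (inj₁ refl , zero-nothing (map f (range1 k)))
    where
    zero-nothing : ∀ {B : Set} (W : List B) → atM W 0 ≡ nothing
    zero-nothing []      = refl
    zero-nothing (x ∷ W) = refl
  atM-range1-map {B} f k (suc i) with i ℕ.<? k
  ... | yes lt = inj₁ (∈-range1⁺ lt , trans (cong (λ l → atM l (suc i)) (trans (cong (map f) (range1-applyUpTo k)) (Listₚ.map-applyUpTo suc f k))) (go (f ∘ suc) k lt))
    where
    go : ∀ (h : ℕ → B) k {i} → i < k → atM (applyUpTo h k) (suc i) ≡ just (h i)
    go h (suc k) {zero}  _        = refl
    go h (suc k) {suc i} (s≤s lt) = go (h ∘ suc) k lt
  ... | no ge = inj₂ (inj₂ (s≤s (ℕₚ.≮⇒≥ ge)) , none (map f (range1 k)) (subst (_≤ i) (sym (trans (Listₚ.length-map f (range1 k)) (range1-length k))) (ℕₚ.≮⇒≥ ge)))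
    where
    none : ∀ {B : Set} (W : List B) {i} → length W ≤ i → atM W (suc i) ≡ nothing
    none []      _ = refl
    none (x ∷ W) {suc i} (s≤s le) = none W le

  cell-zero : ∀ C j → cell C j 0 ≡ nothing
  cell-zero C j with atM C j
  ... | just W  = atM-zero W
  ... | nothing = refl

  cell-tr : ∀ {C k} → Decreasing C → All (λ W → length W ≤ k) C → ∀ i j → cell (tr k C) i j ≡ cell C j i
  cell-tr {C} {k} dec le i j with atM-range1-map (λ i → mapMaybe (λ W → atM W i) C) k i
  ... | inj₁ (i∈ , e) rewrite e with i′ , _ , refl ← ∈-range1⁻ i∈ = cell-row dec i′ j
  ... | inj₂ (inj₁ refl , e) rewrite e = sym (cell-zero C j)
  ... | inj₂ (inj₂ k<i , e) rewrite e with i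
  ...   | suc i′ = sym (cell-nothing (All.map (λ l → ℕₚ.≤-trans l (ℕₚ.≤-pred k<i)) le) j)

  atM-ext : ∀ (W W′ : List A) → (∀ j → atM W j ≡ atM W′ j) → W ≡ W′
  atM-ext []      []       _ = refl
  atM-ext []      (x ∷ W′) e with () ← e 1
  atM-ext (x ∷ W) []       e with () ← e 1
  atM-ext (x ∷ W) (y ∷ W′) e with refl ← Maybeₚ.just-injective (e 1) = cong (x ∷_) (atM-ext W W′ rest)
    where
    rest : ∀ j → atM W j ≡ atM W′ j
    rest zero    = trans (atM-zero W) (sym (atM-zero W′))
    rest (suc j) = e (suc (suc j))

  -- Trailing empty words are invisible in the cells, hence the condition on lengths.
  cell-ext : ∀ {C D} → All (λ W → 1 ≤ length W) C → All (λ W → 1 ≤ length W) D → (∀ i j → cell C i j ≡ cell D i j) → C ≡ D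
  cell-ext [] [] _ = refl
  cell-ext [] (_∷_ {x = y ∷ _} _ _) e with () ← e 1 1
  cell-ext (_∷_ {x = y ∷ _} _ _) [] e with () ← e 1 1
  cell-ext {W ∷ C} {W′ ∷ D} (_ ∷ nc) (_ ∷ nd) e = cong₂ _∷_ (atM-ext W W′ (e 1)) (cell-ext nc nd rest)
    where
    rest : ∀ i j → cell C i j ≡ cell D i j
    rest zero    j = trans (zeroth C) (sym (zeroth D))
      where
      zeroth : ∀ C → cell C 0 j ≡ nothing
      zeroth []      = refl
      zeroth (W ∷ C) = refl
    rest (suc i) j = e (suc (suc i)) j

  longer : ℕ → List (List A) → ℕ
  longer i C = length (filterᵇ (λ a → i ℕ.≤ᵇ a) (map length C))

  length-row : ∀ i C → length (mapMaybe (λ W → atM W (suc i)) C) ≡ longer (suc i) C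
  length-row i []      = refl
  length-row i (W ∷ C) with i ℕ.<? length W
  ... | yes lt with a , e ← atM-just W lt rewrite e | <⇒<ᵇ≡true lt = cong suc (length-row i C)
  ... | no ge rewrite atM-nothing W (ℕₚ.≮⇒≥ ge) | ≥⇒<ᵇ≡false {i} {length W} (ℕₚ.≮⇒≥ ge) = length-row i C

conjugate : ℕ → List ℕ → List ℕ
conjugate k ν = map (λ j → length (filterᵇ (λ a → j ℕ.≤ᵇ a) ν)) (range1 k)

first : List ℕ → ℕ
first []      = 0
first (l ∷ _) = l

transpose-conjugate : ∀ ν → transpose ν ≡ conjugate (first ν) ν
transpose-conjugate []      = refl
transpose-conjugate (l ∷ ν) = refl

tr-shape : ∀ {A : Set} k (C : List (List A)) → map length (tr k C) ≡ conjugate k (map length C)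
tr-shape k C = trans (sym (Listₚ.map-∘ (range1 k))) (Listₚ.map-cong-local (All.tabulate λ i∈ → case ∈-range1⁻ i∈ of λ { (i , _ , refl) → length-row i C }))

filter-antitone : ∀ {i j} ν → i ≤ j → length (filterᵇ (λ a → j ℕ.≤ᵇ a) ν) ≤ length (filterᵇ (λ a → i ℕ.≤ᵇ a) ν)
filter-antitone {i} {j} ν i≤j = subst₂ _≤_ (sym (length-filterᵇ (j ℕ.≤ᵇ_) ν)) (sym (length-filterᵇ (i ℕ.≤ᵇ_) ν)) (sumOf-mono ν λ {a} _ → mono a)
  where
  mono : ∀ a → χ (j ℕ.≤ᵇ a) ≤ χ (i ℕ.≤ᵇ a)
  mono a with j ℕ.≤ᵇ a in ej | i ℕ.≤ᵇ a in ei
  ... | false | _     = z≤n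
  ... | true  | true  = ℕₚ.≤-refl
  ... | true  | false = contradiction (ℕₚ.≤⇒≤ᵇ (ℕₚ.≤-trans i≤j (ℕₚ.≤ᵇ⇒≤ j a (subst T (sym ej) tt)))) (subst T ei)

tr-decreasing : ∀ {A : Set} k (C : List (List A)) → Decreasing (tr k C)
tr-decreasing k C = AllPairsₚ.map⁺ (local (range1-increasing k) (All.tabulate id))
  where
  row : ℕ → ℕ
  row i = length (mapMaybe (λ W → atM W i) C)
  local : ∀ {L} → AllPairs _<_ L → All (_∈ range1 k) L → AllPairs (λ i j → row j ≤ row i) L
  local []       []         = []
  local (a ∷ ap) (i∈ ∷ ins) = All.tabulate (λ j∈ → antitone (All.lookup ins j∈) i∈ (All.lookup a j∈)) ∷ local ap ins
    where
    antitone : ∀ {i j} → j ∈ range1 k → i ∈ range1 k → i < j → row j ≤ row i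
    antitone j∈ i∈ lt with i , _ , refl ← ∈-range1⁻ i∈ | j , _ , refl ← ∈-range1⁻ j∈ =
      subst₂ _≤_ (sym (length-row j C)) (sym (length-row i C)) (filter-antitone (map length C) (ℕₚ.<⇒≤ lt))

tr-bounded : ∀ {A : Set} k (C : List (List A)) → All (λ W → length W ≤ length C) (tr k C)
tr-bounded k C = Allₚ.map⁺ (All.tabulate λ {i} _ → Listₚ.length-mapMaybe (λ W → atM W i) C)

decreasing-from-shape : ∀ {A : Set} {C : List (List A)} → AllPairs (λ a b → b ≤ a) (map length C) → Decreasing C
decreasing-from-shape = AllPairsₚ.map⁻

all-positive : ∀ ν → All (1 ≤_) ν → length (filterᵇ (λ a → 1 ℕ.≤ᵇ a) ν) ≡ length ν
all-positive []          _        = refl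
all-positive (suc a ∷ ν) (_ ∷ ps) = cong suc (all-positive ν ps)

module Partition {ν : List ℕ} (part : IsPartition ν) where

  positive : All (1 ≤_) ν
  positive = proj₁ part

  sorted : AllPairs (λ a b → b ≤ a) ν
  sorted = Linkedₚ.Linked⇒AllPairs (λ a≥b b≥c → ℕₚ.≤-trans b≥c a≥b) (proj₂ part)

  ≤-first : All (_≤ first ν) ν
  ≤-first = go ν sorted
    where
    go : ∀ ν → AllPairs (λ a b → b ≤ a) ν → All (_≤ first ν) ν
    go []      _       = []
    go (l ∷ ν) (a ∷ _) = ℕₚ.≤-refl ∷ a

  module _ {A : Set} where

    rows-nonempty : ∀ {C : List (List A)} → map length C ≡ ν → All (λ W → 1 ≤ length W) (tr (first ν) C)
    rows-nonempty {C} e = Allₚ.map⁺ (All.tabulate λ i∈ → case ∈-range1⁻ i∈ of λ { (i , i< , refl) →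
        subst (1 ≤_) (sym (trans (length-row i C) (cong (λ l → length (filterᵇ (λ a → suc i ℕ.≤ᵇ a) l)) e))) (nonempty ν i<) })
      where
      nonempty : ∀ ν {i} → i < first ν → 1 ≤ length (filterᵇ (λ a → suc i ℕ.≤ᵇ a) ν)
      nonempty (l ∷ ν) lt rewrite <⇒<ᵇ≡true lt = s≤s z≤n

    private
      shape-facts : ∀ {C : List (List A)} → map length C ≡ ν → Decreasing C × All (λ W → length W ≤ first ν) C × All (λ W → 1 ≤ length W) C
      shape-facts refl = decreasing-from-shape sorted , Allₚ.map⁻ ≤-first , Allₚ.map⁻ positive

    columns-nonempty : ∀ {U : List (List A)} → map length U ≡ transpose ν → All (λ W → 1 ≤ length W) (tr (length ν) U)
    columns-nonempty {U} e = Allₚ.map⁺ (All.tabulate λ j∈ → case ∈-range1⁻ j∈ of λ { (j , j< , refl) →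
        subst (1 ≤_) (sym (trans (length-row j U) (cong (λ l → length (filterᵇ (λ a → suc j ℕ.≤ᵇ a) l)) e))) (nonempty ν positive j<) })
      where
      nonempty : ∀ ν → All (1 ≤_) ν → ∀ {j} → j < length ν → 1 ≤ length (filterᵇ (λ a → suc j ℕ.≤ᵇ a) (transpose ν))
      nonempty (suc l ∷ ν) (p ∷ ps) {j} lt rewrite all-positive ν ps | <⇒<ᵇ≡true lt = s≤s z≤n

    tr-tr : ∀ {C : List (List A)} → map length C ≡ ν → tr (length ν) (tr (first ν) C) ≡ C
    tr-tr {C} e with dec , le , ne ← shape-facts e = cell-ext (columns-nonempty shape) ne λ i j →
        trans (cell-tr (tr-decreasing (first ν) C) (All.map (λ {W} → subst (length W ≤_) size) (tr-bounded (first ν) C)) i j) (cell-tr dec le j i)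
      where
      size : length C ≡ length ν
      size = trans (sym (Listₚ.length-map length C)) (cong length e)
      shape : map length (tr (first ν) C) ≡ transpose ν
      shape = trans (tr-shape (first ν) C) (trans (cong (conjugate (first ν)) e) (sym (transpose-conjugate ν)))

  -- Double conjugation is read off from the shapes in `tr-tr` for a filling by zeros.
  conjugate-transpose : conjugate (length ν) (transpose ν) ≡ ν
  conjugate-transpose = trans (cong (conjugate (length ν)) (sym shape)) (trans (sym (tr-shape (length ν) (tr (first ν) C₀))) (trans (cong (map length) (tr-tr e)) e))
    where
    C₀ : List (List ℕ)
    C₀ = map (λ l → replicate l 0) ν
    e : map length C₀ ≡ ν
    e = trans (sym (Listₚ.map-∘ ν)) (trans (Listₚ.map-cong (λ l → Listₚ.length-replicate l) ν) (Listₚ.map-id ν))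
    shape : map length (tr (first ν) C₀) ≡ transpose ν
    shape = trans (tr-shape (first ν) C₀) (trans (cong (conjugate (first ν)) e) (sym (transpose-conjugate ν)))

  module _ {A : Set} {U : List (List A)} (e : map length U ≡ transpose ν) where

    untr-shape : map length (tr (length ν) U) ≡ ν
    untr-shape = trans (tr-shape (length ν) U) (trans (cong (conjugate (length ν)) e) conjugate-transpose)

    tr-untr : tr (first ν) (tr (length ν) U) ≡ U
    tr-untr = cell-ext (rows-nonempty untr-shape) ne λ i j →
        trans (cell-tr (tr-decreasing (length ν) U) bounded i j) (cell-tr dec le j i)
      where
      shape : map length U ≡ map (λ j → length (filterᵇ (λ a → j ℕ.≤ᵇ a) ν)) (range1 (first ν))
      shape = trans e (transpose-conjugate ν)
      ne : All (λ W → 1 ≤ length W) U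
      ne = Allₚ.map⁻ (subst (All (1 ≤_)) (sym shape) (Allₚ.map⁺ (All.tabulate λ i∈ → case ∈-range1⁻ i∈ of λ { (i , i< , refl) → nonempty ν i< })))
        where
        nonempty : ∀ ν {i} → i < first ν → 1 ≤ length (filterᵇ (λ a → suc i ℕ.≤ᵇ a) ν)
        nonempty (l ∷ ν) lt rewrite <⇒<ᵇ≡true lt = s≤s z≤n
      le : All (λ W → length W ≤ length ν) U
      le = Allₚ.map⁻ (subst (All (_≤ length ν)) (sym shape) (Allₚ.map⁺ (All.tabulate λ {i} _ → Listₚ.length-filter (λ a → 𝔹ₚ.T? (i ℕ.≤ᵇ a)) ν)))
      dec : Decreasing U
      dec = decreasing-from-shape (subst (AllPairs (λ a b → b ≤ a)) (sym shape) (AllPairsₚ.map⁺ (AllPairs.map (λ i<j → filter-antitone ν (ℕₚ.<⇒≤ i<j)) (range1-increasing (first ν)))))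
      size : length U ≡ first ν
      size = trans (sym (Listₚ.length-map length U)) (trans (cong length shape) (trans (Listₚ.length-map _ (range1 (first ν))) (range1-length (first ν))))
      bounded : All (λ W → length W ≤ first ν) (tr (length ν) U)
      bounded = All.map (λ {W} → subst (length W ≤_) size) (tr-bounded (length ν) U)

  module _ {A : Set} {C : List (List A)} (e : map length C ≡ ν) where
    tr-cells : ∀ i j → cell (tr (first ν) C) i j ≡ cell C j i
    tr-cells = cell-tr (decreasing-from-shape (subst (AllPairs (λ a b → b ≤ a)) (sym e) sorted)) (Allₚ.map⁻ (subst (All (_≤ first ν)) (sym e) ≤-first))

concatMap-++-↭ : ∀ {A B : Set} (f g : A → List B) xs → concatMap (λ x → f x ++ g x) xs ↭ concatMap f xs ++ concatMap g xs
concatMap-++-↭ f g []       = ↭-refl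
concatMap-++-↭ f g (x ∷ xs) = ↭-trans (↭ₚ.++⁺ˡ (f x ++ g x) (concatMap-++-↭ f g xs)) (↭-trans (↭-reflexive (Listₚ.++-assoc (f x) (g x) _))
  (↭-trans (↭ₚ.++⁺ˡ (f x) (↭-trans (↭-reflexive (sym (Listₚ.++-assoc (g x) (concatMap f xs) _))) (↭-trans (↭ₚ.++⁺ʳ (concatMap g xs) (↭ₚ.++-comm (g x) (concatMap f xs))) (↭-reflexive (Listₚ.++-assoc (concatMap f xs) (g x) _)))))
    (↭-reflexive (sym (Listₚ.++-assoc (f x) (concatMap f xs) _)))))

concatMap-swap-↭ : ∀ {A B C : Set} (f : A → B → List C) xs ys → concatMap (λ x → concatMap (f x) ys) xs ↭ concatMap (λ y → concatMap (λ x → f x y) xs) ys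
concatMap-swap-↭ f []       ys = ↭-reflexive (sym (empty ys))
  where
  empty : ∀ {B C : Set} (ys : List B) → concatMap {B = C} (λ _ → []) ys ≡ []
  empty []       = refl
  empty (y ∷ ys) = empty ys
concatMap-swap-↭ f (x ∷ xs) ys = ↭-trans (↭ₚ.++⁺ˡ (concatMap (f x) ys) (concatMap-swap-↭ f xs ys)) (↭-sym (concatMap-++-↭ (f x) (λ y → concatMap (λ x → f x y) xs) ys))

module _ {A : Set} where
  private
    toL : Maybe A → List A
    toL = maybe′ (λ a → a ∷ []) []

    mapMaybe-toL : ∀ {B : Set} (g : B → Maybe A) xs → mapMaybe g xs ≡ concatMap (toL ∘ g) xs
    mapMaybe-toL g []       = refl
    mapMaybe-toL g (x ∷ xs) with g x
    ... | just a  = cong (a ∷_) (mapMaybe-toL g xs)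
    ... | nothing = mapMaybe-toL g xs

    column-self : ∀ k (W : List A) → length W ≤ k → concatMap (λ i → toL (atM W i)) (range1 k) ≡ W
    column-self zero    []      _ = refl
    column-self (suc k) W le = trans (cong (concatMap (λ i → toL (atM W i))) (range1-cons k)) (go W le)
      where
      shift : ∀ (x : A) W → concatMap (λ i → toL (atM (x ∷ W) i)) (map suc (range1 k)) ≡ concatMap (λ i → toL (atM W i)) (range1 k)
      shift x W = trans (cong concat (sym (Listₚ.map-∘ (range1 k)))) (cong concat (Listₚ.map-cong-local {f = λ i → toL (atM (x ∷ W) (suc i))} {g = λ i → toL (atM W i)} {xs = range1 k} (All.tabulate λ i∈ → case ∈-range1⁻ i∈ of λ { (_ , _ , refl) → refl })))
      empty : ∀ is → concatMap (λ i → toL (atM {A} [] i)) is ≡ []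
      empty []       = refl
      empty (i ∷ is) = empty is
      go : ∀ W → length W ≤ suc k → toL (atM W 1) ++ concatMap (λ i → toL (atM W i)) (map suc (range1 k)) ≡ W
      go []      _        = empty (map suc (range1 k))
      go (x ∷ W) (s≤s le) = cong (x ∷_) (trans (shift x W) (column-self k W le))

  -- Exchanging the two concatenations lists the same cells word by word, and each word is recovered
  -- from its cells.
  tr-concat : ∀ k (C : List (List A)) → All (λ W → length W ≤ k) C → concat (tr k C) ↭ concat C
  tr-concat k C le = ↭-trans (↭-reflexive (cong concat (Listₚ.map-cong (λ i → mapMaybe-toL (λ W → atM W i) C) (range1 k))))
    (↭-trans (concatMap-swap-↭ (λ i W → toL (atM W i)) (range1 k) C) (↭-reflexive (trans (cong concat (Listₚ.map-cong-local (All.map (λ {W} → column-self k W) le))) (cong concat (Listₚ.map-id C)))))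

atM-map : ∀ {A B : Set} (f : A → B) W i → atM (map f W) i ≡ Maybe.map f (atM W i)
atM-map f []      i             = refl
atM-map f (x ∷ W) zero          = refl
atM-map f (x ∷ W) (suc zero)    = refl
atM-map f (x ∷ W) (suc (suc i)) = atM-map f W (suc i)

map-tr : ∀ {A B : Set} (f : A → B) k C → map (map f) (tr k C) ≡ tr k (map (map f) C)
map-tr f k C = trans (sym (Listₚ.map-∘ (range1 k))) (Listₚ.map-cong (λ i → row i C) (range1 k))
  where
  row : ∀ i C → map f (mapMaybe (λ W → atM W i) C) ≡ mapMaybe (λ W → atM W i) (map (map f) C)
  row i []      = refl
  row i (W ∷ C) rewrite atM-map f W i with atM W i
  ... | just a  = cong (f a ∷_) (row i C)
  ... | nothing = row i C

entry-cell : ∀ U i j → entry U i j ≡ cell U i j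
entry-cell U i j with atM U i
... | just _  = refl
... | nothing = refl

Linked-atM⁺ : ∀ {A : Set} {R : A → A → Set} W → (∀ i a b → atM W i ≡ just a → atM W (suc i) ≡ just b → R a b) → Linked R W
Linked-atM⁺ []           _ = []
Linked-atM⁺ (x ∷ [])     _ = [-]
Linked-atM⁺ (x ∷ y ∷ W) h = h 1 x y refl refl ∷ Linked-atM⁺ (y ∷ W) (λ { (suc i) a b e e′ → h (suc (suc i)) a b e e′ ; zero a b () e′ })

Linked-atM⁻ : ∀ {A : Set} {R : A → A → Set} {W} → Linked R W → ∀ i a b → atM W i ≡ just a → atM W (suc i) ≡ just b → R a b
Linked-atM⁻ [-]     (suc zero)    a b refl ()
Linked-atM⁻ (r ∷ l) (suc zero)    a b refl refl = r
Linked-atM⁻ (r ∷ l) (suc (suc i)) a b e e′ = Linked-atM⁻ l (suc i) a b e e′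

cell-word : ∀ {A : Set} (C : List (List A)) {b} i → b < length C → cell C (suc b) i ≡ atM (at [] C (suc b)) i
cell-word (W ∷ C) {zero}  i _        = refl
cell-word (W ∷ C) {suc b} i (s≤s lt) = cell-word C i lt

cell-index : ∀ {A : Set} (C : List (List A)) {j i a} → cell C j i ≡ just a → ∃ λ b → j ≡ suc b × b < length C
cell-index []      ()
cell-index (W ∷ C) {zero}        ()
cell-index (W ∷ C) {suc zero}    e = 0 , refl , s≤s z≤n
cell-index (W ∷ C) {suc (suc j)} e with b , refl , lt ← cell-index C {suc j} e = suc b , refl , s≤s lt

shapeOf : FillCond → List ℕ → List ℕ
shapeOf colStrict     ν = transpose ν
shapeOf rowSemistrict ν = ν

-- Blocks are the columns of a column-strict filling and the rows of a row-semistrict one.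
encode decode : {A : Set} → FillCond → List ℕ → List (List A) → List (List A)
encode colStrict     ν C = tr (first ν) C
encode rowSemistrict ν C = C
decode colStrict     ν U = tr (length ν) U
decode rowSemistrict ν U = U

AdjR : (ℕ → ℕ → Set) → FillCond → ℕ → ℕ → Set
AdjR R colStrict     a b = R a b
AdjR R rowSemistrict a b = ¬ R b a

module Coding {ν : List ℕ} (part : IsPartition ν) where
  open Partition part

  encode-shape : ∀ {A : Set} t {C : List (List A)} → map length C ≡ ν → map length (encode t ν C) ≡ shapeOf t ν
  encode-shape rowSemistrict e = e
  encode-shape colStrict {C} e = trans (tr-shape (first ν) C) (trans (cong (conjugate (first ν)) e) (sym (transpose-conjugate ν)))

  decode-shape : ∀ {A : Set} t {U : List (List A)} → map length U ≡ shapeOf t ν → map length (decode t ν U) ≡ ν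
  decode-shape rowSemistrict e = e
  decode-shape colStrict e = untr-shape e

  decode-encode : ∀ {A : Set} t {C : List (List A)} → map length C ≡ ν → decode t ν (encode t ν C) ≡ C
  decode-encode rowSemistrict e = refl
  decode-encode colStrict e = tr-tr e

  encode-decode : ∀ {A : Set} t {U : List (List A)} → map length U ≡ shapeOf t ν → encode t ν (decode t ν U) ≡ U
  encode-decode rowSemistrict e = refl
  encode-decode colStrict e = tr-untr e

  encode-concat : ∀ {A : Set} t {C : List (List A)} → map length C ≡ ν → concat (encode t ν C) ↭ concat C
  encode-concat rowSemistrict e = ↭-refl
  encode-concat colStrict {C} e = tr-concat (first ν) C (Allₚ.map⁻ (subst (All (_≤ first ν)) (sym e) ≤-first))

  encode-map : ∀ {A B : Set} (f : A → B) t C → map (map f) (encode t ν C) ≡ encode t ν (map (map f) C)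
  encode-map f rowSemistrict C = refl
  encode-map f colStrict C = map-tr f (first ν) C

  cond⇒linked : ∀ {R} t {C} → map length C ≡ ν → Cond R t (encode t ν C) → ∀ {b} → b < length C → Linked (AdjR R t) (at [] C (suc b))
  cond⇒linked rowSemistrict {C} e h {b} b< = Linked-atM⁺ _ λ i a a′ p q → h (suc b) i a a′
    (trans (entry-cell C (suc b) i) (trans (cell-word C i b<) p)) (trans (entry-cell C (suc b) (suc i)) (trans (cell-word C (suc i) b<) q))
  cond⇒linked colStrict {C} e h {b} b< = Linked-atM⁺ _ λ i a a′ p q → h i (suc b) a a′ (look i p) (look (suc i) q)
    where
    look : ∀ i {a} → atM (at [] C (suc b)) i ≡ just a → entry (tr (first ν) C) i (suc b) ≡ just a
    look i p = trans (entry-cell (tr (first ν) C) i (suc b)) (trans (tr-cells e i (suc b)) (trans (cell-word C i b<) p))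

  linked⇒cond : ∀ {R} t {C} → map length C ≡ ν → (∀ {b} → b < length C → Linked (AdjR R t) (at [] C (suc b))) → Cond R t (encode t ν C)
  linked⇒cond rowSemistrict {C} e h i j a a′ p q with p′ ← trans (sym (entry-cell C i j)) p with b , refl , b< ← cell-index C {i} {j} p′ =
    Linked-atM⁻ (h b<) j a a′ (trans (sym (cell-word C j b<)) p′) (trans (sym (cell-word C (suc j) b<)) (trans (sym (entry-cell C (suc b) (suc j))) q))
  linked⇒cond colStrict {C} e h i j a a′ p q with p′ ← trans (sym (tr-cells e i j)) (trans (sym (entry-cell (tr (first ν) C) i j)) p)
    with b , refl , b< ← cell-index C {j} {i} p′ =
    Linked-atM⁻ (h b<) i a a′ (trans (sym (cell-word C i b<)) p′) (trans (sym (cell-word C (suc i) b<)) (trans (sym (tr-cells e (suc i) (suc b))) (trans (sym (entry-cell (tr (first ν) C) (suc i) (suc b))) q)))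

Linked-local : ∀ {A : Set} {R R′ : A → A → Set} {W} → (∀ {a b} → a ∈ W → b ∈ W → R a b → R′ a b) → Linked R W → Linked R′ W
Linked-local f []      = []
Linked-local f [-]     = [-]
Linked-local f (r ∷ l) = f (here refl) (there (here refl)) r ∷ Linked-local (λ p q → f (there p) (there q)) l

concat-at : ∀ {A : Set} {x : A} (C : List (List A)) → x ∈ concat C → ∃ λ b → b < length C × x ∈ at [] C (suc b)
concat-at (W ∷ C) x∈ with ∈ₚ.∈-++⁻ W x∈
... | inj₁ m = 0 , s≤s z≤n , m
... | inj₂ m with b , lt , h ← concat-at C m = suc b , s≤s lt , h

vals-concat : ∀ A → concat (vals A) ≡ map proj₁ (concat A)
vals-concat A = Listₚ.concat-map A

lengths-vals : ∀ A → map length (vals A) ≡ map length A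
lengths-vals A = trans (sym (Listₚ.map-∘ A)) (Listₚ.map-cong (Listₚ.length-map proj₁) A)

-- Bijection between arrangements and bitableaux

module Tableaux {n : ℕ} {cs : List Iv} {π : ℤ → List Vtx} (zig : Zig cs) (fam : IsFamily n cs π id)
                (λ′ μ : List ℕ) (pλ : IsPartition λ′) (pμ : IsPartition μ) (tU tV : FillCond) where
  private
    r = length λ′
    s = length μ
    q = r + s
    module Cλ = Coding pλ
    module Cμ = Coding pμ
  open Poset cs
  open TypeE n cs zig fam
  open Arrangements cs n r q tU tV (λ′ ++ μ) public

  QLt⇒<Q : ∀ {a b} → a ∈ range1 n → b ∈ range1 n → QLt π a b → a <Q b
  QLt⇒<Q a∈ b∈ (a<b , ¬s) = a<b , λ s → ¬s (Shares⇒ShareVtx (range1-wire a∈) (range1-wire b∈) (ℤ.+<+ a<b) s)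

  <Q⇒QLt : ∀ {a b} → a ∈ range1 n → b ∈ range1 n → a <Q b → QLt π a b
  <Q⇒QLt a∈ b∈ (a<b , ¬s) = a<b , λ s → ¬s (ShareVtx⇒Shares (range1-wire a∈) (range1-wire b∈) (ℤ.+<+ a<b) s)

  private
    -x<x : ∀ {x} → x ∈ range1 n → ℤ.- (+ x) ℤ.< + x
    -x<x x∈ with j , _ , refl ← ∈-range1⁻ x∈ = ℤ.-<+

  grounded⇒ : ∀ {x} → x ∈ range1 n → Grounded π x → Shares cs (ℤ.- (+ x)) (+ x)
  grounded⇒ x∈ (v , p , q) = ShareVtx⇒Shares (wires-neg n (range1-wire x∈)) (range1-wire x∈) (-x<x x∈) (v , q , p)

  ⇒grounded : ∀ {x} → x ∈ range1 n → Shares cs (ℤ.- (+ x)) (+ x) → Grounded π x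
  ⇒grounded x∈ s with v , p , q ← Shares⇒ShareVtx (wires-neg n (range1-wire x∈)) (range1-wire x∈) (-x<x x∈) s = v , q , p

  Adj⇒ : ∀ t {a b} → a ∈ range1 n → b ∈ range1 n → Adj t a b → AdjR (QLt π) t a b
  Adj⇒ colStrict     a∈ b∈ p = <Q⇒QLt a∈ b∈ p
  Adj⇒ rowSemistrict a∈ b∈ p = p ∘ QLt⇒<Q b∈ a∈

  ⇒Adj : ∀ t {a b} → a ∈ range1 n → b ∈ range1 n → AdjR (QLt π) t a b → Adj t a b
  ⇒Adj colStrict     a∈ b∈ p = QLt⇒<Q a∈ b∈ p
  ⇒Adj rowSemistrict a∈ b∈ p = p ∘ <Q⇒QLt b∈ a∈

  toTab : List (List Entry) → BiTab
  toTab A = encode tU λ′ (take r A) , vals (encode tV μ (drop r A))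

  unmark : List (List ℕ) → List (List Entry)
  unmark = map (map (λ x → x , false))

  fromTab : BiTab → List (List Entry)
  fromTab (U , V) = decode tU λ′ U ++ decode tV μ (unmark V)

  private
    low-kind : ∀ {b} → b < r → (b ℕ.<ᵇ r) ≡ true
    low-kind = <⇒<ᵇ≡true
    high-kind : ∀ j → (r + j ℕ.<ᵇ r) ≡ false
    high-kind j = ≥⇒<ᵇ≡false (ℕₚ.m≤m+n r j)

  -- An arrangement cut after the colours of λ. The conditions are stated for each half separately,
  -- as a bitableau states them.
  record Split (A₁ A₂ : List (List Entry)) : Set where
    constructor mkSplit
    field
      shape₁ : map length A₁ ≡ λ′
      shape₂ : map length A₂ ≡ μ
      adj₁   : ∀ {b} → b < length A₁ → Linked (Adj tU) (at [] (vals A₁) (suc b))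
      adj₂   : ∀ {b} → b < length A₂ → Linked (Adj tV) (at [] (vals A₂) (suc b))
      mark₁  : ∀ {e} → e ∈ concat A₁ → Marked true e
      mark₂  : ∀ {e} → e ∈ concat A₂ → Marked false e
      uses   : concat (vals A₁) ++ concat (vals A₂) ↭ range1 n

  split⇒arranged : ∀ {A₁ A₂} → Split A₁ A₂ → Arranged (A₁ ++ A₂)
  split⇒arranged {A₁} {A₂} (mkSplit sh₁ sh₂ adj₁ adj₂ mark₁ mark₂ uses) = arranged
    (trans (Listₚ.length-++ A₁) (cong₂ _+_ l₁ l₂)) good-word
    (↭-trans (↭-reflexive (trans (cong concat (Listₚ.map-++ (map proj₁) A₁ A₂)) (sym (Listₚ.concat-++ (vals A₁) (vals A₂))))) uses)
    (trans (Listₚ.map-++ length A₁ A₂) (cong₂ _++_ sh₁ sh₂))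
    where
    l₁ : length A₁ ≡ r
    l₁ = trans (sym (Listₚ.length-map length A₁)) (cong length sh₁)
    l₂ : length A₂ ≡ s
    l₂ = trans (sym (Listₚ.length-map length A₂)) (cong length sh₂)
    good-word : ∀ {b} → b < q → GoodWord b (at [] (A₁ ++ A₂) (suc b))
    good-word {b} b<q with b ℕ.<? r
    ... | yes b<r rewrite low-kind b<r = subst (λ W → Linked (Adj tU) (map proj₁ W) × All (Marked true) W)
          (sym (at-++ˡ A₁ (∈-range1⁺ b<A)))
          (subst (Linked (Adj tU)) (vals-at A₁ b) (adj₁ b<A) , All.tabulate (λ e∈ → mark₁ (at-concat A₁ b<A e∈)))
      where b<A = subst (b <_) (sym l₁) b<r
    ... | no b≮r with r≤b ← ℕₚ.≮⇒≥ b≮r with j , refl ← ℕₚ.m≤n⇒∃[o]m+o≡n r≤b rewrite high-kind j = subst (λ W → Linked (Adj tV) (map proj₁ W) × All (Marked false) W)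
          (sym at-second)
          (subst (Linked (Adj tV)) (vals-at A₂ j) (adj₂ j<A) , All.tabulate (λ e∈ → mark₂ (at-concat A₂ j<A e∈)))
      where
      j<A : j < length A₂
      j<A = subst (j <_) (sym l₂) (ℕₚ.+-cancelˡ-< r j s b<q)
      at-second : at [] (A₁ ++ A₂) (suc (r + j)) ≡ at [] A₂ (suc j)
      at-second = trans (cong (at [] (A₁ ++ A₂)) (trans (sym (ℕₚ.+-suc r j)) (cong (_+ suc j) (sym l₁)))) (at-++ʳ A₁ (∈-range1⁺ j<A))

  arranged⇒split : ∀ {A} → Arranged A → Split (take r A) (drop r A)
  arranged⇒split {A} (arranged size gw uses shape) = mkSplit sh₁ sh₂ adj₁ adj₂ mark₁ mark₂
      (↭-trans (↭-reflexive (trans (Listₚ.concat-++ (vals A₁) (vals A₂)) (cong concat (trans (sym (Listₚ.map-++ (map proj₁) A₁ A₂)) (cong vals split))))) uses)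
    where
    A₁ = take r A
    A₂ = drop r A
    split : A₁ ++ A₂ ≡ A
    split = Listₚ.take++drop≡id r A
    sh₁ : map length A₁ ≡ λ′
    sh₁ = trans (sym (Listₚ.take-map r A)) (trans (cong (take r) shape) (take-length-++ λ′ μ))
      where
      take-length-++ : ∀ (xs ys : List ℕ) → take (length xs) (xs ++ ys) ≡ xs
      take-length-++ []       ys = refl
      take-length-++ (x ∷ xs) ys = cong (x ∷_) (take-length-++ xs ys)
    sh₂ : map length A₂ ≡ μ
    sh₂ = trans (sym (Listₚ.drop-map r A)) (trans (cong (drop r) shape) (drop-length-++ λ′ μ))
      where
      drop-length-++ : ∀ (xs ys : List ℕ) → drop (length xs) (xs ++ ys) ≡ ys
      drop-length-++ []       ys = refl
      drop-length-++ (x ∷ xs) ys = drop-length-++ xs ys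
    l₁ : length A₁ ≡ r
    l₁ = trans (sym (Listₚ.length-map length A₁)) (cong length sh₁)
    l₂ : length A₂ ≡ s
    l₂ = trans (sym (Listₚ.length-map length A₂)) (cong length sh₂)
    word₁ : ∀ {b} → b < length A₁ → Linked (Adj tU) (map proj₁ (at [] A₁ (suc b))) × All (Marked true) (at [] A₁ (suc b))
    word₁ {b} b< = subst (λ W → Linked (Adj tU) (map proj₁ W) × All (Marked true) W) (trans (cong (λ A → at [] A (suc b)) (sym split)) (at-++ˡ A₁ (∈-range1⁺ b<)))
      (subst₂ (λ t c → Linked (Adj t) (map proj₁ (at [] A (suc b))) × All (Marked c) (at [] A (suc b))) (cong (λ c → if c then tU else tV) (low-kind b<r)) (low-kind b<r) (gw (ℕₚ.<-≤-trans b<r (ℕₚ.m≤m+n r s))))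
      where b<r = subst (b <_) l₁ b<
    word₂ : ∀ {j} → j < length A₂ → Linked (Adj tV) (map proj₁ (at [] A₂ (suc j))) × All (Marked false) (at [] A₂ (suc j))
    word₂ {j} j< = subst (λ W → Linked (Adj tV) (map proj₁ W) × All (Marked false) W) at-second
      (subst₂ (λ t c → Linked (Adj t) (map proj₁ (at [] A (suc (r + j)))) × All (Marked c) (at [] A (suc (r + j)))) (cong (λ c → if c then tU else tV) (high-kind j)) (high-kind j) (gw (ℕₚ.+-monoʳ-< r (subst (j <_) l₂ j<))))
      where
      at-second : at [] A (suc (r + j)) ≡ at [] A₂ (suc j)
      at-second = trans (cong₂ (at []) (sym split) (trans (sym (ℕₚ.+-suc r j)) (cong (_+ suc j) (sym l₁)))) (at-++ʳ A₁ (∈-range1⁺ j<))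
    adj₁ : ∀ {b} → b < length A₁ → Linked (Adj tU) (at [] (vals A₁) (suc b))
    adj₁ {b} b< = subst (Linked (Adj tU)) (sym (vals-at A₁ b)) (proj₁ (word₁ b<))
    adj₂ : ∀ {b} → b < length A₂ → Linked (Adj tV) (at [] (vals A₂) (suc b))
    adj₂ {b} b< = subst (Linked (Adj tV)) (sym (vals-at A₂ b)) (proj₁ (word₂ b<))
    mark₁ : ∀ {e} → e ∈ concat A₁ → Marked true e
    mark₁ e∈ with b , b< , m ← concat-at A₁ e∈ = All.lookup (proj₂ (word₁ b<)) m
    mark₂ : ∀ {e} → e ∈ concat A₂ → Marked false e
    mark₂ e∈ with b , b< , m ← concat-at A₂ e∈ = All.lookup (proj₂ (word₂ b<)) m

  private
    vals-length : ∀ A {b} → b < length (vals A) → b < length A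
    vals-length A {b} = subst (b <_) (Listₚ.length-map (map proj₁) A)
    length-vals : ∀ A {b} → b < length A → b < length (vals A)
    length-vals A {b} = subst (b <_) (sym (Listₚ.length-map (map proj₁) A))

  toTab-sound : ∀ {A} → Arranged A → TabWith n π (shapeOf tU λ′) (shapeOf tV μ) tU tV (toTab A)
  toTab-sound {A} ar with mkSplit sh₁ sh₂ adj₁ adj₂ mark₁ mark₂ uses ← arranged⇒split ar =
    (Cλ.encode-shape tU sh₁ , trans (lengths-vals (encode tV μ A₂)) (Cμ.encode-shape tV sh₂) ,
     ↭-trans (↭ₚ.++⁺ (concat-vals Cλ.encode-concat tU A₁ sh₁) (concat-vals Cμ.encode-concat tV A₂ sh₂)) uses ,
     (λ x x∈ g → let x∈′ = ↭ₚ.∈-resp-↭ (concat-vals Cμ.encode-concat tV A₂ sh₂) x∈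
                     e , e∈ , eq = ∈ₚ.∈-map⁻ proj₁ (subst (x ∈_) (vals-concat A₂) x∈′) in
        proj₂ (mark₂ e∈) (subst (λ y → Shares cs (ℤ.- (+ y)) (+ y)) eq (grounded⇒ (↭ₚ.∈-resp-↭ uses (∈ₚ.∈-++⁺ʳ (concat (vals A₁)) x∈′)) g))) ,
     (λ x x∈ → let e∈ = ↭ₚ.∈-resp-↭ (Cλ.encode-concat tU sh₁) x∈ in
        ⇒grounded (↭ₚ.∈-resp-↭ uses (∈ₚ.∈-++⁺ˡ (subst (x ∈_) (sym (vals-concat A₁)) (∈ₚ.∈-map⁺ proj₁ e∈)))) (mark₁ e∈ refl))) ,
    subst (Cond (QLt π) tU) (sym (Cλ.encode-map proj₁ tU A₁)) (Cλ.linked⇒cond tU (trans (lengths-vals A₁) sh₁) (λ {b} b< →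
      Linked-local (λ a∈ b∈ → Adj⇒ tU (in₁ b< a∈) (in₁ b< b∈)) (adj₁ (vals-length A₁ b<)))) ,
    subst (Cond (QLt π) tV) (sym (Cμ.encode-map proj₁ tV A₂)) (Cμ.linked⇒cond tV (trans (lengths-vals A₂) sh₂) (λ {b} b< →
      Linked-local (λ a∈ b∈ → Adj⇒ tV (in₂ b< a∈) (in₂ b< b∈)) (adj₂ (vals-length A₂ b<))))
    where
    A₁ = take r A
    A₂ = drop r A
    concat-vals : ∀ {ν} → (∀ {B : Set} t {C : List (List B)} → map length C ≡ ν → concat (encode t ν C) ↭ concat C) →
                  ∀ t C → map length C ≡ ν → concat (vals (encode t ν C)) ↭ concat (vals C)
    concat-vals {ν} ec t C e = ↭-trans (↭-reflexive (vals-concat (encode t ν C))) (↭-trans (↭ₚ.map⁺ proj₁ (ec t e)) (↭-reflexive (sym (vals-concat C))))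
    in₁ : ∀ {b a} → b < length (vals A₁) → a ∈ at [] (vals A₁) (suc b) → a ∈ range1 n
    in₁ b< a∈ = ↭ₚ.∈-resp-↭ uses (∈ₚ.∈-++⁺ˡ (at-concat (vals A₁) b< a∈))
    in₂ : ∀ {b a} → b < length (vals A₂) → a ∈ at [] (vals A₂) (suc b) → a ∈ range1 n
    in₂ b< a∈ = ↭ₚ.∈-resp-↭ uses (∈ₚ.∈-++⁺ʳ (concat (vals A₁)) (at-concat (vals A₂) b< a∈))

  vals-unmark : ∀ V → vals (unmark V) ≡ V
  vals-unmark V = trans (sym (Listₚ.map-∘ V)) (trans (Listₚ.map-cong (λ W → trans (sym (Listₚ.map-∘ W)) (Listₚ.map-id W)) V) (Listₚ.map-id V))

  unmark-vals : ∀ A → (∀ {e} → e ∈ concat A → Marked false e) → unmark (vals A) ≡ A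
  unmark-vals []      _ = refl
  unmark-vals (W ∷ A) h = cong₂ _∷_ (go W (h ∘ ∈ₚ.∈-++⁺ˡ)) (unmark-vals A (h ∘ ∈ₚ.∈-++⁺ʳ W))
    where
    go : ∀ W → (∀ {e} → e ∈ W → Marked false e) → map (λ x → x , false) (map proj₁ W) ≡ W
    go []            _ = refl
    go ((x , f) ∷ W) h = cong₂ _∷_ (cong (x ,_) (sym (proj₁ (h (here refl))))) (go W (h ∘ there))

  private
    unmark-shape : ∀ V → map length (unmark V) ≡ map length V
    unmark-shape V = trans (sym (lengths-vals (unmark V))) (cong (map length) (vals-unmark V))

  fromTab-split : ∀ {U V} → TabWith n π (shapeOf tU λ′) (shapeOf tV μ) tU tV (U , V) → Split (decode tU λ′ U) (decode tV μ (unmark V))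
  fromTab-split {U} {V} ((shU , shV , uses , ¬gr , gr) , cU , cV) = mkSplit sh₁ sh₂ adj₁ adj₂ mark₁ mark₂ uses′
    where
    A₁ = decode tU λ′ U
    A₂ = decode tV μ (unmark V)
    shV′ = trans (unmark-shape V) shV
    sh₁ = Cλ.decode-shape tU shU
    sh₂ = Cμ.decode-shape tV shV′
    e₁ : encode tU λ′ A₁ ≡ U
    e₁ = Cλ.encode-decode tU shU
    e₂ : encode tV μ A₂ ≡ unmark V
    e₂ = Cμ.encode-decode tV shV′
    p₁ : concat A₁ ↭ concat U
    p₁ = ↭-trans (↭-sym (Cλ.encode-concat tU sh₁)) (↭-reflexive (cong concat e₁))
    p₂ : concat A₂ ↭ concat (unmark V)
    p₂ = ↭-trans (↭-sym (Cμ.encode-concat tV sh₂)) (↭-reflexive (cong concat e₂))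
    v₁ : concat (vals A₁) ↭ concat (vals U)
    v₁ = ↭-trans (↭-reflexive (vals-concat A₁)) (↭-trans (↭ₚ.map⁺ proj₁ p₁) (↭-reflexive (sym (vals-concat U))))
    v₂ : concat (vals A₂) ↭ concat V
    v₂ = ↭-trans (↭-reflexive (vals-concat A₂)) (↭-trans (↭ₚ.map⁺ proj₁ p₂) (↭-reflexive (trans (sym (vals-concat (unmark V))) (cong concat (vals-unmark V)))))
    uses′ : concat (vals A₁) ++ concat (vals A₂) ↭ range1 n
    uses′ = ↭-trans (↭ₚ.++⁺ v₁ v₂) uses
    in₁ : ∀ {b a} → b < length (vals A₁) → a ∈ at [] (vals A₁) (suc b) → a ∈ range1 n
    in₁ b< a∈ = ↭ₚ.∈-resp-↭ uses′ (∈ₚ.∈-++⁺ˡ (at-concat (vals A₁) b< a∈))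
    in₂ : ∀ {b a} → b < length (vals A₂) → a ∈ at [] (vals A₂) (suc b) → a ∈ range1 n
    in₂ b< a∈ = ↭ₚ.∈-resp-↭ uses′ (∈ₚ.∈-++⁺ʳ (concat (vals A₁)) (at-concat (vals A₂) b< a∈))
    adj₁ : ∀ {b} → b < length A₁ → Linked (Adj tU) (at [] (vals A₁) (suc b))
    adj₁ b< = Linked-local (λ a∈ b∈ → ⇒Adj tU (in₁ (length-vals A₁ b<) a∈) (in₁ (length-vals A₁ b<) b∈))
      (Cλ.cond⇒linked tU (trans (lengths-vals A₁) sh₁) (subst (Cond (QLt π) tU) (trans (cong vals (sym e₁)) (Cλ.encode-map proj₁ tU A₁)) cU) (length-vals A₁ b<))
    adj₂ : ∀ {b} → b < length A₂ → Linked (Adj tV) (at [] (vals A₂) (suc b))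
    adj₂ b< = Linked-local (λ a∈ b∈ → ⇒Adj tV (in₂ (length-vals A₂ b<) a∈) (in₂ (length-vals A₂ b<) b∈))
      (Cμ.cond⇒linked tV (trans (lengths-vals A₂) sh₂) (subst (Cond (QLt π) tV) (trans (trans (sym (vals-unmark V)) (cong vals (sym e₂))) (Cμ.encode-map proj₁ tV A₂)) cV) (length-vals A₂ b<))
    mark₁ : ∀ {e} → e ∈ concat A₁ → Marked true e
    mark₁ {x , .true} e∈ refl = grounded⇒ (↭ₚ.∈-resp-↭ uses′ (∈ₚ.∈-++⁺ˡ (subst (x ∈_) (sym (vals-concat A₁)) (∈ₚ.∈-map⁺ proj₁ e∈)))) (gr x (↭ₚ.∈-resp-↭ p₁ e∈))
    mark₂ : ∀ {e} → e ∈ concat A₂ → Marked false e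
    mark₂ {x , f} e∈ = unmarked V (↭ₚ.∈-resp-↭ p₂ e∈) , λ sh → ¬gr x (↭ₚ.∈-resp-↭ v₂ x∈) (⇒grounded (↭ₚ.∈-resp-↭ uses′ (∈ₚ.∈-++⁺ʳ (concat (vals A₁)) x∈)) sh)
      where
      x∈ : x ∈ concat (vals A₂)
      x∈ = subst (x ∈_) (sym (vals-concat A₂)) (∈ₚ.∈-map⁺ proj₁ e∈)
      unmarked : ∀ V {f} → (x , f) ∈ concat (unmark V) → f ≡ false
      unmarked V m with _ , _ , refl ← ∈ₚ.∈-map⁻ (λ x → x , false) (subst ((x , _) ∈_) (Listₚ.concat-map V) m) = refl

  toTab-fromTab : ∀ {t} → TabWith n π (shapeOf tU λ′) (shapeOf tV μ) tU tV t → toTab (fromTab t) ≡ t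
  toTab-fromTab {U , V} tw@((shU , shV , _) , _) = cong₂ _,_
    (trans (cong (encode tU λ′) take≡) (Cλ.encode-decode tU shU))
    (trans (cong (λ A → vals (encode tV μ A)) drop≡) (trans (cong vals (Cμ.encode-decode tV (trans (unmark-shape V) shV))) (vals-unmark V)))
    where
    A₁ = decode tU λ′ U
    l₁ : length A₁ ≡ r
    l₁ = trans (sym (Listₚ.length-map length A₁)) (cong length (Cλ.decode-shape tU shU))
    take-++ : ∀ {A : Set} (xs ys : List A) → take (length xs) (xs ++ ys) ≡ xs
    take-++ []       ys = refl
    take-++ (x ∷ xs) ys = cong (x ∷_) (take-++ xs ys)
    drop-++ : ∀ {A : Set} (xs ys : List A) → drop (length xs) (xs ++ ys) ≡ ys
    drop-++ []       ys = refl
    drop-++ (x ∷ xs) ys = drop-++ xs ys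
    take≡ : take r (fromTab (U , V)) ≡ A₁
    take≡ = trans (cong (λ m → take m (fromTab (U , V))) (sym l₁)) (take-++ A₁ (decode tV μ (unmark V)))
    drop≡ : drop r (fromTab (U , V)) ≡ decode tV μ (unmark V)
    drop≡ = trans (cong (λ m → drop m (fromTab (U , V))) (sym l₁)) (drop-++ A₁ (decode tV μ (unmark V)))

  fromTab-toTab : ∀ {A} → Arranged A → fromTab (toTab A) ≡ A
  fromTab-toTab {A} ar with mkSplit sh₁ sh₂ _ _ _ mark₂ _ ← arranged⇒split ar =
    trans (cong₂ _++_ (Cλ.decode-encode tU sh₁) (trans (cong (decode tV μ) (unmark-vals (encode tV μ (drop r A)) (λ e∈ → mark₂ (↭ₚ.∈-resp-↭ (Cμ.encode-concat tV sh₂) e∈)))) (Cμ.decode-encode tV sh₂)))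
      (Listₚ.take++drop≡id r A)

  tableaux : List BiTab
  tableaux = map toTab arrangements

  tableaux-unique : Unique tableaux
  tableaux-unique = unique-map-on arrangements-unique λ a∈ b∈ e →
    trans (sym (fromTab-toTab (arrangements-sound a∈))) (trans (cong fromTab e) (fromTab-toTab (arrangements-sound b∈)))

  tableaux-spec : ∀ t → (t ∈ tableaux) ⇔ TabWith n π (shapeOf tU λ′) (shapeOf tV μ) tU tV t
  tableaux-spec t = mk⇔ (λ t∈ → case ∈ₚ.∈-map⁻ toTab t∈ of λ { (A , A∈ , refl) → toTab-sound (arrangements-sound A∈) })
    (λ tw → subst (_∈ tableaux) (toTab-fromTab tw) (∈ₚ.∈-map⁺ toTab (arrangements-complete (split⇒arranged (fromTab-split tw)))))

-- The character evaluation

-- Both sides are the same sum of `factors` over the colourings of content `λ′ ++ μ`: the trace by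
-- exchanging the sums over `v` and over colourings, the tableaux by `arrangements-length`.
charCount : ∀ {w : List ℤ} {cs : List Iv} {π : ℤ → List Vtx} (λ′ μ : List ℕ) → let n = sum λ′ + sum μ in
  IsBn n w → ZigZag n cs → MaxCoverType n cs (appB w) → IsFamily n cs π id → IsPartition λ′ → IsPartition μ → ∀ tU tV →
  CharCount n w π λ′ (charOf tU λ′) (charOf tV μ) (shapeOf tU λ′) (shapeOf tV μ) tU tV
charCount {w} {cs} {π} λ′ μ bw zz mct fam pλ pμ tU tV m size L uL mem = begin
  ∑ L (bichar n (sum λ′) (charOf tU λ′) (charOf tV μ))
    ≡⟨ ∑-cong L (λ {v} v∈ → bichar-formula λ′ μ tU tV (proj₁ (Equivalence.to (BruhatInterval.Bruhat⇔Compat bw zz mct v) (Equivalence.to (mem v) v∈)))) ⟩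
  ∑ L (λ v → ∑col q n ν (wt n r tU tV v))
    ≡⟨ ∑col-swap L q n ν (λ v → wt n r tU tV v) ⟩
  ∑col q n ν (λ κ → ∑ L (λ v → wt n r tU tV v κ))
    ≡⟨ ∑col-cong q n ν (λ {κ} _ _ → Evaluate.∑-wt-factors bw zz mct κ r tU tV L uL mem) ⟩
  ∑col q n ν (λ κ → + Factor.factors cs κ r tU tV n)
    ≡⟨ sym arrangements-length ⟩
  + length arrangements
    -- `size` speaks about every enumeration of the tableaux without repetitions; the explicit list
    -- `tableaux` is one.
    ≡⟨ cong +_ (trans (sym (Listₚ.length-map toTab arrangements)) (size tableaux tableaux-unique tableaux-spec)) ⟩
  + m ∎
  where
  open ≡-Reasoning
  n = sum λ′ + sum μ
  r = length λ′
  q = length λ′ + length μ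
  ν = λ′ ++ μ
  open Tableaux {n} {cs} {π} (ZigZag⇒Zig {n} zz) fam λ′ μ pλ pμ tU tV

theorem9p6 :
    (n : ℕ) (w : List ℤ) → IsBn n w → Avoids3412-4231 w →
    -- F_w = F_{[c_1,d_1]} • ⋯ • F_{[c_t,d_t]} is the zig-zag network with w(F_w) = w
    (cs : List (ℤ × ℤ)) → ZigZag n cs → MaxCoverType n cs (appB w) →
    -- π is the path family of type e covering F_w; it determines Q = Q(w)
    (π : ℤ → List Vtx) → IsFamily n cs π (λ i → i) → Covers n cs π →
    -- (λ, μ) ⊢ n
    (λ′ μ : List ℕ) → IsPartition λ′ → IsPartition μ → sum λ′ + sum μ ≡ n →
    CharCount n w π λ′ (epsChar λ′) (epsChar μ) (transpose λ′) (transpose μ) colStrict colStrict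
    × CharCount n w π λ′ (epsChar λ′) (etaChar μ) (transpose λ′) μ colStrict rowSemistrict
    × CharCount n w π λ′ (etaChar λ′) (epsChar μ) λ′ (transpose μ) rowSemistrict colStrict
    × CharCount n w π λ′ (etaChar λ′) (etaChar μ) λ′ μ rowSemistrict rowSemistrict
theorem9p6 _ w bw _ cs zz mct π fam _ λ′ μ pλ pμ refl =
  charCount λ′ μ bw zz mct fam pλ pμ colStrict colStrict ,
  charCount λ′ μ bw zz mct fam pλ pμ colStrict rowSemistrict ,
  charCount λ′ μ bw zz mct fam pλ pμ rowSemistrict colStrict ,
  charCount λ′ μ bw zz mct fam pλ pμ rowSemistrict rowSemistrict
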